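{- Let $q$ be a prime power and let $m>1$ be an integer, written as $m=2^k l$ with $k,l$ nonnegative integers and $l$ odd. Then $$ \left|\mathrm{TSRI}(m,2;q)\right|=\left(q-\frac{1+(-1)^q}{2}\right) \left(\sum_{d\mid l}\mu(d)q^{m/d}-\left\lfloor\frac{1}{l}\right\rfloor \frac{1+(-1)^{q-1}}{2}\right) \frac{|\operatorname{GL}_m(\mathbb{F}_q)|}{2m(q^m-1)} , $$ where $\mu$ is the Möbius function and $\lfloor\cdot\rfloor$ the floor function.
   Context: For positive integers $m,n$, an $(m,n)$-TSR matrix over $\mathbb{F}_q$ is a matrix $T\in \operatorname{M}_{mn}(\mathbb{F}_q)$ which, viewed as an $n\times n$ array of $m\times m$ blocks, has the identity matrix $I_m$ in block positions $(i+1,i)$ for $1\le i\le n-1$, has last block column $(c_0B, c_1B,\dots,c_{n-1}B)^{T}$ (blocks listed from top to bottom) for some $c_0,\dots,c_{n-1}\in\mathbb{F}_q$ and $B\in \operatorname{M}_m(\mathbb{F}_q)$, and has all other blocks equal to zero. $\mathrm{TSR}(m,n;q)$ denotes the set of all such matrices, and $\mathrm{TSRI}(m,n;q)$ denotes the set of those $T\in\mathrm{TSR}(m,n;q)$ whose characteristic polynomial $\det(XI_{mn}-T)$ is irreducible in $\mathbb{F}_q[X]$. -}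

module Defs where

open import Level using (0ℓ)
open import Data.Bool using (Bool; true; false; if_then_else_)
open import Data.Nat as ℕ using (ℕ; zero; suc; _≡ᵇ_; _∸_)
open import Data.Nat.Divisibility using (_∣?_)
open import Data.Nat.Primality using (prime?)
open import Data.Integer as ℤ using (ℤ; +_)
open import Data.Fin as Fin using (Fin; toℕ; remQuot)
open import Data.Vec as Vec using (Vec; []; _∷_; lookup; tabulate; removeAt)
open import Data.List as List using (List; []; _∷_; length)
open import Data.List.Membership.Propositional using (_∈_)
open import Data.List.Relation.Unary.Unique.Propositional using (Unique)
open import Data.Product using (Σ; _×_; _,_)
open import Data.Sum using (_⊎_)
open import Relation.Nullary using (¬_)
open import Relation.Nullary.Decidable using (⌊_⌋)
open import Relation.Binary.PropositionalEquality using (_≡_; _≢_)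
open import Algebra.Structures using (IsCommutativeRing)

record FiniteField : Set₁ where
  infixl 7 _*_
  infixl 6 _+_
  field
    Carrier  : Set
    _+_ _*_  : Carrier → Carrier → Carrier
    -_       : Carrier → Carrier
    0# 1#    : Carrier
    isCommutativeRing : IsCommutativeRing _≡_ _+_ _*_ -_ 0# 1#
    0≢1      : 0# ≢ 1#
    inverse  : ∀ x → x ≢ 0# → Σ Carrier (λ y → x * y ≡ 1#)
    elements : List Carrier
    elements-unique   : Unique elements
    elements-complete : ∀ x → x ∈ elements

  order : ℕ
  order = length elements

HasCard : {A : Set} → (A → Set) → ℕ → Set
HasCard {A} P N =
  Σ (List A) λ xs → Unique xs × (∀ x → (x ∈ xs → P x) × (P x → x ∈ xs)) × length xs ≡ N

module _ (F : FiniteField) where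
  open FiniteField F

  Matrix : ℕ → Set
  Matrix k = Vec (Vec Carrier k) k

  identity : (k : ℕ) → Matrix k
  identity k = tabulate λ i → tabulate λ j → if toℕ i ≡ᵇ toℕ j then 1# else 0#

  sumF : ∀ {k} → Vec Carrier k → Carrier
  sumF = Vec.foldr _ _+_ 0#

  matMul : ∀ {k} → Matrix k → Matrix k → Matrix k
  matMul {k} M N = tabulate λ i → tabulate λ j →
    sumF (tabulate λ l → lookup (lookup M i) l * lookup (lookup N l) j)

  Invertible : (k : ℕ) → Matrix k → Set
  Invertible k M = Σ (Matrix k) λ M' → matMul M M' ≡ identity k × matMul M' M ≡ identity k

  -- Polynomials over F: coefficient lists, lowest degree first
  -- (trailing zeros allowed; equality is coefficientwise).

  Poly : Set
  Poly = List Carrier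

  coef : Poly → ℕ → Carrier
  coef []       _       = 0#
  coef (a ∷ f)  zero    = a
  coef (a ∷ f)  (suc i) = coef f i

  _≈ₚ_ : Poly → Poly → Set
  f ≈ₚ g = ∀ i → coef f i ≡ coef g i

  addP : Poly → Poly → Poly
  addP []      g       = g
  addP f       []      = f
  addP (a ∷ f) (b ∷ g) = (a + b) ∷ addP f g

  negP : Poly → Poly
  negP = List.map -_

  mulP : Poly → Poly → Poly
  mulP []      g = []
  mulP (a ∷ f) g = addP (List.map (a *_) g) (0# ∷ mulP f g)

  zeroP oneP : Poly
  zeroP = []
  oneP  = 1# ∷ []

  IsUnitP : Poly → Set
  IsUnitP f = Σ Poly λ g → mulP f g ≈ₚ oneP

  IrreducibleP : Poly → Set
  IrreducibleP p = ¬ (p ≈ₚ zeroP) × ¬ IsUnitP p ×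
    (∀ f g → p ≈ₚ mulP f g → IsUnitP f ⊎ IsUnitP g)

  detP : ∀ k → Vec (Vec Poly k) k → Poly
  detP zero    []       = oneP
  detP (suc k) (r ∷ rs) = Vec.foldr _ addP zeroP (tabulate λ j →
    mulP (signed (toℕ j) (lookup r j)) (detP k (Vec.map (λ row → removeAt row j) rs)))
    where
    signed : ℕ → Poly → Poly
    signed zero          f = f
    signed (suc zero)    f = negP f
    signed (suc (suc n)) f = signed n f

  charPoly : ∀ k → Matrix k → Poly
  charPoly k T = detP k (tabulate λ i → tabulate λ j →
    if toℕ i ≡ᵇ toℕ j then (- lookup (lookup T i) j) ∷ 1# ∷ []
                      else (- lookup (lookup T i) j) ∷ [])

  -- (m,n)-TSR matrices.  Index of size n*m; index r corresponds to
  -- block row I and inner row a via remQuot m r = (I , a).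

  tsr : (m n : ℕ) → Vec Carrier n → Matrix m → Matrix (n ℕ.* m)
  tsr m n c B = tabulate λ r → tabulate λ s → entry (remQuot m r) (remQuot m s)
    where
    entry : Fin n × Fin m → Fin n × Fin m → Carrier
    entry (I , a) (J , b) =
      if toℕ J ≡ᵇ (n ∸ 1) then lookup c I * lookup (lookup B a) b
      else if toℕ I ≡ᵇ suc (toℕ J)
        then (if toℕ a ≡ᵇ toℕ b then 1# else 0#)
        else 0#

  IsTSR : (m n : ℕ) → Matrix (n ℕ.* m) → Set
  IsTSR m n T = Σ (Vec Carrier n) λ c → Σ (Matrix m) λ B → T ≡ tsr m n c B

  IsTSRI : (m n : ℕ) → Matrix (n ℕ.* m) → Set
  IsTSRI m n T = IsTSR m n T × IrreducibleP (charPoly (n ℕ.* m) T)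

private
  anyUpTo : (ℕ → Bool) → ℕ → Bool
  anyUpTo p zero    = false
  anyUpTo p (suc n) = if p (suc n) then true else anyUpTo p n

  countUpTo : (ℕ → Bool) → ℕ → ℕ
  countUpTo p zero    = 0
  countUpTo p (suc n) = if p (suc n) then suc (countUpTo p n) else countUpTo p n

μ : ℕ → ℤ
μ zero = + 0
μ n@(suc _) =
  if anyUpTo (λ d → if 2 ℕ.≤ᵇ d then ⌊ (d ℕ.* d) ∣? n ⌋ else false) n
  then + 0
  else ℤ.-1ℤ ℤ.^ countUpTo (λ p → if ⌊ prime? p ⌋ then ⌊ p ∣? n ⌋ else false) n

mobiusSum : (q m l : ℕ) → ℤ
mobiusSum q m l = go l
  where
  go : ℕ → ℤ
  go zero    = + 0
  go (suc d) = if ⌊ suc d ∣? l ⌋ then μ (suc d) ℤ.* (+ (q ℕ.^ (m ℕ./ suc d))) ℤ.+ go d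
               else go d

floorRecip : ℕ → ℕ
floorRecip zero    = 0
floorRecip (suc l) = 1 ℕ./ suc l

module Submission where

-- Let T be the matrix of c₀, c₁, B.  Then T² = (c₀ + c₁ T) · diag(B, B), so an irreducible characteristic polynomial of T
-- is (c₀ + c₁ X)^m f(X² / (c₀ + c₁ X)), where f is the characteristic polynomial of B.  Write φ for x ↦ x^(q^m).  If α is an
-- eigenvalue of T in an extension of F and β the corresponding eigenvalue of B, then α and φ(α) are the two roots of
-- X² - c₁ β X - c₀ β; hence u = 1/α satisfies φ(u) + u = - c₁ / c₀ ∈ F.  Conversely an element u of degree 2m over F with
-- φ(u) + u = t ∈ F determines T up to the choice of B: normalizing c₀ = 1 one gets c₁ = - t, and B has to be annihilated
-- by the minimal polynomial of β = - α φ(α).  Such B together with a nonzero (hence cyclic) vector v correspond to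
-- invertible matrices with rows v, v B, v B², ….  Counting the pairs (T, u) gives
-- |TSRI| · 2m (q^m - 1) = |U| · |GL_m|, where U is the set of all those u.
-- If u + φ(u) = t and φ(u) ≠ u, then [F_{q^2m} : F(u)] is odd, and for n = m / d with d odd there are exactly q^n elements
-- with u^(q^n) + u = t; Möbius inversion over d ∣ l gives |U|.  The solutions with φ(u) = u are those of 2 u = t:
-- there is one if q is odd, and none if q is even and t ≠ 0, while t = 0 contributes nothing to U if q is even.

open import Algebra.Bundles using (CommutativeRing)
import Algebra.Properties.Ring
import Algebra.Properties.Semiring.Mult
import Algebra.Properties.Semiring.Mult.TCOptimised
import Algebra.Solver.Ring
open import Algebra.Solver.Ring.AlmostCommutativeRing using
  (AlmostCommutativeRing; fromCommutativeRing; _-Raw-AlmostCommutative⟶_)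
open import Algebra.Structures using (IsCommutativeRing)
open import Data.Bool using (Bool; true; false; if_then_else_)
open import Data.Empty using (⊥; ⊥-elim)
open import Data.Fin as Fin using (Fin; toℕ; zero; suc; _↑ˡ_; _↑ʳ_; remQuot)
import Data.Fin.Properties as Finₚ
open import Data.Integer as ℤ using (ℤ; -[1+_])
import Data.Integer.Properties as ℤₚ
open import Data.List as List using
  (List; []; _∷_; length; map; filter; foldr; applyUpTo; downFrom; cartesianProduct; cartesianProductWith)
open import Data.List.Membership.Propositional using (_∈_; find; lose)
open import Data.List.Membership.Propositional.Properties using
  (∈-∃++; ∈-++⁺ˡ; ∈-++⁺ʳ; ∈-++⁻; ∈-filter⁺; ∈-filter⁻; ∈-map⁺; ∈-map⁻; ∈-cartesianProductWith⁺;
  ∈-cartesianProduct⁺; ∈-cartesianProduct⁻; ∈-applyUpTo⁻; ∈-downFrom⁺; ∈-downFrom⁻)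
open import Data.List.Membership.Propositional.Properties.WithK using (unique∧set⇒bag)
import Data.List.Properties as Listₚ
open import Data.List.Relation.Binary.BagAndSetEquality using (∼bag⇒↭)
open import Data.List.Relation.Binary.Permutation.Propositional as Perm using (_↭_)
open import Data.List.Relation.Binary.Permutation.Propositional.Properties using () renaming (map⁺ to map-↭)
open import Data.List.Relation.Unary.All as All using (All; []; _∷_)
open import Data.List.Relation.Unary.AllPairs using ([]; _∷_)
open import Data.List.Relation.Unary.Any as Any using (Any; here; there)
import Data.List.Relation.Unary.Any.Properties as Anyₚ
open import Data.List.Relation.Unary.Unique.Propositional using (Unique)
import Data.List.Relation.Unary.Unique.Propositional.Properties as Uniqueₚ
open import Data.Maybe using (Maybe; just; nothing)
open import Data.Nat as ℕ using (ℕ; zero; suc; _≤_; _<_; z≤n; s≤s; _≡ᵇ_; _∸_; _%_)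
open import Data.Nat.Coprimality using (Coprime; coprime-divisor)
open import Data.Nat.Divisibility
import Data.Nat.DivMod as DivMod
open import Data.Nat.Primality using
  (Prime; prime?; euclidsLemma; prime⇒nonTrivial; prime⇒nonZero; prime⇒irreducible; irreducible[2])
open import Data.Nat.Primality.Factorisation using (factorise; module PrimeFactorisation)
import Data.Nat.Properties as ℕₚ
open import Data.Product using (Σ; _×_; _,_; proj₁; proj₂; ∃-syntax)
import Data.Rational.Properties as ℚₚ
import Data.Rational.Unnormalised as ℚᵘ
import Data.Rational.Unnormalised.Properties as ℚᵘₚ
import Data.Sign as Sign
open import Data.Sum using (_⊎_; inj₁; inj₂)
open import Data.Vec as Vec using (Vec; []; _∷_; _++_)
import Data.Vec.Properties as Vecₚ
import Defs
open Defs using (FiniteField; HasCard; IsTSRI; Invertible; μ; mobiusSum; floorRecip)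
open import Function.Bundles using (mk⇔)
open import Level using (0ℓ)
open import Relation.Binary.Definitions using (DecidableEquality)
open import Relation.Binary.PropositionalEquality
open import Relation.Nullary using (¬_; Dec; yes; no; ¬?)
open import Relation.Nullary.Decidable using (⌊_⌋; _×-dec_; _→-dec_; map′)
open import Relation.Unary using (Decidable)

open ≡-Reasoning

-- A field is given by nothing but an enumeration of its elements; neither its characteristic nor
-- dimensions are at hand. Sizes are therefore pinned down by counting: a polynomial has at most as
-- many roots as its degree, and when such upper bounds multiply to the number of available
-- elements, all of them are equalities. The ambient extension splits X^(q^(2m)) - X; its own size
-- is not tracked, only that φ² has q^(2m) fixed points in it. Passing from α to u = 1/α makes the
-- condition on eigenvalues affine: 1/α + 1/φ(α) is the sum of the two roots divided by their
-- product, where β cancels. That φ fixes β comes from Vieta: a power of x ↦ x^q that fixes β but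
-- not α exchanges the two roots of the quadratic, so its square fixes α. The characteristic
-- polynomial is found without block determinants: both sides are monic of degree 2m and annihilate
-- one nonzero vector, by Cayley-Hamilton and by the relation for T², so if one side is irreducible
-- they agree. In the final count 2m is the number of eigenvalues of one T, and q^m - 1 the number
-- of nonzero v.

-- Arithmetic in a finite field

module Field (F : FiniteField) where
  open FiniteField F public
  open Algebra.Structures.IsCommutativeRing isCommutativeRing public
    using (+-assoc; +-comm; +-identityˡ; +-identityʳ; -‿inverseˡ; -‿inverseʳ;
           *-assoc; *-comm; *-identityˡ; *-identityʳ; distribˡ; distribʳ; zeroˡ; zeroʳ)

  commutativeRing : CommutativeRing 0ℓ 0ℓ
  commutativeRing = record { isCommutativeRing = isCommutativeRing }

  open Algebra.Properties.Ring (CommutativeRing.ring commutativeRing) public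
    using (-‿distribˡ-*; -‿distribʳ-*; -0#≈0#; -‿involutive; -‿+-comm)
  open Algebra.Properties.Semiring.Mult (CommutativeRing.semiring commutativeRing) public
    using (×-homo-+; ×1-homo-*) renaming (_×_ to _·_)

  private
    module O = Algebra.Properties.Semiring.Mult.TCOptimised (CommutativeRing.semiring commutativeRing)
    open O using () renaming (_×_ to _·′_)

    -- Integer coefficients have decidable equality, which lets the ring solver cancel constants.
    -- The optimised multiple makes the images of 1 and -1 definitionally `1#` and `- 1#`, so solved
    -- goals match the terms of the field.
    ⟦_⟧ : ℤ → Carrier
    ⟦ ℤ.+ n ⟧ = n ·′ 1#
    ⟦ -[1+ n ] ⟧ = - (suc n ·′ 1#)

    ⟦-⟧ : ∀ i → ⟦ ℤ.- i ⟧ ≡ - ⟦ i ⟧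
    ⟦-⟧ (ℤ.+ zero) = sym -0#≈0#
    ⟦-⟧ (ℤ.+ suc n) = refl
    ⟦-⟧ -[1+ n ] = sym (-‿involutive _)

    cancel-1 : ∀ x y → x + - y ≡ (1# + x) + - (1# + y)
    cancel-1 x y = sym (begin
      (1# + x) + - (1# + y)      ≡⟨ cong₂ _+_ (+-comm 1# x) (sym (-‿+-comm 1# y)) ⟩
      (x + 1#) + (- 1# + - y)    ≡⟨ +-assoc x 1# _ ⟩
      x + (1# + (- 1# + - y))    ≡⟨ cong (x +_) (sym (+-assoc 1# (- 1#) (- y))) ⟩
      x + ((1# + - 1#) + - y)    ≡⟨ cong (λ z → x + (z + - y)) (-‿inverseʳ 1#) ⟩
      x + (0# + - y)             ≡⟨ cong (x +_) (+-identityˡ _) ⟩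
      x + - y                    ∎)

    ⟦⊖⟧ : ∀ m n → ⟦ m ℤ.⊖ n ⟧ ≡ m ·′ 1# + - (n ·′ 1#)
    ⟦⊖⟧ m zero = sym (trans (cong (m ·′ 1# +_) -0#≈0#) (+-identityʳ _))
    ⟦⊖⟧ zero (suc n) = sym (+-identityˡ _)
    ⟦⊖⟧ (suc m) (suc n) =
      trans (cong ⟦_⟧ (ℤₚ.[1+m]⊖[1+n]≡m⊖n m n)) (trans (⟦⊖⟧ m n) (trans (cancel-1 (m ·′ 1#) (n ·′ 1#))
        (sym (cong₂ (λ x y → x + - y) (O.1+× m 1#) (O.1+× n 1#)))))

    ⟦+⟧ : ∀ i j → ⟦ i ℤ.+ j ⟧ ≡ ⟦ i ⟧ + ⟦ j ⟧
    ⟦+⟧ (ℤ.+ m) (ℤ.+ n) = O.×-homo-+ 1# m n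
    ⟦+⟧ (ℤ.+ m) -[1+ n ] = ⟦⊖⟧ m (suc n)
    ⟦+⟧ -[1+ m ] (ℤ.+ n) = trans (⟦⊖⟧ n (suc m)) (+-comm _ _)
    ⟦+⟧ -[1+ m ] -[1+ n ] = trans (cong (λ k → - (suc k ·′ 1#)) (sym (ℕₚ.+-suc m n)))
      (trans (cong -_ (O.×-homo-+ 1# (suc m) (suc n))) (sym (-‿+-comm _ _)))

    ⟦◃⟧ : ∀ n → ⟦ Sign.- ℤ.◃ n ⟧ ≡ - (n ·′ 1#)
    ⟦◃⟧ zero = sym -0#≈0#
    ⟦◃⟧ (suc n) = refl

    ⟦*⟧ : ∀ i j → ⟦ i ℤ.* j ⟧ ≡ ⟦ i ⟧ * ⟦ j ⟧
    ⟦*⟧ (ℤ.+ m) (ℤ.+ n) = trans (cong ⟦_⟧ (ℤₚ.+◃n≡+n (m ℕ.* n))) (O.×1-homo-* m n)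
    ⟦*⟧ (ℤ.+ m) -[1+ n ] = trans (⟦◃⟧ (m ℕ.* suc n)) (trans (cong -_ (O.×1-homo-* m (suc n))) (-‿distribʳ-* _ _))
    ⟦*⟧ -[1+ m ] (ℤ.+ n) = trans (⟦◃⟧ (suc m ℕ.* n)) (trans (cong -_ (O.×1-homo-* (suc m) n)) (-‿distribˡ-* _ _))
    ⟦*⟧ -[1+ m ] -[1+ n ] = trans (O.×1-homo-* (suc m) (suc n))
      (trans (sym (-‿involutive _)) (trans (cong -_ (-‿distribˡ-* _ _)) (-‿distribʳ-* _ _)))

    almostRing : AlmostCommutativeRing 0ℓ 0ℓ
    almostRing = fromCommutativeRing commutativeRing

    fromℤ : AlmostCommutativeRing.rawRing (fromCommutativeRing ℤₚ.+-*-commutativeRing)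
              -Raw-AlmostCommutative⟶ almostRing
    fromℤ = record
      { ⟦_⟧ = ⟦_⟧ ; +-homo = ⟦+⟧ ; *-homo = ⟦*⟧ ; -‿homo = ⟦-⟧
      ; 0-homo = refl ; 1-homo = refl }

    ⟦⟧≟ : ∀ i j → Maybe (⟦ i ⟧ ≡ ⟦ j ⟧)
    ⟦⟧≟ i j with i ℤₚ.≟ j
    ... | yes i≡j = just (cong ⟦_⟧ i≡j)
    ... | no _ = nothing

  open Algebra.Solver.Ring _ almostRing fromℤ ⟦⟧≟ public
    using (solve; _:=_; _:+_; _:*_; :-_; con)

  infix 4 _≟_
  -- Decidability is a consequence of the enumeration: two elements agree iff they are found at the
  -- same position of `elements`.
  _≟_ : DecidableEquality Carrier
  x ≟ y with Any.index (elements-complete x) Fin.≟ Any.index (elements-complete y)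
  ... | yes i≡j = yes (trans (Anyₚ.lookup-index (elements-complete x))
                      (trans (cong (List.lookup elements) i≡j) (sym (Anyₚ.lookup-index (elements-complete y)))))
  ... | no i≢j = no (λ { refl → i≢j refl })

  x-y≡0⇒x≡y : ∀ {x y} → x + - y ≡ 0# → x ≡ y
  x-y≡0⇒x≡y {x} {y} eq = begin
    x              ≡⟨ solve 2 (λ x y → x := (x :+ :- y) :+ y) refl x y ⟩
    (x + - y) + y  ≡⟨ cong (_+ y) eq ⟩
    0# + y         ≡⟨ +-identityˡ y ⟩
    y              ∎

  x≡y⇒x-y≡0 : ∀ {x y} → x ≡ y → x + - y ≡ 0#
  x≡y⇒x-y≡0 {x} refl = -‿inverseʳ x

  *-cancelˡ : ∀ x {y z} → x ≢ 0# → x * y ≡ x * z → y ≡ z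
  *-cancelˡ x {y} {z} x≢0 eq with inverse x x≢0
  ... | x⁻¹ , xx⁻¹≡1 = begin
    y               ≡⟨ lem y ⟩
    x⁻¹ * (x * y)   ≡⟨ cong (x⁻¹ *_) eq ⟩
    x⁻¹ * (x * z)   ≡⟨ sym (lem z) ⟩
    z               ∎
    where
    lem : ∀ w → w ≡ x⁻¹ * (x * w)
    lem w = begin
      w              ≡⟨ sym (*-identityˡ w) ⟩
      1# * w         ≡⟨ cong (_* w) (sym xx⁻¹≡1) ⟩
      (x * x⁻¹) * w  ≡⟨ solve 3 (λ x y w → (x :* y) :* w := y :* (x :* w)) refl x x⁻¹ w ⟩
      x⁻¹ * (x * w)  ∎

  xy≡0⇒y≡0 : ∀ {x y} → x ≢ 0# → x * y ≡ 0# → y ≡ 0#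
  xy≡0⇒y≡0 {x} x≢0 eq = *-cancelˡ x x≢0 (trans eq (sym (zeroʳ x)))

  xy≡0 : ∀ {x y} → x * y ≡ 0# → x ≡ 0# ⊎ y ≡ 0#
  xy≡0 {x} eq with x ≟ 0#
  ... | yes x≡0 = inj₁ x≡0
  ... | no x≢0 = inj₂ (xy≡0⇒y≡0 x≢0 eq)

  -- The value 0 at 0 makes inversion a total involution that commutes with the powers of x ↦ x^q,
  -- so that it can serve as a bijection of lists without side conditions.
  inv : Carrier → Carrier
  inv x with x ≟ 0#
  ... | yes _ = 0#
  ... | no x≢0 = proj₁ (inverse x x≢0)

  x*inv : ∀ {x} → x ≢ 0# → x * inv x ≡ 1#
  x*inv {x} x≢0 with x ≟ 0#
  ... | yes x≡0 = ⊥-elim (x≢0 x≡0)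
  ... | no p = proj₂ (inverse x p)

  inv-0 : inv 0# ≡ 0#
  inv-0 with 0# ≟ 0#
  ... | yes _ = refl
  ... | no p = ⊥-elim (p refl)

  inv≢0 : ∀ {x} → x ≢ 0# → inv x ≢ 0#
  inv≢0 {x} x≢0 eq = 0≢1 (trans (sym (zeroʳ x)) (trans (cong (x *_) (sym eq)) (x*inv x≢0)))

  inv-unique : ∀ {x y} → x * y ≡ 1# → inv x ≡ y
  inv-unique {x} {y} xy≡1 = *-cancelˡ x x≢0 (trans (x*inv x≢0) (sym xy≡1))
    where
    x≢0 : x ≢ 0#
    x≢0 refl = 0≢1 (trans (sym (zeroˡ y)) xy≡1)

  inv-involutive : ∀ x → inv (inv x) ≡ x
  inv-involutive x with x ≟ 0#
  ... | yes x≡0 = trans inv-0 (sym x≡0)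
  ... | no x≢0 = inv-unique (trans (*-comm _ x) (proj₂ (inverse x x≢0)))

  infixr 8 _^_
  _^_ : Carrier → ℕ → Carrier
  x ^ zero = 1#
  x ^ suc n = x * x ^ n

  ^-+ : ∀ x m n → x ^ (m ℕ.+ n) ≡ x ^ m * x ^ n
  ^-+ x zero n = sym (*-identityˡ _)
  ^-+ x (suc m) n = trans (cong (x *_) (^-+ x m n)) (sym (*-assoc x _ _))

  ^-* : ∀ x m n → x ^ (m ℕ.* n) ≡ (x ^ n) ^ m
  ^-* x zero n = refl
  ^-* x (suc m) n = trans (^-+ x n (m ℕ.* n)) (cong (x ^ n *_) (^-* x m n))

  *-^ : ∀ x y n → (x * y) ^ n ≡ x ^ n * y ^ n
  *-^ x y zero = sym (*-identityˡ 1#)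
  *-^ x y (suc n) = trans (cong (x * y *_) (*-^ x y n))
    (solve 4 (λ x y a b → (x :* y) :* (a :* b) := (x :* a) :* (y :* b)) refl x y (x ^ n) (y ^ n))

  0^ : ∀ {n} → n ≢ 0 → 0# ^ n ≡ 0#
  0^ {zero} p = ⊥-elim (p refl)
  0^ {suc n} _ = zeroˡ _

  ^-≢0 : ∀ {x} n → x ≢ 0# → x ^ n ≢ 0#
  ^-≢0 zero x≢0 eq = 0≢1 (sym eq)
  ^-≢0 (suc n) x≢0 eq = ^-≢0 n x≢0 (xy≡0⇒y≡0 x≢0 eq)

  order≢0 : order ≢ 0
  order≢0 eq with elements | elements-complete 0#
  ... | _ ∷ _ | _ with () ← eq

-- Counting with duplicate-free lists

∈-drop-middle : {A : Set} {x y : A} (as : List A) {bs : List A} → y ∈ as List.++ x ∷ bs → y ≢ x → y ∈ as List.++ bs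
∈-drop-middle as y∈ y≢x with ∈-++⁻ as y∈
... | inj₁ y∈as = ∈-++⁺ˡ y∈as
... | inj₂ (here y≡x) = ⊥-elim (y≢x y≡x)
... | inj₂ (there y∈bs) = ∈-++⁺ʳ as y∈bs

module _ {A B : Set} where

  -- The image of the head is removed from `ys`; by injectivity the images of the remaining entries
  -- survive this removal.
  length-injection : (f : A → B) {xs : List A} {ys : List B} → Unique xs →
    (∀ {x y} → x ∈ xs → y ∈ xs → f x ≡ f y → x ≡ y) →
    (∀ {x} → x ∈ xs → f x ∈ ys) → length xs ≤ length ys
  length-injection f {[]} [] inj into = z≤n
  length-injection f {x ∷ xs} (x∉xs ∷ uniq) inj into with ∈-∃++ (into (here refl))
  ... | as , bs , refl = subst (suc (length xs) ≤_)
    (sym (trans (Listₚ.length-++ as) (trans (ℕₚ.+-suc _ _) (cong suc (sym (Listₚ.length-++ as))))))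
    (s≤s (length-injection f uniq (λ p q → inj (there p) (there q))
      (λ {y} y∈xs → ∈-drop-middle as (into (there y∈xs))
        (λ eq → All.lookup x∉xs y∈xs (sym (inj (there y∈xs) (here refl) eq))))))

module _ {A B : Set} where

  length-bijection : (f : A → B) (g : B → A) {xs : List A} {ys : List B} → Unique xs → Unique ys →
    (∀ {x} → x ∈ xs → f x ∈ ys × g (f x) ≡ x) →
    (∀ {y} → y ∈ ys → g y ∈ xs × f (g y) ≡ y) → length xs ≡ length ys
  length-bijection f g ux uy p q = ℕₚ.≤-antisym
    (length-injection f ux (λ x∈ y∈ eq → trans (sym (proj₂ (p x∈))) (trans (cong g eq) (proj₂ (p y∈))))
      (λ x∈ → proj₁ (p x∈)))
    (length-injection g uy (λ x∈ y∈ eq → trans (sym (proj₂ (q x∈))) (trans (cong f eq) (proj₂ (q y∈))))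
      (λ x∈ → proj₁ (q x∈)))

  pigeonhole : DecidableEquality A → DecidableEquality B → (f : A → B) {xs : List A} {ys : List B} →
    Unique xs → (∀ {x} → x ∈ xs → f x ∈ ys) → length ys < length xs →
    ∃[ x ] ∃[ y ] x ≢ y × f x ≡ f y
  pigeonhole _≟A_ _≟B_ f {xs} uniq into lt
    with Any.any? (λ x → Any.any? (λ y → ¬? (x ≟A y) ×-dec (f x ≟B f y)) xs) xs
  ... | yes p with find p
  ...   | x , _ , q with find q
  ...     | y , _ , x≢y , eq = x , y , x≢y , eq
  pigeonhole _≟A_ _≟B_ f {xs} uniq into lt | no ¬p =
    ⊥-elim (ℕₚ.<⇒≱ lt (length-injection f uniq inj into))
    where
    inj : ∀ {x y} → x ∈ xs → y ∈ xs → f x ≡ f y → x ≡ y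
    inj {x} {y} x∈ y∈ eq with x ≟A y
    ... | yes x≡y = x≡y
    ... | no x≢y = ⊥-elim (¬p (lose x∈ (lose y∈ (x≢y , eq))))

𝟙 : {P : Set} → Dec P → ℕ
𝟙 (yes _) = 1
𝟙 (no _) = 0

module _ {A : Set} where

  length-≡ : {xs ys : List A} → Unique xs → Unique ys → (∀ {x} → x ∈ xs → x ∈ ys) → (∀ {x} → x ∈ ys → x ∈ xs) →
    length xs ≡ length ys
  length-≡ ux uy p q = length-bijection (λ x → x) (λ x → x) ux uy (λ x∈ → p x∈ , refl) (λ x∈ → q x∈ , refl)

  -- A missed value y, put in front of all the images, would give a duplicate-free list longer than
  -- the whole type.
  injective⇒surjective : DecidableEquality A → {xs : List A} → Unique xs → (∀ x → x ∈ xs) →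
    (f : A → A) → (∀ {x y} → f x ≡ f y → x ≡ y) → ∀ y → ∃[ x ] f x ≡ y
  injective⇒surjective _≟A_ {xs} uniq complete f inj y with Any.any? (λ x → f x ≟A y) xs
  ... | yes p = let x , _ , eq = find p in x , eq
  ... | no ¬p = ⊥-elim (ℕₚ.1+n≰n (subst (λ n → suc n ≤ length xs) (Listₚ.length-map f xs)
      (length-injection (λ x → x) {y ∷ List.map f xs} {xs}
        (All.tabulate (λ {z} z∈ y≡z → let x , x∈ , eq = ∈-map⁻ f z∈ in ¬p (lose x∈ (sym (trans y≡z eq))))
          ∷ Uniqueₚ.map⁺ inj uniq)
        (λ _ _ eq → eq) (λ _ → complete _))))

  ∑ : (A → ℕ) → List A → ℕ
  ∑ f [] = 0
  ∑ f (x ∷ xs) = f x ℕ.+ ∑ f xs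

  count : {P : A → Set} → Decidable P → List A → ℕ
  count P? xs = length (filter P? xs)

  count-∑ : {P : A → Set} (P? : Decidable P) → ∀ xs → count P? xs ≡ ∑ (λ x → 𝟙 (P? x)) xs
  count-∑ P? [] = refl
  count-∑ P? (x ∷ xs) with P? x
  ... | yes _ = cong suc (count-∑ P? xs)
  ... | no _ = count-∑ P? xs

  ∑-cong : {f g : A → ℕ} → ∀ xs → (∀ {x} → x ∈ xs → f x ≡ g x) → ∑ f xs ≡ ∑ g xs
  ∑-cong [] eq = refl
  ∑-cong (x ∷ xs) eq = cong₂ ℕ._+_ (eq (here refl)) (∑-cong xs (λ p → eq (there p)))

  ∑-const : ∀ c xs → ∑ (λ _ → c) xs ≡ length xs ℕ.* c
  ∑-const c [] = refl
  ∑-const c (x ∷ xs) = cong (c ℕ.+_) (∑-const c xs)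

  ∑-+ : ∀ f g xs → ∑ (λ x → f x ℕ.+ g x) xs ≡ ∑ f xs ℕ.+ ∑ g xs
  ∑-+ f g [] = refl
  ∑-+ f g (x ∷ xs) = trans (cong (f x ℕ.+ g x ℕ.+_) (∑-+ f g xs)) (ℕ-interchange (f x) (g x) (∑ f xs) (∑ g xs))
    where
    ℕ-interchange : ∀ a b c d → a ℕ.+ b ℕ.+ (c ℕ.+ d) ≡ a ℕ.+ c ℕ.+ (b ℕ.+ d)
    ℕ-interchange a b c d = trans (ℕₚ.+-assoc a b (c ℕ.+ d)) (trans (cong (a ℕ.+_)
      (trans (sym (ℕₚ.+-assoc b c d)) (trans (cong (ℕ._+ d) (ℕₚ.+-comm b c)) (ℕₚ.+-assoc c b d))))
        (sym (ℕₚ.+-assoc a c (b ℕ.+ d))))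

  ∑-*ʳ : ∀ f c xs → ∑ (λ x → f x ℕ.* c) xs ≡ ∑ f xs ℕ.* c
  ∑-*ʳ f c [] = refl
  ∑-*ʳ f c (x ∷ xs) = trans (cong (f x ℕ.* c ℕ.+_) (∑-*ʳ f c xs)) (sym (ℕₚ.*-distribʳ-+ c (f x) (∑ f xs)))

  ∑-≤ : ∀ {f c} xs → (∀ {x} → x ∈ xs → f x ≤ c) → ∑ f xs ≤ length xs ℕ.* c
  ∑-≤ [] le = z≤n
  ∑-≤ (x ∷ xs) le = ℕₚ.+-mono-≤ (le (here refl)) (∑-≤ xs (λ p → le (there p)))

  count-none : {P : A → Set} (P? : Decidable P) → ∀ xs → (∀ {x} → x ∈ xs → ¬ P x) → count P? xs ≡ 0
  count-none P? [] none = refl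
  count-none P? (x ∷ xs) none with P? x
  ... | yes p = ⊥-elim (none (here refl) p)
  ... | no _ = count-none P? xs (λ q → none (there q))

  count-unique : {P : A → Set} (P? : Decidable P) → ∀ {xs y} → Unique xs → y ∈ xs → P y → (∀ {x} → P x → x ≡ y) →
    count P? xs ≡ 1
  count-unique P? {x ∷ xs} (x∉ ∷ u) (here refl) py uniq with P? x
  ... | yes _ = cong suc (count-none P? xs (λ z∈ pz → All.lookup x∉ z∈ (sym (uniq pz))))
  ... | no ¬p = ⊥-elim (¬p py)
  count-unique P? {x ∷ xs} (x∉ ∷ u) (there y∈) py uniq with P? x
  ... | yes p = ⊥-elim (All.lookup x∉ y∈ (uniq p))
  ... | no _ = count-unique P? u y∈ py uniq

  count-¬ : {P : A → Set} (P? : Decidable P) → ∀ xs → count P? xs ℕ.+ count (λ x → ¬? (P? x)) xs ≡ length xs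
  count-¬ P? [] = refl
  count-¬ P? (x ∷ xs) with P? x
  ... | yes _ = cong suc (count-¬ P? xs)
  ... | no _ = trans (ℕₚ.+-suc _ _) (cong suc (count-¬ P? xs))

  -- At most b summands, each at most a, can only add up to b a if none of them falls short.
  ∑-tight : ∀ {c : A → ℕ} {a} b ys → (∀ {y} → y ∈ ys → c y ≤ a) → length ys ≤ b → b ℕ.* a ≤ ∑ c ys →
    ∀ {y} → y ∈ ys → c y ≡ a
  ∑-tight {c} {a} (suc b) (y ∷ ys) le (s≤s len) tight (here refl) = ℕₚ.≤-antisym (le (here refl))
    (ℕₚ.+-cancelʳ-≤ (b ℕ.* a) a (c y) (ℕₚ.≤-trans tight (ℕₚ.+-monoʳ-≤ (c y)
      (ℕₚ.≤-trans (∑-≤ ys (λ p → le (there p))) (ℕₚ.*-monoˡ-≤ a len)))))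
  ∑-tight {c} {a} (suc b) (y ∷ ys) le (s≤s len) tight (there y∈) = ∑-tight b ys (λ p → le (there p)) len
    (ℕₚ.+-cancelˡ-≤ a _ _ (ℕₚ.≤-trans tight (ℕₚ.+-monoˡ-≤ (∑ c ys) (le (here refl))))) y∈

∑-swap : {A B : Set} (h : A → B → ℕ) → ∀ xs ys → ∑ (λ x → ∑ (h x) ys) xs ≡ ∑ (λ y → ∑ (λ x → h x y) xs) ys
∑-swap h [] ys = sym (trans (∑-const 0 ys) (ℕₚ.*-zeroʳ (length ys)))
∑-swap h (x ∷ xs) ys = trans (cong (∑ (h x) ys ℕ.+_) (∑-swap h xs ys)) (sym (∑-+ (h x) (λ y → ∑ (λ x → h x y) xs) ys))

double-count : {A B : Set} {R : A → B → Set} (R? : ∀ x y → Dec (R x y)) → ∀ xs ys →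
  ∑ (λ x → count (R? x) ys) xs ≡ ∑ (λ y → count (λ x → R? x y) xs) ys
double-count R? xs ys = trans (∑-cong xs (λ {x} _ → count-∑ (R? x) ys))
  (trans (∑-swap (λ x y → 𝟙 (R? x y)) xs ys) (sym (∑-cong ys (λ {y} _ → count-∑ (λ x → R? x y) xs))))

-- This takes the place of the rank theorem for additive maps: an upper bound for the fibres, one
-- for the target and a lower bound for the source determine every fibre, and in particular give
-- surjectivity.
fibres-tight : {A B : Set} (_≟B_ : DecidableEquality B) (f : A → B) {xs : List A} {ys : List B} → Unique ys →
  (∀ {x} → x ∈ xs → f x ∈ ys) → ∀ {a b} → (∀ {y} → y ∈ ys → count (λ x → f x ≟B y) xs ≤ a) → length ys ≤ b →
  b ℕ.* a ≤ length xs → ∀ {y} → y ∈ ys → count (λ x → f x ≟B y) xs ≡ a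
fibres-tight _≟B_ f {xs} {ys} uy into {a} {b} le len tight = ∑-tight b ys le len
  (ℕₚ.≤-trans tight (ℕₚ.≤-reflexive (trans (sym (trans (∑-const 1 xs) (ℕₚ.*-identityʳ _)))
    (trans (sym (∑-cong xs (λ {x} x∈ → count-unique (λ y → f x ≟B y) uy (into x∈) refl sym)))
      (double-count (λ x y → f x ≟B y) xs ys)))))

length-cartesianProductWith : {A B C : Set} (f : A → B → C) → ∀ xs ys →
  length (cartesianProductWith f xs ys) ≡ length xs ℕ.* length ys
length-cartesianProductWith f [] ys = refl
length-cartesianProductWith f (x ∷ xs) ys = trans (Listₚ.length-++ (List.map (f x) ys))
  (cong₂ ℕ._+_ (Listₚ.length-map (f x) ys) (length-cartesianProductWith f xs ys))

module _ {A : Set} (xs : List A) where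

  vectors : ∀ n → List (Vec A n)
  vectors zero = [] ∷ []
  vectors (suc n) = cartesianProductWith _∷_ xs (vectors n)

  vectors-unique : Unique xs → ∀ n → Unique (vectors n)
  vectors-unique u zero = [] ∷ []
  vectors-unique u (suc n) = Uniqueₚ.cartesianProductWith⁺ _∷_ (λ { refl → refl , refl }) u (vectors-unique u n)

  vectors-complete : (∀ x → x ∈ xs) → ∀ {n} (v : Vec A n) → v ∈ vectors n
  vectors-complete c [] = here refl
  vectors-complete c (x ∷ v) = ∈-cartesianProductWith⁺ _∷_ (c x) (vectors-complete c v)

  length-vectors : ∀ n → length (vectors n) ≡ length xs ℕ.^ n
  length-vectors zero = refl
  length-vectors (suc n) = trans (length-cartesianProductWith _∷_ xs (vectors n))
    (cong (length xs ℕ.*_) (length-vectors n))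

-- Polynomials: degree, division, roots, derivatives

module Polynomial (F : FiniteField) where
  open Field F

  Poly : Set
  Poly = Defs.Poly F

  coef : Poly → ℕ → Carrier
  coef = Defs.coef F

  addP mulP : Poly → Poly → Poly
  addP = Defs.addP F
  mulP = Defs.mulP F

  infix 4 _≈ₚ_
  _≈ₚ_ : Poly → Poly → Set
  _≈ₚ_ = Defs._≈ₚ_ F

  scale : Carrier → Poly → Poly
  scale a = map (a *_)

  coef-map : ∀ (g : Carrier → Carrier) → g 0# ≡ 0# → ∀ f i → coef (map g f) i ≡ g (coef f i)
  coef-map g g0 [] i = sym g0
  coef-map g g0 (a ∷ f) zero = refl
  coef-map g g0 (a ∷ f) (suc i) = coef-map g g0 f i

  coef-scale : ∀ a f i → coef (scale a f) i ≡ a * coef f i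
  coef-scale a = coef-map (a *_) (zeroʳ a)

  coef-addP : ∀ f g i → coef (addP f g) i ≡ coef f i + coef g i
  coef-addP [] g i = sym (+-identityˡ _)
  coef-addP (a ∷ f) [] i = sym (+-identityʳ _)
  coef-addP (a ∷ f) (b ∷ g) zero = refl
  coef-addP (a ∷ f) (b ∷ g) (suc i) = coef-addP f g i

  coef-mulP-∷ : ∀ a f g i → coef (mulP (a ∷ f) g) i ≡ a * coef g i + coef (0# ∷ mulP f g) i
  coef-mulP-∷ a f g i = trans (coef-addP (scale a g) (0# ∷ mulP f g) i)
    (cong (_+ coef (0# ∷ mulP f g) i) (coef-scale a g i))

  -- Coefficient lists may end in zeros, so their length says nothing about the degree; degrees are
  -- handled by vanishing conditions on coefficients instead.
  DegLt : Poly → ℕ → Set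
  DegLt f n = ∀ i → n ≤ i → coef f i ≡ 0#

  Monic : Poly → ℕ → Set
  Monic f n = coef f n ≡ 1# × DegLt f (suc n)

  ExactDeg : Poly → ℕ → Set
  ExactDeg f n = coef f n ≢ 0# × DegLt f (suc n)

  Monic⇒ExactDeg : ∀ {f n} → Monic f n → ExactDeg f n
  Monic⇒ExactDeg (top , lt) = (λ eq → 0≢1 (trans (sym eq) top)) , lt

  Monic≉0 : ∀ {f n} → Monic f n → ¬ (f ≈ₚ [])
  Monic≉0 {n = n} (top , _) eq = 0≢1 (trans (sym (eq n)) top)

  DegLt-mono : ∀ {f m n} → m ≤ n → DegLt f m → DegLt f n
  DegLt-mono m≤n lt i n≤i = lt i (ℕₚ.≤-trans m≤n n≤i)

  DegLt-addP : ∀ f g {n} → DegLt f n → DegLt g n → DegLt (addP f g) n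
  DegLt-addP f g p q i n≤i = trans (coef-addP f g i) (trans (cong₂ _+_ (p i n≤i) (q i n≤i)) (+-identityˡ 0#))

  DegLt-scale : ∀ a f {n} → DegLt f n → DegLt (scale a f) n
  DegLt-scale a f p i n≤i = trans (coef-scale a f i) (trans (cong (a *_) (p i n≤i)) (zeroʳ a))

  DegLt-∷ : ∀ {a f n} → DegLt f n → DegLt (a ∷ f) (suc n)
  DegLt-∷ p (suc i) (s≤s n≤i) = p i n≤i

  DegLt-tail : ∀ {a f n} → DegLt (a ∷ f) (suc n) → DegLt f n
  DegLt-tail p i n≤i = p (suc i) (s≤s n≤i)

  DegLt-length : ∀ f → DegLt f (length f)
  DegLt-length [] i _ = refl
  DegLt-length (a ∷ f) = DegLt-∷ {a} {f} (DegLt-length f)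

  mulP-0ˡ : ∀ f g → f ≈ₚ [] → mulP f g ≈ₚ []
  mulP-0ˡ [] g eq i = refl
  mulP-0ˡ (a ∷ f) g eq i = begin
    coef (mulP (a ∷ f) g) i                    ≡⟨ coef-mulP-∷ a f g i ⟩
    a * coef g i + coef (0# ∷ mulP f g) i      ≡⟨ cong₂ _+_ (trans (cong (_* coef g i) (eq 0)) (zeroˡ _)) (rest i) ⟩
    0# + 0#                                    ≡⟨ +-identityˡ 0# ⟩
    0#                                         ∎
    where
    rest : ∀ i → coef (0# ∷ mulP f g) i ≡ 0#
    rest zero = refl
    rest (suc i) = mulP-0ˡ f g (λ j → eq (suc j)) i

  -- The degrees (d - 1) and e add up. The successor on one side only avoids subtraction and
  -- includes d = 0, where f is zero.
  DegLt-mulP : ∀ f g {d e} → DegLt f d → DegLt g (suc e) → DegLt (mulP f g) (d ℕ.+ e)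
  DegLt-mulP f g {zero} p q i le = mulP-0ˡ f g (λ j → p j z≤n) i
  DegLt-mulP [] g {suc d} p q i le = refl
  DegLt-mulP (a ∷ f) g {suc d} {e} p q (suc i) (s≤s le) = begin
    coef (mulP (a ∷ f) g) (suc i)              ≡⟨ coef-mulP-∷ a f g (suc i) ⟩
    a * coef g (suc i) + coef (mulP f g) i
      ≡⟨ cong₂ _+_ (trans (cong (a *_) (q (suc i) (s≤s (ℕₚ.≤-trans (ℕₚ.m≤n+m e d) le)))) (zeroʳ a))
                                                            (DegLt-mulP f g (DegLt-tail {a} {f} p) q i le) ⟩
    0# + 0#                                    ≡⟨ +-identityˡ 0# ⟩
    0#                                         ∎

  coef-mulP-top : ∀ f g {d e} → DegLt f (suc d) → DegLt g (suc e) → coef (mulP f g) (d ℕ.+ e) ≡ coef f d * coef g e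
  coef-mulP-top [] g p q = sym (zeroˡ _)
  coef-mulP-top (a ∷ f) g {zero} {e} p q = trans (coef-mulP-∷ a f g e)
    (trans (cong (a * coef g e +_) (rest e)) (+-identityʳ _))
    where
    rest : ∀ i → coef (0# ∷ mulP f g) i ≡ 0#
    rest zero = refl
    rest (suc i) = mulP-0ˡ f g (λ j → p (suc j) (s≤s z≤n)) i
  coef-mulP-top (a ∷ f) g {suc d} {e} p q = trans (coef-mulP-∷ a f g (suc (d ℕ.+ e)))
    (trans (cong₂ _+_ (trans (cong (a *_) (q _ (s≤s (ℕₚ.m≤n+m e d)))) (zeroʳ a))
      (coef-mulP-top f g (DegLt-tail {a} {f} p) q)) (+-identityˡ _))

  mulP-ExactDeg : ∀ {f g d e} → ExactDeg f d → ExactDeg g e → coef (mulP f g) (d ℕ.+ e) ≢ 0#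
  mulP-ExactDeg {f} {g} (f≢0 , p) (g≢0 , q) eq = g≢0 (xy≡0⇒y≡0 f≢0 (trans (sym (coef-mulP-top f g p q)) eq))

  Monic-mulP : ∀ f g {d e} → Monic f d → Monic g e → Monic (mulP f g) (d ℕ.+ e)
  Monic-mulP f g (f1 , p) (g1 , q) =
    trans (coef-mulP-top f g p q) (trans (cong₂ _*_ f1 g1) (*-identityˡ 1#)) , DegLt-mulP f g p q

  -- The search starts from the tail: the head decides only if all higher coefficients vanish.
  degree : ∀ f → f ≈ₚ [] ⊎ ∃[ e ] ExactDeg f e
  degree [] = inj₁ (λ _ → refl)
  degree (a ∷ f) with degree f
  ... | inj₂ (e , f≢0 , p) = inj₂ (suc e , f≢0 , DegLt-∷ {a} {f} p)
  ... | inj₁ f≈0 with a ≟ 0#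
  ...   | yes a≡0 = inj₁ (λ { zero → a≡0 ; (suc i) → f≈0 i })
  ...   | no a≢0 = inj₂ (0 , a≢0 , DegLt-∷ {a} {f} (λ i _ → f≈0 i))

  ExactDeg<DegLt : ∀ {f e n} → ExactDeg f e → DegLt f n → e < n
  ExactDeg<DegLt {e = e} (f≢0 , _) lt = ℕₚ.≰⇒> (λ n≤e → f≢0 (lt e n≤e))

  -- A monic polynomial is stored by its n lower coefficients, lowest first. The monic polynomials
  -- of a given degree thus form a finite type that can be searched, with the vectors also serving
  -- as residues.
  mon : ∀ {n} → Vec Carrier n → Poly
  mon [] = 1# ∷ []
  mon (a ∷ v) = a ∷ mon v

  mon-Monic : ∀ {n} (v : Vec Carrier n) → Monic (mon v) n
  mon-Monic [] = refl , DegLt-∷ {1#} {[]} (λ _ _ → refl)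
  mon-Monic (a ∷ v) = proj₁ (mon-Monic v) , DegLt-∷ {a} {mon v} (proj₂ (mon-Monic v))

  Monic⇒mon : ∀ {n} f → Monic f n → Σ (Vec Carrier n) λ v → f ≈ₚ mon v
  Monic⇒mon [] (top , _) = ⊥-elim (0≢1 top)
  Monic⇒mon {zero} (a ∷ f) (top , lt) = [] , λ { zero → top ; (suc i) → lt (suc i) (s≤s z≤n) }
  Monic⇒mon {suc n} (a ∷ f) (top , lt) with Monic⇒mon {n} f (top , DegLt-tail {a} {f} lt)
  ... | v , eq = a ∷ v , λ { zero → refl ; (suc i) → eq i }

  DegLt⇒vec : ∀ n f → DegLt f n → Σ (Vec Carrier n) λ v → f ≈ₚ Vec.toList v
  DegLt⇒vec zero f lt = [] , λ i → lt i z≤n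
  DegLt⇒vec (suc n) [] lt with DegLt⇒vec n [] (λ _ _ → refl)
  ... | v , eq = 0# ∷ v , λ { zero → refl ; (suc i) → eq i }
  DegLt⇒vec (suc n) (a ∷ f) lt with DegLt⇒vec n f (DegLt-tail {a} {f} lt)
  ... | v , eq = a ∷ v , λ { zero → refl ; (suc i) → eq i }

  DegLt-toList : ∀ {n} (v : Vec Carrier n) → DegLt (Vec.toList v) n
  DegLt-toList [] i _ = refl
  DegLt-toList (a ∷ v) = DegLt-∷ {a} {Vec.toList v} (DegLt-toList v)

  ExactDeg⇒mon : ∀ {e} f → ExactDeg f e → Σ (Vec Carrier e) λ u → scale (inv (coef f e)) f ≈ₚ mon u
  ExactDeg⇒mon {e} f (f≢0 , lt) = Monic⇒mon (scale (inv (coef f e)) f)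
    (trans (coef-scale _ f e) (trans (*-comm _ _) (x*inv f≢0)) , DegLt-scale _ f lt)

  record Division (v : Poly) (n : ℕ) (f : Poly) : Set where
    field
      quotient remainder : Poly
      division-≈ : f ≈ₚ addP (mulP quotient v) remainder
      remainder-DegLt : DegLt remainder n

  -- If f = s v + r then a + X f = X s v + (a + X r). The new remainder can only reach degree n; its
  -- coefficient b there is removed by subtracting b v, which puts b in front of the quotient.
  divide : ∀ v n → Monic v n → ∀ f → Division v n f
  divide v n mv [] = record { quotient = [] ; remainder = [] ; division-≈ = λ _ → refl ; remainder-DegLt = λ _ _ →
    refl }
  divide v n (v1 , vlt) (a ∷ f) = record
    { quotient = b ∷ s
    ; remainder = r′
    ; division-≈ = λ i → sym (trans (coef-addP (mulP (b ∷ s) v) r′ i)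
        (trans (cong₂ _+_ (coef-mulP-∷ b s v i) (coef-r′ i)) (trans (cancel _ _ _ _) (eq i))))
    ; remainder-DegLt = lt }
    where
    open Division (divide v n (v1 , vlt) f) renaming (quotient to s; remainder to r)
    b = coef (a ∷ r) n
    r′ = addP (a ∷ r) (scale (- b) v)
    coef-r′ : ∀ i → coef r′ i ≡ coef (a ∷ r) i + - b * coef v i
    coef-r′ i = trans (coef-addP (a ∷ r) (scale (- b) v) i) (cong (coef (a ∷ r) i +_) (coef-scale (- b) v i))
    cancel : ∀ b v x y → (b * v + x) + (y + - b * v) ≡ x + y
    cancel = solve 4 (λ b v x y → (b :* v :+ x) :+ (y :+ (:- b) :* v) := x :+ y) refl
    eq : ∀ i → coef (0# ∷ mulP s v) i + coef (a ∷ r) i ≡ coef (a ∷ f) i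
    eq zero = +-identityˡ a
    eq (suc i) = sym (trans (division-≈ i) (coef-addP (mulP s v) r i))
    lt : DegLt r′ n
    lt i n≤i with n ℕ.≟ i
    ... | yes refl = trans (coef-r′ n) (trans (cong (λ z → b + - b * z) v1)
      (solve 1 (λ b → b :+ (:- b) :* con (ℤ.+ 1) := con (ℤ.+ 0)) refl b))
    ... | no n≢i = trans (coef-r′ i) (trans
      (cong₂ _+_ (beyond i (ℕₚ.≤∧≢⇒< n≤i n≢i)) (trans (cong (- b *_) (vlt i (ℕₚ.≤∧≢⇒< n≤i n≢i))) (zeroʳ _)))
      (+-identityˡ 0#))
      where
      beyond : ∀ i → n < i → coef (a ∷ r) i ≡ 0#
      beyond (suc i) (s≤s le) = remainder-DegLt i le

  eval : Poly → Carrier → Carrier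
  eval [] x = 0#
  eval (a ∷ f) x = a + x * eval f x

  eval-≈0 : ∀ f x → f ≈ₚ [] → eval f x ≡ 0#
  eval-≈0 [] x eq = refl
  eval-≈0 (a ∷ f) x eq = trans (cong₂ _+_ (eq 0) (trans (cong (x *_) (eval-≈0 f x (λ i → eq (suc i)))) (zeroʳ x)))
    (+-identityˡ 0#)

  eval-≈ : ∀ f g x → f ≈ₚ g → eval f x ≡ eval g x
  eval-≈ [] g x eq = sym (eval-≈0 g x (λ i → sym (eq i)))
  eval-≈ (a ∷ f) [] x eq = eval-≈0 (a ∷ f) x eq
  eval-≈ (a ∷ f) (b ∷ g) x eq = cong₂ (λ u v → u + x * v) (eq 0) (eval-≈ f g x (λ i → eq (suc i)))

  eval-addP : ∀ f g x → eval (addP f g) x ≡ eval f x + eval g x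
  eval-addP [] g x = sym (+-identityˡ _)
  eval-addP (a ∷ f) [] x = sym (+-identityʳ _)
  eval-addP (a ∷ f) (b ∷ g) x = trans (cong (λ z → (a + b) + x * z) (eval-addP f g x))
    (solve 5 (λ a b x u v → (a :+ b) :+ x :* (u :+ v) := (a :+ x :* u) :+ (b :+ x :* v)) refl a b x _ _)

  eval-scale : ∀ a f x → eval (scale a f) x ≡ a * eval f x
  eval-scale a [] x = sym (zeroʳ a)
  eval-scale a (b ∷ f) x = trans (cong (λ z → a * b + x * z) (eval-scale a f x))
    (solve 4 (λ a b x u → a :* b :+ x :* (a :* u) := a :* (b :+ x :* u)) refl a b x _)

  -- Synthetic division by X - r: the quotient has as coefficients the intermediate values of
  -- Horner's scheme at r.
  quot : Poly → Carrier → Poly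
  quot [] r = []
  quot (a ∷ f) r = eval f r ∷ quot f r

  linmul : Carrier → Poly → Poly
  linmul r s = addP (0# ∷ s) (scale (- r) s)

  eval-linmul : ∀ r s x → eval (linmul r s) x ≡ (x + - r) * eval s x
  eval-linmul r s x = trans (eval-addP (0# ∷ s) (scale (- r) s) x)
    (trans (cong₂ _+_ (+-identityˡ _) (eval-scale (- r) s x)) (sym (distribʳ _ x (- r))))

  coef-linmul : ∀ r s i → coef (linmul r s) i ≡ coef (0# ∷ s) i + - r * coef s i
  coef-linmul r s i = trans (coef-addP (0# ∷ s) (scale (- r) s) i) (cong (coef (0# ∷ s) i +_) (coef-scale (- r) s i))

  coef-quot : ∀ f r i → coef f i ≡ (coef (0# ∷ quot f r) i + - r * coef (quot f r) i) + coef (eval f r ∷ []) i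
  coef-quot [] r i = trans (sym (+-identityʳ 0#)) (cong₂ _+_ (trans (sym (+-identityʳ 0#))
      (cong₂ _+_ (z i) (sym (zeroʳ (- r))))) (z i))
    where
    z : ∀ i → 0# ≡ coef (0# ∷ []) i
    z zero = refl
    z (suc i) = refl
  coef-quot (a ∷ f) r zero = solve 3 (λ a r e → a := (con (ℤ.+ 0) :+ (:- r) :* e) :+ (a :+ r :* e)) refl a r
    (eval f r)
  coef-quot (a ∷ f) r (suc zero) = trans (coef-quot f r 0)
    (solve 3 (λ r e q → (con (ℤ.+ 0) :+ (:- r) :* q) :+ e := (e :+ (:- r) :* q) :+ con (ℤ.+ 0)) refl r (eval f r)
      (coef (quot f r) 0))
  coef-quot (a ∷ f) r (suc (suc i)) = coef-quot f r (suc i)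

  factor : ∀ f r → eval f r ≡ 0# → f ≈ₚ linmul r (quot f r)
  factor f r root i = trans (coef-quot f r i)
    (trans (cong (coef (0# ∷ quot f r) i + - r * coef (quot f r) i +_) (zero-rest i))
    (trans (+-identityʳ _) (sym (coef-linmul r (quot f r) i))))
    where
    zero-rest : ∀ i → coef (eval f r ∷ []) i ≡ 0#
    zero-rest zero = root
    zero-rest (suc i) = refl

  DegLt-quot : ∀ f r {n} → DegLt f (suc n) → DegLt (quot f r) n
  DegLt-quot [] r lt i le = refl
  DegLt-quot (a ∷ f) r {suc n} lt = DegLt-∷ {eval f r} {quot f r} (DegLt-quot f r (DegLt-tail {a} {f} lt))
  DegLt-quot (a ∷ f) r {zero} lt zero le = eval-≈0 f r (λ i → DegLt-tail {a} {f} lt i z≤n)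
  DegLt-quot (a ∷ f) r {zero} lt (suc i) le = DegLt-quot f r {0} (λ j _ → DegLt-tail {a} {f} lt j z≤n) i z≤n

  Monic-quot : ∀ f r {n} → Monic f (suc n) → Monic (quot f r) n
  Monic-quot f r (top , lt) = go f top lt , DegLt-quot f r lt
    where
    go : ∀ f {n} → coef f (suc n) ≡ 1# → DegLt f (suc (suc n)) → coef (quot f r) n ≡ 1#
    go [] top lt = top
    go (a ∷ f) {suc n} top lt = go f top (DegLt-tail {a} {f} lt)
    go (a ∷ []) {zero} top lt = top
    go (a ∷ b ∷ f) {zero} top lt = trans
      (cong₂ (λ u v → u + r * v) top (eval-≈0 f r (λ i → lt (suc (suc i)) (s≤s (s≤s z≤n)))))
      (trans (cong (1# +_) (zeroʳ r)) (+-identityʳ 1#))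

  linmul-0 : ∀ r s → s ≈ₚ [] → linmul r s ≈ₚ []
  linmul-0 r s eq i = trans (coef-linmul r s i)
    (trans (cong₂ _+_ (shifted i) (trans (cong (- r *_) (eq i)) (zeroʳ _))) (+-identityʳ 0#))
    where
    shifted : ∀ i → coef (0# ∷ s) i ≡ 0#
    shifted zero = refl
    shifted (suc i) = eq i

  -- One root is split off as a linear factor; the others differ from it, so they remain roots of
  -- the quotient, whose degree has dropped by one.
  too-many-roots : ∀ f rs → Unique rs → All (λ r → eval f r ≡ 0#) rs → DegLt f (length rs) → f ≈ₚ []
  too-many-roots f [] u roots lt i = lt i z≤n
  too-many-roots f (r ∷ rs) (r∉ ∷ u) (root ∷ roots) lt i = trans (factor f r root i)
    (linmul-0 r (quot f r) (too-many-roots (quot f r) rs u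
      (All.tabulate (λ {x} x∈ → xy≡0⇒y≡0 (λ eq → All.lookup r∉ x∈ (sym (x-y≡0⇒x≡y eq)))
        (trans (sym (eval-linmul r (quot f r) x))
          (trans (sym (eval-≈ f (linmul r (quot f r)) x (factor f r root))) (All.lookup roots x∈)))))
      (DegLt-quot f r lt)) i)

  roots-≤ : ∀ f n rs → ¬ (f ≈ₚ []) → DegLt f (suc n) → Unique rs → All (λ r → eval f r ≡ 0#) rs → length rs ≤ n
  roots-≤ f n rs f≉0 lt u roots with length rs ℕ.≤? n
  ... | yes le = le
  ... | no ¬le = ⊥-elim (f≉0 (too-many-roots f rs u roots (DegLt-mono {f} (ℕₚ.≰⇒> ¬le) lt)))

  prodlin : List Carrier → Poly
  prodlin [] = 1# ∷ []
  prodlin (r ∷ rs) = linmul r (prodlin rs)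

  Monic-linmul : ∀ r s {n} → Monic s n → Monic (linmul r s) (suc n)
  Monic-linmul r s {n} (top , lt) = trans (coef-linmul r s (suc n))
    (trans (cong₂ _+_ top (trans (cong (- r *_) (lt (suc n) ℕₚ.≤-refl)) (zeroʳ _))) (+-identityʳ 1#))
    , DegLt-addP (0# ∷ s) (scale (- r) s) (DegLt-∷ {0#} {s} lt)
      (DegLt-mono {scale (- r) s} (ℕₚ.n≤1+n _) (DegLt-scale (- r) s lt))

  prodlin-Monic : ∀ rs → Monic (prodlin rs) (length rs)
  prodlin-Monic [] = refl , DegLt-∷ {1#} {[]} (λ _ _ → refl)
  prodlin-Monic (r ∷ rs) = Monic-linmul r (prodlin rs) (prodlin-Monic rs)

  linmul-cong : ∀ r {s t} → s ≈ₚ t → linmul r s ≈ₚ linmul r t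
  linmul-cong r {s} {t} eq i = trans (coef-linmul r s i)
    (trans (cong₂ (λ u v → u + - r * v) (shifted i) (eq i)) (sym (coef-linmul r t i)))
    where
    shifted : ∀ i → coef (0# ∷ s) i ≡ coef (0# ∷ t) i
    shifted zero = refl
    shifted (suc i) = eq i

  -- The value of the formal derivative, from the product rule for a + X f.
  deriv : Poly → Carrier → Carrier
  deriv [] x = 0#
  deriv (a ∷ f) x = eval f x + x * deriv f x

  deriv-≈0 : ∀ f x → f ≈ₚ [] → deriv f x ≡ 0#
  deriv-≈0 [] x eq = refl
  deriv-≈0 (a ∷ f) x eq = trans (cong₂ _+_ (eval-≈0 f x (λ i → eq (suc i)))
    (trans (cong (x *_) (deriv-≈0 f x (λ i → eq (suc i)))) (zeroʳ x))) (+-identityˡ 0#)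

  deriv-≈ : ∀ f g x → f ≈ₚ g → deriv f x ≡ deriv g x
  deriv-≈ [] g x eq = sym (deriv-≈0 g x (λ i → sym (eq i)))
  deriv-≈ (a ∷ f) [] x eq = deriv-≈0 (a ∷ f) x eq
  deriv-≈ (a ∷ f) (b ∷ g) x eq = cong₂ (λ u v → u + x * v) (eval-≈ f g x (λ i → eq (suc i)))
    (deriv-≈ f g x (λ i → eq (suc i)))

  deriv-addP : ∀ f g x → deriv (addP f g) x ≡ deriv f x + deriv g x
  deriv-addP [] g x = sym (+-identityˡ _)
  deriv-addP (a ∷ f) [] x = sym (+-identityʳ _)
  deriv-addP (a ∷ f) (b ∷ g) x = trans (cong₂ (λ u v → u + x * v) (eval-addP f g x) (deriv-addP f g x))
    (solve 5 (λ p q x u v → (p :+ q) :+ x :* (u :+ v) := (p :+ x :* u) :+ (q :+ x :* v)) refl _ _ x _ _)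

  deriv-scale : ∀ a f x → deriv (scale a f) x ≡ a * deriv f x
  deriv-scale a [] x = sym (zeroʳ a)
  deriv-scale a (b ∷ f) x = trans (cong₂ (λ u v → u + x * v) (eval-scale a f x) (deriv-scale a f x))
    (solve 4 (λ a b x u → a :* b :+ x :* (a :* u) := a :* (b :+ x :* u)) refl a _ x _)

  deriv-linmul : ∀ r s x → deriv (linmul r s) x ≡ eval s x + (x + - r) * deriv s x
  deriv-linmul r s x = trans (deriv-addP (0# ∷ s) (scale (- r) s) x)
    (trans (cong (_ +_) (deriv-scale (- r) s x))
    (solve 4 (λ x r u v → (u :+ x :* v) :+ (:- r) :* v := u :+ (x :+ :- r) :* v) refl x r _ _))

  eval-prodlin-root : ∀ rs {x} → x ∈ rs → eval (prodlin rs) x ≡ 0#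
  eval-prodlin-root (r ∷ rs) {x} (here refl) = trans (eval-linmul r (prodlin rs) x)
    (trans (cong (_* eval (prodlin rs) x) (-‿inverseʳ x)) (zeroˡ _))
  eval-prodlin-root (r ∷ rs) {x} (there x∈) = trans (eval-linmul r (prodlin rs) x)
    (trans (cong (_ *_) (eval-prodlin-root rs x∈)) (zeroʳ _))

  Separable : Poly → Set
  Separable f = ∀ x → eval f x ≡ 0# → deriv f x ≢ 0#

  -- If r occurs a second time, both terms of the product rule for (X - r) s vanish at r, so r is a
  -- common zero of the polynomial and its derivative.
  separable⇒unique : ∀ rs → Separable (prodlin rs) → Unique rs
  separable⇒unique [] sep = []
  separable⇒unique (r ∷ rs) sep = All.tabulate distinct ∷ separable⇒unique rs sep′
    where
    s = prodlin rs
    double : ∀ x → eval s x ≡ 0# → (x + - r) * deriv s x ≡ 0# → ⊥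
    double x sx dx = sep x (trans (eval-linmul r s x) (trans (cong (_ *_) sx) (zeroʳ _)))
      (trans (deriv-linmul r s x) (trans (cong₂ _+_ sx dx) (+-identityˡ 0#)))
    sep′ : Separable s
    sep′ x sx dx = double x sx (trans (cong (_ *_) dx) (zeroʳ _))
    distinct : ∀ {x} → x ∈ rs → r ≢ x
    distinct {x} x∈ refl = double r (eval-prodlin-root rs x∈) (trans (cong (_* deriv s r) (-‿inverseʳ r)) (zeroˡ _))

  X^ : ℕ → Poly
  X^ zero = 1# ∷ []
  X^ (suc n) = 0# ∷ X^ n

  X^-Monic : ∀ n → Monic (X^ n) n
  X^-Monic zero = refl , DegLt-∷ {1#} {[]} (λ _ _ → refl)
  X^-Monic (suc n) = proj₁ (X^-Monic n) , DegLt-∷ {0#} {X^ n} (proj₂ (X^-Monic n))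

  eval-X^ : ∀ n x → eval (X^ n) x ≡ x ^ n
  eval-X^ zero x = trans (cong (1# +_) (zeroʳ x)) (+-identityʳ 1#)
  eval-X^ (suc n) x = trans (+-identityˡ _) (cong (x *_) (eval-X^ n x))

  deriv-X^ : ∀ n x → deriv (X^ (suc n)) x ≡ (suc n · 1#) * x ^ n
  deriv-X^ zero x = trans (cong₂ _+_ (eval-X^ 0 x) (trans (cong (x *_) (trans (+-identityˡ _) (zeroʳ x))) (zeroʳ x)))
    (sym (trans (*-identityʳ _) refl))
  deriv-X^ (suc n) x = trans (cong₂ _+_ (eval-X^ (suc n) x) (cong (x *_) (deriv-X^ n x)))
    (solve 3 (λ x c y → x :* y :+ x :* (c :* y) := (con (ℤ.+ 1) :+ c) :* (x :* y)) refl x (suc n · 1#) (x ^ n))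

-- Vector spaces, and polynomials in an operator

module Linear (F : FiniteField) where
  open Field F
  open Polynomial F

  infixl 6 _⊕_
  infixr 7 _•_

  -- Spaces are kept abstract because operators act on row vectors, on pairs of them, on extension
  -- fields and on an exterior algebra. Negation is multiplication by -1, which `0-smul` turns into
  -- an additive inverse.
  record Space : Set₁ where
    field
      V : Set
      add : V → V → V
      smul : Carrier → V → V
      𝟘 : V
      add-assoc : ∀ u v w → add (add u v) w ≡ add u (add v w)
      add-comm : ∀ u v → add u v ≡ add v u
      add-identityˡ : ∀ v → add 𝟘 v ≡ v
      smul-add : ∀ c u v → smul c (add u v) ≡ add (smul c u) (smul c v)
      add-smul : ∀ c d v → smul (c + d) v ≡ add (smul c v) (smul d v)
      smul-smul : ∀ c d v → smul (c * d) v ≡ smul c (smul d v)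
      1-smul : ∀ v → smul 1# v ≡ v
      0-smul : ∀ v → smul 0# v ≡ 𝟘

  open Space using (V)

  𝟘 : ∀ {S} → V S
  𝟘 {S} = Space.𝟘 S

  _⊕_ : ∀ {S} → V S → V S → V S
  _⊕_ {S} = Space.add S

  _•_ : ∀ {S} → Carrier → V S → V S
  _•_ {S} = Space.smul S

  module SpaceLaws (S : Space) where
    open Space S public hiding (V; 𝟘; add; smul)

    ⊖_ : V S → V S
    ⊖_ v = _•_ {S} (- 1#) v

    add-identityʳ : ∀ v → _⊕_ {S} v (𝟘 {S}) ≡ v
    add-identityʳ v = trans (add-comm v _) (add-identityˡ v)

    ⊖-inverse : ∀ v → _⊕_ {S} v (⊖ v) ≡ 𝟘 {S}
    ⊖-inverse v = trans (cong (λ w → _⊕_ {S} w (⊖ v)) (sym (1-smul v)))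
      (trans (sym (add-smul 1# (- 1#) v)) (trans (cong (λ c → _•_ {S} c v) (-‿inverseʳ 1#)) (0-smul v)))

    smul-0 : ∀ c → _•_ {S} c (𝟘 {S}) ≡ 𝟘 {S}
    smul-0 c = trans (cong (_•_ {S} c) (sym (0-smul (𝟘 {S}))))
      (trans (sym (smul-smul c 0# _)) (trans (cong (λ d → _•_ {S} d (𝟘 {S})) (zeroʳ c)) (0-smul _)))

    interchange : ∀ a b c d → _⊕_ {S} (_⊕_ {S} a b) (_⊕_ {S} c d) ≡ _⊕_ {S} (_⊕_ {S} a c) (_⊕_ {S} b d)
    interchange a b c d = trans (add-assoc a b _) (trans (cong (_⊕_ {S} a)
      (trans (sym (add-assoc b c d)) (trans (cong (λ z → _⊕_ {S} z d) (add-comm b c)) (add-assoc c b d))))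
        (sym (add-assoc a c _)))

    smul-comm : ∀ c d v → _•_ {S} c (_•_ {S} d v) ≡ _•_ {S} d (_•_ {S} c v)
    smul-comm c d v = trans (sym (smul-smul c d v)) (trans (cong (λ e → _•_ {S} e v) (*-comm c d)) (smul-smul d c v))

    add-zero⇒neg : ∀ u v → _⊕_ {S} u v ≡ 𝟘 {S} → v ≡ ⊖ u
    add-zero⇒neg u v eq = trans (sym (add-identityˡ v))
      (trans (cong (λ z → _⊕_ {S} z v) (sym (trans (add-comm _ u) (⊖-inverse u))))
      (trans (add-assoc (⊖ u) u v) (trans (cong (_⊕_ {S} (⊖ u)) eq) (add-identityʳ _))))

    ⊖-⊖ : ∀ v → ⊖ (⊖ v) ≡ v
    ⊖-⊖ v = trans (sym (smul-smul _ _ v))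
      (trans (cong (λ c → _•_ {S} c v) (trans (sym (-‿distribˡ-* 1# (- 1#)))
      (trans (cong -_ (*-identityˡ _)) (-‿involutive 1#)))) (1-smul v))

    sub≡0 : ∀ u v → _⊕_ {S} u (⊖ v) ≡ 𝟘 {S} → u ≡ v
    sub≡0 u v eq = sym (trans (sym (⊖-⊖ v)) (sym (trans (add-zero⇒neg (⊖ v) u (trans (add-comm _ u) eq)) refl)))

  record IsLinear (S S′ : Space) (φ : V S → V S′) : Set where
    field
      map-⊕ : ∀ u v → φ (_⊕_ {S} u v) ≡ _⊕_ {S′} (φ u) (φ v)
      map-• : ∀ c v → φ (_•_ {S} c v) ≡ _•_ {S′} c (φ v)

    map-𝟘 : φ (𝟘 {S}) ≡ 𝟘 {S′}
    map-𝟘 = trans (cong φ (sym (Space.0-smul S (𝟘 {S})))) (trans (map-• 0# _) (Space.0-smul S′ _))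

  open IsLinear public

  id-linear : ∀ S → IsLinear S S (λ v → v)
  id-linear S = record { map-⊕ = λ _ _ → refl ; map-• = λ _ _ → refl }

  ∘-linear : ∀ {S S′ S″ φ ψ} → IsLinear S′ S″ ψ → IsLinear S S′ φ → IsLinear S S″ (λ v → ψ (φ v))
  ∘-linear {ψ = ψ} lψ lφ = record
    { map-⊕ = λ u v → trans (cong ψ (map-⊕ lφ u v)) (map-⊕ lψ _ _)
    ; map-• = λ c v → trans (cong ψ (map-• lφ c v)) (map-• lψ _ _) }

  smul-linear : ∀ S c → IsLinear S S (_•_ {S} c)
  smul-linear S c = record { map-⊕ = Space.smul-add S c ; map-• = λ d v → SpaceLaws.smul-comm S c d v }

  ⊕-linear : ∀ S S′ {φ ψ} → IsLinear S S′ φ → IsLinear S S′ ψ → IsLinear S S′ (λ v → _⊕_ {S′} (φ v) (ψ v))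
  ⊕-linear S S′ lφ lψ = record
    { map-⊕ = λ u v → trans (cong₂ (_⊕_ {S′}) (map-⊕ lφ u v) (map-⊕ lψ u v)) (SpaceLaws.interchange S′ _ _ _ _)
    ; map-• = λ c v → trans (cong₂ (_⊕_ {S′}) (map-• lφ c v) (map-• lψ c v)) (sym (Space.smul-add S′ c _ _)) }

  -- Horner's scheme for f(T) v.
  act : ∀ S → (V S → V S) → Poly → V S → V S
  act S T [] v = 𝟘 {S}
  act S T (a ∷ f) v = _⊕_ {S} (_•_ {S} a v) (T (act S T f v))

  -- Commutation of polynomials in operators, the passage between a matrix and its block form and
  -- the conjugation of matrices are all instances of this.
  act-intertwine : ∀ S S′ {T T′ φ} → IsLinear S S′ φ → (∀ v → φ (T v) ≡ T′ (φ v)) →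
    ∀ f v → φ (act S T f v) ≡ act S′ T′ f (φ v)
  act-intertwine S S′ lφ comm [] v = map-𝟘 lφ
  act-intertwine S S′ {T′ = T′} lφ comm (a ∷ f) v = trans (map-⊕ lφ _ _)
    (cong₂ (_⊕_ {S′}) (map-• lφ a v) (trans (comm _) (cong T′ (act-intertwine S S′ lφ comm f v))))

  module Action (S : Space) (T : V S → V S) (lT : IsLinear S S T) where
    open SpaceLaws S

    act-linear : ∀ f → IsLinear S S (act S T f)
    act-linear [] = record { map-⊕ = λ _ _ → sym (add-identityˡ _) ; map-• = λ c _ → sym (smul-0 c) }
    act-linear (a ∷ f) = ⊕-linear S S (smul-linear S a) (∘-linear {S} {S} {S} lT (act-linear f))

    act-T : ∀ f v → act S T f (T v) ≡ T (act S T f v)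
    act-T f v = sym (act-intertwine S S lT (λ _ → refl) f v)

    act-comm : ∀ f g v → act S T f (act S T g v) ≡ act S T g (act S T f v)
    act-comm f g v = act-intertwine S S (act-linear f) (act-T f) g v

    act-addP : ∀ f g v → act S T (addP f g) v ≡ _⊕_ {S} (act S T f v) (act S T g v)
    act-addP [] g v = sym (add-identityˡ _)
    act-addP (a ∷ f) [] v = sym (add-identityʳ _)
    act-addP (a ∷ f) (b ∷ g) v = trans (cong₂ (_⊕_ {S}) (add-smul a b v)
      (trans (cong T (act-addP f g v)) (map-⊕ lT _ _))) (interchange _ _ _ _)

    act-scale : ∀ a f v → act S T (scale a f) v ≡ _•_ {S} a (act S T f v)
    act-scale a [] v = sym (smul-0 a)
    act-scale a (b ∷ f) v = trans (cong₂ (_⊕_ {S}) (smul-smul a b v)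
      (trans (cong T (act-scale a f v)) (map-• lT a _))) (sym (smul-add a _ _))

    act-shift : ∀ f v → act S T (0# ∷ f) v ≡ T (act S T f v)
    act-shift f v = trans (cong (λ z → _⊕_ {S} z (T (act S T f v))) (0-smul v)) (add-identityˡ _)

    act-mulP : ∀ f g v → act S T (mulP f g) v ≡ act S T f (act S T g v)
    act-mulP [] g v = refl
    act-mulP (a ∷ f) g v = trans (act-addP (scale a g) (0# ∷ mulP f g) v)
      (cong₂ (_⊕_ {S}) (act-scale a g v) (trans (act-shift (mulP f g) v) (cong T (act-mulP f g v))))

    act-≈0 : ∀ f v → f ≈ₚ [] → act S T f v ≡ 𝟘 {S}
    act-≈0 [] v eq = refl
    act-≈0 (a ∷ f) v eq = trans (cong₂ (_⊕_ {S}) (trans (cong (λ c → _•_ {S} c v) (eq 0)) (0-smul v))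
      (trans (cong T (act-≈0 f v (λ i → eq (suc i)))) (map-𝟘 lT))) (add-identityˡ _)

    act-≈ : ∀ f g v → f ≈ₚ g → act S T f v ≡ act S T g v
    act-≈ [] g v eq = sym (act-≈0 g v (λ i → sym (eq i)))
    act-≈ (a ∷ f) [] v eq = act-≈0 (a ∷ f) v eq
    act-≈ (a ∷ f) (b ∷ g) v eq = cong₂ (λ c w → _⊕_ {S} (_•_ {S} c v) (T w)) (eq 0) (act-≈ f g v (λ i → eq (suc i)))

    act-one : ∀ v → act S T (1# ∷ []) v ≡ v
    act-one v = trans (cong₂ (_⊕_ {S}) (1-smul v) (map-𝟘 lT)) (add-identityʳ v)

    act-negP : ∀ f v → act S T (Defs.negP F f) v ≡ ⊖ act S T f v
    act-negP [] v = sym (smul-0 _)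
    act-negP (a ∷ f) v = trans (cong₂ (_⊕_ {S})
      (trans (cong (λ c → _•_ {S} c v) (trans (cong -_ (sym (*-identityˡ a))) (-‿distribˡ-* 1# a)))
      (smul-smul (- 1#) a v))
      (trans (cong T (act-negP f v)) (map-• lT _ _))) (sym (smul-add _ _ _))

  -- Irreducibility in the form in which division uses it: no monic divisor has a degree strictly
  -- between 0 and n.
  Irr : ∀ {n} → Vec Carrier n → Set
  Irr {n} c = ∀ {d} (u : Vec Carrier d) → 0 < d → d < n → ∀ s → ¬ (mon c ≈ₚ mulP s (mon u))

  module _ (S : Space) (T : V S → V S) (lT : IsLinear S S T) {n} (c : Vec Carrier n) (irr : Irr c) (w : V S)
           (cw≡0 : act S T (mon c) w ≡ 𝟘 {S}) where
    open SpaceLaws S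
    open Action S T lT

    -- Euclid's algorithm: the remainder of `mon c` by an annihilator of w annihilates w again, is
    -- not zero because c is irreducible, and has smaller degree. The descent ends at the constant
    -- 1. The number `b` bounds the recursion.
    mon-faithful : ∀ b {e} (u : Vec Carrier e) → e < b → e < n → act S T (mon u) w ≡ 𝟘 {S} → w ≡ 𝟘 {S}
    mon-faithful b {zero} [] _ _ eq = trans (sym (act-one w)) eq
    mon-faithful (suc b) {suc e} u (s≤s lt) e<n eq = cases (degree r)
      where
      open Division (divide (mon u) (suc e) (mon-Monic u) (mon c)) renaming (quotient to s; remainder to r)
      rw≡0 : act S T r w ≡ 𝟘 {S}
      rw≡0 = begin
        act S T r w                                     ≡⟨ sym (add-identityˡ _) ⟩
        _⊕_ {S} (𝟘 {S}) (act S T r w)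
          ≡⟨ cong (λ z → _⊕_ {S} z (act S T r w))
          (sym (trans (act-mulP s (mon u) w) (trans (cong (act S T s) eq) (map-𝟘 (act-linear s))))) ⟩
        _⊕_ {S} (act S T (mulP s (mon u)) w) (act S T r w) ≡⟨ sym (act-addP (mulP s (mon u)) r w) ⟩
        act S T (addP (mulP s (mon u)) r) w
          ≡⟨ sym (act-≈ (mon c) (addP (mulP s (mon u)) r) w division-≈) ⟩
        act S T (mon c) w                               ≡⟨ cw≡0 ⟩
        𝟘 {S}                                           ∎
      cases : r ≈ₚ [] ⊎ (∃[ e′ ] ExactDeg r e′) → w ≡ 𝟘 {S}
      cases (inj₁ r≈0) = ⊥-elim (irr u (s≤s z≤n) e<n s (λ i → trans (division-≈ i)
        (trans (coef-addP (mulP s (mon u)) r i) (trans (cong (coef (mulP s (mon u)) i +_) (r≈0 i)) (+-identityʳ _)))))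
      cases (inj₂ (e′ , ex)) = mon-faithful b (proj₁ (ExactDeg⇒mon r ex)) (ℕₚ.<-≤-trans e′<e lt) (ℕₚ.<-trans e′<e e<n)
        (trans (sym (act-≈ (scale (inv (coef r e′)) r) (mon (proj₁ (ExactDeg⇒mon r ex))) w
          (proj₂ (ExactDeg⇒mon r ex))))
        (trans (act-scale _ r w) (trans (cong (_•_ {S} (inv (coef r e′))) rw≡0) (smul-0 _))))
        where
        e′<e = ExactDeg<DegLt {r} ex remainder-DegLt

    faithful : ∀ f → DegLt f n → ¬ (f ≈ₚ []) → act S T f w ≡ 𝟘 {S} → w ≡ 𝟘 {S}
    faithful f lt f≉0 eq with degree f
    ... | inj₁ f≈0 = ⊥-elim (f≉0 f≈0)
    ... | inj₂ (e , ex) = mon-faithful (suc e) (proj₁ (ExactDeg⇒mon f ex)) ℕₚ.≤-refl (ExactDeg<DegLt {f} ex lt)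
        (trans (sym (act-≈ (scale (inv (coef f e)) f) (mon (proj₁ (ExactDeg⇒mon f ex))) w
          (proj₂ (ExactDeg⇒mon f ex))))
        (trans (act-scale _ f w) (trans (cong (_•_ {S} (inv (coef f e))) eq) (smul-0 _))))

  vecSpace : ℕ → Space
  vecSpace n = record
    { V = Vec Carrier n
    ; add = Vec.zipWith _+_
    ; smul = λ c → Vec.map (c *_)
    ; 𝟘 = Vec.replicate n 0#
    ; add-assoc = assoc
    ; add-comm = comm
    ; add-identityˡ = idˡ
    ; smul-add = λ c → d₁ c
    ; add-smul = λ c d → d₂ c d
    ; smul-smul = λ c d → a₂ c d
    ; 1-smul = one
    ; 0-smul = nil
    }
    where
    assoc : ∀ {n} (u v w : Vec Carrier n) → Vec.zipWith _+_ (Vec.zipWith _+_ u v) w ≡ Vec.zipWith _+_ u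
      (Vec.zipWith _+_ v w)
    assoc [] [] [] = refl
    assoc (a ∷ u) (b ∷ v) (c ∷ w) = cong₂ _∷_ (+-assoc a b c) (assoc u v w)
    comm : ∀ {n} (u v : Vec Carrier n) → Vec.zipWith _+_ u v ≡ Vec.zipWith _+_ v u
    comm [] [] = refl
    comm (a ∷ u) (b ∷ v) = cong₂ _∷_ (+-comm a b) (comm u v)
    idˡ : ∀ {n} (v : Vec Carrier n) → Vec.zipWith _+_ (Vec.replicate n 0#) v ≡ v
    idˡ [] = refl
    idˡ (a ∷ v) = cong₂ _∷_ (+-identityˡ a) (idˡ v)
    d₁ : ∀ c {n} (u v : Vec Carrier n) → Vec.map (c *_) (Vec.zipWith _+_ u v) ≡ Vec.zipWith _+_ (Vec.map (c *_) u)
      (Vec.map (c *_) v)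
    d₁ c [] [] = refl
    d₁ c (a ∷ u) (b ∷ v) = cong₂ _∷_ (distribˡ c a b) (d₁ c u v)
    d₂ : ∀ c d {n} (v : Vec Carrier n) → Vec.map ((c + d) *_) v ≡ Vec.zipWith _+_ (Vec.map (c *_) v)
      (Vec.map (d *_) v)
    d₂ c d [] = refl
    d₂ c d (a ∷ v) = cong₂ _∷_ (distribʳ a c d) (d₂ c d v)
    a₂ : ∀ c d {n} (v : Vec Carrier n) → Vec.map ((c * d) *_) v ≡ Vec.map (c *_) (Vec.map (d *_) v)
    a₂ c d [] = refl
    a₂ c d (a ∷ v) = cong₂ _∷_ (*-assoc c d a) (a₂ c d v)
    one : ∀ {n} (v : Vec Carrier n) → Vec.map (1# *_) v ≡ v
    one [] = refl
    one (a ∷ v) = cong₂ _∷_ (*-identityˡ a) (one v)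
    nil : ∀ {n} (v : Vec Carrier n) → Vec.map (0# *_) v ≡ Vec.replicate n 0#
    nil [] = refl
    nil (a ∷ v) = cong₂ _∷_ (zeroˡ a) (nil v)

-- Matrices as linear maps on row vectors

module Matrices (F : FiniteField) where
  open Field F
  open Polynomial F
  open Linear F

  Vector : ℕ → Set
  Vector = Vec Carrier

  infixl 6 _+ᵥ_
  infixr 7 _*ᵥ_
  _+ᵥ_ : ∀ {n} → Vector n → Vector n → Vector n
  _+ᵥ_ = Vec.zipWith _+_

  _*ᵥ_ : ∀ {n} → Carrier → Vector n → Vector n
  c *ᵥ v = Vec.map (c *_) v

  0ᵥ : ∀ {n} → Vector n
  0ᵥ = Vec.replicate _ 0#

  module V n = SpaceLaws (vecSpace n)

  LinearV : ∀ {m n} → (Vector m → Vector n) → Set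
  LinearV {m} {n} = IsLinear (vecSpace m) (vecSpace n)

  -- The product of the row vector with the matrix: matrices act from the right, so composition of
  -- maps reverses the order of factors.
  combine : ∀ {m n} → Vector m → Vec (Vector n) m → Vector n
  combine [] [] = 0ᵥ
  combine (a ∷ v) (r ∷ M) = a *ᵥ r +ᵥ combine v M

  combine-linear : ∀ {m n} (M : Vec (Vector n) m) → LinearV (λ v → combine v M)
  combine-linear {n = n} [] = record { map-⊕ = λ { [] [] → sym (V.add-identityˡ n _) } ; map-• =
    λ { c [] → sym (V.smul-0 n c) } }
  combine-linear {n = n} (r ∷ M) = record
    { map-⊕ = λ { (a ∷ u) (b ∷ v) → trans (cong₂ _+ᵥ_ (V.add-smul n a b r) (map-⊕ (combine-linear M) u v))
      (V.interchange n _ _ _ _) }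
    ; map-• = λ { c (a ∷ v) → trans (cong₂ _+ᵥ_ (V.smul-smul n c a r) (map-• (combine-linear M) c v))
      (sym (V.smul-add n c _ _)) } }

  lookup-combine : ∀ {m n} (v : Vector m) (M : Vec (Vector n) m) j →
    Vec.lookup (combine v M) j ≡ Defs.sumF F (Vec.tabulate λ l → Vec.lookup v l * Vec.lookup (Vec.lookup M l) j)
  lookup-combine [] [] j = Vecₚ.lookup-replicate j 0#
  lookup-combine (a ∷ v) (r ∷ M) j = trans (Vecₚ.lookup-zipWith _+_ j (a *ᵥ r) (combine v M))
    (cong₂ _+_ (Vecₚ.lookup-map j (a *_) r) (lookup-combine v M j))

  combine-tabulate : ∀ {m n} (v : Vector m) (M : Vec (Vector n) m) →
    combine v M ≡ Vec.tabulate λ j → Defs.sumF F (Vec.tabulate λ l → Vec.lookup v l * Vec.lookup (Vec.lookup M l) j)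
  combine-tabulate v M = trans (sym (Vecₚ.tabulate∘lookup _)) (Vecₚ.tabulate-cong (lookup-combine v M))

  matMul-map : ∀ {k} (M N : Defs.Matrix F k) → Defs.matMul F M N ≡ Vec.map (λ r → combine r N) M
  matMul-map M N = trans (Vecₚ.tabulate-cong (λ i → sym (combine-tabulate (Vec.lookup M i) N)))
    (trans (Vecₚ.tabulate-∘ (λ r → combine r N) (Vec.lookup M)) (cong (Vec.map _) (Vecₚ.tabulate∘lookup M)))

  combine-map : ∀ {k m n} {φ : Vector m → Vector n} → LinearV φ → ∀ (v : Vector k) M → combine v (Vec.map φ M) ≡ φ
    (combine v M)
  combine-map lφ [] [] = sym (map-𝟘 lφ)
  combine-map {φ = φ} lφ (a ∷ v) (r ∷ M) = trans (cong₂ _+ᵥ_ (sym (map-• lφ a r)) (combine-map lφ v M))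
    (sym (map-⊕ lφ _ _))

  combine-matMul : ∀ {k} (v : Vector k) M N → combine v (Defs.matMul F M N) ≡ combine (combine v M) N
  combine-matMul v M N = trans (cong (combine v) (matMul-map M N)) (combine-map (combine-linear N) v M)

  -- The rows are the images of the unit vectors; restricting the map to vectors with first entry 0
  -- yields the later rows by recursion.
  mat : ∀ {m n} → (Vector m → Vector n) → Vec (Vector n) m
  mat {zero} φ = []
  mat {suc m} φ = φ (1# ∷ 0ᵥ) ∷ mat (λ v → φ (0# ∷ v))

  mat-cong : ∀ {m n} {φ ψ : Vector m → Vector n} → (∀ v → φ v ≡ ψ v) → mat φ ≡ mat ψ
  mat-cong {zero} eq = refl
  mat-cong {suc m} eq = cong₂ _∷_ (eq _) (mat-cong (λ v → eq (0# ∷ v)))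

  mat-map : ∀ {k m n} (ψ : Vector m → Vector n) (φ : Vector k → Vector m) → mat (λ v → ψ (φ v)) ≡ Vec.map ψ (mat φ)
  mat-map {zero} ψ φ = refl
  mat-map {suc k} ψ φ = cong (_ ∷_) (mat-map ψ (λ v → φ (0# ∷ v)))

  0∷-linear : ∀ {n} → LinearV {n} (0# ∷_)
  0∷-linear = record { map-⊕ = λ _ _ → cong (_∷ _) (sym (+-identityˡ 0#)) ; map-• = λ c _ → cong (_∷ _)
    (sym (zeroʳ c)) }

  split-head : ∀ {n} a (v : Vector n) → a *ᵥ (1# ∷ 0ᵥ) +ᵥ (0# ∷ v) ≡ a ∷ v
  split-head {n} a v = cong₂ _∷_ (trans (+-identityʳ _) (*-identityʳ a))
    (trans (cong (_+ᵥ v) (V.smul-0 n a)) (V.add-identityˡ n v))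

  combine-mat : ∀ {m n} {φ : Vector m → Vector n} → LinearV φ → ∀ v → combine v (mat φ) ≡ φ v
  combine-mat {zero} lφ [] = sym (map-𝟘 lφ)
  combine-mat {suc m} {n} {φ} lφ (a ∷ v) = trans
    (cong₂ _+ᵥ_ (sym (map-• lφ a _)) (combine-mat
    (∘-linear {vecSpace m} {vecSpace (suc m)} {vecSpace n} lφ 0∷-linear) v))
    (trans (sym (map-⊕ lφ _ _)) (cong φ (split-head a v)))

  mat-combine : ∀ {m n} (M : Vec (Vector n) m) → mat (λ v → combine v M) ≡ M
  mat-combine [] = refl
  mat-combine {suc m} {n} (r ∷ M) = cong₂ _∷_
    (trans (cong₂ _+ᵥ_ (V.1-smul n r) (map-𝟘 (combine-linear M))) (V.add-identityʳ n r))
    (trans (mat-cong (λ v → trans (cong (_+ᵥ combine v M) (V.0-smul n r)) (V.add-identityˡ n _))) (mat-combine M))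

  mat-ext : ∀ {m n} {M N : Vec (Vector n) m} → (∀ v → combine v M ≡ combine v N) → M ≡ N
  mat-ext {M = M} {N} eq = trans (sym (mat-combine M)) (trans (mat-cong eq) (mat-combine N))

  identity-mat : ∀ k → Defs.identity F k ≡ mat (λ v → v)
  identity-mat zero = refl
  identity-mat (suc k) = cong₂ _∷_ (cong (1# ∷_) (zeros k))
    (trans (Vecₚ.tabulate-∘ (0# ∷_) _) (trans (cong (Vec.map (0# ∷_)) (identity-mat k))
      (sym (mat-map (0# ∷_) (λ v → v)))))
    where
    zeros : ∀ n → Vec.tabulate {n = n} (λ _ → 0#) ≡ 0ᵥ
    zeros zero = refl
    zeros (suc n) = cong (0# ∷_) (zeros n)

  combine-identity : ∀ {k} (v : Vector k) → combine v (Defs.identity F k) ≡ v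
  combine-identity {k} v = trans (cong (combine v) (identity-mat k)) (combine-mat (id-linear (vecSpace k)) v)

  allVectors : ∀ n → List (Vector n)
  allVectors = vectors elements

  allVectors-complete : ∀ {n} (v : Vector n) → v ∈ allVectors n
  allVectors-complete = vectors-complete elements elements-complete

  allVectors-unique : ∀ n → Unique (allVectors n)
  allVectors-unique = vectors-unique elements elements-unique

  _≟ᵥ_ : ∀ {n} → DecidableEquality (Vector n)
  _≟ᵥ_ = Vecₚ.≡-dec _≟_

  module _ {k} {φ : Vector k → Vector k} (lφ : LinearV φ) (inj : ∀ v → φ v ≡ 0ᵥ → v ≡ 0ᵥ) where

    linear-injective : ∀ {u v} → φ u ≡ φ v → u ≡ v
    linear-injective {u} {v} eq = V.sub≡0 k u v (inj _ (trans (map-⊕ lφ u _)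
      (trans (cong₂ _+ᵥ_ eq (map-• lφ _ v)) (V.⊖-inverse k _))))

    -- Finiteness of the set of vectors replaces an argument on dimensions.
    linear-surjective : ∀ w → ∃[ v ] φ v ≡ w
    linear-surjective = injective⇒surjective _≟ᵥ_ (allVectors-unique k) allVectors-complete φ linear-injective

    mat-invertible : Defs.Invertible F k (mat φ)
    mat-invertible = mat ψ ,
      trans (mat-ext (λ v → trans (combine-matMul v (mat φ) (mat ψ))
        (trans (cong (λ w → combine w (mat ψ)) (combine-mat lφ v))
        (trans (combine-mat lψ _) (trans (ψφ v) (sym (combine-identity v))))))) refl ,
      mat-ext (λ v → trans (combine-matMul v (mat ψ) (mat φ))
        (trans (cong (λ w → combine w (mat φ)) (combine-mat lψ v))
        (trans (combine-mat lφ _) (trans (φψ v) (sym (combine-identity v))))))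
      where
      ψ : Vector k → Vector k
      ψ w = proj₁ (linear-surjective w)
      φψ : ∀ w → φ (ψ w) ≡ w
      φψ w = proj₂ (linear-surjective w)
      ψφ : ∀ v → ψ (φ v) ≡ v
      ψφ v = linear-injective (φψ (φ v))
      lψ : LinearV ψ
      lψ = record { map-⊕ = λ u v → linear-injective
        (trans (φψ _) (sym (trans (map-⊕ lφ _ _) (cong₂ _+ᵥ_ (φψ u) (φψ v)))))
                  ; map-• = λ c v → linear-injective (trans (φψ _)
                    (sym (trans (map-• lφ c _) (cong (c *ᵥ_) (φψ v))))) }

-- Residue rings modulo a monic polynomial

-- Multiplication by X on F[X]/(X^n + c_{n-1} X^{n-1} + … + c_0), elements being written in the basis 1, X, …, X^{n-1}.
module Companion (F : FiniteField) where
  open Field F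
  open Polynomial F
  open Linear F
  open Matrices F

  -- Together with `top` this describes a + X v: `push a v` holds the coefficients below X^n, and
  -- `top a v` is the coefficient of X^n that overflows.
  push : ∀ {n} → Carrier → Vector n → Vector n
  push a [] = []
  push a (b ∷ v) = a ∷ push b v

  top : ∀ {n} → Carrier → Vector n → Carrier
  top a [] = a
  top a (b ∷ v) = top b v

  mulX : ∀ {n} → Vector n → Vector n → Vector n
  mulX c v = push 0# v +ᵥ top 0# v *ᵥ (- 1# *ᵥ c)

  push-+ : ∀ {n} a b (u v : Vector n) → push (a + b) (u +ᵥ v) ≡ push a u +ᵥ push b v
  push-+ a b [] [] = refl
  push-+ a b (x ∷ u) (y ∷ v) = cong (_ ∷_) (push-+ x y u v)

  push-* : ∀ {n} c a (u : Vector n) → push (c * a) (c *ᵥ u) ≡ c *ᵥ push a u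
  push-* c a [] = refl
  push-* c a (x ∷ u) = cong (_ ∷_) (push-* c x u)

  top-+ : ∀ {n} a b (u v : Vector n) → top (a + b) (u +ᵥ v) ≡ top a u + top b v
  top-+ a b [] [] = refl
  top-+ a b (x ∷ u) (y ∷ v) = top-+ x y u v

  top-* : ∀ {n} c a (u : Vector n) → top (c * a) (c *ᵥ u) ≡ c * top a u
  top-* c a [] = refl
  top-* c a (x ∷ u) = top-* c x u

  mulX-linear : ∀ {n} (c : Vector n) → LinearV (mulX c)
  mulX-linear {n} c = record
    { map-⊕ = λ u v → trans (cong₂ (λ p t → p +ᵥ t *ᵥ c′)
      (trans (cong (λ z → push z (u +ᵥ v)) (sym (+-identityˡ 0#))) (push-+ 0# 0# u v))
                                    (trans (cong (λ z → top z (u +ᵥ v)) (sym (+-identityˡ 0#))) (top-+ 0# 0# u v)))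
        (trans (cong (_ +ᵥ_) (V.add-smul n _ _ c′)) (V.interchange n _ _ _ _))
    ; map-• = λ d v → trans (cong₂ (λ p t → p +ᵥ t *ᵥ c′)
      (trans (cong (λ z → push z (d *ᵥ v)) (sym (zeroʳ d))) (push-* d 0# v))
                                    (trans (cong (λ z → top z (d *ᵥ v)) (sym (zeroʳ d))) (top-* d 0# v)))
        (trans (cong (_ +ᵥ_) (V.smul-smul n d _ c′)) (sym (V.smul-add n d _ _))) }
    where c′ = - 1# *ᵥ c

  padTo : ∀ n → Poly → Vector n
  padTo zero f = []
  padTo (suc n) [] = 0# ∷ padTo n []
  padTo (suc n) (a ∷ f) = a ∷ padTo n f

  padTo-[] : ∀ n → padTo n [] ≡ 0ᵥ
  padTo-[] zero = refl
  padTo-[] (suc n) = cong (0# ∷_) (padTo-[] n)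

  padTo-0 : ∀ n → padTo n (0# ∷ []) ≡ padTo n []
  padTo-0 zero = refl
  padTo-0 (suc n) = refl

  padTo-toList : ∀ {n} (v : Vector n) → padTo n (Vec.toList v) ≡ v
  padTo-toList [] = refl
  padTo-toList (a ∷ v) = cong (a ∷_) (padTo-toList v)

  push-padTo : ∀ n a f → push a (padTo n f) ≡ padTo n (a ∷ f)
  push-padTo zero a f = refl
  push-padTo (suc n) a [] = cong (a ∷_) (trans (push-padTo n 0# []) (padTo-0 n))
  push-padTo (suc n) a (b ∷ f) = cong (a ∷_) (push-padTo n b f)

  top-padTo : ∀ n a f → length f < n → top a (padTo n f) ≡ 0#
  top-padTo (suc zero) a [] _ = refl
  top-padTo (suc (suc n)) a [] _ = top-padTo (suc n) 0# [] (s≤s z≤n)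
  top-padTo (suc n) a (b ∷ f) (s≤s lt) = top-padTo n b f lt

  padTo-X^ : ∀ n → padTo n (X^ n) ≡ 0ᵥ
  padTo-X^ zero = refl
  padTo-X^ (suc n) = cong (0# ∷_) (padTo-X^ n)

  top-X^ : ∀ n a → top a (padTo (suc n) (X^ n)) ≡ 1#
  top-X^ zero a = refl
  top-X^ (suc n) a = top-X^ n 0#

  length-X^ : ∀ n → length (X^ n) ≡ suc n
  length-X^ zero = refl
  length-X^ (suc n) = cong suc (length-X^ n)

  mon-≈ : ∀ {n} (c : Vector n) → mon c ≈ₚ addP (Vec.toList c) (X^ n)
  mon-≈ [] i = refl
  mon-≈ (a ∷ c) zero = sym (+-identityʳ a)
  mon-≈ (a ∷ c) (suc i) = mon-≈ c i

  module _ {n} (c : Vector (suc n)) where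
    private
      S = vecSpace (suc n)
      module A = Action S (mulX c) (mulX-linear c)
      open SpaceLaws S using (add-identityˡ; add-identityʳ; smul-0; ⊖-inverse)

    one : Vector (suc n)
    one = 1# ∷ 0ᵥ

    -- No coefficient overflows as long as the degree stays at most n, so f applied to 1 just writes
    -- down the coefficients of f. Hence 1 is a cyclic vector for multiplication by X.
    act-one-padTo : ∀ f → length f ≤ suc n → act S (mulX c) f one ≡ padTo (suc n) f
    act-one-padTo [] _ = sym (padTo-[] (suc n))
    act-one-padTo (a ∷ f) (s≤s le) = begin
      a *ᵥ one +ᵥ mulX c (act S (mulX c) f one)
        ≡⟨ cong (λ z → a *ᵥ one +ᵥ mulX c z) (act-one-padTo f (ℕₚ.≤-trans le (ℕₚ.n≤1+n n))) ⟩
      a *ᵥ one +ᵥ mulX c (padTo (suc n) f)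
        ≡⟨ cong₂ (λ p t → a *ᵥ one +ᵥ (p +ᵥ t *ᵥ (- 1# *ᵥ c))) (push-padTo (suc n) 0# f)
        (top-padTo (suc n) 0# f (s≤s le)) ⟩
      a *ᵥ one +ᵥ (padTo (suc n) (0# ∷ f) +ᵥ 0# *ᵥ (- 1# *ᵥ c))
        ≡⟨ cong (a *ᵥ one +ᵥ_) (trans (cong (_ +ᵥ_) (V.0-smul (suc n) _)) (add-identityʳ _)) ⟩
      a *ᵥ one +ᵥ (0# ∷ padTo n f)                ≡⟨ split-head a (padTo n f) ⟩
      a ∷ padTo n f                               ∎

    act-toList-one : ∀ v → act S (mulX c) (Vec.toList v) one ≡ v
    act-toList-one v = trans (act-one-padTo (Vec.toList v) (ℕₚ.≤-reflexive (Vecₚ.length-toList v))) (padTo-toList v)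

    act-mon-one : act S (mulX c) (mon c) one ≡ 0ᵥ
    act-mon-one = begin
      act S (mulX c) (mon c) one
        ≡⟨ A.act-≈ (mon c) (addP (Vec.toList c) (X^ (suc n))) one (mon-≈ c) ⟩
      act S (mulX c) (addP (Vec.toList c) (X^ (suc n))) one     ≡⟨ A.act-addP (Vec.toList c) (X^ (suc n)) one ⟩
      act S (mulX c) (Vec.toList c) one +ᵥ act S (mulX c) (0# ∷ X^ n) one
        ≡⟨ cong₂ _+ᵥ_ (act-toList-one c) (A.act-shift (X^ n) one) ⟩
      c +ᵥ mulX c (act S (mulX c) (X^ n) one)
        ≡⟨ cong (λ z → c +ᵥ mulX c z) (act-one-padTo (X^ n) (ℕₚ.≤-reflexive (length-X^ n))) ⟩
      c +ᵥ mulX c (padTo (suc n) (X^ n))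
        ≡⟨ cong₂ (λ p t → c +ᵥ (p +ᵥ t *ᵥ (- 1# *ᵥ c))) (trans (push-padTo (suc n) 0# (X^ n)) (padTo-X^ (suc n)))
        (top-X^ n 0#) ⟩
      c +ᵥ (0ᵥ +ᵥ 1# *ᵥ (- 1# *ᵥ c))
        ≡⟨ cong (c +ᵥ_) (trans (add-identityˡ _) (V.1-smul (suc n) _)) ⟩
      c +ᵥ (- 1# *ᵥ c)                                          ≡⟨ ⊖-inverse c ⟩
      0ᵥ                                                        ∎

    act-mon : ∀ v → act S (mulX c) (mon c) v ≡ 0ᵥ
    act-mon v = trans (cong (act S (mulX c) (mon c)) (sym (act-toList-one v)))
      (trans (A.act-comm (mon c) (Vec.toList v) one)
        (trans (cong (act S (mulX c) (Vec.toList v)) act-mon-one) (map-𝟘 (A.act-linear (Vec.toList v)))))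

    infixl 7 _⊛_
    -- The left factor is read as a polynomial in X and applied to the right one. Every vector is a
    -- polynomial in X applied to 1, so the ring laws follow from the commutation of such
    -- polynomials.
    _⊛_ : Vector (suc n) → Vector (suc n) → Vector (suc n)
    u ⊛ v = act S (mulX c) (Vec.toList u) v

    ⊛-comm : ∀ u v → u ⊛ v ≡ v ⊛ u
    ⊛-comm u v = trans (cong (u ⊛_) (sym (act-toList-one v)))
      (trans (A.act-comm (Vec.toList u) (Vec.toList v) one) (cong (v ⊛_) (act-toList-one u)))

    ⊛-linear : ∀ u → LinearV (u ⊛_)
    ⊛-linear u = A.act-linear (Vec.toList u)

    ⊛-exchange : ∀ u v w → u ⊛ (v ⊛ w) ≡ v ⊛ (u ⊛ w)
    ⊛-exchange u v w = A.act-comm (Vec.toList u) (Vec.toList v) w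

    ⊛-assoc : ∀ u v w → (u ⊛ v) ⊛ w ≡ u ⊛ (v ⊛ w)
    ⊛-assoc u v w = trans (⊛-comm (u ⊛ v) w) (trans (⊛-exchange w u v) (cong (u ⊛_) (⊛-comm w v)))

    one-⊛ : ∀ v → one ⊛ v ≡ v
    one-⊛ v = trans (⊛-comm one v) (act-toList-one v)

    mulX-⊛ : ∀ v → mulX c one ⊛ v ≡ mulX c v
    mulX-⊛ v = trans (⊛-comm (mulX c one) v) (trans (A.act-T (Vec.toList v) one) (cong (mulX c) (act-toList-one v)))

    +ᵥ-inverse : ∀ {k} (v : Vector k) → v +ᵥ Vec.map -_ v ≡ 0ᵥ
    +ᵥ-inverse [] = refl
    +ᵥ-inverse (a ∷ v) = cong₂ _∷_ (-‿inverseʳ a) (+ᵥ-inverse v)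

    quotient-isCommutativeRing : IsCommutativeRing _≡_ (_+ᵥ_ {suc n}) _⊛_ (Vec.map -_) 0ᵥ one
    quotient-isCommutativeRing = record
      { isRing = record
        { +-isAbelianGroup = record
          { isGroup = record
            { isMonoid = record
              { isSemigroup = record
                { isMagma = record { isEquivalence = isEquivalence ; ∙-cong = cong₂ _+ᵥ_ }
                ; assoc = V.add-assoc (suc n) }
              ; identity = V.add-identityˡ (suc n) , add-identityʳ }
            ; inverse = (λ v → trans (V.add-comm (suc n) _ v) (+ᵥ-inverse v)) , +ᵥ-inverse
            ; ⁻¹-cong = cong (Vec.map -_) }
          ; comm = V.add-comm (suc n) }
        ; *-cong = cong₂ _⊛_
        ; *-assoc = ⊛-assoc
        ; *-identity = one-⊛ , act-toList-one
        ; distrib = (λ u v w → map-⊕ (⊛-linear u) v w)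
                  , (λ u v w → trans (⊛-comm (v +ᵥ w) u)
                    (trans (map-⊕ (⊛-linear u) v w) (cong₂ _+ᵥ_ (⊛-comm u v) (⊛-comm u w)))) }
      ; *-comm = ⊛-comm }

    coef-0ᵥ : ∀ k i → coef (Vec.toList (0ᵥ {k})) i ≡ 0#
    coef-0ᵥ zero i = refl
    coef-0ᵥ (suc k) zero = refl
    coef-0ᵥ (suc k) (suc i) = coef-0ᵥ k i

    toList≈0 : ∀ {k} (v : Vector k) → Vec.toList v ≈ₚ [] → v ≡ 0ᵥ
    toList≈0 [] eq = refl
    toList≈0 (a ∷ v) eq = cong₂ _∷_ (eq 0) (toList≈0 v (λ i → eq (suc i)))

    -- A nonzero residue has degree below that of the irreducible c, which annihilates everything;
    -- it therefore acts injectively, hence onto, and 1 has a preimage.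
    quotientField : Irr c → FiniteField
    quotientField irr = record
      { Carrier = Vector (suc n)
      ; _+_ = _+ᵥ_
      ; _*_ = _⊛_
      ; -_ = Vec.map -_
      ; 0# = 0ᵥ
      ; 1# = one
      ; isCommutativeRing = quotient-isCommutativeRing
      ; 0≢1 = λ eq → 0≢1 (cong Vec.head eq)
      ; inverse = λ v v≢0 → linear-surjective (⊛-linear v)
          (λ w → faithful S (mulX c) (mulX-linear c) c irr w (act-mon w) (Vec.toList v) (DegLt-toList v)
            (λ eq → v≢0 (toList≈0 v eq))) one
      ; elements = allVectors (suc n)
      ; elements-unique = allVectors-unique (suc n)
      ; elements-complete = allVectors-complete }

-- Laplace expansion, exterior algebra and the vanishing of determinants

-- The auxiliary functions of the definition of detP are not exported; they are recovered by unification.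
module LaplaceExpansion (F : FiniteField) where
  open Polynomial F using (Poly)

  minor : ∀ {n} → Vec (Vec Poly (suc n)) n → Fin (suc n) → Poly
  minor {n} rs j = Defs.detP F n (Vec.map (λ row → Vec.removeAt row j) rs)

  mutual
    laplaceTail : ∀ k (r : Vec Poly (suc k)) (rs : Vec (Vec Poly (suc k)) k) → Fin k → Poly
    laplaceTail = _

    signedSuc : ∀ k (r : Vec Poly (suc k)) (rs : Vec (Vec Poly (suc k)) k) → ℕ → Poly → Poly
    signedSuc = _

    detP-suc : ∀ k (r : Vec Poly (suc k)) (rs : Vec (Vec Poly (suc k)) k) → Defs.detP F (suc k) (r ∷ rs) ≡
      Defs.addP F (Defs.mulP F (Vec.lookup r zero) (Defs.detP F k (Vec.map (λ row → Vec.removeAt row zero) rs)))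
        (Vec.foldr _ (Defs.addP F) (Defs.zeroP F) (Vec.tabulate (laplaceTail k r rs)))
    detP-suc k r rs = refl

    laplaceTail-eq : ∀ k (r : Vec Poly (suc k)) (rs : Vec (Vec Poly (suc k)) k) (j : Fin k) → laplaceTail k r rs j ≡
      Defs.mulP F (signedSuc k r rs (toℕ j) (Vec.lookup r (suc j)))
        (Defs.detP F k (Vec.map (λ row → Vec.removeAt row (suc j)) rs))
    laplaceTail-eq k r rs j with toℕ j | Vec.lookup r (suc j) | Defs.mulP F
    ... | n | f | g = refl

-- Exterior algebra on n generators with coefficients in a space with an operator: node a b stands for a + eₙ ∧ b.
-- The determinant is obtained by contracting the volume form with the rows of a matrix, and a family w that is
-- annihilated by all rows anticommutes with these contractions; as w ∧ vol = 0, the determinant annihilates w.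
module CayleyHamilton (F : FiniteField) (S : Linear.Space F)
  (T : Linear.Space.V S → Linear.Space.V S) (lT : Linear.IsLinear F S S T) where
  open Field F
  open Polynomial F
  open Linear F
  open LaplaceExpansion F
  open Action S T lT
  private
    W = Space.V S
    _⟨_⟩ : Poly → W → W
    f ⟨ w ⟩ = act S T f w
    module W = SpaceLaws S

  infix 20 _⟨_⟩

  data Ext : ℕ → Set where
    leaf : W → Ext 0
    node : ∀ {n} → Ext n → Ext n → Ext (suc n)

  private
    addₑ : ∀ {n} → Ext n → Ext n → Ext n
    addₑ (leaf u) (leaf v) = leaf (_⊕_ {S} u v)
    addₑ (node a b) (node c d) = node (addₑ a c) (addₑ b d)

    smulₑ : ∀ {n} → Carrier → Ext n → Ext n
    smulₑ c (leaf u) = leaf (_•_ {S} c u)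
    smulₑ c (node a b) = node (smulₑ c a) (smulₑ c b)

    0ₑ : ∀ {n} → Ext n
    0ₑ {zero} = leaf (𝟘 {S})
    0ₑ {suc n} = node 0ₑ 0ₑ

    assoc : ∀ {n} (u v w : Ext n) → addₑ (addₑ u v) w ≡ addₑ u (addₑ v w)
    assoc (leaf u) (leaf v) (leaf w) = cong leaf (W.add-assoc u v w)
    assoc (node a b) (node c d) (node e f) = cong₂ node (assoc a c e) (assoc b d f)
    comm : ∀ {n} (u v : Ext n) → addₑ u v ≡ addₑ v u
    comm (leaf u) (leaf v) = cong leaf (W.add-comm u v)
    comm (node a b) (node c d) = cong₂ node (comm a c) (comm b d)
    idˡ : ∀ {n} (v : Ext n) → addₑ 0ₑ v ≡ v
    idˡ (leaf u) = cong leaf (W.add-identityˡ u)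
    idˡ (node a b) = cong₂ node (idˡ a) (idˡ b)
    d₁ : ∀ c {n} (u v : Ext n) → smulₑ c (addₑ u v) ≡ addₑ (smulₑ c u) (smulₑ c v)
    d₁ c (leaf u) (leaf v) = cong leaf (W.smul-add c u v)
    d₁ c (node a b) (node a′ b′) = cong₂ node (d₁ c a a′) (d₁ c b b′)
    d₂ : ∀ c d {n} (v : Ext n) → smulₑ (c + d) v ≡ addₑ (smulₑ c v) (smulₑ d v)
    d₂ c d (leaf u) = cong leaf (W.add-smul c d u)
    d₂ c d (node a b) = cong₂ node (d₂ c d a) (d₂ c d b)
    a₂ : ∀ c d {n} (v : Ext n) → smulₑ (c * d) v ≡ smulₑ c (smulₑ d v)
    a₂ c d (leaf u) = cong leaf (W.smul-smul c d u)
    a₂ c d (node a b) = cong₂ node (a₂ c d a) (a₂ c d b)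
    one : ∀ {n} (v : Ext n) → smulₑ 1# v ≡ v
    one (leaf u) = cong leaf (W.1-smul u)
    one (node a b) = cong₂ node (one a) (one b)
    nil : ∀ {n} (v : Ext n) → smulₑ 0# v ≡ 0ₑ
    nil (leaf u) = cong leaf (W.0-smul u)
    nil (node a b) = cong₂ node (nil a) (nil b)

  ext : ℕ → Space
  ext n = record
    { V = Ext n ; add = addₑ ; smul = smulₑ ; 𝟘 = 0ₑ ; add-assoc = assoc ; add-comm = comm ; add-identityˡ = idˡ
    ; smul-add = λ c → d₁ c ; add-smul = λ c d → d₂ c d ; smul-smul = λ c d → a₂ c d ; 1-smul = one ; 0-smul = nil }

  private module X {n} = SpaceLaws (ext n)

  infixl 6 _+ₑ_
  _+ₑ_ : ∀ {n} → Ext n → Ext n → Ext n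
  _+ₑ_ = addₑ

  infix 8 -ₑ_
  -ₑ_ : ∀ {n} → Ext n → Ext n
  -ₑ_ = smulₑ (- 1#)

  Lin : ∀ {m n} → (Ext m → Ext n) → Set
  Lin {m} {n} = IsLinear (ext m) (ext n)

  map-neg : ∀ {m n} {φ : Ext m → Ext n} → Lin φ → ∀ x → φ (-ₑ x) ≡ -ₑ φ x
  map-neg lφ = map-• lφ (- 1#)

  infix 9 _∙_
  _∙_ : ∀ {n} → Poly → Ext n → Ext n
  f ∙ leaf w = leaf (f ⟨ w ⟩)
  f ∙ node a b = node (f ∙ a) (f ∙ b)

  ∙-linear : ∀ {n} f → Lin {n} (f ∙_)
  ∙-linear f = record { map-⊕ = plus ; map-• = λ c → times c }
    where
    plus : ∀ {n} (x y : Ext n) → f ∙ (x +ₑ y) ≡ f ∙ x +ₑ f ∙ y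
    plus (leaf u) (leaf v) = cong leaf (map-⊕ (act-linear f) u v)
    plus (node a b) (node c d) = cong₂ node (plus a c) (plus b d)
    times : ∀ c {n} (x : Ext n) → f ∙ smulₑ c x ≡ smulₑ c (f ∙ x)
    times c (leaf u) = cong leaf (map-• (act-linear f) c u)
    times c (node a b) = cong₂ node (times c a) (times c b)

  ∙-comm : ∀ f g {n} (x : Ext n) → f ∙ (g ∙ x) ≡ g ∙ (f ∙ x)
  ∙-comm f g (leaf w) = cong leaf (act-comm f g w)
  ∙-comm f g (node a b) = cong₂ node (∙-comm f g a) (∙-comm f g b)

  fst snd : ∀ {n} → Ext (suc n) → Ext n
  fst (node a b) = a
  snd (node a b) = b

  fst-+ : ∀ {n} (x y : Ext (suc n)) → fst (x +ₑ y) ≡ fst x +ₑ fst y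
  fst-+ (node _ _) (node _ _) = refl

  snd-+ : ∀ {n} (x y : Ext (suc n)) → snd (x +ₑ y) ≡ snd x +ₑ snd y
  snd-+ (node _ _) (node _ _) = refl

  fst-∙ : ∀ f {n} (x : Ext (suc n)) → fst (f ∙ x) ≡ f ∙ fst x
  fst-∙ f (node _ _) = refl

  snd-∙ : ∀ f {n} (x : Ext (suc n)) → snd (f ∙ x) ≡ f ∙ snd x
  snd-∙ f (node _ _) = refl

  -- The interior product with the linear form that has the entries of the row as values on the
  -- generators; the minus sign comes from moving it past the first generator.
  contract : ∀ {n} → Vec Poly n → Ext n → Ext n
  contract [] x = 0ₑ
  contract (p ∷ r) (node a b) = node (contract r a +ₑ p ∙ b) (-ₑ contract r b)

  contract-linear : ∀ {n} (r : Vec Poly n) → Lin (contract r)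
  contract-linear [] = record { map-⊕ = λ _ _ → sym (X.add-identityˡ _) ; map-• = λ c _ → sym (X.smul-0 c) }
  contract-linear (p ∷ r) = record
    { map-⊕ = λ { (node a b) (node c d) → cong₂ node
        (trans (cong₂ _+ₑ_ (map-⊕ (contract-linear r) a c) (map-⊕ (∙-linear p) b d)) (X.interchange _ _ _ _))
        (trans (cong -ₑ_ (map-⊕ (contract-linear r) b d)) (X.smul-add _ _ _)) }
    ; map-• = λ { c (node a b) → cong₂ node
        (trans (cong₂ _+ₑ_ (map-• (contract-linear r) c a) (map-• (∙-linear p) c b)) (sym (X.smul-add c _ _)))
        (trans (cong -ₑ_ (map-• (contract-linear r) c b)) (X.smul-comm _ c _)) } }

  contract-∙ : ∀ f {n} (r : Vec Poly n) x → contract r (f ∙ x) ≡ f ∙ contract r x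
  contract-∙ f [] (leaf w) = cong leaf (sym (map-𝟘 (act-linear f)))
  contract-∙ f (p ∷ r) (node a b) = cong₂ node
    (trans (cong₂ _+ₑ_ (contract-∙ f r a) (∙-comm p f b)) (sym (map-⊕ (∙-linear f) _ _)))
    (trans (cong -ₑ_ (contract-∙ f r b)) (sym (map-neg (∙-linear f) _)))

  -- Linearity over F[X], where X acts on W through T.
  record Equivariant {n} (x : W → Ext n) : Set where
    field
      equi-⊕ : ∀ u v → x (_⊕_ {S} u v) ≡ x u +ₑ x v
      equi-act : ∀ f v → x (f ⟨ v ⟩) ≡ f ∙ x v
  open Equivariant

  equi-fst : ∀ {n} {x : W → Ext (suc n)} → Equivariant x → Equivariant (λ v → fst (x v))
  equi-fst {x = x} e = record
    { equi-⊕ = λ u v → trans (cong fst (equi-⊕ e u v)) (fst-+ (x u) (x v))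
    ; equi-act = λ f v → trans (cong fst (equi-act e f v)) (fst-∙ f (x v)) }

  equi-snd : ∀ {n} {x : W → Ext (suc n)} → Equivariant x → Equivariant (λ v → snd (x v))
  equi-snd {x = x} e = record
    { equi-⊕ = λ u v → trans (cong snd (equi-⊕ e u v)) (snd-+ (x u) (x v))
    ; equi-act = λ f v → trans (cong snd (equi-act e f v)) (snd-∙ f (x v)) }

  equi-contract : ∀ {n} (r : Vec Poly n) {x} → Equivariant x → Equivariant (λ v → contract r (x v))
  equi-contract r e = record
    { equi-⊕ = λ u v → trans (cong (contract r) (equi-⊕ e u v)) (map-⊕ (contract-linear r) _ _)
    ; equi-act = λ f v → trans (cong (contract r) (equi-act e f v)) (contract-∙ f r _) }

  -- W has no multiplication, so a form with coefficients in F[X] is kept as a map `x` that awaits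
  -- the element of W to which they are applied. This is the exterior product of the sum of all w_j
  -- e_j with that form.
  wedge : ∀ {n} → Vec W n → (W → Ext n) → Ext n
  wedge [] x = 0ₑ
  wedge (w ∷ ws) x = node (wedge ws (λ v → fst (x v))) (fst (x w) +ₑ -ₑ wedge ws (λ v → snd (x v)))

  wedge-cong : ∀ {n} (ws : Vec W n) {x y} → (∀ v → x v ≡ y v) → wedge ws x ≡ wedge ws y
  wedge-cong [] eq = refl
  wedge-cong (w ∷ ws) eq = cong₂ node (wedge-cong ws (λ v → cong fst (eq v)))
    (cong₂ (λ a b → a +ₑ -ₑ b) (cong fst (eq w)) (wedge-cong ws (λ v → cong snd (eq v))))

  wedge-+ : ∀ {n} (ws : Vec W n) x y → wedge ws (λ v → x v +ₑ y v) ≡ wedge ws x +ₑ wedge ws y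
  wedge-+ [] x y = sym (X.add-identityˡ _)
  wedge-+ (w ∷ ws) x y = cong₂ node
    (trans (wedge-cong ws (λ v → fst-+ (x v) (y v))) (wedge-+ ws _ _))
    (trans (cong₂ (λ a b → a +ₑ -ₑ b) (fst-+ (x w) (y w))
      (trans (wedge-cong ws (λ v → snd-+ (x v) (y v))) (wedge-+ ws _ _)))
      (trans (cong (_ +ₑ_) (X.smul-add _ _ _)) (X.interchange _ _ _ _)))

  wedge-map : ∀ (φ : ∀ {n} → Ext n → Ext n) → (∀ {n} → Lin {n} φ) →
    (∀ {n} (x : Ext (suc n)) → φ x ≡ node (φ (fst x)) (φ (snd x))) →
    ∀ {n} (ws : Vec W n) x → wedge ws (λ v → φ (x v)) ≡ φ (wedge ws x)
  wedge-map φ lφ eq [] x = sym (map-𝟘 lφ)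
  wedge-map φ lφ eq (w ∷ ws) x = trans (cong₂ node
    (trans (wedge-cong ws (λ v → cong fst (eq (x v)))) (wedge-map φ lφ eq ws _))
    (trans (cong₂ (λ a b → a +ₑ -ₑ b) (cong fst (eq (x w)))
      (trans (wedge-cong ws (λ v → cong snd (eq (x v)))) (wedge-map φ lφ eq ws _)))
      (trans (cong (_ +ₑ_) (sym (map-neg lφ _))) (sym (map-⊕ lφ _ _))))) (sym (eq _))

  wedge-∙ : ∀ f {n} (ws : Vec W n) x → wedge ws (λ v → f ∙ x v) ≡ f ∙ wedge ws x
  wedge-∙ f = wedge-map (f ∙_) (∙-linear f) (λ { (node _ _) → refl })

  wedge-neg : ∀ {n} (ws : Vec W n) x → wedge ws (λ v → -ₑ x v) ≡ -ₑ wedge ws x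
  wedge-neg = wedge-map -ₑ_ (smul-linear (ext _) _) (λ { (node _ _) → refl })

  wedge-0 : ∀ {n} (ws : Vec W n) → wedge ws (λ _ → 0ₑ) ≡ 0ₑ
  wedge-0 ws = trans (wedge-cong ws (λ v → sym (X.0-smul 0ₑ)))
    (trans (wedge-map (smulₑ 0#) (smul-linear (ext _) 0#) (λ { (node _ _) → refl }) ws (λ _ → 0ₑ)) (X.0-smul _))

  dot : ∀ {n} → Vec Poly n → Vec W n → W
  dot [] [] = 𝟘 {S}
  dot (p ∷ r) (w ∷ ws) = _⊕_ {S} (p ⟨ w ⟩) (dot r ws)

  cancel₁ : ∀ {n} (A B C D : Ext n) → (A +ₑ (B +ₑ -ₑ C)) +ₑ (D +ₑ C) ≡ B +ₑ (A +ₑ D)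
  cancel₁ A B C D = trans (X.interchange A _ D C) (trans (X.add-comm _ _) (cong (_+ₑ (A +ₑ D))
    (trans (X.add-assoc B (-ₑ C) C) (trans (cong (B +ₑ_) (trans (X.add-comm _ C) (X.⊖-inverse C)))
      (X.add-identityʳ B)))))

  cancel₂ : ∀ {n} (P Q R Z : Ext n) → -ₑ (P +ₑ -ₑ Q) +ₑ ((P +ₑ R) +ₑ -ₑ (-ₑ Z)) ≡ R +ₑ (Q +ₑ Z)
  cancel₂ P Q R Z = begin
    -ₑ (P +ₑ -ₑ Q) +ₑ ((P +ₑ R) +ₑ -ₑ (-ₑ Z))
      ≡⟨ cong₂ _+ₑ_ (trans (X.smul-add _ P _) (cong (-ₑ P +ₑ_) (X.⊖-⊖ Q))) (cong ((P +ₑ R) +ₑ_) (X.⊖-⊖ Z)) ⟩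
    (-ₑ P +ₑ Q) +ₑ ((P +ₑ R) +ₑ Z)            ≡⟨ X.interchange _ _ _ _ ⟩
    (-ₑ P +ₑ (P +ₑ R)) +ₑ (Q +ₑ Z)
      ≡⟨ cong (_+ₑ (Q +ₑ Z)) (trans (sym (X.add-assoc _ P R))
      (trans (cong (_+ₑ R) (trans (X.add-comm _ P) (X.⊖-inverse P))) (X.add-identityˡ R))) ⟩
    R +ₑ (Q +ₑ Z)                             ∎

  node-η : ∀ {n} (x : Ext (suc n)) → x ≡ node (fst x) (snd x)
  node-η (node _ _) = refl

  -- The antiderivation rule of the interior product, for a first factor of degree one: its own
  -- contraction is the pairing of `r` with `ws`.
  contract-wedge : ∀ {n} (r : Vec Poly n) (ws : Vec W n) x → Equivariant x →
    contract r (wedge ws x) +ₑ wedge ws (λ v → contract r (x v)) ≡ x (dot r ws)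
  contract-wedge [] [] x e = trans (X.add-identityˡ _) (sym (trans (equi-act e [] (𝟘 {S})) (empty (x (𝟘 {S})))))
    where
    empty : (y : Ext 0) → [] ∙ y ≡ 0ₑ
    empty (leaf w) = refl
  contract-wedge (p ∷ r) (w ∷ ws) x e = trans (cong₂ node left right) (trans (sym (node-η _)) (sym dot-eq))
    where
    x₁ = λ v → fst (x v)
    x₂ = λ v → snd (x v)
    contract-fst : ∀ y → fst (contract (p ∷ r) y) ≡ contract r (fst y) +ₑ p ∙ snd y
    contract-fst (node _ _) = refl
    contract-snd : ∀ y → snd (contract (p ∷ r) y) ≡ -ₑ contract r (snd y)
    contract-snd (node _ _) = refl
    dot-eq : x (dot (p ∷ r) (w ∷ ws)) ≡ p ∙ x w +ₑ x (dot r ws)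
    dot-eq = trans (equi-⊕ e _ _) (cong (_+ₑ x (dot r ws)) (equi-act e p w))
    fst-rhs : ∀ {n} f (y z : Ext (suc n)) → fst (f ∙ y +ₑ z) ≡ f ∙ fst y +ₑ fst z
    fst-rhs f (node _ _) (node _ _) = refl
    snd-rhs : ∀ {n} f (y z : Ext (suc n)) → snd (f ∙ y +ₑ z) ≡ f ∙ snd y +ₑ snd z
    snd-rhs f (node _ _) (node _ _) = refl
    left : (contract r (wedge ws x₁) +ₑ p ∙ (x₁ w +ₑ -ₑ wedge ws x₂)) +ₑ wedge ws (λ v → fst (contract (p ∷ r) (x v)))
           ≡ fst (p ∙ x w +ₑ x (dot r ws))
    left = begin
      (contract r (wedge ws x₁) +ₑ p ∙ (x₁ w +ₑ -ₑ wedge ws x₂)) +ₑ wedge ws (λ v → fst (contract (p ∷ r) (x v)))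
        ≡⟨ cong₂ (λ a b → (contract r (wedge ws x₁) +ₑ a) +ₑ b)
             (trans (map-⊕ (∙-linear p) (x₁ w) _) (cong (p ∙ x₁ w +ₑ_) (map-neg (∙-linear p) _)))
             (trans (wedge-cong ws (λ v → contract-fst (x v)))
               (trans (wedge-+ ws _ _) (cong (_ +ₑ_) (wedge-∙ p ws x₂)))) ⟩
      (contract r (wedge ws x₁) +ₑ (p ∙ x₁ w +ₑ -ₑ (p ∙ wedge ws x₂))) +ₑ
        (wedge ws (λ v → contract r (x₁ v)) +ₑ p ∙ wedge ws x₂)
        ≡⟨ cancel₁ _ _ _ _ ⟩
      p ∙ x₁ w +ₑ (contract r (wedge ws x₁) +ₑ wedge ws (λ v → contract r (x₁ v)))
        ≡⟨ cong (p ∙ x₁ w +ₑ_) (contract-wedge r ws x₁ (equi-fst e)) ⟩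
      p ∙ x₁ w +ₑ x₁ (dot r ws)
        ≡⟨ sym (fst-rhs p (x w) (x (dot r ws))) ⟩
      fst (p ∙ x w +ₑ x (dot r ws)) ∎
    right : -ₑ contract r (x₁ w +ₑ -ₑ wedge ws x₂) +ₑ
      (fst (contract (p ∷ r) (x w)) +ₑ -ₑ wedge ws (λ v → snd (contract (p ∷ r) (x v))))
           ≡ snd (p ∙ x w +ₑ x (dot r ws))
    right = begin
      -ₑ contract r (x₁ w +ₑ -ₑ wedge ws x₂) +ₑ
        (fst (contract (p ∷ r) (x w)) +ₑ -ₑ wedge ws (λ v → snd (contract (p ∷ r) (x v))))
        ≡⟨ cong₂ _+ₑ_ (cong -ₑ_ (trans (map-⊕ (contract-linear r) (x₁ w) _)
          (cong (contract r (x₁ w) +ₑ_) (map-neg (contract-linear r) _))))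
             (cong₂ (λ a b → a +ₑ -ₑ b) (contract-fst (x w))
               (trans (wedge-cong ws (λ v → contract-snd (x v))) (wedge-neg ws _))) ⟩
      -ₑ (contract r (x₁ w) +ₑ -ₑ contract r (wedge ws x₂)) +ₑ
        ((contract r (x₁ w) +ₑ p ∙ x₂ w) +ₑ -ₑ (-ₑ wedge ws (λ v → contract r (x₂ v))))
        ≡⟨ cancel₂ _ _ _ _ ⟩
      p ∙ x₂ w +ₑ (contract r (wedge ws x₂) +ₑ wedge ws (λ v → contract r (x₂ v)))
        ≡⟨ cong (p ∙ x₂ w +ₑ_) (contract-wedge r ws x₂ (equi-snd e)) ⟩
      p ∙ x₂ w +ₑ x₂ (dot r ws)
        ≡⟨ sym (snd-rhs p (x w) (x (dot r ws))) ⟩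
      snd (p ∙ x w +ₑ x (dot r ws)) ∎

  vol : ∀ n → W → Ext n
  vol zero w = leaf w
  vol (suc n) w = node 0ₑ (vol n w)

  ∙-0 : ∀ f {n} → f ∙ 0ₑ {n} ≡ 0ₑ
  ∙-0 f = map-𝟘 (∙-linear f)

  equi-vol : ∀ n → Equivariant (vol n)
  equi-vol zero = record { equi-⊕ = λ _ _ → refl ; equi-act = λ _ _ → refl }
  equi-vol (suc n) = record
    { equi-⊕ = λ u v → cong₂ node (sym (X.add-identityˡ _)) (equi-⊕ (equi-vol n) u v)
    ; equi-act = λ f v → cong₂ node (sym (∙-0 f)) (equi-act (equi-vol n) f v) }

  wedge-vol : ∀ {n} (ws : Vec W n) → wedge ws (vol n) ≡ 0ₑ
  wedge-vol [] = refl
  wedge-vol (w ∷ ws) = cong₂ node (wedge-0 ws)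
    (trans (X.add-identityˡ _) (trans (cong -ₑ_ (wedge-vol ws)) (X.smul-0 _)))

  contractAll : ∀ {k n} → Vec (Vec Poly n) k → Ext n → Ext n
  contractAll [] x = x
  contractAll (r ∷ rs) x = contract r (contractAll rs x)

  contractAll-linear : ∀ {k n} (rs : Vec (Vec Poly n) k) → Lin (contractAll rs)
  contractAll-linear [] = id-linear (ext _)
  contractAll-linear {n = n} (r ∷ rs) = ∘-linear {ext n} {ext n} {ext n} (contract-linear r) (contractAll-linear rs)

  equi-contractAll : ∀ {k n} (rs : Vec (Vec Poly n) k) → Equivariant (λ v → contractAll rs (vol n v))
  equi-contractAll [] = equi-vol _
  equi-contractAll (r ∷ rs) = equi-contract r (equi-contractAll rs)

  wedge-contractAll : ∀ {k n} (rs : Vec (Vec Poly n) k) (ws : Vec W n) → (∀ i → dot (Vec.lookup rs i) ws ≡ 𝟘 {S}) →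
    wedge ws (λ v → contractAll rs (vol n v)) ≡ 0ₑ
  wedge-contractAll [] ws eq = wedge-vol ws
  wedge-contractAll (r ∷ rs) ws eq = begin
    wedge ws (λ v → contract r (x v))                                 ≡⟨ sym (X.add-identityˡ _) ⟩
    0ₑ +ₑ wedge ws (λ v → contract r (x v))
      ≡⟨ cong (_+ₑ wedge ws (λ v → contract r (x v)))
      (sym (trans (cong (contract r) (wedge-contractAll rs ws (λ i → eq (suc i)))) (map-𝟘 (contract-linear r)))) ⟩
    contract r (wedge ws x) +ₑ wedge ws (λ v → contract r (x v))      ≡⟨ contract-wedge r ws x (equi-contractAll rs) ⟩
    x (dot r ws)                                                      ≡⟨ cong x (eq zero) ⟩
    x (𝟘 {S})                                                         ≡⟨ equi-act (equi-contractAll rs) [] (𝟘 {S}) ⟩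
    [] ∙ x (𝟘 {S})                                                    ≡⟨ empty _ ⟩
    0ₑ                                                                ∎
    where
    x = λ v → contractAll rs (vol _ v)
    empty : ∀ {n} (y : Ext n) → [] ∙ y ≡ 0ₑ
    empty (leaf w) = refl
    empty (node a b) = cong₂ node (empty a) (empty b)

  scal : ∀ {n} → Ext n → W
  scal (leaf w) = w
  scal (node a b) = scal a

  scal-fst : ∀ {n} (y : Ext (suc n)) → scal (fst y) ≡ scal y
  scal-fst (node _ _) = refl

  scal-linear : ∀ n → IsLinear (ext n) S scal
  scal-linear n = record { map-⊕ = plus ; map-• = λ c → times c }
    where
    plus : ∀ {n} (x y : Ext n) → scal (x +ₑ y) ≡ _⊕_ {S} (scal x) (scal y)
    plus (leaf _) (leaf _) = refl
    plus (node a _) (node b _) = plus a b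
    times : ∀ c {n} (x : Ext n) → scal (smulₑ c x) ≡ _•_ {S} c (scal x)
    times c (leaf _) = refl
    times c (node a _) = times c a

  scal-∙ : ∀ f {n} (x : Ext n) → scal (f ∙ x) ≡ f ⟨ scal x ⟩
  scal-∙ f (leaf _) = refl
  scal-∙ f (node a _) = scal-∙ f a

  -- Contraction with the j-th coordinate form, the result being written in the remaining
  -- generators; the sign appears whenever an earlier generator is passed.
  ∂ : ∀ {n} → Fin (suc n) → Ext (suc n) → Ext n
  ∂ zero (node a b) = b
  ∂ {suc n} (suc j) (node a b) = node (∂ j a) (-ₑ ∂ j b)

  ∂-linear : ∀ {n} (j : Fin (suc n)) → Lin (∂ j)
  ∂-linear zero = record { map-⊕ = λ { (node _ _) (node _ _) → refl } ; map-• = λ { c (node _ _) → refl } }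
  ∂-linear {suc n} (suc j) = record
    { map-⊕ = λ { (node a b) (node c d) → cong₂ node (map-⊕ (∂-linear j) a c)
      (trans (cong -ₑ_ (map-⊕ (∂-linear j) b d)) (X.smul-add _ _ _)) }
    ; map-• = λ { c (node a b) → cong₂ node (map-• (∂-linear j) c a)
      (trans (cong -ₑ_ (map-• (∂-linear j) c b)) (X.smul-comm _ c _)) } }

  ∂-∙ : ∀ f {n} (j : Fin (suc n)) x → ∂ j (f ∙ x) ≡ f ∙ ∂ j x
  ∂-∙ f zero (node a b) = refl
  ∂-∙ f {suc n} (suc j) (node a b) = cong₂ node (∂-∙ f j a)
    (trans (cong -ₑ_ (∂-∙ f j b)) (sym (map-neg (∙-linear f) _)))

  scal-wedge : ∀ {n} (ws : Vec W n) x → scal (wedge ws x) ≡ 𝟘 {S}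
  scal-wedge [] x = refl
  scal-wedge (w ∷ ws) x = scal-wedge ws _

  scal-∂-wedge : ∀ {n} (ws : Vec W (suc n)) x j → scal (∂ j (wedge ws x)) ≡ scal (x (Vec.lookup ws j))
  scal-∂-wedge (w ∷ ws) x zero = trans (map-⊕ (scal-linear _) (fst (x w)) _)
    (trans (cong₂ (_⊕_ {S}) (scal-fst (x w))
      (trans (map-• (scal-linear _) (- 1#) (wedge ws (λ v → snd (x v))))
      (trans (cong (_•_ {S} (- 1#)) (scal-wedge ws (λ v → snd (x v)))) (W.smul-0 _)))) (W.add-identityʳ _))
  scal-∂-wedge {suc n} (w ∷ ws) x (suc j) = trans (scal-∂-wedge ws (λ v → fst (x v)) j)
    (scal-fst (x (Vec.lookup ws j)))

  sumW : ∀ {n} → (Fin n → W) → W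
  sumW {zero} f = 𝟘 {S}
  sumW {suc n} f = _⊕_ {S} (f zero) (sumW (λ j → f (suc j)))

  sumW-cong : ∀ {n} {f g : Fin n → W} → (∀ j → f j ≡ g j) → sumW f ≡ sumW g
  sumW-cong {zero} eq = refl
  sumW-cong {suc n} eq = cong₂ (_⊕_ {S}) (eq zero) (sumW-cong (λ j → eq (suc j)))

  scal-0 : ∀ n → scal (0ₑ {n}) ≡ 𝟘 {S}
  scal-0 n = map-𝟘 (scal-linear n)

  scal-contract : ∀ {n} (r : Vec Poly (suc n)) x → scal (contract r x) ≡ sumW (λ j → Vec.lookup r j ⟨ scal (∂ j x) ⟩)
  scal-contract (p ∷ r) (node a b) = trans (map-⊕ (scal-linear _) (contract r a) _)
    (trans (W.add-comm _ _) (cong₂ (_⊕_ {S}) (scal-∙ p b) (rest r a b)))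
    where
    rest : ∀ {n} (r : Vec Poly n) (a b : Ext n) → scal (contract r a) ≡ sumW
      (λ j → Vec.lookup r j ⟨ scal (∂ (suc j) (node a b)) ⟩)
    rest [] a b = refl
    rest r@(_ ∷ _) a b = scal-contract r a

  ∂-contract : ∀ {n} (r : Vec Poly (suc n)) j x → ∂ j (contract r x) ≡ -ₑ contract (Vec.removeAt r j) (∂ j x)
  ∂-contract (p ∷ r) zero (node a b) = refl
  ∂-contract (p ∷ r@(_ ∷ _)) (suc j) (node a b) = cong₂ node
    (begin
      ∂ j (contract r a +ₑ p ∙ b)                          ≡⟨ map-⊕ (∂-linear j) (contract r a) (p ∙ b) ⟩
      ∂ j (contract r a) +ₑ ∂ j (p ∙ b)
        ≡⟨ cong₂ _+ₑ_ (∂-contract r j a) (trans (∂-∙ p j b) (sym (X.⊖-⊖ _))) ⟩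
      -ₑ contract (Vec.removeAt r j) (∂ j a) +ₑ -ₑ (-ₑ (p ∙ ∂ j b))
        ≡⟨ cong (λ z → _ +ₑ -ₑ z) (sym (map-neg (∙-linear p) _)) ⟩
      -ₑ contract (Vec.removeAt r j) (∂ j a) +ₑ -ₑ (p ∙ (-ₑ ∂ j b)) ≡⟨ sym (X.smul-add _ _ _) ⟩
      -ₑ (contract (Vec.removeAt r j) (∂ j a) +ₑ p ∙ (-ₑ ∂ j b)) ∎)
    (begin
      -ₑ ∂ j (-ₑ contract r b)
        ≡⟨ cong -ₑ_ (trans (map-neg (∂-linear j) _) (cong -ₑ_ (∂-contract r j b))) ⟩
      -ₑ (-ₑ (-ₑ contract (Vec.removeAt r j) (∂ j b)))
        ≡⟨ cong (λ z → -ₑ (-ₑ z)) (sym (map-neg (contract-linear (Vec.removeAt r j)) _)) ⟩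
      -ₑ (-ₑ contract (Vec.removeAt r j) (-ₑ ∂ j b))       ∎)

  negs : ∀ S′ → ℕ → Space.V S′ → Space.V S′
  negs S′ zero v = v
  negs S′ (suc n) v = _•_ {S′} (- 1#) (negs S′ n v)

  map-negs : ∀ {S′ S″ φ} → IsLinear S′ S″ φ → ∀ n v → φ (negs S′ n v) ≡ negs S″ n (φ v)
  map-negs lφ zero v = refl
  map-negs {S″ = S″} lφ (suc n) v = trans (map-• lφ _ _) (cong (_•_ {S″} (- 1#)) (map-negs lφ n v))

  negs-linear : ∀ S′ n → IsLinear S′ S′ (negs S′ n)
  negs-linear S′ zero = id-linear S′
  negs-linear S′ (suc n) = ∘-linear {S′} {S′} {S′} (smul-linear S′ (- 1#)) (negs-linear S′ n)

  negs-+ : ∀ S′ m n v → negs S′ (m ℕ.+ n) v ≡ negs S′ m (negs S′ n v)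
  negs-+ S′ zero n v = refl
  negs-+ S′ (suc m) n v = cong (_•_ {S′} (- 1#)) (negs-+ S′ m n v)

  negs-comm : ∀ S′ m n v → negs S′ m (negs S′ n v) ≡ negs S′ n (negs S′ m v)
  negs-comm S′ m n v = map-negs (negs-linear S′ m) n v

  ∂-vol : ∀ n j w → ∂ j (vol (suc n) w) ≡ negs (ext n) (toℕ j) (vol n w)
  ∂-vol n zero w = refl
  ∂-vol (suc n) (suc j) w = trans (cong₂ node (map-𝟘 (∂-linear j)) (cong -ₑ_ (∂-vol n j w)))
    (trans (cong (λ z → node z (-ₑ negs (ext n) (toℕ j) (vol n w)))
      (sym (trans (cong -ₑ_ (negs-0 (toℕ j))) (X.smul-0 _)))) (cong -ₑ_ (sym (negs-node (toℕ j) 0ₑ (vol n w)))))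
    where
    negs-0 : ∀ k → negs (ext n) k 0ₑ ≡ 0ₑ
    negs-0 k = map-𝟘 (negs-linear (ext n) k)
    negs-node : ∀ k a b → negs (ext (suc n)) k (node a b) ≡ node (negs (ext n) k a) (negs (ext n) k b)
    negs-node zero a b = refl
    negs-node (suc k) a b = cong -ₑ_ (negs-node k a b)

  ∂-contractAll : ∀ {k n} (rs : Vec (Vec Poly (suc n)) k) j x →
    ∂ j (contractAll rs x) ≡ negs (ext n) k (contractAll (Vec.map (λ row → Vec.removeAt row j) rs) (∂ j x))
  ∂-contractAll [] j x = refl
  ∂-contractAll {suc k} {n} (r ∷ rs) j x = trans (∂-contract r j _) (cong -ₑ_
    (trans (cong (contract (Vec.removeAt r j)) (∂-contractAll rs j x))
      (map-negs {ext n} {ext n} (contract-linear (Vec.removeAt r j)) k _)))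

  -- Contracting with the rows produces the Laplace expansion up to the sign (-1)^{n(n-1)/2}.
  signExponent : ℕ → ℕ
  signExponent zero = 0
  signExponent (suc n) = n ℕ.+ signExponent n

  act-foldr : ∀ {n} (g : Fin n → Poly) w → Vec.foldr _ addP [] (Vec.tabulate g) ⟨ w ⟩ ≡ sumW (λ j → g j ⟨ w ⟩)
  act-foldr {zero} g w = refl
  act-foldr {suc n} g w = trans (act-addP (g zero) (Vec.foldr _ addP [] (Vec.tabulate (λ j → g (suc j)))) w)
    (cong (_⊕_ {S} (g zero ⟨ w ⟩)) (act-foldr (λ j → g (suc j)) w))

  act-signedSuc : ∀ k r rs n f w → signedSuc k r rs n f ⟨ w ⟩ ≡ negs S (suc n) (f ⟨ w ⟩)
  act-signedSuc k r rs zero f w = act-negP f w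
  act-signedSuc k r rs (suc zero) f w = sym (W.⊖-⊖ _)
  act-signedSuc k r rs (suc (suc n)) f w = trans (act-signedSuc k r rs n f w) (sym (W.⊖-⊖ _))

  act-detP : ∀ n (r : Vec Poly (suc n)) rs w → Defs.detP F (suc n) (r ∷ rs) ⟨ w ⟩ ≡ sumW
    (λ j → negs S (toℕ j) (Vec.lookup r j ⟨ minor rs j ⟨ w ⟩ ⟩))
  act-detP n r rs w = trans (cong (_⟨ w ⟩) (detP-suc n r rs))
    (trans (act-addP (mulP (Vec.lookup r zero) (minor rs zero)) _ w)
    (cong₂ (_⊕_ {S}) (act-mulP (Vec.lookup r zero) (minor rs zero) w)
      (trans (act-foldr (laplaceTail n r rs) w) (sumW-cong (λ j → trans (cong (_⟨ w ⟩) (laplaceTail-eq n r rs j))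
        (trans (act-mulP (signedSuc n r rs (toℕ j) (Vec.lookup r (suc j))) (minor rs (suc j)) w)
          (act-signedSuc n r rs (toℕ j) (Vec.lookup r (suc j)) _)))))))

  sumW-linear : ∀ {φ} → IsLinear S S φ → ∀ {n} (f : Fin n → W) → φ (sumW f) ≡ sumW (λ j → φ (f j))
  sumW-linear lφ {zero} f = map-𝟘 lφ
  sumW-linear {φ} lφ {suc n} f = trans (map-⊕ lφ _ _) (cong (_⊕_ {S} (φ (f zero))) (sumW-linear lφ (λ j → f (suc j))))

  contractAll-vol : ∀ n (M : Vec (Vec Poly n) n) w → scal (contractAll M (vol n w)) ≡ negs S (signExponent n)
    (Defs.detP F n M ⟨ w ⟩)
  contractAll-vol zero [] w = sym (act-one w)
  contractAll-vol (suc n) (r ∷ rs) w = begin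
    scal (contract r (contractAll rs (vol (suc n) w)))
      ≡⟨ scal-contract r _ ⟩
    sumW (λ j → Vec.lookup r j ⟨ scal (∂ j (contractAll rs (vol (suc n) w))) ⟩)
      ≡⟨ sumW-cong (λ j → trans (cong (Vec.lookup r j ⟨_⟩) (term j))
        (trans (map-negs {S} {S} (act-linear (Vec.lookup r j)) (n ℕ.+ signExponent n) _)
        (cong (negs S (n ℕ.+ signExponent n)) (map-negs {S} {S} (act-linear (Vec.lookup r j)) (toℕ j) _)))) ⟩
    sumW (λ j → negs S (n ℕ.+ signExponent n) (negs S (toℕ j) (Vec.lookup r j ⟨ minor rs j ⟨ w ⟩ ⟩)))
      ≡⟨ sym (sumW-linear (negs-linear S (n ℕ.+ signExponent n))
        (λ j → negs S (toℕ j) (Vec.lookup r j ⟨ minor rs j ⟨ w ⟩ ⟩))) ⟩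
    negs S (n ℕ.+ signExponent n) (sumW (λ j → negs S (toℕ j) (Vec.lookup r j ⟨ minor rs j ⟨ w ⟩ ⟩)))
      ≡⟨ cong (negs S (n ℕ.+ signExponent n)) (sym (act-detP n r rs w)) ⟩
    negs S (signExponent (suc n)) (Defs.detP F (suc n) (r ∷ rs) ⟨ w ⟩) ∎
    where
    term : ∀ j → scal (∂ j (contractAll rs (vol (suc n) w))) ≡ negs S (n ℕ.+ signExponent n)
      (negs S (toℕ j) (minor rs j ⟨ w ⟩))
    term j = begin
      scal (∂ j (contractAll rs (vol (suc n) w)))                     ≡⟨ cong scal (∂-contractAll rs j _) ⟩
      scal (negs (ext n) n (contractAll rs′ (∂ j (vol (suc n) w))))
        ≡⟨ cong (λ z → scal (negs (ext n) n (contractAll rs′ z))) (∂-vol n j w) ⟩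
      scal (negs (ext n) n (contractAll rs′ (negs (ext n) (toℕ j) (vol n w))))
        ≡⟨ cong (λ z → scal (negs (ext n) n z)) (map-negs {ext n} {ext n} (contractAll-linear rs′) (toℕ j) _) ⟩
      scal (negs (ext n) n (negs (ext n) (toℕ j) (contractAll rs′ (vol n w))))
        ≡⟨ map-negs {ext n} {S} (scal-linear n) n _ ⟩
      negs S n (scal (negs (ext n) (toℕ j) (contractAll rs′ (vol n w))))
        ≡⟨ cong (negs S n) (map-negs {ext n} {S} (scal-linear n) (toℕ j) _) ⟩
      negs S n (negs S (toℕ j) (scal (contractAll rs′ (vol n w))))
        ≡⟨ cong (λ z → negs S n (negs S (toℕ j) z)) (contractAll-vol n rs′ w) ⟩
      negs S n (negs S (toℕ j) (negs S (signExponent n) (minor rs j ⟨ w ⟩)))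
        ≡⟨ cong (negs S n) (negs-comm S (toℕ j) (signExponent n) _) ⟩
      negs S n (negs S (signExponent n) (negs S (toℕ j) (minor rs j ⟨ w ⟩))) ≡⟨ sym (negs-+ S n (signExponent n) _) ⟩
      negs S (n ℕ.+ signExponent n) (negs S (toℕ j) (minor rs j ⟨ w ⟩)) ∎
      where rs′ = Vec.map (λ row → Vec.removeAt row j) rs

  -- For the fully contracted volume form, the coefficient of e_j in its product with the family
  -- `ws` is, up to sign, the determinant applied to w_j; that product is zero.
  det-annihilates : ∀ n (M : Vec (Vec Poly n) n) (ws : Vec W n) → (∀ i → dot (Vec.lookup M i) ws ≡ 𝟘 {S}) →
    ∀ j → Defs.detP F n M ⟨ Vec.lookup ws j ⟩ ≡ 𝟘 {S}
  det-annihilates (suc n) M ws eq j = unneg (signExponent (suc n)) _ (trans (sym (contractAll-vol (suc n) M _))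
    (trans (sym (scal-∂-wedge ws (λ v → contractAll M (vol (suc n) v)) j))
      (trans (cong (λ z → scal (∂ j z)) (wedge-contractAll M ws eq))
      (trans (cong scal (map-𝟘 (∂-linear j))) (scal-0 n)))))
    where
    unneg : ∀ k v → negs S k v ≡ 𝟘 {S} → v ≡ 𝟘 {S}
    unneg zero v eq = eq
    unneg (suc k) v eq = unneg k v (trans (sym (W.⊖-⊖ _)) (trans (cong (_•_ {S} (- 1#)) eq) (W.smul-0 _)))

-- The characteristic polynomial and the Cayley-Hamilton theorem

module CharacteristicPolynomial (F : FiniteField) where
  open Field F
  open Polynomial F
  open Linear F
  open Matrices F
  open LaplaceExpansion F

  -- The entries of X I - T have degree at most one, a property that passes to all minors of the
  -- Laplace expansion.
  data Bounded {n} : ∀ {k} → Vec (Vec Poly n) k → Set where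
    [] : Bounded []
    _∷_ : ∀ {k r} {rs : Vec (Vec Poly n) k} → (∀ j → DegLt (Vec.lookup r j) 2) → Bounded rs → Bounded (r ∷ rs)

  lookup-removeAt : ∀ {A : Set} {P : A → Set} {n} (r : Vec A (suc n)) j → (∀ i → P (Vec.lookup r i)) → ∀ i → P
    (Vec.lookup (Vec.removeAt r j) i)
  lookup-removeAt (x ∷ xs) zero p i = p (suc i)
  lookup-removeAt (x ∷ xs@(_ ∷ _)) (suc j) p zero = p zero
  lookup-removeAt {P = P} (x ∷ xs@(_ ∷ _)) (suc j) p (suc i) = lookup-removeAt {P = P} xs j (λ i → p (suc i)) i

  Bounded-removeAt : ∀ {n k} {rs : Vec (Vec Poly (suc n)) k} j → Bounded rs → Bounded
    (Vec.map (λ row → Vec.removeAt row j) rs)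
  Bounded-removeAt j [] = []
  Bounded-removeAt j (_∷_ {r = r} b bs) = lookup-removeAt {P = λ f → DegLt f 2} r j b ∷ Bounded-removeAt j bs

  DegLt-negP : ∀ f {n} → DegLt f n → DegLt (Defs.negP F f) n
  DegLt-negP f lt i n≤i = trans (coef-map -_ -0#≈0# f i) (trans (cong -_ (lt i n≤i)) -0#≈0#)

  DegLt-signedSuc : ∀ k r rs j {f n} → DegLt f n → DegLt (signedSuc k r rs j f) n
  DegLt-signedSuc k r rs zero {f} lt = DegLt-negP f lt
  DegLt-signedSuc k r rs (suc zero) lt = lt
  DegLt-signedSuc k r rs (suc (suc j)) {f} lt = DegLt-signedSuc k r rs j {f} lt

  DegLt-foldr : ∀ {k n} (g : Fin k → Poly) → (∀ j → DegLt (g j) n) → DegLt (Vec.foldr _ addP [] (Vec.tabulate g)) n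
  DegLt-foldr {zero} g lt i _ = refl
  DegLt-foldr {suc k} g lt = DegLt-addP (g zero) (Vec.foldr _ addP [] (Vec.tabulate (λ j → g (suc j)))) (lt zero)
    (DegLt-foldr (λ j → g (suc j)) (λ j → lt (suc j)))

  DegLt-laplaceTail : ∀ n r (rs : Vec (Vec Poly (suc n)) n) {d e} → (∀ j → DegLt (Vec.lookup r (suc j)) d) →
    (∀ j → DegLt (minor rs (suc j)) (suc e)) →
    DegLt (Vec.foldr _ addP [] (Vec.tabulate (laplaceTail n r rs))) (d ℕ.+ e)
  DegLt-laplaceTail n r rs {d} {e} p q = DegLt-foldr (laplaceTail n r rs)
    (λ j → subst (λ f → DegLt f (d ℕ.+ e)) (sym (laplaceTail-eq n r rs j))
    (DegLt-mulP (signedSuc n r rs (toℕ j) (Vec.lookup r (suc j))) (minor rs (suc j))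
      (DegLt-signedSuc n r rs (toℕ j) {Vec.lookup r (suc j)} (p j)) (q j)))

  DegLt-detP : ∀ n (M : Vec (Vec Poly n) n) → Bounded M → DegLt (Defs.detP F n M) (suc n)
  DegLt-detP zero [] [] = DegLt-length (1# ∷ [])
  DegLt-detP (suc n) (r ∷ rs) (b ∷ bs) = subst (λ f → DegLt f (suc (suc n))) (sym (detP-suc n r rs))
    (DegLt-addP (mulP (Vec.lookup r zero) (minor rs zero)) (Vec.foldr _ addP [] (Vec.tabulate (laplaceTail n r rs)))
      (DegLt-mulP (Vec.lookup r zero) (minor rs zero) {2} {n} (b zero) (minor-lt zero))
      (DegLt-laplaceTail n r rs (λ j → b (suc j)) (λ j → minor-lt (suc j))))
    where
    minor-lt : ∀ j → DegLt (minor rs j) (suc n)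
    minor-lt j = DegLt-detP n (Vec.map (λ row → Vec.removeAt row j) rs) (Bounded-removeAt j bs)

  charEntry : ∀ {n} → (Fin n → Fin n → Carrier) → Fin n → Fin n → Poly
  charEntry a i j = if toℕ i ≡ᵇ toℕ j then (- a i j) ∷ 1# ∷ [] else (- a i j) ∷ []

  DegLt-charEntry : ∀ {n} (a : Fin n → Fin n → Carrier) i j → DegLt (charEntry a i j) 2
  DegLt-charEntry a i j with toℕ i ≡ᵇ toℕ j
  ... | Data.Bool.true = DegLt-length ((- a i j) ∷ 1# ∷ [])
  ... | Data.Bool.false = DegLt-mono {(- a i j) ∷ []} (s≤s z≤n) (DegLt-length ((- a i j) ∷ []))

  Bounded-tabulate : ∀ {k n} (g : Fin k → Fin n → Poly) → (∀ i j → DegLt (g i j) 2) → Bounded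
    (Vec.tabulate λ i → Vec.tabulate (g i))
  Bounded-tabulate {zero} g lt = []
  Bounded-tabulate {suc k} g lt = (λ j → subst (λ f → DegLt f 2) (sym (Vecₚ.lookup∘tabulate (g zero) j))
    (lt zero j)) ∷ Bounded-tabulate (λ i → g (suc i)) (λ i → lt (suc i))

  -- Only the diagonal entry of the first row contains X. All other summands of the expansion thus
  -- have degree at most that of a minor, and the leading summand is monic by induction, its minor
  -- being of the same shape.
  detP-Monic : ∀ n (a : Fin n → Fin n → Carrier) → Monic
    (Defs.detP F n (Vec.tabulate λ i → Vec.tabulate (charEntry a i))) n
  detP-Monic zero a = refl , DegLt-length (1# ∷ [])
  detP-Monic (suc n) a = trans (cong (λ f → coef f (suc n)) (detP-suc n r rs)) (trans (coef-addP lead tail (suc n))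
      (trans (cong₂ _+_ (proj₁ lead-Monic) (tail-lt (suc n) ℕₚ.≤-refl)) (+-identityʳ 1#)))
    , DegLt-detP (suc n) (r ∷ rs) (Bounded-tabulate (charEntry a) (DegLt-charEntry a))
    where
    r = Vec.tabulate (charEntry a zero)
    rs = Vec.tabulate λ i → Vec.tabulate (charEntry a (suc i))
    lead = mulP (Vec.lookup r zero) (minor rs zero)
    tail = Vec.foldr _ addP [] (Vec.tabulate (laplaceTail n r rs))
    minor0 : minor rs zero ≡ Defs.detP F n (Vec.tabulate λ i → Vec.tabulate (charEntry (λ i j → a (suc i) (suc j)) i))
    minor0 = cong (Defs.detP F n) (sym (Vecₚ.tabulate-∘ (λ row → Vec.removeAt row zero)
      (λ i → Vec.tabulate (charEntry a (suc i)))))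
    lead-Monic : Monic lead (suc n)
    lead-Monic = Monic-mulP (Vec.lookup r zero) (minor rs zero) {1} {n}
      (refl , DegLt-length ((- a zero zero) ∷ 1# ∷ []))
      (subst (λ f → Monic f n) (sym minor0) (detP-Monic n (λ i j → a (suc i) (suc j))))
    tail-lt : DegLt tail (suc n)
    tail-lt = DegLt-laplaceTail n r rs {1} {n}
      (λ j → subst (λ f → DegLt f 1) (sym (Vecₚ.lookup∘tabulate (charEntry a zero) (suc j)))
        (DegLt-length ((- a zero (suc j)) ∷ [])))
      (λ j → DegLt-detP n (Vec.map (λ row → Vec.removeAt row (suc j)) rs)
        (Bounded-removeAt (suc j) (Bounded-tabulate (λ i → charEntry a (suc i)) (λ i → DegLt-charEntry a (suc i)))))

  charPoly-Monic : ∀ {k} (M : Defs.Matrix F k) → Monic (Defs.charPoly F k M) k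
  charPoly-Monic {k} M = detP-Monic k (λ i j → Vec.lookup (Vec.lookup M i) j)

  lookup-mat-id : ∀ {k n} (M : Vec (Vector n) k) i → combine (Vec.lookup (mat (λ v → v)) i) M ≡ Vec.lookup M i
  lookup-mat-id M i = trans (sym (Vecₚ.lookup-map i (λ v → combine v M) (mat (λ v → v))))
    (trans (cong (λ N → Vec.lookup N i) (sym (mat-map (λ v → combine v M) (λ v → v))))
      (cong (λ N → Vec.lookup N i) (mat-combine M)))

  vanish-on-basis : ∀ {k n} {φ : Vector k → Vector n} → LinearV φ → (∀ i → φ (Vec.lookup (mat (λ v → v)) i) ≡ 0ᵥ) →
    ∀ v → φ v ≡ 0ᵥ
  vanish-on-basis {k} {n} {φ} lφ eq v = trans (sym (combine-mat lφ v))
    (trans (cong (combine v) mat≡) (combine-mat zero-linear v))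
    where
    zero-linear : LinearV {k} {n} (λ _ → 0ᵥ)
    zero-linear = record { map-⊕ = λ _ _ → sym (V.add-identityˡ n _) ; map-• = λ c _ → sym (V.smul-0 n c) }
    mat≡ : mat φ ≡ mat (λ _ → 0ᵥ)
    mat≡ = trans (mat-map φ (λ v → v)) (trans (sym (Vecₚ.tabulate∘lookup _))
      (trans (Vecₚ.tabulate-cong (λ i → trans (Vecₚ.lookup-map i φ (mat (λ v → v)))
      (trans (eq i) (sym (Vecₚ.lookup-map i (λ _ → 0ᵥ) (mat (λ v → v)))))))
        (trans (Vecₚ.tabulate∘lookup _) (sym (mat-map (λ _ → 0ᵥ) (λ v → v))))))

  module _ {k} (M : Defs.Matrix F k) where
    private
      S = vecSpace k
      T : Vector k → Vector k
      T v = combine v M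
      lT = combine-linear M
      module C = CayleyHamilton F S T lT
      module A = Action S T lT

    neg-smul : ∀ c (w : Vector k) → - c *ᵥ w ≡ - 1# *ᵥ c *ᵥ w
    neg-smul c w = trans (cong (_*ᵥ w) (trans (cong -_ (sym (*-identityˡ c))) (-‿distribˡ-* 1# c)))
      (V.smul-smul k (- 1#) c w)

    dot-charRow : ∀ {n} (a : Fin n → Carrier) i (ws : Vec (Vector k) n) →
      C.dot (Vec.tabulate λ j → if toℕ i ≡ᵇ toℕ j then (- a j) ∷ 1# ∷ [] else (- a j) ∷ []) ws
        ≡ T (Vec.lookup ws i) +ᵥ - 1# *ᵥ combine (Vec.tabulate a) ws
    dot-charRow a zero (w ∷ ws) = begin
      (- a zero *ᵥ w +ᵥ T (act S T (1# ∷ []) w)) +ᵥ C.dot (Vec.tabulate λ j → (- a (suc j)) ∷ []) ws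
        ≡⟨ cong₂ _+ᵥ_ (trans (V.add-comm k _ _) (cong₂ _+ᵥ_ (cong T (A.act-one w)) (neg-smul (a zero) w)))
          (constants (λ j → a (suc j)) ws) ⟩
      (T w +ᵥ - 1# *ᵥ a zero *ᵥ w) +ᵥ - 1# *ᵥ combine (Vec.tabulate (λ j → a (suc j))) ws
        ≡⟨ trans (V.add-assoc k (T w) _ _) (cong (T w +ᵥ_) (sym (V.smul-add k _ _ _))) ⟩
      T w +ᵥ - 1# *ᵥ (a zero *ᵥ w +ᵥ combine (Vec.tabulate (λ j → a (suc j))) ws) ∎
      where
      constants : ∀ {n} (a : Fin n → Carrier) ws → C.dot (Vec.tabulate λ j → (- a j) ∷ []) ws ≡ - 1# *ᵥ combine
        (Vec.tabulate a) ws
      constants {zero} a [] = sym (V.smul-0 k _)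
      constants {suc n} a (w ∷ ws) = trans
        (cong₂ _+ᵥ_ (trans (cong (- a zero *ᵥ w +ᵥ_) (map-𝟘 lT))
        (trans (V.add-identityʳ k _) (neg-smul (a zero) w))) (constants (λ j → a (suc j)) ws))
        (sym (V.smul-add k _ _ _))
    dot-charRow a (suc i) (w ∷ ws) = begin
      (- a zero *ᵥ w +ᵥ T 0ᵥ) +ᵥ C.dot (Vec.tabulate λ j → if toℕ i ≡ᵇ toℕ j then (- a (suc j)) ∷ 1# ∷ [] else
        (- a (suc j)) ∷ []) ws
        ≡⟨ cong₂ _+ᵥ_ (trans (cong (- a zero *ᵥ w +ᵥ_) (map-𝟘 lT))
          (trans (V.add-identityʳ k _) (neg-smul (a zero) w))) (dot-charRow (λ j → a (suc j)) i ws) ⟩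
      - 1# *ᵥ a zero *ᵥ w +ᵥ (T (Vec.lookup ws i) +ᵥ - 1# *ᵥ rest)
        ≡⟨ trans (sym (V.add-assoc k _ _ _))
          (trans (cong (_+ᵥ - 1# *ᵥ rest) (V.add-comm k _ _)) (V.add-assoc k _ _ _)) ⟩
      T (Vec.lookup ws i) +ᵥ (- 1# *ᵥ a zero *ᵥ w +ᵥ - 1# *ᵥ rest)
        ≡⟨ cong (T (Vec.lookup ws i) +ᵥ_) (sym (V.smul-add k _ _ _)) ⟩
      T (Vec.lookup ws i) +ᵥ - 1# *ᵥ (a zero *ᵥ w +ᵥ rest) ∎
      where
      rest = combine (Vec.tabulate (λ j → a (suc j))) ws

    -- With X acting as M, row i of X I - M pairs with the standard basis to e_i M minus the i-th
    -- row of M, which is zero. The determinant therefore annihilates each basis vector.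
    cayley-hamilton : ∀ v → act S T (Defs.charPoly F k M) v ≡ 0ᵥ
    cayley-hamilton = vanish-on-basis (A.act-linear (Defs.charPoly F k M)) (C.det-annihilates k _ basis rows)
      where
      basis = mat (λ v → v)
      rows : ∀ i → C.dot (Vec.lookup (Vec.tabulate λ i → Vec.tabulate
        (charEntry (λ i j → Vec.lookup (Vec.lookup M i) j) i)) i) basis ≡ 0ᵥ
      rows i = begin
        C.dot (Vec.lookup (Vec.tabulate λ i → Vec.tabulate (charEntry (λ i j → Vec.lookup (Vec.lookup M i) j) i))
          i) basis
          ≡⟨ cong (λ r → C.dot r basis) (Vecₚ.lookup∘tabulate _ i) ⟩
        C.dot (Vec.tabulate (charEntry (λ i j → Vec.lookup (Vec.lookup M i) j) i)) basis
          ≡⟨ dot-charRow (Vec.lookup (Vec.lookup M i)) i basis ⟩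
        T (Vec.lookup basis i) +ᵥ - 1# *ᵥ combine (Vec.tabulate (Vec.lookup (Vec.lookup M i))) basis
          ≡⟨ cong₂ (λ u v → u +ᵥ - 1# *ᵥ v) (lookup-mat-id M i)
            (trans (cong (λ u → combine u basis) (Vecₚ.tabulate∘lookup (Vec.lookup M i)))
            (combine-mat (id-linear S) (Vec.lookup M i))) ⟩
        Vec.lookup M i +ᵥ - 1# *ᵥ Vec.lookup M i
          ≡⟨ V.⊖-inverse k (Vec.lookup M i) ⟩
        0ᵥ ∎

-- Fermat's theorem

unique-↭ : {A : Set} {xs ys : List A} → Unique xs → Unique ys → (∀ {x} → x ∈ xs → x ∈ ys) →
  (∀ {x} → x ∈ ys → x ∈ xs) → xs ↭ ys
unique-↭ ux uy p q = ∼bag⇒↭ (unique∧set⇒bag ux uy (mk⇔ p q))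

foldr-↭ : {A : Set} (_∙_ : A → A → A) → (∀ x y z → (x ∙ y) ∙ z ≡ x ∙ (y ∙ z)) → (∀ x y → x ∙ y ≡ y ∙ x) →
  ∀ e {xs ys} → xs ↭ ys → foldr _∙_ e xs ≡ foldr _∙_ e ys
foldr-↭ _∙_ assoc comm e Perm.refl = refl
foldr-↭ _∙_ assoc comm e (Perm.prep x p) = cong (x ∙_) (foldr-↭ _∙_ assoc comm e p)
foldr-↭ _∙_ assoc comm e {ys = _ ∷ _ ∷ ys} (Perm.swap x y p) = trans
  (cong (λ z → x ∙ (y ∙ z)) (foldr-↭ _∙_ assoc comm e p))
  (trans (sym (assoc x y _)) (trans (cong (_∙ foldr _∙_ e ys) (comm x y)) (assoc y x _)))
foldr-↭ _∙_ assoc comm e (Perm.trans p q) = trans (foldr-↭ _∙_ assoc comm e p) (foldr-↭ _∙_ assoc comm e q)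

module Fermat (F : FiniteField) where
  open Field F

  product : List Carrier → Carrier
  product = foldr _*_ 1#

  product-↭ : ∀ {xs ys} → xs ↭ ys → product xs ≡ product ys
  product-↭ = foldr-↭ _*_ *-assoc *-comm 1#

  elements-↭ : (f g : Carrier → Carrier) → (∀ x → f (g x) ≡ x) → (∀ x → g (f x) ≡ x) → map f elements ↭ elements
  elements-↭ f g fg gf = unique-↭ (Uniqueₚ.map⁺ (λ eq → trans (sym (gf _)) (trans (cong g eq) (gf _)))
    elements-unique) elements-unique
    (λ _ → elements-complete _) (λ {x} _ → subst (_∈ map f elements) (fg x) (∈-map⁺ f (elements-complete (g x))))

  -- Translation by 1 permutes the field and so preserves the sum of all elements, although it adds
  -- 1 once for each of them. All information on the characteristic is drawn from this.
  order·1 : order · 1# ≡ 0#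
  order·1 = +-cancel (foldr _+_ 0# elements) (trans (sym (sum-shift elements))
      (foldr-↭ _+_ +-assoc +-comm 0# (elements-↭ (1# +_) (- 1# +_)
        (λ x → solve 1 (λ x → con (ℤ.+ 1) :+ (con (ℤ.-[1+ 0 ]) :+ x) := x) refl x)
        (λ x → solve 1 (λ x → con (ℤ.-[1+ 0 ]) :+ (con (ℤ.+ 1) :+ x) := x) refl x))))
    where
    +-cancel : ∀ s {x} → x + s ≡ s → x ≡ 0#
    +-cancel s {x} eq = trans (solve 2 (λ x s → x := (x :+ s) :+ :- s) refl x s)
      (trans (cong (_+ - s) eq) (-‿inverseʳ s))
    sum-shift : ∀ xs → foldr _+_ 0# (map (1# +_) xs) ≡ length xs · 1# + foldr _+_ 0# xs
    sum-shift [] = sym (+-identityˡ 0#)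
    sum-shift (x ∷ xs) = trans (cong ((1# + x) +_) (sum-shift xs))
      (solve 3 (λ x n s → (con (ℤ.+ 1) :+ x) :+ (n :+ s) := (con (ℤ.+ 1) :+ n) :+ (x :+ s)) refl x (length xs · 1#)
        (foldr _+_ 0# xs))

  nonzero : List Carrier
  nonzero = filter (λ x → ¬? (x ≟ 0#)) elements

  length-nonzero : suc (length nonzero) ≡ order
  length-nonzero = trans (cong (ℕ._+ length nonzero)
    (sym (count-unique (_≟ 0#) elements-unique (elements-complete 0#) refl (λ eq → eq)))) (count-¬ (_≟ 0#) elements)

  -- Multiplication by a nonzero x permutes the nonzero elements; their product is not zero and can
  -- be cancelled.
  fermat : ∀ x → x ^ order ≡ x
  fermat x with x ≟ 0#
  ... | yes refl = 0^ order≢0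
  ... | no x≢0 = trans (cong (x ^_) (sym length-nonzero)) (trans (cong (x *_) x^≡1) (*-identityʳ x))
    where
    product≢0 : ∀ xs → (∀ {y} → y ∈ xs → y ≢ 0#) → product xs ≢ 0#
    product≢0 [] _ eq = 0≢1 (sym eq)
    product≢0 (y ∷ xs) nz eq = product≢0 xs (λ p → nz (there p)) (xy≡0⇒y≡0 (nz (here refl)) eq)
    product-scale : ∀ xs → product (map (x *_) xs) ≡ x ^ length xs * product xs
    product-scale [] = sym (*-identityˡ 1#)
    product-scale (y ∷ xs) = trans (cong (x * y *_) (product-scale xs))
      (solve 4 (λ x y a b → (x :* y) :* (a :* b) := (x :* a) :* (y :* b)) refl x y (x ^ length xs) (product xs))
    nz : ∀ {y} → y ∈ nonzero → y ≢ 0#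
    nz y∈ = proj₂ (∈-filter⁻ (λ x → ¬? (x ≟ 0#)) {xs = elements} y∈)
    scaled-↭ : map (x *_) nonzero ↭ nonzero
    scaled-↭ = unique-↭ (Uniqueₚ.map⁺ (*-cancelˡ x x≢0) (Uniqueₚ.filter⁺ _ elements-unique))
      (Uniqueₚ.filter⁺ _ elements-unique) to from
      where
      to : ∀ {y} → y ∈ map (x *_) nonzero → y ∈ nonzero
      to y∈ with ∈-map⁻ (x *_) y∈
      ... | z , z∈ , refl = ∈-filter⁺ (λ x → ¬? (x ≟ 0#)) (elements-complete _) (λ eq → nz z∈ (xy≡0⇒y≡0 x≢0 eq))
      cancel : ∀ y → x * (inv x * y) ≡ y
      cancel y = trans (sym (*-assoc x (inv x) y)) (trans (cong (_* y) (x*inv x≢0)) (*-identityˡ y))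
      from : ∀ {y} → y ∈ nonzero → y ∈ map (x *_) nonzero
      from {y} y∈ = subst (_∈ map (x *_) nonzero) (cancel y)
        (∈-map⁺ (x *_) (∈-filter⁺ (λ x → ¬? (x ≟ 0#)) (elements-complete _)
          (λ eq → nz y∈ (trans (sym (cancel y)) (trans (cong (x *_) eq) (zeroʳ x))))))
    x^≡1 : x ^ length nonzero ≡ 1#
    x^≡1 = *-cancelˡ (product nonzero) (product≢0 nonzero nz)
      (trans (*-comm _ _) (trans (sym (product-scale nonzero)) (trans (product-↭ scaled-↭) (sym (*-identityʳ _)))))

  2≤order : 2 ≤ order
  2≤order = length-injection (λ x → x) {0# ∷ 1# ∷ []} ((0≢1 ∷ []) ∷ [] ∷ []) (λ _ _ eq → eq)
    (λ _ → elements-complete _)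

-- Field extensions and the map x ↦ x^q

record Embedding (F E : FiniteField) : Set where
  private
    module F = FiniteField F
    module E = FiniteField E
  field
    ι : F.Carrier → E.Carrier
    ι-+ : ∀ x y → ι (x F.+ y) ≡ ι x E.+ ι y
    ι-* : ∀ x y → ι (x F.* y) ≡ ι x E.* ι y
    ι-1 : ι F.1# ≡ E.1#

module Extension {F E : FiniteField} (emb : Embedding F E) where
  open Embedding emb public
  module F = Field F
  module PF = Polynomial F
  open Field E
  open Polynomial E hiding (Poly; _≈ₚ_)
  open Linear F

  ι-0 : ι F.0# ≡ 0#
  ι-0 = trans (solve 1 (λ z → z := (z :+ z) :+ :- z) refl (ι F.0#))
    (trans (cong (_+ - ι F.0#) (trans (sym (ι-+ F.0# F.0#)) (cong ι (F.+-identityˡ F.0#)))) (-‿inverseʳ _))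

  ι-neg : ∀ x → ι (F.- x) ≡ - ι x
  ι-neg x = x-y≡0⇒x≡y (trans (cong (ι (F.- x) +_) (-‿involutive (ι x)))
    (trans (sym (ι-+ _ x)) (trans (cong ι (F.-‿inverseˡ x)) ι-0)))

  ι≡0⇒≡0 : ∀ {x} → ι x ≡ 0# → x ≡ F.0#
  ι≡0⇒≡0 {x} eq with x F.≟ F.0#
  ... | yes x≡0 = x≡0
  ... | no x≢0 = ⊥-elim (0≢1 (trans (sym (zeroˡ _))
    (trans (cong (_* ι (F.inv x)) (sym eq)) (trans (sym (ι-* x _)) (trans (cong ι (F.x*inv x≢0)) ι-1)))))

  ι-injective : ∀ {x y} → ι x ≡ ι y → x ≡ y
  ι-injective {x} {y} eq = F.x-y≡0⇒x≡y (ι≡0⇒≡0 (trans (ι-+ x _) (trans (cong₂ _+_ eq (ι-neg y)) (-‿inverseʳ _))))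

  ι-^ : ∀ x n → ι (x F.^ n) ≡ ι x ^ n
  ι-^ x zero = ι-1
  ι-^ x (suc n) = trans (ι-* x _) (cong (ι x *_) (ι-^ x n))

  coef-mapι : ∀ f i → coef (map ι f) i ≡ ι (PF.coef f i)
  coef-mapι [] i = sym ι-0
  coef-mapι (a ∷ f) zero = refl
  coef-mapι (a ∷ f) (suc i) = coef-mapι f i

  DegLt-mapι : ∀ f {n} → PF.DegLt f n → DegLt (map ι f) n
  DegLt-mapι f lt i n≤i = trans (coef-mapι f i) (trans (cong ι (lt i n≤i)) ι-0)

  Monic-mapι : ∀ f {n} → PF.Monic f n → Monic (map ι f) n
  Monic-mapι f {n} (top , lt) = trans (coef-mapι f n) (trans (cong ι top) ι-1) , DegLt-mapι f lt

  evalι : PF.Poly → Carrier → Carrier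
  evalι f = eval (map ι f)

  evalι-≈ : ∀ f g x → f PF.≈ₚ g → evalι f x ≡ evalι g x
  evalι-≈ f g x eq = eval-≈ (map ι f) (map ι g) x
    (λ i → trans (coef-mapι f i) (trans (cong ι (eq i)) (sym (coef-mapι g i))))

  -- Viewing the extension as a space with α acting by multiplication turns evaluation at α into the
  -- action of a polynomial on 1, so the rules for `act` give those for `evalι`.
  extSpace : Space
  extSpace = record
    { V = Carrier ; add = _+_ ; smul = λ c x → ι c * x ; 𝟘 = 0#
    ; add-assoc = +-assoc ; add-comm = +-comm ; add-identityˡ = +-identityˡ
    ; smul-add = λ c → distribˡ (ι c)
    ; add-smul = λ c d x → trans (cong (_* x) (ι-+ c d)) (distribʳ x _ _)
    ; smul-smul = λ c d x → trans (cong (_* x) (ι-* c d)) (*-assoc _ _ x)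
    ; 1-smul = λ x → trans (cong (_* x) ι-1) (*-identityˡ x)
    ; 0-smul = λ x → trans (cong (_* x) ι-0) (zeroˡ x) }

  *-linear : ∀ α → IsLinear extSpace extSpace (α *_)
  *-linear α = record { map-⊕ = distribˡ α ; map-• = λ c x → solve 3 (λ a c x → a :* (c :* x) := c :* (a :* x))
    refl α (ι c) x }

  act-evalι : ∀ α f x → act extSpace (α *_) f x ≡ evalι f α * x
  act-evalι α [] x = sym (zeroˡ x)
  act-evalι α (a ∷ f) x = trans (cong (λ z → ι a * x + α * z) (act-evalι α f x))
    (solve 4 (λ a α e x → a :* x :+ α :* (e :* x) := (a :+ α :* e) :* x) refl (ι a) α _ x)

  evalι-act : ∀ α f → evalι f α ≡ act extSpace (α *_) f 1#
  evalι-act α f = trans (sym (*-identityʳ _)) (sym (act-evalι α f 1#))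

  module AE α = Action extSpace (α *_) (*-linear α)

  evalι-addP : ∀ f g α → evalι (PF.addP f g) α ≡ evalι f α + evalι g α
  evalι-addP f g α = trans (evalι-act α (PF.addP f g))
    (trans (AE.act-addP α f g 1#) (sym (cong₂ _+_ (evalι-act α f) (evalι-act α g))))

  evalι-scale : ∀ a f α → evalι (PF.scale a f) α ≡ ι a * evalι f α
  evalι-scale a f α = trans (evalι-act α (PF.scale a f))
    (trans (AE.act-scale α a f 1#) (cong (ι a *_) (sym (evalι-act α f))))

  evalι-mulP : ∀ f g α → evalι (PF.mulP f g) α ≡ evalι f α * evalι g α
  evalι-mulP f g α = trans (evalι-act α (PF.mulP f g))
    (trans (AE.act-mulP α f g 1#) (trans (act-evalι α f _) (cong (evalι f α *_) (sym (evalι-act α g)))))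

  mapι-≈0 : ∀ f → Polynomial._≈ₚ_ E (map ι f) [] → f PF.≈ₚ []
  mapι-≈0 f eq i = ι≡0⇒≡0 (trans (sym (coef-mapι f i)) (eq i))

  too-many-rootsι : ∀ f rs → Unique rs → All (λ r → evalι f r ≡ 0#) rs → PF.DegLt f (length rs) → f PF.≈ₚ []
  too-many-rootsι f rs u roots lt = mapι-≈0 f (too-many-roots (map ι f) rs u roots (DegLt-mapι f lt))

  mapι-linmul : ∀ r s → map ι (PF.linmul r s) ≡ linmul (ι r) (map ι s)
  mapι-linmul r s = trans (mapι-addP (F.0# ∷ s) (PF.scale (F.- r) s))
    (cong₂ (Polynomial.addP E) (cong (_∷ map ι s) ι-0) (mapι-scale s))
    where
    mapι-addP : ∀ f g → map ι (PF.addP f g) ≡ Polynomial.addP E (map ι f) (map ι g)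
    mapι-addP [] g = refl
    mapι-addP (a ∷ f) [] = refl
    mapι-addP (a ∷ f) (b ∷ g) = cong₂ _∷_ (ι-+ a b) (mapι-addP f g)
    mapι-scale : ∀ s → map ι (PF.scale (F.- r) s) ≡ Polynomial.scale E (- ι r) (map ι s)
    mapι-scale [] = refl
    mapι-scale (a ∷ s) = cong₂ _∷_ (trans (ι-* _ a) (cong (_* ι a) (ι-neg r))) (mapι-scale s)

module _ (F : FiniteField) where
  open Field F
  open Polynomial F

  subP : Poly → Poly → Poly
  subP f g = addP f (scale (- 1#) g)

  coef-subP : ∀ f g i → coef (subP f g) i ≡ coef f i + - coef g i
  coef-subP f g i = trans (coef-addP f (scale (- 1#) g) i)
    (cong (coef f i +_) (trans (coef-scale (- 1#) g i) (trans (sym (-‿distribˡ-* 1# _)) (cong -_ (*-identityˡ _)))))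

  eval-subP : ∀ f g x → eval (subP f g) x ≡ eval f x + - eval g x
  eval-subP f g x = trans (eval-addP f (scale (- 1#) g) x)
    (cong (eval f x +_) (trans (eval-scale (- 1#) g x) (trans (sym (-‿distribˡ-* 1# _)) (cong -_ (*-identityˡ _)))))

  Monic-subP : ∀ f g {n} → Monic f n → Monic g n → DegLt (subP f g) n
  Monic-subP f g {n} (f1 , p) (g1 , q) i n≤i with n ℕ.≟ i
  ... | yes refl = trans (coef-subP f g n) (trans (cong₂ (λ a b → a + - b) f1 g1) (-‿inverseʳ 1#))
  ... | no n≢i = trans (coef-subP f g i)
    (trans (cong₂ (λ a b → a + - b) (p i (ℕₚ.≤∧≢⇒< n≤i n≢i)) (q i (ℕₚ.≤∧≢⇒< n≤i n≢i))) (-‿inverseʳ 0#))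

  subP≈0⇒≈ : ∀ f g → subP f g ≈ₚ [] → f ≈ₚ g
  subP≈0⇒≈ f g eq i = x-y≡0⇒x≡y (trans (sym (coef-subP f g i)) (eq i))

  -- The common shape X^Q + a X + c covers X^Q - X, the comparison polynomial for additivity and the
  -- equations affine in a power of x ↦ x^q.
  trinomial : ℕ → Carrier → Carrier → Poly
  trinomial Q a c = addP (X^ Q) (c ∷ a ∷ [])

  trinomial-Monic : ∀ {Q} → 2 ≤ Q → ∀ a c → Monic (trinomial Q a c) Q
  trinomial-Monic {Q} 2≤Q a c =
    trans (coef-addP (X^ Q) (c ∷ a ∷ []) Q)
      (trans (cong₂ _+_ (proj₁ (X^-Monic Q)) (DegLt-length (c ∷ a ∷ []) Q 2≤Q)) (+-identityʳ 1#)) ,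
    DegLt-addP (X^ Q) (c ∷ a ∷ []) (proj₂ (X^-Monic Q))
      (DegLt-mono {c ∷ a ∷ []} (ℕₚ.≤-trans 2≤Q (ℕₚ.n≤1+n Q)) (DegLt-length (c ∷ a ∷ [])))

  eval-trinomial : ∀ Q a c x → eval (trinomial Q a c) x ≡ x ^ Q + (a * x + c)
  eval-trinomial Q a c x = trans (eval-addP (X^ Q) (c ∷ a ∷ []) x) (cong₂ _+_ (eval-X^ Q x)
    (solve 3 (λ a c x → c :+ x :* (a :+ x :* con (ℤ.+ 0)) := a :* x :+ c) refl a c x))

  eval-prodlin : ∀ rs x → eval (prodlin rs) x ≡ foldr _*_ 1# (map (λ r → x + - r) rs)
  eval-prodlin [] x = trans (cong (1# +_) (zeroʳ x)) (+-identityʳ 1#)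
  eval-prodlin (r ∷ rs) x = trans (eval-linmul r (prodlin rs) x) (cong ((x + - r) *_) (eval-prodlin rs x))

  prodlin-root⇒∈ : ∀ rs x → eval (prodlin rs) x ≡ 0# → x ∈ rs
  prodlin-root⇒∈ [] x eq = ⊥-elim (0≢1 (trans (sym eq) (trans (cong (1# +_) (zeroʳ x)) (+-identityʳ 1#))))
  prodlin-root⇒∈ (r ∷ rs) x eq with xy≡0 (trans (sym (eval-linmul r (prodlin rs) x)) eq)
  ... | inj₁ x-r≡0 = here (x-y≡0⇒x≡y x-r≡0)
  ... | inj₂ root = there (prodlin-root⇒∈ rs x root)

module Frobenius {F E : FiniteField} (emb : Embedding F E) where
  open Extension emb
  open Field E
  open Polynomial E hiding (Poly)
  open Fermat F using (fermat; 2≤order; elements-↭)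

  q : ℕ
  q = F.order

  σ : Carrier → Carrier
  σ x = x ^ q

  σ-ι : ∀ a → σ (ι a) ≡ ι a
  σ-ι a = trans (sym (ι-^ a q)) (cong ι (fermat a))

  private
    ιF : List Carrier
    ιF = map ι F.elements

    ιF-unique : Unique ιF
    ιF-unique = Uniqueₚ.map⁺ ι-injective F.elements-unique

    length-ιF : length ιF ≡ q
    length-ιF = Listₚ.length-map ι F.elements

  -- X^q - X and the product of all X - a are monic of degree q, and both vanish on the q elements
  -- of F; their difference has lower degree and too many roots.
  Artin-Schreier-product : ∀ y → y ^ q + - y ≡ eval (prodlin ιF) y
  Artin-Schreier-product y = x-y≡0⇒x≡y
    (trans (cong₂ (λ a b → a + - b) (sym (trans (eval-trinomial E q (- 1#) 0# y) (simplify (y ^ q) y))) refl)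
    (trans (sym (eval-subP E (trinomial E q (- 1#) 0#) (prodlin ιF) y))
      (eval-≈0 D y (too-many-roots D ιF ιF-unique (All.tabulate roots)
      (subst (DegLt D) (sym length-ιF) (Monic-subP E (trinomial E q (- 1#) 0#) (prodlin ιF)
        (trinomial-Monic E 2≤order (- 1#) 0#) (subst (Monic (prodlin ιF)) length-ιF (prodlin-Monic ιF))))))))
    where
    D = subP E (trinomial E q (- 1#) 0#) (prodlin ιF)
    simplify : ∀ z y → z + (- 1# * y + 0#) ≡ z + - y
    simplify = solve 2 (λ z y → z :+ (con (ℤ.-[1+ 0 ]) :* y :+ con (ℤ.+ 0)) := z :+ :- y) refl
    roots : ∀ {x} → x ∈ ιF → eval D x ≡ 0#
    roots {x} x∈ with ∈-map⁻ ι x∈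
    ... | a , _ , refl = trans (eval-subP E (trinomial E q (- 1#) 0#) (prodlin ιF) (ι a))
      (trans (cong₂ (λ u v → u + - v) (trans (eval-trinomial E q (- 1#) 0# (ι a))
        (trans (simplify _ _) (x≡y⇒x-y≡0 (σ-ι a)))) (eval-prodlin-root ιF x∈)) (-‿inverseʳ 0#))

  σ-fixed⇒∈F : ∀ x → σ x ≡ x → ∃[ a ] ι a ≡ x
  σ-fixed⇒∈F x eq = let a , _ , x≡ιa = ∈-map⁻ ι (prodlin-root⇒∈ E ιF x (trans (sym (Artin-Schreier-product x)) (x≡y⇒x-y≡0 eq)))
                    in a , sym x≡ιa

  -- Subtracting ι b + y on both sides leaves the values of X^q - X at ι b + y and at y, and as a product
  -- over F this polynomial is invariant under translation by F.
  σ-shift : ∀ b y → σ (ι b + y) ≡ ι b + σ y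
  σ-shift b y = begin
    σ (ι b + y)                              ≡⟨ solve 2 (λ s z → s := (s :+ :- z) :+ z) refl (σ (ι b + y)) (ι b + y) ⟩
    (σ (ι b + y) + - (ι b + y)) + (ι b + y)  ≡⟨ cong (_+ (ι b + y)) (Artin-Schreier-product (ι b + y)) ⟩
    eval (prodlin ιF) (ι b + y) + (ι b + y)  ≡⟨ cong (_+ (ι b + y)) translate ⟩
    eval (prodlin ιF) y + (ι b + y)          ≡⟨ cong (_+ (ι b + y)) (sym (Artin-Schreier-product y)) ⟩
    (σ y + - y) + (ι b + y)
      ≡⟨ solve 3 (λ s y b → (s :+ :- y) :+ (b :+ y) := b :+ s) refl (σ y) y (ι b) ⟩
    ι b + σ y                                ∎
    where
    module FF = Field F
    move : ∀ a → (ι b + y) + - ι a ≡ y + - ι (F.- b F.+ a)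
    move a = trans (solve 3 (λ b y a → (b :+ y) :+ :- a := y :+ :- (:- b :+ a)) refl (ι b) y (ι a))
      (cong (λ z → y + - z) (trans (cong (_+ ι a) (sym (ι-neg b))) (sym (ι-+ _ a))))
    translate : eval (prodlin ιF) (ι b + y) ≡ eval (prodlin ιF) y
    translate = begin
      eval (prodlin ιF) (ι b + y)                                           ≡⟨ eval-prodlin E ιF _ ⟩
      foldr _*_ 1# (map (λ r → (ι b + y) + - r) (map ι F.elements))
        ≡⟨ cong (foldr _*_ 1#) (trans (sym (Listₚ.map-∘ F.elements))
        (trans (Listₚ.map-cong move F.elements) (Listₚ.map-∘ F.elements))) ⟩
      foldr _*_ 1# (map (λ a → y + - ι a) (map (F.- b F.+_) F.elements))
        ≡⟨ foldr-↭ _*_ *-assoc *-comm 1# (map-↭ (λ a → y + - ι a) (elements-↭ (F.- b F.+_) (b F.+_)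
            (λ x → F.solve 2 (λ b x → (F.:- b) F.:+ (b F.:+ x) F.:= x) refl b x)
              (λ x → F.solve 2 (λ b x → b F.:+ ((F.:- b) F.:+ x) F.:= x) refl b x))) ⟩
      foldr _*_ 1# (map (λ a → y + - ι a) F.elements)
        ≡⟨ cong (foldr _*_ 1#) (Listₚ.map-∘ F.elements) ⟩
      foldr _*_ 1# (map (λ r → y + - r) ιF)                                 ≡⟨ sym (eval-prodlin E ιF y) ⟩
      eval (prodlin ιF) y                                                   ∎

  -- As a polynomial in x the difference of the two sides has degree less than q and vanishes on F.
  σ-+ : ∀ x y → σ (x + y) ≡ σ x + σ y
  σ-+ x y = x-y≡0⇒x≡y (trans (sym (eval-D x)) (eval-≈0 D x (too-many-roots D ιF ιF-unique (All.tabulate roots)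
      (subst (DegLt D) (sym length-ιF) (Monic-subP E A B A-Monic B-Monic)))))
    where
    A = prodlin (List.replicate q (- y))
    B = trinomial E q 0# (σ y)
    D = subP E A B
    A-Monic : Monic A q
    A-Monic = subst (Monic A) (Listₚ.length-replicate q) (prodlin-Monic (List.replicate q (- y)))
    B-Monic = trinomial-Monic E 2≤order 0# (σ y)
    eval-A : ∀ n x → eval (prodlin (List.replicate n (- y))) x ≡ (x + y) ^ n
    eval-A zero x = eval-prodlin E [] x
    eval-A (suc n) x = trans (eval-linmul (- y) (prodlin (List.replicate n (- y))) x)
      (cong₂ _*_ (cong (x +_) (-‿involutive y)) (eval-A n x))
    eval-D : ∀ x → eval D x ≡ σ (x + y) + - (σ x + σ y)
    eval-D x = trans (eval-subP E A B x) (cong₂ (λ u v → u + - v) (eval-A q x)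
      (trans (eval-trinomial E q 0# (σ y) x) (cong (σ x +_) (trans (cong (_+ σ y) (zeroˡ x)) (+-identityˡ _)))))
    roots : ∀ {x} → x ∈ ιF → eval D x ≡ 0#
    roots {x} x∈ with ∈-map⁻ ι x∈
    ... | b , _ , refl = trans (eval-D (ι b)) (x≡y⇒x-y≡0 (trans (σ-shift b y) (cong (_+ σ y) (sym (σ-ι b)))))

  σ-* : ∀ x y → σ (x * y) ≡ σ x * σ y
  σ-* x y = *-^ x y q

  frob : ℕ → Carrier → Carrier
  frob zero x = x
  frob (suc k) x = σ (frob k x)

  frob-^ : ∀ k x → frob k x ≡ x ^ (q ℕ.^ k)
  frob-^ zero x = sym (*-identityʳ x)
  frob-^ (suc k) x = trans (cong σ (frob-^ k x)) (sym (^-* x q (q ℕ.^ k)))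

  frob-+ : ∀ k x y → frob k (x + y) ≡ frob k x + frob k y
  frob-+ zero x y = refl
  frob-+ (suc k) x y = trans (cong σ (frob-+ k x y)) (σ-+ _ _)

  frob-* : ∀ k x y → frob k (x * y) ≡ frob k x * frob k y
  frob-* zero x y = refl
  frob-* (suc k) x y = trans (cong σ (frob-* k x y)) (σ-* _ _)

  frob-ι : ∀ k a → frob k (ι a) ≡ ι a
  frob-ι zero a = refl
  frob-ι (suc k) a = trans (cong σ (frob-ι k a)) (σ-ι a)

  frob-0 : ∀ k → frob k 0# ≡ 0#
  frob-0 k = trans (cong (frob k) (sym ι-0)) (trans (frob-ι k F.0#) ι-0)

  frob-1 : ∀ k → frob k 1# ≡ 1#
  frob-1 k = trans (cong (frob k) (sym ι-1)) (trans (frob-ι k F.1#) ι-1)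

  frob-neg : ∀ k x → frob k (- x) ≡ - frob k x
  frob-neg k x = x-y≡0⇒x≡y (trans (cong (frob k (- x) +_) (-‿involutive _))
    (trans (sym (frob-+ k (- x) x)) (trans (cong (frob k) (-‿inverseˡ x)) (frob-0 k))))

  frob-∘ : ∀ j k x → frob (j ℕ.+ k) x ≡ frob j (frob k x)
  frob-∘ zero k x = refl
  frob-∘ (suc j) k x = cong σ (frob-∘ j k x)

  frob-injective : ∀ k {x y} → frob k x ≡ frob k y → x ≡ y
  frob-injective k {x} {y} eq = x-y≡0⇒x≡y
    (nil k _ (trans (frob-+ k x (- y)) (trans (cong₂ _+_ eq (frob-neg k y)) (-‿inverseʳ _))))
    where
    nil : ∀ k x → frob k x ≡ 0# → x ≡ 0#
    nil zero x eq = eq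
    nil (suc k) x eq with frob k x ≟ 0#
    ... | yes p = nil k x p
    ... | no p = ⊥-elim (^-≢0 q p eq)

  frob-inv : ∀ k x → frob k (inv x) ≡ inv (frob k x)
  frob-inv k x with x ≟ 0#
  ... | yes refl = trans (frob-0 k) (sym (trans (cong inv (frob-0 k)) inv-0))
  ... | no x≢0 = sym (inv-unique (trans (sym (frob-* k x _))
    (trans (cong (frob k) (proj₂ (inverse x x≢0))) (frob-1 k))))

  frob-multiple : ∀ {k x} → frob k x ≡ x → ∀ n → frob (n ℕ.* k) x ≡ x
  frob-multiple eq zero = refl
  frob-multiple {k} {x} eq (suc n) = trans (frob-∘ k (n ℕ.* k) x) (trans (cong (frob k) (frob-multiple eq n)) eq)

  frob-evalι : ∀ k f x → frob k (evalι f x) ≡ evalι f (frob k x)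
  frob-evalι k [] x = frob-0 k
  frob-evalι k (a ∷ f) x = trans (frob-+ k _ _)
    (cong₂ _+_ (frob-ι k a) (trans (frob-* k _ _) (cong (frob k x *_) (frob-evalι k f x))))

  -- u has degree exactly n over F.
  Ord : Carrier → ℕ → Set
  Ord u n = frob n u ≡ u × (∀ k → 0 < k → k < n → frob k u ≢ u)

  conjugates : Carrier → ℕ → List Carrier
  conjugates u n = applyUpTo (λ i → frob i u) n

  frob-collision : ∀ {u i j} → i < j → frob i u ≡ frob j u → frob (j ℕ.∸ i) u ≡ u
  frob-collision {u} {i} {j} i<j eq = frob-injective i
    (trans (sym (frob-∘ i (j ℕ.∸ i) u)) (trans (cong (λ k → frob k u) (ℕₚ.m+[n∸m]≡n (ℕₚ.<⇒≤ i<j))) (sym eq)))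

  conjugates-unique : ∀ {u n} → (∀ k → 0 < k → k < n → frob k u ≢ u) → Unique (conjugates u n)
  conjugates-unique {u} {n} ord = Uniqueₚ.applyUpTo⁺₁ (λ i → frob i u) n (λ {i} {j} i<j j<n eq →
    ord (j ℕ.∸ i) (ℕₚ.m<n⇒0<n∸m i<j) (ℕₚ.≤-<-trans (ℕₚ.m∸n≤m j i) j<n) (frob-collision i<j eq))

  conjugates-roots : ∀ f u n → evalι f u ≡ 0# → All (λ r → evalι f r ≡ 0#) (conjugates u n)
  conjugates-roots f u n eq = All.tabulate go
    where
    go : ∀ {x} → x ∈ conjugates u n → evalι f x ≡ 0#
    go x∈ with ∈-applyUpTo⁻ (λ i → frob i u) x∈
    ... | i , _ , refl = trans (sym (frob-evalι i f u)) (trans (cong (frob i) eq) (frob-0 i))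

  -- A polynomial over F that vanishes at u vanishes at its conjugates, and there are n distinct
  -- ones.
  Ord⇒minimal : ∀ {u n} → (∀ k → 0 < k → k < n → frob k u ≢ u) → ∀ f → PF.DegLt f n → evalι f u ≡ 0# → f PF.≈ₚ []
  Ord⇒minimal {u} {n} ord f lt eq = too-many-rootsι f (conjugates u n) (conjugates-unique ord)
    (conjugates-roots f u n eq)
    (subst (PF.DegLt f) (sym (Listₚ.length-applyUpTo (λ i → frob i u) n)) lt)

  count-roots : ∀ f n → Monic f n → ∀ {P : Carrier → Set} (P? : ∀ x → Dec (P x)) → (∀ {x} → P x → eval f x ≡ 0#) →
    count P? elements ≤ n
  count-roots f n mf P? root = roots-≤ f n (filter P? elements) (Monic≉0 {f} mf) (proj₂ mf)
    (Uniqueₚ.filter⁺ P? elements-unique)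
    (All.tabulate (λ x∈ → root (proj₂ (∈-filter⁻ P? {xs = elements} x∈))))

  fixed : ℕ → List Carrier
  fixed k = filter (λ x → frob k x ≟ x) elements

  2≤q^ : ∀ {k} → 0 < k → 2 ≤ q ℕ.^ k
  2≤q^ {suc k} _ = ℕₚ.≤-trans 2≤order
    (ℕₚ.≤-trans (ℕₚ.≤-reflexive (sym (ℕₚ.*-identityʳ q)))
    (ℕₚ.*-monoʳ-≤ q (ℕₚ.m^n>0 q {{ℕ.>-nonZero (ℕₚ.≤-trans (s≤s z≤n) 2≤order)}} k)))

  count-frob-affine : ∀ {k} → 0 < k → ∀ a c {P : Carrier → Set} (P? : ∀ x → Dec (P x)) →
    (∀ {x} → P x → frob k x + (a * x + c) ≡ 0#) → count P? elements ≤ q ℕ.^ k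
  count-frob-affine {k} 0<k a c P? p = count-roots (trinomial E (q ℕ.^ k) a c) (q ℕ.^ k)
    (trinomial-Monic E (2≤q^ 0<k) a c) P?
    (λ {x} px → trans (eval-trinomial E (q ℕ.^ k) a c x) (trans (cong (_+ (a * x + c)) (sym (frob-^ k x))) (p px)))

  length-fixed : ∀ {k} → 0 < k → length (fixed k) ≤ q ℕ.^ k
  length-fixed {k} 0<k = count-frob-affine 0<k (- 1#) 0# (λ x → frob k x ≟ x)
    (λ {x} eq → trans (cong (_+ (- 1# * x + 0#)) eq)
      (solve 1 (λ x → x :+ (con (ℤ.-[1+ 0 ]) :* x :+ con (ℤ.+ 0)) := con (ℤ.+ 0)) refl x))

  toList-injective : ∀ {n} (v w : Vec F.Carrier n) → Vec.toList v PF.≈ₚ Vec.toList w → v ≡ w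
  toList-injective [] [] eq = refl
  toList-injective (a ∷ v) (b ∷ w) eq = cong₂ _∷_ (eq 0) (toList-injective v w (λ i → eq (suc i)))

  difference-annihilates : ∀ {n} (v w : Vec F.Carrier n) {u} → v ≢ w → evalι (Vec.toList v) u ≡ evalι
    (Vec.toList w) u →
    ∃[ f ] PF.DegLt f n × ¬ (f PF.≈ₚ []) × evalι f u ≡ 0#
  difference-annihilates v w {u} v≢w eq = subP F (Vec.toList v) (Vec.toList w) ,
    PF.DegLt-addP (Vec.toList v) (PF.scale (F.- F.1#) (Vec.toList w)) (PF.DegLt-toList v)
      (PF.DegLt-scale (F.- F.1#) (Vec.toList w) (PF.DegLt-toList w)) ,
    (λ f≈0 → v≢w (toList-injective v w (subP≈0⇒≈ F (Vec.toList v) (Vec.toList w) f≈0))) ,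
    trans (evalι-addP (Vec.toList v) (PF.scale (F.- F.1#) (Vec.toList w)) u)
      (trans (cong (evalι (Vec.toList v) u +_) (trans (evalι-scale (F.- F.1#) (Vec.toList w) u)
          (trans (cong₂ _*_ (trans (ι-neg F.1#) (cong -_ ι-1)) (sym eq))
            (trans (sym (-‿distribˡ-* 1# _)) (cong -_ (*-identityˡ _)))))) (-‿inverseʳ _))

  -- The q^{D+1} polynomials of degree at most D take values in the fixed field of frob D, which has at most q^D elements.
  annihilator : ∀ {u D} → 0 < D → frob D u ≡ u → ∃[ f ] PF.DegLt f (suc D) × ¬ (f PF.≈ₚ []) × evalι f u ≡ 0#
  annihilator {u} {D} 0<D eq =
    let v , w , v≢w , eq′ = pigeonhole (Matrices._≟ᵥ_ F) _≟_ (λ v → evalι (Vec.toList v) u) (Matrices.allVectors-unique F (suc D)) into enough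
    in difference-annihilates v w v≢w eq′
    where
    into : ∀ {v} → v ∈ Matrices.allVectors F (suc D) → evalι (Vec.toList v) u ∈ fixed D
    into {v} _ = ∈-filter⁺ (λ x → frob D x ≟ x) (elements-complete _)
      (trans (frob-evalι D (Vec.toList v) u) (cong (evalι (Vec.toList v)) eq))
    enough : length (fixed D) < length (Matrices.allVectors F (suc D))
    enough = ℕₚ.≤-<-trans (length-fixed 0<D)
      (ℕₚ.<-≤-trans (ℕₚ.m<m*n (q ℕ.^ D) q {{ℕ.>-nonZero (ℕₚ.≤-trans (s≤s z≤n) (2≤q^ 0<D))}} 2≤order)
        (ℕₚ.≤-reflexive (trans (ℕₚ.*-comm _ q) (sym (length-vectors F.elements (suc D))))))

  Ord⇒ExactDeg : ∀ {u n} → Ord u n → ∀ f → PF.DegLt f (suc n) → ¬ (f PF.≈ₚ []) → evalι f u ≡ 0# → PF.ExactDeg f n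
  Ord⇒ExactDeg {u} {n} (fix , ord) f lt f≉0 root = (λ eq → f≉0 (Ord⇒minimal ord f (below eq) root)) , lt
    where
    below : PF.coef f n ≡ F.0# → ∀ i → n ≤ i → PF.coef f i ≡ F.0#
    below eq i n≤i with n ℕ.≟ i
    ... | yes refl = eq
    ... | no n≢i = lt i (ℕₚ.≤∧≢⇒< n≤i n≢i)

  -- Some nonzero polynomial of degree at most n annihilates u, and none of smaller degree does; it
  -- remains to divide by the leading coefficient.
  minimal-polynomial : ∀ {u n} → 0 < n → Ord u n → Σ (Vec F.Carrier n) λ c → evalι (PF.mon c) u ≡ 0#
  minimal-polynomial {u} {n} 0<n ord =
    let f , lt , f≉0 , root = annihilator 0<n (proj₁ ord)
        c , f≈c = PF.ExactDeg⇒mon f (Ord⇒ExactDeg ord f lt f≉0 root)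
    in c , trans (sym (evalι-≈ (PF.scale (F.inv (PF.coef f n)) f) (PF.mon c) u f≈c))
        (trans (evalι-scale _ f u) (trans (cong (ι (F.inv (PF.coef f n)) *_) root) (zeroʳ _)))

-- Irreducible polynomials and decidable divisibility

module Irreducibility (F : FiniteField) where
  open Field F
  open Polynomial F
  open Linear F
  open Matrices F
  open Companion F

  mulP-0ʳ : ∀ f g → g ≈ₚ [] → mulP f g ≈ₚ []
  mulP-0ʳ [] g eq i = refl
  mulP-0ʳ (a ∷ f) g eq i = trans (coef-mulP-∷ a f g i)
    (trans (cong₂ _+_ (trans (cong (a *_) (eq i)) (zeroʳ a)) (rest i)) (+-identityˡ 0#))
    where
    rest : ∀ i → coef (0# ∷ mulP f g) i ≡ 0#
    rest zero = refl
    rest (suc i) = mulP-0ʳ f g eq i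

  mulP-constant : ∀ f c → (∀ i → coef f (suc i) ≡ 0#) → mulP f (c ∷ []) ≈ₚ (coef f 0 * c ∷ [])
  mulP-constant [] c eq zero = sym (zeroˡ c)
  mulP-constant [] c eq (suc i) = refl
  mulP-constant (a ∷ f) c eq zero = trans (coef-mulP-∷ a f (c ∷ []) 0) (+-identityʳ _)
  mulP-constant (a ∷ f) c eq (suc i) = trans (coef-mulP-∷ a f (c ∷ []) (suc i))
    (trans (cong₂ _+_ (zeroʳ a) (mulP-0ˡ f (c ∷ []) eq i)) (+-identityˡ 0#))

  ExactDeg0⇒unit : ∀ f → ExactDeg f 0 → Defs.IsUnitP F f
  ExactDeg0⇒unit f (f≢0 , lt) = inv (coef f 0) ∷ [] , λ i → trans
    (mulP-constant f (inv (coef f 0)) (λ j → lt (suc j) (s≤s z≤n)) i) (cancel i)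
    where
    cancel : ∀ i → coef (coef f 0 * inv (coef f 0) ∷ []) i ≡ coef (1# ∷ []) i
    cancel zero = x*inv f≢0
    cancel (suc i) = refl

  unit⇒ExactDeg0 : ∀ {f e} → Defs.IsUnitP F f → ExactDeg f e → e ≡ 0
  unit⇒ExactDeg0 {f} {e} (g , fg≈1) ex with degree g
  ... | inj₁ g≈0 = ⊥-elim (0≢1 (trans (sym (mulP-0ʳ f g g≈0 0)) (fg≈1 0)))
  ... | inj₂ (e′ , ex′) = zero-sum e e′
    (λ k eq → mulP-ExactDeg {f} {g} ex ex′ (trans (fg≈1 (e ℕ.+ e′)) (trans (cong (coef (1# ∷ [])) eq) refl)))
    where
    zero-sum : ∀ e e′ → (∀ k → e ℕ.+ e′ ≡ suc k → ⊥) → e ≡ 0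
    zero-sum zero e′ _ = refl
    zero-sum (suc e) e′ absurd = ⊥-elim (absurd _ refl)

  irreducibleP⇒Irr : ∀ {n} (c : Vec Carrier n) f → f ≈ₚ mon c → Defs.IrreducibleP F f → Irr c
  irreducibleP⇒Irr {n} c f f≈c (_ , _ , irr) {d} u 0<d d<n s eq with irr s (mon u) (λ i → trans (f≈c i) (eq i))
  ... | inj₂ unit-u = ℕₚ.<⇒≢ 0<d (sym (unit⇒ExactDeg0 {mon u} unit-u (Monic⇒ExactDeg {mon u} (mon-Monic u))))
  ... | inj₁ unit-s with degree s
  ...   | inj₁ s≈0 = Monic≉0 {mon c} (mon-Monic c) (λ i → trans (eq i) (mulP-0ˡ s (mon u) s≈0 i))
  ...   | inj₂ (e , ex) = 0≢1 (trans (sym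
    (trans (eq n) (DegLt-mulP s (mon u) {1} {d}
    (subst (λ e → DegLt s (suc e)) (unit⇒ExactDeg0 {s} unit-s ex) (proj₂ ex)) (proj₂ (mon-Monic u)) n d<n)))
    (proj₁ (mon-Monic c)))

  -- Divisibility by the monic polynomial u is decided in F[X]/(u).
  divisible : ∀ {d} (u : Vector (suc d)) f → act (vecSpace (suc d)) (mulX u) f (one u) ≡ 0ᵥ → Σ Poly λ s → f ≈ₚ
    mulP s (mon u)
  divisible {d} u f f1≡0 = s , λ i → trans (division-≈ i) (trans (coef-addP (mulP s (mon u)) r i)
      (trans (cong (coef (mulP s (mon u)) i +_) (r≈0 i)) (+-identityʳ _)))
    where
    open Division (divide (mon u) (suc d) (mon-Monic u) f) renaming (quotient to s; remainder to r)
    S = vecSpace (suc d)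
    module A = Action S (mulX u) (mulX-linear u)
    v = proj₁ (DegLt⇒vec (suc d) r remainder-DegLt)
    r≈v = proj₂ (DegLt⇒vec (suc d) r remainder-DegLt)
    v≡0 : v ≡ 0ᵥ
    v≡0 = begin
      v                                                      ≡⟨ sym (act-toList-one u v) ⟩
      act S (mulX u) (Vec.toList v) (one u)                  ≡⟨ sym (A.act-≈ r (Vec.toList v) (one u) r≈v) ⟩
      act S (mulX u) r (one u)                               ≡⟨ sym (SpaceLaws.add-identityˡ S _) ⟩
      0ᵥ +ᵥ act S (mulX u) r (one u)
        ≡⟨ cong (_+ᵥ act S (mulX u) r (one u))
        (sym (trans (A.act-mulP s (mon u) (one u))
        (trans (cong (act S (mulX u) s) (act-mon u (one u))) (map-𝟘 (A.act-linear s))))) ⟩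
      act S (mulX u) (mulP s (mon u)) (one u) +ᵥ act S (mulX u) r (one u)
        ≡⟨ sym (A.act-addP (mulP s (mon u)) r (one u)) ⟩
      act S (mulX u) (addP (mulP s (mon u)) r) (one u)
        ≡⟨ sym (A.act-≈ f (addP (mulP s (mon u)) r) (one u) division-≈) ⟩
      act S (mulX u) f (one u)                               ≡⟨ f1≡0 ⟩
      0ᵥ                                                     ∎
    r≈0 : r ≈ₚ []
    r≈0 i = trans (r≈v i) (trans (cong (λ w → coef (Vec.toList w) i) v≡0) (coef-0ᵥ u (suc d) i))

  multiple⇒0 : ∀ {d} (u : Vector (suc d)) f s → f ≈ₚ mulP s (mon u) → act (vecSpace (suc d)) (mulX u) f (one u) ≡ 0ᵥ
  multiple⇒0 {d} u f s eq = trans (A.act-≈ f (mulP s (mon u)) (one u) eq)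
    (trans (A.act-mulP s (mon u) (one u))
    (trans (cong (act S (mulX u) s) (act-mon u (one u))) (map-𝟘 (A.act-linear s))))
    where
    S = vecSpace (suc d)
    module A = Action S (mulX u) (mulX-linear u)

  ProperDivisor : ∀ {n} → Vector n → Set
  ProperDivisor {n} p = ∃[ d ] suc d < n × Σ (Vector (suc d)) λ u → Σ Poly λ s → mon p ≈ₚ mulP s (mon u)

  -- There are finitely many monic candidates of each degree, and each is tested by computing the
  -- residue of p. A divisor is sought in degree d + 1 with d < n - 1, which excludes the constants
  -- and p itself.
  proper-divisor? : ∀ {n} (p : Vector n) → ProperDivisor p ⊎ Irr p
  proper-divisor? {n} p = decide (ℕₚ.anyUpTo? (λ d → Any.any? (λ u → residue u ≟ᵥ 0ᵥ) (allVectors (suc d)))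
    (ℕ.pred n))
    where
    residue : ∀ {d} → Vector (suc d) → Vector (suc d)
    residue {d} u = act (vecSpace (suc d)) (mulX u) (mon p) (one u)
    bound : ∀ {d n} → d < ℕ.pred n → suc d < n
    bound {n = suc n} lt = s≤s lt
    bound′ : ∀ {d n} → suc d < n → d < ℕ.pred n
    bound′ (s≤s lt) = lt
    decide : Dec (∃[ d ] d < ℕ.pred n × Any (λ u → residue u ≡ 0ᵥ) (allVectors (suc d))) → ProperDivisor p ⊎ Irr p
    decide (yes (d , lt , any)) = let u , _ , eq = find any in inj₁ (d , bound lt , u , divisible u (mon p) eq)
    decide (no none) = inj₂ λ { {suc d} u _ lt s eq → none
      (d , bound′ lt , lose (allVectors-complete u) (multiple⇒0 u (mon p) s eq)) }

  module _ {n} (c : Vector (suc n)) (irr : Irr c) where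
    private
      S = vecSpace (suc n)

    quotient-embedding : Embedding F (quotientField c irr)
    quotient-embedding = record
      { ι = λ a → a *ᵥ one c
      ; ι-+ = λ x y → Space.add-smul S x y (one c)
      ; ι-* = λ x y → sym (trans (map-• (⊛-linear c (x *ᵥ one c)) y (one c))
        (trans (cong (y *ᵥ_) (trans (⊛-comm c (x *ᵥ one c) (one c)) (one-⊛ c (x *ᵥ one c))))
          (trans (sym (Space.smul-smul S y x (one c))) (cong (_*ᵥ one c) (*-comm y x)))))
      ; ι-1 = Space.1-smul S (one c) }

    evalι-quotient : ∀ f → Extension.evalι quotient-embedding f (mulX c (one c)) ≡ act S (mulX c) f (one c)
    evalι-quotient [] = refl
    evalι-quotient (a ∷ f) = cong (a *ᵥ one c +ᵥ_) (trans (mulX-⊛ c _) (cong (mulX c) (evalι-quotient f)))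

-- Splitting fields

id-embedding : ∀ F → Embedding F F
id-embedding F = record { ι = λ x → x ; ι-+ = λ _ _ → refl ; ι-* = λ _ _ → refl ; ι-1 = refl }

∘-embedding : ∀ {F K E} → Embedding K E → Embedding F K → Embedding F E
∘-embedding g f = record
  { ι = λ x → G.ι (F.ι x)
  ; ι-+ = λ x y → trans (cong G.ι (F.ι-+ x y)) (G.ι-+ _ _)
  ; ι-* = λ x y → trans (cong G.ι (F.ι-* x y)) (G.ι-* _ _)
  ; ι-1 = trans (cong G.ι F.ι-1) G.ι-1 }
  where
  module G = Embedding g
  module F = Embedding f

record HasRoot (F : FiniteField) (f : Polynomial.Poly F) : Set₁ where
  field
    field-extension : FiniteField
    embedding : Embedding F field-extension
    root : FiniteField.Carrier field-extension
    isRoot : Extension.evalι embedding f root ≡ FiniteField.0# field-extension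

-- Either p is irreducible and the class of X is a root in F[X]/(p), or a proper divisor of p takes
-- its place; `b` bounds the descent in degree.
root-extension : ∀ F b {n} → n < b → (p : Vec (FiniteField.Carrier F) (suc n)) → HasRoot F (Polynomial.mon F p)
root-extension F (suc b) {n} (s≤s n≤b) p = decide (proper-divisor? p)
  where
  open Irreducibility F
  open Polynomial F
  open Linear F using (Irr)
  open Companion F
  decide : ProperDivisor p ⊎ Irr p → HasRoot F (mon p)
  decide (inj₁ (d , s≤s d<n , u , s , eq)) = record
    { field-extension = field-extension ; embedding = embedding ; root = root
    ; isRoot = trans (evalι-≈ (mon p) (mulP s (mon u)) root eq)
      (trans (evalι-mulP s (mon u) root) (trans (cong (evalι s root E.*_) isRoot) (E.zeroʳ _))) }
    where
    open HasRoot (root-extension F b (ℕₚ.<-≤-trans d<n n≤b) u)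
    open Extension embedding
    module E = Field field-extension
  decide (inj₂ irr) = record
    { field-extension = quotientField p irr ; embedding = quotient-embedding p irr ; root = mulX p (one p)
    ; isRoot = trans (evalι-quotient p irr (mon p)) (act-mon p (one p)) }

record Splitting (F : FiniteField) (f : Polynomial.Poly F) (n : ℕ) : Set₁ where
  field
    field-extension : FiniteField
    embedding : Embedding F field-extension
    roots : List (FiniteField.Carrier field-extension)
    length-roots : length roots ≡ n
    splits : Polynomial._≈ₚ_ field-extension (map (Embedding.ι embedding) f)
      (Polynomial.prodlin field-extension roots)

-- A root is adjoined, its linear factor is divided out over the new field, and the quotient is
-- split further; the roots found earlier are carried along the tower.
splitting : ∀ n F f → Polynomial.Monic F f n → Splitting F f n
splitting zero F f (top , lt) = record
  { field-extension = F ; embedding = id-embedding F ; roots = [] ; length-roots = refl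
  ; splits = λ { zero → trans (cong (λ g → coef g 0) (Listₚ.map-id f)) top ; (suc i) → trans
    (cong (λ g → coef g (suc i)) (Listₚ.map-id f)) (lt (suc i) (s≤s z≤n)) } }
  where open Polynomial F
splitting (suc n) F f mf = record
  { field-extension = L ; embedding = ∘-embedding g e ; roots = G.ι x ∷ rs ; length-roots = cong suc
    (Splitting.length-roots rec)
  ; splits = λ i → trans (cong (λ h → PL.coef h i) (Listₚ.map-∘ f))
    (trans (trans (G.coef-mapι (map E.ι f) i)
    (trans (cong G.ι (PK.factor (map E.ι f) x root-f i)) (sym (G.coef-mapι (PK.linmul x s) i))))
      (trans (cong (λ h → PL.coef h i) (G.mapι-linmul x s))
        (PL.linmul-cong (G.ι x) {map G.ι s} {PL.prodlin rs} (Splitting.splits rec) i))) }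
  where
  module PF = Polynomial F
  p = proj₁ (PF.Monic⇒mon f mf)
  f≈p = proj₂ (PF.Monic⇒mon f mf)
  K-root = root-extension F (suc n) ℕₚ.≤-refl p
  open HasRoot K-root renaming (field-extension to K; embedding to e; root to x)
  module E = Extension e
  module PK = Polynomial K
  root-f : E.evalι f x ≡ FiniteField.0# K
  root-f = trans (E.evalι-≈ f (PF.mon p) x f≈p) isRoot
  s = PK.quot (map E.ι f) x
  rec = splitting n K s (PK.Monic-quot (map E.ι f) x (E.Monic-mapι f mf))
  L = Splitting.field-extension rec
  g = Splitting.embedding rec
  rs = Splitting.roots rec
  module G = Extension g
  module PL = Polynomial L

module FixedFields {F E : FiniteField} (emb : Embedding F E) where
  open Extension emb
  open Frobenius emb
  open Field E
  open Polynomial E hiding (Poly)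

  mapι-trinomial : ∀ Q a c → map ι (trinomial F Q a c) ≡ trinomial E Q (ι a) (ι c)
  mapι-trinomial zero a c = cong (_∷ ι a ∷ []) (trans (ι-+ _ c) (cong (_+ ι c) ι-1))
  mapι-trinomial (suc zero) a c = cong₂ _∷_ (trans (ι-+ _ c) (cong (_+ ι c) ι-0))
    (cong (_∷ []) (trans (ι-+ _ a) (cong (_+ ι a) ι-1)))
  mapι-trinomial (suc (suc Q)) a c = cong₂ _∷_ (trans (ι-+ _ c) (cong (_+ ι c) ι-0))
    (cong₂ _∷_ (trans (ι-+ _ a) (cong (_+ ι a) ι-0)) (rest Q))
    where
    mapι-X^ : ∀ Q → map ι (PF.X^ Q) ≡ X^ Q
    mapι-X^ zero = cong (_∷ []) ι-1
    mapι-X^ (suc Q) = cong₂ _∷_ ι-0 (mapι-X^ Q)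
    rest : ∀ Q → map ι (PF.addP (PF.X^ Q) []) ≡ Polynomial.addP E (X^ Q) []
    rest zero = cong (_∷ []) ι-1
    rest (suc Q) = cong₂ _∷_ ι-0 (mapι-X^ Q)

  ι-· : ∀ n → ι (n F.· F.1#) ≡ n · 1#
  ι-· zero = ι-0
  ι-· (suc n) = trans (ι-+ F.1# _) (cong₂ _+_ ι-1 (ι-· n))

  order^·1 : ∀ {k} → 0 < k → (q ℕ.^ k) · 1# ≡ 0#
  order^·1 {suc k} _ = trans (×1-homo-* q (q ℕ.^ k))
    (trans (cong (_* ((q ℕ.^ k) · 1#)) (trans (sym (ι-· q)) (trans (cong ι (Fermat.order·1 F)) ι-0))) (zeroˡ _))

  X^Q-X : ℕ → PF.Poly
  X^Q-X k = trinomial F (q ℕ.^ k) (F.- F.1#) F.0#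

  mapι-X^Q-X : ∀ k → map ι (X^Q-X k) ≡ trinomial E (q ℕ.^ k) (- 1#) 0#
  mapι-X^Q-X k = trans (mapι-trinomial (q ℕ.^ k) (F.- F.1#) F.0#)
    (cong₂ (trinomial E (q ℕ.^ k)) (trans (ι-neg F.1#) (cong -_ ι-1)) ι-0)

  evalι-X^Q-X : ∀ k x → evalι (X^Q-X k) x ≡ x ^ (q ℕ.^ k) + - x
  evalι-X^Q-X k x = trans (cong (λ f → eval f x) (mapι-X^Q-X k)) (trans (eval-trinomial E (q ℕ.^ k) (- 1#) 0# x)
    (solve 2 (λ y x → y :+ (con (ℤ.-[1+ 0 ]) :* x :+ con (ℤ.+ 0)) := y :+ :- x) refl (x ^ (q ℕ.^ k)) x))

  fixed⇒root : ∀ k {x} → frob k x ≡ x → evalι (X^Q-X k) x ≡ 0#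
  fixed⇒root k {x} eq = trans (evalι-X^Q-X k x) (x≡y⇒x-y≡0 (trans (sym (frob-^ k x)) eq))

  root⇒fixed : ∀ k {x} → evalι (X^Q-X k) x ≡ 0# → frob k x ≡ x
  root⇒fixed k {x} eq = trans (frob-^ k x) (x-y≡0⇒x≡y (trans (sym (evalι-X^Q-X k x)) eq))

  deriv-trinomial : ∀ {k} → 0 < k → ∀ x → deriv (trinomial E (q ℕ.^ k) (- 1#) 0#) x ≡ - 1#
  deriv-trinomial {k} 0<k x = trans (deriv-addP (X^ (q ℕ.^ k)) (0# ∷ - 1# ∷ []) x)
    (trans (cong₂ _+_ (vanish (q ℕ.^ k) (order^·1 0<k))
      (solve 1 (λ x → (con (ℤ.-[1+ 0 ]) :+ x :* con (ℤ.+ 0)) :+ x :* (con (ℤ.+ 0) :+ x :* con (ℤ.+ 0)) := con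
        (ℤ.-[1+ 0 ])) refl x)) (+-identityˡ _))
    where
    vanish : ∀ Q → Q · 1# ≡ 0# → deriv (X^ Q) x ≡ 0#
    vanish zero _ = trans (+-identityˡ _) (zeroʳ x)
    vanish (suc Q) eq = trans (deriv-X^ Q x) (trans (cong (_* x ^ Q) eq) (zeroˡ _))

  -- The derivative of X^Q - X is the constant -1, since Q is zero in the field. Hence the Q roots
  -- in the factorization are distinct, and they are exactly the points fixed by `frob k`.
  split⇒length-fixed : ∀ {k} → 0 < k → ∀ rs → length rs ≡ q ℕ.^ k → Polynomial._≈ₚ_ E (map ι (X^Q-X k))
    (prodlin rs) → length (fixed k) ≡ q ℕ.^ k
  split⇒length-fixed {k} 0<k rs len eq = ℕₚ.≤-antisym (length-fixed 0<k) (ℕₚ.≤-trans (ℕₚ.≤-reflexive (sym len))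
    (length-injection (λ x → x) (separable⇒unique rs separable) (λ _ _ eq → eq) rs⊆fixed))
    where
    rs⊆fixed : ∀ {x} → x ∈ rs → x ∈ fixed k
    rs⊆fixed {x} x∈ = ∈-filter⁺ (λ x → frob k x ≟ x) (elements-complete x)
      (root⇒fixed k (trans (eval-≈ (map ι (X^Q-X k)) (prodlin rs) x eq) (eval-prodlin-root rs x∈)))
    separable : Separable (prodlin rs)
    separable x _ d≡0 = 0≢1 (trans (sym -0#≈0#)
      (trans (cong -_ (sym (trans (sym (trans (deriv-≈ (prodlin rs) (map ι (X^Q-X k)) x (λ i → sym (eq i)))
      (trans (cong (λ f → deriv f x) (mapι-X^Q-X k)) (deriv-trinomial 0<k x)))) d≡0))) (-‿involutive 1#)))

-- The elements of E fixed by `frob k` play the role of the field with q^k elements; E is merely a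
-- field large enough to contain them.
record FixedExtension (F : FiniteField) (k : ℕ) : Set₁ where
  field
    E : FiniteField
    embedding : Embedding F E
    length-fixed≡ : length (Frobenius.fixed embedding k) ≡ FiniteField.order F ℕ.^ k

fixed-extension : ∀ F {k} → 0 < k → FixedExtension F k
fixed-extension F {k} 0<k = record
  { E = field-extension ; embedding = embedding
  ; length-fixed≡ = FixedFields.split⇒length-fixed embedding 0<k roots length-roots splits }
  where
  q = FiniteField.order F
  open Field F
  open Splitting (splitting (q ℕ.^ k) F (trinomial F (q ℕ.^ k) (- 1#) 0#)
    (trinomial-Monic F (Frobenius.2≤q^ (id-embedding F) 0<k) (- 1#) 0#))

-- Roots of irreducible polynomials in an extension

module IrreducibleRoots {F E : FiniteField} (emb : Embedding F E) where
  open Extension emb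
  open Frobenius emb
  open FixedFields emb
  open Field E
  open Polynomial E hiding (Poly)
  open Linear F using (Irr; faithful; act)
  open Irreducibility F

  -- The field F[X]/(c) has q^(n+1) elements, so by Fermat's theorem the class of X is a zero of X^Q
  -- - X with Q = q^(n+1).
  irr-divides : ∀ {n} (c : Vec F.Carrier (suc n)) → Irr c → Σ PF.Poly λ s → X^Q-X (suc n) PF.≈ₚ PF.mulP s (PF.mon c)
  irr-divides {n} c irr = divisible c (X^Q-X (suc n))
    (trans (sym (evalι-quotient c irr (X^Q-X (suc n)))) (K.fixed⇒root (suc n)
      (trans (KF.frob-^ (suc n) x) (trans (cong (x KK.^_) (sym (length-vectors F.elements (suc n))))
        (Fermat.fermat K x)))))
    where
    K = Companion.quotientField F c irr
    module K = FixedFields (quotient-embedding c irr)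
    module KF = Frobenius (quotient-embedding c irr)
    module KK = Field K
    x = Companion.mulX F c (Companion.one F c)

  irr-root⇒fixed : ∀ {n} (c : Vec F.Carrier (suc n)) → Irr c → ∀ {x} → evalι (PF.mon c) x ≡ 0# → frob (suc n) x ≡ x
  irr-root⇒fixed {n} c irr {x} root = root⇒fixed (suc n)
    (trans (evalι-≈ (X^Q-X (suc n)) (PF.mulP s (PF.mon c)) x eq)
    (trans (evalι-mulP s (PF.mon c) x) (trans (cong (evalι s x *_) root) (zeroʳ _))))
    where
    s = proj₁ (irr-divides c irr)
    eq = proj₂ (irr-divides c irr)

  irr-minimal : ∀ {n} (c : Vec F.Carrier n) → Irr c → ∀ {x} → evalι (PF.mon c) x ≡ 0# → ∀ f → PF.DegLt f n → ¬
    (f PF.≈ₚ []) → evalι f x ≢ 0#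
  irr-minimal c irr {x} root f lt f≉0 eq = 0≢1
    (sym (faithful extSpace (x *_) (*-linear x) c irr 1# (trans (sym (evalι-act x (PF.mon c))) root) f lt f≉0
    (trans (sym (evalι-act x f)) eq)))

  -- A period k below the degree of c would make x a root of a nonzero polynomial of degree at most
  -- k, but c is minimal at x.
  irr-root⇒Ord : ∀ {n} (c : Vec F.Carrier (suc n)) → Irr c → ∀ {x} → evalι (PF.mon c) x ≡ 0# → Ord x (suc n)
  irr-root⇒Ord {n} c irr {x} root = irr-root⇒fixed c irr root , λ k 0<k k<n eq →
    let f , lt , f≉0 , f-root = annihilator 0<k eq in irr-minimal c irr root f (PF.DegLt-mono {f} k<n lt) f≉0 f-root

  -- Write X^Q - X = s c. All Q fixed points are roots of s or of c, and s has at most Q - (n + 1)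
  -- of them, which leaves n + 1 for c.
  irr-count-roots : ∀ {n} (c : Vec F.Carrier (suc n)) → Irr c → length (fixed (suc n)) ≡ q ℕ.^ suc n →
    count (λ x → evalι (PF.mon c) x ≟ 0#) elements ≡ suc n
  irr-count-roots {n} c irr len = ℕₚ.≤-antisym
      (count-roots (map ι (PF.mon c)) (suc n) (Monic-mapι (PF.mon c) (PF.mon-Monic c))
        (λ x → evalι (PF.mon c) x ≟ 0#) (λ eq → eq))
      (bound (PF.degree s))
    where
    s = proj₁ (irr-divides c irr)
    eq = proj₂ (irr-divides c irr)
    isRoot? : ∀ x → Dec (evalι (PF.mon c) x ≡ 0#)
    isRoot? x = evalι (PF.mon c) x ≟ 0#
    Q = q ℕ.^ suc n
    X^Q-X-Monic : PF.Monic (X^Q-X (suc n)) Q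
    X^Q-X-Monic = trinomial-Monic F (2≤q^ {suc n} (s≤s z≤n)) (F.- F.1#) F.0#
    other-root : ∀ {x} → frob (suc n) x ≡ x → evalι (PF.mon c) x ≢ 0# → evalι s x ≡ 0#
    other-root {x} fix not-root = xy≡0⇒y≡0 not-root
      (trans (*-comm _ _) (trans (sym (evalι-mulP s (PF.mon c) x))
      (trans (sym (evalι-≈ (X^Q-X (suc n)) (PF.mulP s (PF.mon c)) x eq)) (fixed⇒root (suc n) fix))))
    in-fixed : ∀ {x} → x ∈ fixed (suc n) → frob (suc n) x ≡ x
    in-fixed x∈ = proj₂ (∈-filter⁻ (λ x → frob (suc n) x ≟ x) {xs = elements} x∈)
    fixed-unique : Unique (fixed (suc n))
    fixed-unique = Uniqueₚ.filter⁺ (λ x → frob (suc n) x ≟ x) elements-unique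
    fewer : count isRoot? (fixed (suc n)) ≤ count isRoot? elements
    fewer = length-injection (λ x → x) (Uniqueₚ.filter⁺ isRoot? fixed-unique) (λ _ _ eq → eq)
      (λ x∈ → ∈-filter⁺ isRoot? (elements-complete _) (proj₂ (∈-filter⁻ isRoot? {xs = fixed (suc n)} x∈)))
    bound : s PF.≈ₚ [] ⊎ (∃[ e ] PF.ExactDeg s e) → suc n ≤ count isRoot? elements
    bound (inj₁ s≈0) = ⊥-elim (PF.Monic≉0 {X^Q-X (suc n)} X^Q-X-Monic
      (λ i → trans (eq i) (PF.mulP-0ˡ s (PF.mon c) s≈0 i)))
    bound (inj₂ (e , ex)) = ℕₚ.+-cancelˡ-≤ e (suc n) _
      (ℕₚ.≤-trans e+n≤Q (ℕₚ.≤-trans (ℕₚ.≤-reflexive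
      (trans (sym len) (trans (sym (count-¬ isRoot? (fixed (suc n)))) (ℕₚ.+-comm (count isRoot? (fixed (suc n))) _))))
        (ℕₚ.+-mono-≤ others fewer)))
      where
      e+n≤Q : e ℕ.+ suc n ≤ Q
      e+n≤Q = ℕₚ.≮⇒≥ (λ lt → PF.mulP-ExactDeg {s} {PF.mon c} ex (PF.Monic⇒ExactDeg {PF.mon c} (PF.mon-Monic c))
        (trans (sym (eq (e ℕ.+ suc n))) (proj₂ X^Q-X-Monic (e ℕ.+ suc n) lt)))
      others : count (λ x → ¬? (isRoot? x)) (fixed (suc n)) ≤ e
      others = roots-≤ (map ι s) e (filter (λ x → ¬? (isRoot? x)) (fixed (suc n)))
        (λ s≈0 → proj₁ ex (ι≡0⇒≡0 (trans (sym (coef-mapι s e)) (s≈0 e)))) (DegLt-mapι s (proj₂ ex))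
        (Uniqueₚ.filter⁺ (λ x → ¬? (isRoot? x)) fixed-unique)
        (All.tabulate (λ x∈ → let x∈fixed , not-root = ∈-filter⁻ (λ x → ¬? (isRoot? x)) {xs = fixed (suc n)} x∈ in other-root (in-fixed x∈fixed) not-root))

  -- In a factorization of h one factor vanishes at x and therefore has degree at least n, so the
  -- other one is a constant.
  minimal⇒irreducible : ∀ {n} h {x} → 0 < n → PF.Monic h n → evalι h x ≡ 0# →
    (∀ f → PF.DegLt f n → evalι f x ≡ 0# → f PF.≈ₚ []) → Defs.IrreducibleP F h
  minimal⇒irreducible {n} h {x} 0<n mh root minimal = PF.Monic≉0 {h} mh , not-unit , factors
    where
    not-unit : ¬ Defs.IsUnitP F h
    not-unit unit = ℕₚ.<⇒≢ 0<n (sym (unit⇒ExactDeg0 {h} unit (PF.Monic⇒ExactDeg {h} mh)))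
    factors : ∀ f g → h PF.≈ₚ PF.mulP f g → Defs.IsUnitP F f ⊎ Defs.IsUnitP F g
    factors f g eq = cases (PF.degree f) (PF.degree g)
      (xy≡0 (trans (sym (evalι-mulP f g x)) (trans (sym (evalι-≈ h (PF.mulP f g) x eq)) root)))
      where
      top≤ : ∀ {d e} → PF.ExactDeg f d → PF.ExactDeg g e → d ℕ.+ e ≤ n
      top≤ {d} {e} exf exg = ℕₚ.≮⇒≥ (λ lt → PF.mulP-ExactDeg {f} {g} exf exg
        (trans (sym (eq (d ℕ.+ e))) (proj₂ mh (d ℕ.+ e) lt)))
      n≤deg : ∀ f {d} → PF.ExactDeg f d → evalι f x ≡ 0# → n ≤ d
      n≤deg f {d} exf fx≡0 = ℕₚ.≮⇒≥ (λ lt → proj₁ exf (minimal f (PF.DegLt-mono {f} lt (proj₂ exf)) fx≡0 d))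
      cases : f PF.≈ₚ [] ⊎ (∃[ d ] PF.ExactDeg f d) → g PF.≈ₚ [] ⊎ (∃[ e ] PF.ExactDeg g e) → evalι f x ≡ 0# ⊎
        evalι g x ≡ 0# → Defs.IsUnitP F f ⊎ Defs.IsUnitP F g
      cases (inj₁ f≈0) _ _ = ⊥-elim (PF.Monic≉0 {h} mh (λ i → trans (eq i) (PF.mulP-0ˡ f g f≈0 i)))
      cases (inj₂ _) (inj₁ g≈0) _ = ⊥-elim (PF.Monic≉0 {h} mh (λ i → trans (eq i) (mulP-0ʳ f g g≈0 i)))
      cases (inj₂ (d , exf)) (inj₂ (e , exg)) (inj₁ fx≡0) = inj₂ (ExactDeg0⇒unit g (subst (PF.ExactDeg g)
        (ℕₚ.n≤0⇒n≡0 (ℕₚ.+-cancelˡ-≤ d e 0 (ℕₚ.≤-trans (top≤ exf exg)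
          (ℕₚ.≤-trans (n≤deg f exf fx≡0) (ℕₚ.≤-reflexive (sym (ℕₚ.+-identityʳ d))))))) exg))
      cases (inj₂ (d , exf)) (inj₂ (e , exg)) (inj₂ gx≡0) = inj₁ (ExactDeg0⇒unit f (subst (PF.ExactDeg f)
        (ℕₚ.n≤0⇒n≡0 (ℕₚ.+-cancelʳ-≤ e d 0 (ℕₚ.≤-trans (top≤ exf exg) (n≤deg g exg gx≡0)))) exf))

-- Integer sums and the Möbius function

⌊⌋-true : {P : Set} (P? : Dec P) → P → ⌊ P? ⌋ ≡ true
⌊⌋-true (yes _) p = refl
⌊⌋-true (no ¬p) p = ⊥-elim (¬p p)

⌊⌋-false : {P : Set} (P? : Dec P) → ¬ P → ⌊ P? ⌋ ≡ false
⌊⌋-false (yes p) ¬p = ⊥-elim (¬p p)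
⌊⌋-false (no _) ¬p = refl

module _ {A : Set} where

  ∑ℤ : (A → ℤ) → List A → ℤ
  ∑ℤ f xs = foldr ℤ._+_ ℤ.0ℤ (map f xs)

  ∑ℤ-cong : ∀ {f g : A → ℤ} xs → (∀ {x} → x ∈ xs → f x ≡ g x) → ∑ℤ f xs ≡ ∑ℤ g xs
  ∑ℤ-cong [] eq = refl
  ∑ℤ-cong (x ∷ xs) eq = cong₂ ℤ._+_ (eq (here refl)) (∑ℤ-cong xs (λ p → eq (there p)))

  ∑ℤ-0 : ∀ (xs : List A) → ∑ℤ (λ _ → ℤ.0ℤ) xs ≡ ℤ.0ℤ
  ∑ℤ-0 [] = refl
  ∑ℤ-0 (x ∷ xs) = trans (ℤₚ.+-identityˡ _) (∑ℤ-0 xs)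

  ∑ℤ-+ : ∀ (f g : A → ℤ) xs → ∑ℤ (λ x → f x ℤ.+ g x) xs ≡ ∑ℤ f xs ℤ.+ ∑ℤ g xs
  ∑ℤ-+ f g [] = refl
  ∑ℤ-+ f g (x ∷ xs) = trans (cong (λ z → (f x ℤ.+ g x) ℤ.+ z) (∑ℤ-+ f g xs))
    (ℤ-interchange (f x) (g x) (∑ℤ f xs) (∑ℤ g xs))
    where
    ℤ-interchange : ∀ a b c d → (a ℤ.+ b) ℤ.+ (c ℤ.+ d) ≡ (a ℤ.+ c) ℤ.+ (b ℤ.+ d)
    ℤ-interchange a b c d = trans (ℤₚ.+-assoc a b (c ℤ.+ d)) (trans (cong (λ z → a ℤ.+ z)
      (trans (sym (ℤₚ.+-assoc b c d)) (trans (cong (λ z → z ℤ.+ d) (ℤₚ.+-comm b c)) (ℤₚ.+-assoc c b d))))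
        (sym (ℤₚ.+-assoc a c (b ℤ.+ d))))

  ∑ℤ-*ˡ : ∀ c (f : A → ℤ) xs → ∑ℤ (λ x → c ℤ.* f x) xs ≡ c ℤ.* ∑ℤ f xs
  ∑ℤ-*ˡ c f [] = sym (ℤₚ.*-zeroʳ c)
  ∑ℤ-*ˡ c f (x ∷ xs) = trans (cong (λ z → c ℤ.* f x ℤ.+ z) (∑ℤ-*ˡ c f xs)) (sym (ℤₚ.*-distribˡ-+ c (f x) (∑ℤ f xs)))

  ∑ℤ-neg : ∀ (f : A → ℤ) xs → ∑ℤ (λ x → ℤ.- f x) xs ≡ ℤ.- ∑ℤ f xs
  ∑ℤ-neg f [] = refl
  ∑ℤ-neg f (x ∷ xs) = trans (cong (λ z → ℤ.- f x ℤ.+ z) (∑ℤ-neg f xs)) (sym (ℤₚ.neg-distrib-+ (f x) (∑ℤ f xs)))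

  ∑ℤ-filter : ∀ {P : A → Set} (P? : Decidable P) (f : A → ℤ) xs → ∑ℤ f (filter P? xs) ≡ ∑ℤ
    (λ x → if ⌊ P? x ⌋ then f x else ℤ.0ℤ) xs
  ∑ℤ-filter P? f [] = refl
  ∑ℤ-filter P? f (x ∷ xs) with P? x
  ... | yes _ = cong (λ z → f x ℤ.+ z) (∑ℤ-filter P? f xs)
  ... | no _ = trans (∑ℤ-filter P? f xs) (sym (ℤₚ.+-identityˡ _))

  ∑ℤ-drop : ∀ {P : A → Set} (P? : Decidable P) (f : A → ℤ) xs → (∀ {x} → x ∈ xs → ¬ P x → f x ≡ ℤ.0ℤ) → ∑ℤ f
    (filter P? xs) ≡ ∑ℤ f xs
  ∑ℤ-drop P? f [] z = refl
  ∑ℤ-drop P? f (x ∷ xs) z with P? x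
  ... | yes _ = cong (λ w → f x ℤ.+ w) (∑ℤ-drop P? f xs (λ p → z (there p)))
  ... | no ¬p = trans (∑ℤ-drop P? f xs (λ p → z (there p)))
    (trans (sym (ℤₚ.+-identityˡ _)) (cong (λ w → w ℤ.+ ∑ℤ f xs) (sym (z (here refl) ¬p))))

  count-∑ℤ : ∀ {P : A → Set} (P? : Decidable P) xs → ℤ.+ count P? xs ≡ ∑ℤ (λ x → if ⌊ P? x ⌋ then ℤ.1ℤ else ℤ.0ℤ) xs
  count-∑ℤ P? [] = refl
  count-∑ℤ P? (x ∷ xs) with P? x
  ... | yes _ = cong (λ z → ℤ.1ℤ ℤ.+ z) (count-∑ℤ P? xs)
  ... | no _ = trans (count-∑ℤ P? xs) (sym (ℤₚ.+-identityˡ _))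

  -- Reindexing by τ shows that the sum equals its own negative. Fixed points of τ do no harm, for
  -- there f is its own negative as well.
  ∑ℤ-involution : ∀ (f : A → ℤ) (τ : A → A) {xs} → Unique xs →
    (∀ {x} → x ∈ xs → τ x ∈ xs × τ (τ x) ≡ x × f (τ x) ≡ ℤ.- f x) → ∑ℤ f xs ≡ ℤ.0ℤ
  ∑ℤ-involution f τ {xs} u inv = self-negative (∑ℤ f xs) (begin
    ∑ℤ f xs                       ≡⟨ foldr-↭ ℤ._+_ ℤₚ.+-assoc ℤₚ.+-comm ℤ.0ℤ
      (map-↭ f (unique-↭ u τxs-unique to from)) ⟩
    ∑ℤ f (map τ xs)               ≡⟨ cong (foldr ℤ._+_ ℤ.0ℤ) (sym (Listₚ.map-∘ xs)) ⟩
    ∑ℤ (λ x → f (τ x)) xs         ≡⟨ ∑ℤ-cong xs (λ x∈ → proj₂ (proj₂ (inv x∈))) ⟩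
    ∑ℤ (λ x → ℤ.- f x) xs         ≡⟨ ∑ℤ-neg f xs ⟩
    ℤ.- ∑ℤ f xs                   ∎)
    where
    self-negative : ∀ i → i ≡ ℤ.- i → i ≡ ℤ.0ℤ
    self-negative (ℤ.+ zero) _ = refl
    self-negative (ℤ.+ suc n) ()
    self-negative -[1+ n ] ()
    map-unique : ∀ {ys} → Unique ys → (∀ {x} → x ∈ ys → x ∈ xs) → Unique (map τ ys)
    map-unique [] _ = []
    map-unique {y ∷ ys} (y∉ ∷ u) sub = All.tabulate (λ z∈ eq → let z , z∈ys , e = ∈-map⁻ τ z∈ in
        All.lookup y∉ z∈ys (trans (sym (proj₁ (proj₂ (inv (sub (here refl))))))
          (trans (cong τ (trans eq e)) (proj₁ (proj₂ (inv (sub (there z∈ys))))))))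
      ∷ map-unique u (λ p → sub (there p))
    τxs-unique = map-unique u (λ p → p)
    to : ∀ {x} → x ∈ xs → x ∈ map τ xs
    to {x} x∈ = subst (_∈ map τ xs) (proj₁ (proj₂ (inv x∈))) (∈-map⁺ τ (proj₁ (inv x∈)))
    from : ∀ {x} → x ∈ map τ xs → x ∈ xs
    from x∈ = let y , y∈ , eq = ∈-map⁻ τ x∈ in subst (_∈ xs) (sym eq) (proj₁ (inv y∈))

∑ℤ-swap : {A B : Set} (h : A → B → ℤ) → ∀ xs ys → ∑ℤ (λ x → ∑ℤ (h x) ys) xs ≡ ∑ℤ (λ y → ∑ℤ (λ x → h x y) xs) ys
∑ℤ-swap h [] ys = sym (∑ℤ-0 ys)
∑ℤ-swap h (x ∷ xs) ys = trans (cong (λ z → ∑ℤ (h x) ys ℤ.+ z) (∑ℤ-swap h xs ys))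
  (sym (∑ℤ-+ (h x) (λ y → ∑ℤ (λ x → h x y) xs) ys))

squareDivides primeDivides : ℕ → ℕ → Bool
squareDivides n d = if 2 ℕ.≤ᵇ d then ⌊ (d ℕ.* d) ∣? n ⌋ else false
primeDivides n p = if ⌊ prime? p ⌋ then ⌊ p ∣? n ⌋ else false

-- The private auxiliary functions of the definitions of μ and mobiusSum, recovered by unification.
mutual
  anyTail : ℕ → Bool
  anyTail = _

  countTail : ℕ → ℕ
  countTail = _

  anyBelow : (ℕ → Bool) → ℕ → Bool
  anyBelow = _

  countBelow : (ℕ → Bool) → ℕ → ℕ
  countBelow = _

  μ-tail : ∀ n → μ (suc n) ≡ (if (if squareDivides (suc n) (suc n) then true else anyTail n) then ℤ.+ 0
     else ℤ.-1ℤ ℤ.^ (if primeDivides (suc n) (suc n) then suc (countTail n) else countTail n))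
  μ-tail n = refl

  anyTail-eq : ∀ n → anyTail n ≡ anyBelow (squareDivides (suc n)) n
  anyTail-eq n with squareDivides (suc n)
  ... | p = refl

  countTail-eq : ∀ n → countTail n ≡ countBelow (primeDivides (suc n)) n
  countTail-eq n with primeDivides (suc n)
  ... | p = refl

  mobiusTail : ℕ → ℕ → ℕ → ℤ
  mobiusTail = _

  mobiusPartial : ℕ → ℕ → ℕ → ℕ → ℤ
  mobiusPartial = _

  mobiusSum-suc : ∀ q m l → mobiusSum q m (suc l) ≡
    (if ⌊ suc l ∣? suc l ⌋ then μ (suc l) ℤ.* (ℤ.+ (q ℕ.^ (m ℕ./ suc l))) ℤ.+ mobiusTail q m l else mobiusTail q m l)
  mobiusSum-suc q m l = refl

  mobiusTail-eq : ∀ q m l → mobiusTail q m l ≡ mobiusPartial q m (suc l) l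
  mobiusTail-eq q m l with suc l
  ... | l′ = refl

positives : ℕ → List ℕ
positives n = map suc (downFrom n)

∈-positives⁺ : ∀ {n d} → 0 < d → d ≤ n → d ∈ positives n
∈-positives⁺ {d = suc d} _ d≤n = ∈-map⁺ suc (∈-downFrom⁺ d≤n)

∈-positives⁻ : ∀ {n d} → d ∈ positives n → 0 < d × d ≤ n
∈-positives⁻ d∈ = let i , i∈ , eq = ∈-map⁻ suc d∈ in subst (0 <_) (sym eq) (s≤s z≤n) , subst (_≤ _) (sym eq) (∈-downFrom⁻ i∈)

positives-unique : ∀ n → Unique (positives n)
positives-unique n = Uniqueₚ.map⁺ ℕₚ.suc-injective (Uniqueₚ.downFrom⁺ n)

mobiusTerm : ℕ → ℕ → ℕ → ℕ → ℤ
mobiusTerm q m l zero = ℤ.0ℤ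
mobiusTerm q m l (suc d) = if ⌊ suc d ∣? l ⌋ then μ (suc d) ℤ.* (ℤ.+ (q ℕ.^ (m ℕ./ suc d))) else ℤ.0ℤ

mobiusPartial-∑ℤ : ∀ q m l d → mobiusPartial q m l d ≡ ∑ℤ (mobiusTerm q m l) (positives d)
mobiusPartial-∑ℤ q m l zero = refl
mobiusPartial-∑ℤ q m l (suc d) = trans (step ⌊ suc d ∣? l ⌋)
  (cong (λ z → mobiusTerm q m l (suc d) ℤ.+ z) (mobiusPartial-∑ℤ q m l d))
  where
  x = μ (suc d) ℤ.* (ℤ.+ (q ℕ.^ (m ℕ./ suc d)))
  y = mobiusPartial q m l d
  step : ∀ b → (if b then x ℤ.+ y else y) ≡ (if b then x else ℤ.0ℤ) ℤ.+ y
  step true = refl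
  step false = sym (ℤₚ.+-identityˡ y)

mobiusSum-∑ℤ : ∀ q m l → mobiusSum q m l ≡ ∑ℤ (mobiusTerm q m l) (positives l)
mobiusSum-∑ℤ q m zero = refl
mobiusSum-∑ℤ q m (suc l) = trans (mobiusSum-suc q m l)
  (trans (cong (λ z → if ⌊ suc l ∣? suc l ⌋ then x ℤ.+ z else z) (mobiusTail-eq q m l))
    (mobiusPartial-∑ℤ q m (suc l) (suc l)))
  where x = μ (suc l) ℤ.* (ℤ.+ (q ℕ.^ (m ℕ./ suc l)))

SquareFree : ℕ → Set
SquareFree n = ∀ k → 2 ≤ k → ¬ (k ℕ.* k ∣ n)

ω : ℕ → ℕ
ω n = countBelow (primeDivides n) n

μ-eq : ∀ n → μ (suc n) ≡ (if anyBelow (squareDivides (suc n)) (suc n) then ℤ.+ 0 else ℤ.-1ℤ ℤ.^ ω (suc n))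
μ-eq n = trans (μ-tail n) (cong₂ (λ a c → if (if squareDivides (suc n) (suc n) then true else a) then ℤ.+ 0
  else ℤ.-1ℤ ℤ.^ (if primeDivides (suc n) (suc n) then suc c else c)) (anyTail-eq n) (countTail-eq n))

anyBelow-true : ∀ p n → anyBelow p n ≡ true → ∃[ d ] p d ≡ true
anyBelow-true p zero ()
anyBelow-true p (suc n) eq with p (suc n) in pn
... | true = suc n , pn
... | false = anyBelow-true p n eq

anyBelow-false : ∀ p n → anyBelow p n ≡ false → ∀ d → 0 < d → d ≤ n → p d ≡ false
anyBelow-false p zero eq (suc d) _ ()
anyBelow-false p (suc n) eq d 0<d d≤n with p (suc n) in pn | d ℕ.≟ suc n
... | false | yes refl = pn
... | false | no d≢ = anyBelow-false p n eq d 0<d (ℕ.s≤s⁻¹ (ℕₚ.≤∧≢⇒< d≤n d≢))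

squareDivides-true : ∀ n d → squareDivides n d ≡ true → 2 ≤ d × d ℕ.* d ∣ n
squareDivides-true n d eq with 2 ℕ.≤ᵇ d in le | d ℕ.* d ∣? n
... | true | yes p = ℕₚ.≤ᵇ⇒≤ 2 d (subst Data.Bool.T (sym le) _) , p

squareDivides-false : ∀ n d → squareDivides n d ≡ false → 2 ≤ d → ¬ (d ℕ.* d ∣ n)
squareDivides-false n d eq 2≤d with 2 ℕ.≤ᵇ d in le | d ℕ.* d ∣? n
... | true | no ¬p = ¬p
... | false | _ = ⊥-elim (subst Data.Bool.T le (ℕₚ.≤⇒≤ᵇ 2≤d))

squareFree? : ∀ n → Dec (SquareFree (suc n))
squareFree? n with anyBelow (squareDivides (suc n)) (suc n) in eq
... | true = no (λ sf → let d , p = anyBelow-true (squareDivides (suc n)) (suc n) eq ; 2≤d , d²∣n = squareDivides-true (suc n) d p in sf d 2≤d d²∣n)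
... | false = yes (λ k 2≤k k²∣n → squareDivides-false (suc n) k
  (anyBelow-false (squareDivides (suc n)) (suc n) eq k (ℕₚ.≤-trans (s≤s z≤n) 2≤k)
    (ℕₚ.≤-trans (ℕₚ.m≤m*n k k {{ℕ.>-nonZero (ℕₚ.≤-trans (s≤s z≤n) 2≤k)}}) (∣⇒≤ k²∣n))) 2≤k k²∣n)

μ-squareFree : ∀ {n} → 0 < n → SquareFree n → μ n ≡ ℤ.-1ℤ ℤ.^ ω n
μ-squareFree {suc n} _ sf = trans (μ-eq n) (cong (λ b → if b then ℤ.+ 0 else ℤ.-1ℤ ℤ.^ ω (suc n)) none)
  where
  none : anyBelow (squareDivides (suc n)) (suc n) ≡ false
  none with anyBelow (squareDivides (suc n)) (suc n) in eq
  ... | false = refl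
  ... | true = let d , p = anyBelow-true (squareDivides (suc n)) (suc n) eq ; 2≤d , d²∣n = squareDivides-true (suc n) d p in ⊥-elim (sf d 2≤d d²∣n)

μ-notSquareFree : ∀ {n} → 0 < n → ¬ SquareFree n → μ n ≡ ℤ.0ℤ
μ-notSquareFree {suc n} _ ¬sf = trans (μ-eq n) (cong (λ b → if b then ℤ.+ 0 else ℤ.-1ℤ ℤ.^ ω (suc n)) some)
  where
  some : anyBelow (squareDivides (suc n)) (suc n) ≡ true
  some with anyBelow (squareDivides (suc n)) (suc n) in eq
  ... | true = refl
  ... | false = ⊥-elim (¬sf (λ k 2≤k k²∣n → squareDivides-false (suc n) k
    (anyBelow-false (squareDivides (suc n)) (suc n) eq k (ℕₚ.≤-trans (s≤s z≤n) 2≤k)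
    (ℕₚ.≤-trans (ℕₚ.m≤m*n k k {{ℕ.>-nonZero (ℕₚ.≤-trans (s≤s z≤n) 2≤k)}}) (∣⇒≤ k²∣n))) 2≤k k²∣n))

countBelow-cong : ∀ p p′ n → (∀ r → r ≤ n → p r ≡ p′ r) → countBelow p n ≡ countBelow p′ n
countBelow-cong p p′ zero eq = refl
countBelow-cong p p′ (suc n) eq = cong₂ (λ b c → if b then suc c else c) (eq (suc n) ℕₚ.≤-refl)
  (countBelow-cong p p′ n (λ r r≤n → eq r (ℕₚ.≤-trans r≤n (ℕₚ.n≤1+n n))))

countBelow-extend : ∀ p n k → (∀ r → n < r → p r ≡ false) → countBelow p (k ℕ.+ n) ≡ countBelow p n
countBelow-extend p n zero none = refl
countBelow-extend p n (suc k) none = trans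
  (cong (λ b → if b then suc (countBelow p (k ℕ.+ n)) else countBelow p (k ℕ.+ n))
  (none (suc (k ℕ.+ n)) (s≤s (ℕₚ.m≤n+m n k)))) (countBelow-extend p n k none)

countBelow-insert : ∀ p p′ a n → 0 < a → a ≤ n → (∀ r → r ≢ a → p r ≡ p′ r) → p a ≡ true → p′ a ≡ false →
  countBelow p n ≡ suc (countBelow p′ n)
countBelow-insert p p′ (suc a) zero _ () eq pa p′a
countBelow-insert p p′ a (suc n) 0<a a≤n eq pa p′a with a ℕ.≟ suc n
... | yes refl = trans (cong (λ b → if b then suc (countBelow p n) else countBelow p n) pa) (cong suc
    (trans (countBelow-cong p p′ n (λ r r≤n → eq r (λ { refl → ℕₚ.1+n≰n r≤n })))
      (sym (cong (λ b → if b then suc (countBelow p′ n) else countBelow p′ n) p′a))))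
... | no a≢ = trans (cong₂ (λ b c → if b then suc c else c) (eq (suc n) (λ e → a≢ (sym e)))
  (countBelow-insert p p′ a n 0<a (ℕ.s≤s⁻¹ (ℕₚ.≤∧≢⇒< a≤n a≢)) eq pa p′a)) (step (p′ (suc n)))
  where
  step : ∀ b → (if b then suc (suc (countBelow p′ n)) else suc (countBelow p′ n)) ≡ suc
    (if b then suc (countBelow p′ n) else countBelow p′ n)
  step true = refl
  step false = refl

prime>1 : ∀ {p} → Prime p → 2 ≤ p
prime>1 {p} pr = ℕ.nonTrivial⇒n>1 p {{prime⇒nonTrivial pr}}

module _ {p d} (pr : Prime p) (0<d : 0 < d) (p∤d : ¬ (p ∣ d)) where
  private
    0<p : 0 < p
    0<p = ℕₚ.≤-trans (s≤s z≤n) (prime>1 pr)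
    0<pd : 0 < p ℕ.* d
    0<pd = ℕₚ.*-mono-≤ 0<p 0<d

  -- Let k² divide p d. If p divides k, then p² divides p d and p divides d. Otherwise p divides the
  -- cofactor and can be cancelled, so k² divides d.
  squareFree-* : SquareFree d → SquareFree (p ℕ.* d)
  squareFree-* sf k 2≤k (divides c eq) = cases (p ∣? k)
    where
    cases : Dec (p ∣ k) → ⊥
    cases (yes p∣k) = p∤d (*-cancelˡ-∣ p {{prime⇒nonZero pr}} (∣-trans (*-pres-∣ p∣k p∣k) (divides c eq)))
    cases (no p∤k) with euclidsLemma c (k ℕ.* k) pr (subst (p ∣_) eq (m∣m*n d))
    ... | inj₂ p∣k² with euclidsLemma k k pr p∣k²
    ...   | inj₁ p∣k = p∤k p∣k
    ...   | inj₂ p∣k = p∤k p∣k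
    cases (no p∤k) | inj₁ (divides c′ refl) = sf k 2≤k
      (divides c′ (ℕₚ.*-cancelˡ-≡ d (c′ ℕ.* (k ℕ.* k)) p {{prime⇒nonZero pr}}
      (trans eq (trans (cong (ℕ._* (k ℕ.* k)) (ℕₚ.*-comm c′ p)) (ℕₚ.*-assoc p c′ (k ℕ.* k))))))

  ω-* : ω (p ℕ.* d) ≡ suc (ω d)
  ω-* = trans (countBelow-insert (primeDivides (p ℕ.* d)) (primeDivides d) p (p ℕ.* d) 0<p
    (∣⇒≤ {{ℕ.>-nonZero 0<pd}} (m∣m*n d)) agree at-p not-at-p)
    -- The number of prime divisors is counted up to the argument itself. No number above d divides
    -- d, so for d the bound may be raised from d to p d.
    (cong suc (trans (cong (countBelow (primeDivides d)) (sym (ℕₚ.m∸n+n≡m (ℕₚ.m≤n*m d p {{prime⇒nonZero pr}}))))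
      (countBelow-extend (primeDivides d) d (p ℕ.* d ℕ.∸ d) large)))
    where
    at-p : primeDivides (p ℕ.* d) p ≡ true
    at-p = trans (cong (λ b → if b then ⌊ p ∣? p ℕ.* d ⌋ else false) (⌊⌋-true (prime? p) pr))
      (⌊⌋-true (p ∣? p ℕ.* d) (m∣m*n d))
    not-at-p : primeDivides d p ≡ false
    not-at-p = trans (cong (λ b → if b then ⌊ p ∣? d ⌋ else false) (⌊⌋-true (prime? p) pr)) (⌊⌋-false (p ∣? d) p∤d)
    large : ∀ r → d < r → primeDivides d r ≡ false
    large r d<r with ⌊ prime? r ⌋
    ... | false = refl
    ... | true = ⌊⌋-false (r ∣? d) (λ r∣d → ℕₚ.<⇒≱ d<r (∣⇒≤ {{ℕ.>-nonZero 0<d}} r∣d))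
    agree : ∀ r → r ≢ p → primeDivides (p ℕ.* d) r ≡ primeDivides d r
    agree r r≢p with prime? r
    ... | no _ = refl
    ... | yes r-prime with r ∣? d
    ...   | yes r∣d = ⌊⌋-true (r ∣? p ℕ.* d) (∣n⇒∣m*n p r∣d)
    ...   | no r∤d = ⌊⌋-false (r ∣? p ℕ.* d) (λ r∣pd → contra (euclidsLemma p d r-prime r∣pd))
      where
      contra : r ∣ p ⊎ r ∣ d → ⊥
      contra (inj₂ r∣d) = r∤d r∣d
      contra (inj₁ r∣p) with prime⇒irreducible pr r∣p
      ... | inj₁ r≡1 = ℕₚ.<⇒≢ (prime>1 r-prime) (sym r≡1)
      ... | inj₂ r≡p = r≢p r≡p

  μ-* : SquareFree d → μ (p ℕ.* d) ≡ ℤ.- μ d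
  μ-* sf = trans (μ-squareFree 0<pd (squareFree-* sf))
    (trans (cong (ℤ._^_ ℤ.-1ℤ) ω-*) (trans (ℤₚ.-1*i≡-i _) (cong ℤ.-_ (sym (μ-squareFree 0<d sf)))))

squareFree-∣ : ∀ {d e} → d ∣ e → SquareFree e → SquareFree d
squareFree-∣ d∣e sf k 2≤k k²∣d = sf k 2≤k (∣-trans k²∣d d∣e)

prime-divisor : ∀ {e} → 1 < e → ∃[ p ] Prime p × p ∣ e
prime-divisor {suc e} 1<e with factorise (suc e)
... | record { factors = [] ; isFactorisation = eq } = ⊥-elim (ℕₚ.<⇒≢ 1<e (sym eq))
... | record { factors = p ∷ ps ; isFactorisation = eq ; factorsPrime = pr ∷ _ } = p , pr , divides
  (foldr ℕ._*_ 1 ps) (trans eq (ℕₚ.*-comm p (foldr ℕ._*_ 1 ps)))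

prime-*-∣ : ∀ {p d e} → Prime p → p ∣ e → d ∣ e → ¬ (p ∣ d) → p ℕ.* d ∣ e
prime-*-∣ {p} {d} pr p∣e (divides c eq) p∤d with euclidsLemma c d pr (subst (p ∣_) eq p∣e)
... | inj₂ p∣d = ⊥-elim (p∤d p∣d)
... | inj₁ (divides c′ refl) = divides c′ (trans eq (ℕₚ.*-assoc c′ p d))

divisors : ℕ → ℕ → List ℕ
divisors e n = filter (_∣? e) (positives n)

-- For a prime p dividing e, exchanging d and p d is a sign-reversing involution on the square-free divisors of e.
∑μ-vanishes : ∀ {e n} → 1 < e → e ≤ n → ∑ℤ μ (divisors e n) ≡ ℤ.0ℤ
∑μ-vanishes {e} {n} 1<e e≤n = trans
  (sym (∑ℤ-drop sf? μ (divisors e n) (λ d∈ ¬sf → μ-notSquareFree (positive d∈) ¬sf)))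
    (∑ℤ-involution μ (λ d → τ d (p ∣? d)) (Uniqueₚ.filter⁺ sf? (Uniqueₚ.filter⁺ (_∣? e) (positives-unique n))) step)
  where
  p = proj₁ (prime-divisor 1<e)
  pr = proj₁ (proj₂ (prime-divisor 1<e))
  p∣e = proj₂ (proj₂ (prime-divisor 1<e))
  0<e : 0 < e
  0<e = ℕₚ.≤-trans (s≤s z≤n) 1<e
  sf? : ∀ d → Dec (SquareFree d)
  sf? zero = no (λ sf → sf 2 ℕₚ.≤-refl (4 ∣0))
  sf? (suc d) = squareFree? d
  positive : ∀ {d} → d ∈ divisors e n → 0 < d
  positive d∈ = proj₁ (∈-positives⁻ (proj₁ (∈-filter⁻ (_∣? e) {xs = positives n} d∈)))
  candidates = filter sf? (divisors e n)
  member : ∀ {d} → 0 < d → d ∣ e → SquareFree d → d ∈ candidates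
  member 0<d d∣e sf = ∈-filter⁺ sf? (∈-filter⁺ (_∣? e)
    (∈-positives⁺ 0<d (ℕₚ.≤-trans (∣⇒≤ {{ℕ.>-nonZero 0<e}} d∣e) e≤n)) d∣e) sf
  τ : ∀ d → Dec (p ∣ d) → ℕ
  τ d (yes p∣d) = quotient p∣d
  τ d (no _) = p ℕ.* d
  pd∣e : ∀ {d} → d ∣ e → ¬ (p ∣ d) → p ℕ.* d ∣ e
  pd∣e = prime-*-∣ pr p∣e
  τ-yes : ∀ {d} (p∣d? : Dec (p ∣ d)) (p∣d : p ∣ d) → d ≡ τ d p∣d? ℕ.* p
  τ-yes (yes (divides c eq)) _ = eq
  τ-yes (no p∤d) p∣d = ⊥-elim (p∤d p∣d)
  τ-no : ∀ {d} (p∣d? : Dec (p ∣ d)) → ¬ (p ∣ d) → τ d p∣d? ≡ p ℕ.* d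
  τ-no (yes p∣d) p∤d = ⊥-elim (p∤d p∣d)
  τ-no (no _) _ = refl
  step : ∀ {d} → d ∈ candidates → τ d (p ∣? d) ∈ candidates × τ (τ d (p ∣? d)) (p ∣? τ d (p ∣? d)) ≡ d × μ
    (τ d (p ∣? d)) ≡ ℤ.- μ d
  step {d} d∈ = cases (p ∣? d)
    where
    sf : SquareFree d
    sf = proj₂ (∈-filter⁻ sf? {xs = divisors e n} d∈)
    d∈divisors = proj₁ (∈-filter⁻ sf? {xs = divisors e n} d∈)
    0<d = positive d∈divisors
    d∣e : d ∣ e
    d∣e = proj₂ (∈-filter⁻ (_∣? e) {xs = positives n} d∈divisors)
    cases : ∀ (p∣d? : Dec (p ∣ d)) → τ d p∣d? ∈ candidates × τ (τ d p∣d?) (p ∣? τ d p∣d?) ≡ d × μ (τ d p∣d?) ≡ ℤ.- μ d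
    cases (no p∤d) = member (ℕₚ.*-mono-≤ (ℕₚ.≤-trans (s≤s z≤n) (prime>1 pr)) 0<d) (pd∣e d∣e p∤d)
      (squareFree-* pr 0<d p∤d sf) ,
      sym (ℕₚ.*-cancelˡ-≡ d (τ (p ℕ.* d) (p ∣? p ℕ.* d)) p {{prime⇒nonZero pr}}
        (trans (τ-yes (p ∣? p ℕ.* d) (m∣m*n d)) (ℕₚ.*-comm _ p))) ,
      μ-* pr 0<d p∤d sf
    cases (yes (divides c eq)) = member 0<c (∣-trans c∣d d∣e) (squareFree-∣ c∣d sf) ,
      trans (τ-no (p ∣? c) p∤c) (sym d≡pc) ,
      trans (sym (ℤₚ.neg-involutive (μ c)))
        (cong ℤ.-_ (trans (sym (μ-* pr 0<c p∤c (squareFree-∣ c∣d sf))) (cong μ (sym d≡pc))))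
      where
      d≡pc : d ≡ p ℕ.* c
      d≡pc = trans eq (ℕₚ.*-comm c p)
      c∣d : c ∣ d
      c∣d = divides p d≡pc
      0<c : 0 < c
      0<c = ℕₚ.n≢0⇒n>0 (λ { refl → ℕₚ.<⇒≢ 0<d (sym eq) })
      p∤c : ¬ (p ∣ c)
      p∤c p∣c = sf p (prime>1 pr) (subst (p ℕ.* p ∣_) (sym eq) (*-pres-∣ p∣c (∣-refl {p})))

∑μ-one : ∀ {n} → 1 ≤ n → ∑ℤ μ (divisors 1 n) ≡ ℤ.1ℤ
∑μ-one {n} 1≤n = foldr-↭ ℤ._+_ ℤₚ.+-assoc ℤₚ.+-comm ℤ.0ℤ
  (map-↭ μ (unique-↭ {ys = 1 ∷ []} (Uniqueₚ.filter⁺ (_∣? 1) (positives-unique n)) ([] ∷ [])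
  (λ d∈ → here (∣1⇒≡1 (proj₂ (∈-filter⁻ (_∣? 1) {xs = positives n} d∈))))
    λ { (here refl) → ∈-filter⁺ (_∣? 1) (∈-positives⁺ (s≤s z≤n) 1≤n) ∣-refl }))

-- The number of solutions of φ(x) + x = t

module TraceCount {F E : FiniteField} (emb : Embedding F E) where
  open Extension emb
  open Frobenius emb
  open Field E
  open Polynomial E hiding (Poly)

  -- alternating n d = φ^{2d-1} - φ^{2d-2} + … + φ - 1 with φ = frob n, so that its composite with φ + 1 is φ^{2d} - 1.
  alternating : ℕ → ℕ → Carrier → Carrier
  alternating n zero y = 0#
  alternating n (suc d) y = frob (n ℕ.* suc (d ℕ.+ d)) y + (alternating n d y + - frob (n ℕ.* (d ℕ.+ d)) y)

  -- The polynomial behind `alternating`; its degree q^(n (2d - 1)) for d > 0 bounds the number of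
  -- zeros.
  alternatingP : ℕ → ℕ → Polynomial.Poly E
  alternatingP n zero = []
  alternatingP n (suc d) = addP (X^ (q ℕ.^ (n ℕ.* suc (d ℕ.+ d))))
    (subP E (alternatingP n d) (X^ (q ℕ.^ (n ℕ.* (d ℕ.+ d)))))

  eval-alternatingP : ∀ n d y → eval (alternatingP n d) y ≡ alternating n d y
  eval-alternatingP n zero y = refl
  eval-alternatingP n (suc d) y = trans (eval-addP (X^ (q ℕ.^ (n ℕ.* suc (d ℕ.+ d)))) _ y)
    (cong₂ _+_ (eval-frob (n ℕ.* suc (d ℕ.+ d)))
    (trans (eval-subP E (alternatingP n d) (X^ (q ℕ.^ (n ℕ.* (d ℕ.+ d)))) y)
      (cong₂ (λ u v → u + - v) (eval-alternatingP n d y) (eval-frob (n ℕ.* (d ℕ.+ d))))))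
    where
    eval-frob : ∀ k → eval (X^ (q ℕ.^ k)) y ≡ frob k y
    eval-frob k = trans (eval-X^ (q ℕ.^ k) y) (sym (frob-^ k y))

  module _ {n} (0<n : 0 < n) where

    q^-mono : ∀ {j k} → j < k → q ℕ.^ (n ℕ.* j) < q ℕ.^ (n ℕ.* k)
    q^-mono {j} {k} j<k = ℕₚ.^-monoʳ-< q (Fermat.2≤order F) (ℕₚ.*-monoʳ-< n {{ℕ.>-nonZero 0<n}} j<k)

    alternatingP-DegLt : ∀ d → DegLt (alternatingP n d) (q ℕ.^ (n ℕ.* (d ℕ.+ d)))
    alternatingP-Monic : ∀ d → Monic (alternatingP n (suc d)) (q ℕ.^ (n ℕ.* suc (d ℕ.+ d)))

    alternatingP-DegLt zero i _ = refl
    alternatingP-DegLt (suc d) = DegLt-mono {alternatingP n (suc d)}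
      (q^-mono (s≤s (ℕₚ.≤-reflexive (sym (ℕₚ.+-suc d d))))) (proj₂ (alternatingP-Monic d))

    alternatingP-Monic d = trans (coef-addP lead rest Q)
      (trans (cong₂ _+_ (proj₁ (X^-Monic Q)) (rest-DegLt Q ℕₚ.≤-refl)) (+-identityʳ 1#)) ,
      DegLt-addP lead rest (proj₂ (X^-Monic Q)) (DegLt-mono {rest} (ℕₚ.n≤1+n Q) rest-DegLt)
      where
      Q = q ℕ.^ (n ℕ.* suc (d ℕ.+ d))
      R = q ℕ.^ (n ℕ.* (d ℕ.+ d))
      lead = X^ Q
      rest = subP E (alternatingP n d) (X^ R)
      rest-DegLt : DegLt rest Q
      rest-DegLt = DegLt-addP (alternatingP n d) (scale (- 1#) (X^ R))
        (DegLt-mono {alternatingP n d} (ℕₚ.<⇒≤ (q^-mono ℕₚ.≤-refl)) (alternatingP-DegLt d))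
        (DegLt-scale (- 1#) (X^ R) (DegLt-mono {X^ R} (q^-mono ℕₚ.≤-refl) (proj₂ (X^-Monic R))))

    -- The sum telescopes: with alternating signs, neighbouring powers of φ cancel when composed
    -- with φ + 1.
    alternating-∘ : ∀ d x → alternating n d (frob n x + x) ≡ frob (n ℕ.* (d ℕ.+ d)) x + - x
    alternating-∘ zero x = sym (trans (cong (λ k → frob k x + - x) (ℕₚ.*-zeroʳ n)) (-‿inverseʳ x))
    alternating-∘ (suc d) x = begin
      frob (n ℕ.* suc k) (frob n x + x) + (alternating n d (frob n x + x) + - frob (n ℕ.* k) (frob n x + x))
        ≡⟨ cong₂ _+_ (expand (suc k)) (cong₂ (λ u v → u + - v) (alternating-∘ d x) (expand k)) ⟩
      (frob (n ℕ.* suc (suc k)) x + frob (n ℕ.* suc k) x) +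
        ((frob (n ℕ.* k) x + - x) + - (frob (n ℕ.* suc k) x + frob (n ℕ.* k) x))
        ≡⟨ solve 4 (λ a b c x → (a :+ b) :+ ((c :+ :- x) :+ :- (b :+ c)) := a :+ :- x) refl
          (frob (n ℕ.* suc (suc k)) x) (frob (n ℕ.* suc k) x) (frob (n ℕ.* k) x) x ⟩
      frob (n ℕ.* suc (suc k)) x + - x
        ≡⟨ cong (λ j → frob (n ℕ.* suc j) x + - x) (sym (ℕₚ.+-suc d d)) ⟩
      frob (n ℕ.* (suc d ℕ.+ suc d)) x + - x ∎
      where
      k = d ℕ.+ d
      expand : ∀ j → frob (n ℕ.* j) (frob n x + x) ≡ frob (n ℕ.* suc j) x + frob (n ℕ.* j) x
      expand j = trans (frob-+ (n ℕ.* j) (frob n x) x) (cong (_+ frob (n ℕ.* j) x)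
        (trans (sym (frob-∘ (n ℕ.* j) n x))
          (cong (λ i → frob i x) (trans (ℕₚ.+-comm (n ℕ.* j) n) (sym (ℕₚ.*-suc n j))))))

    -- Powers of φ fix F, and as many of them occur with a plus sign as with a minus sign.
    alternating-ι : ∀ d t → alternating n d (ι t) ≡ 0#
    alternating-ι zero t = refl
    alternating-ι (suc d) t = trans (cong₂ _+_ (frob-ι (n ℕ.* suc (d ℕ.+ d)) t)
      (cong₂ (λ u v → u + - v) (alternating-ι d t) (frob-ι (n ℕ.* (d ℕ.+ d)) t)))
      (solve 1 (λ t → t :+ (con (ℤ.+ 0) :+ :- t) := con (ℤ.+ 0)) refl (ι t))

    -- As t is fixed by φ, applying φ to the equation and subtracting the original leaves φ²(x) = x.
    frob-square : ∀ {x t} → frob n x + x ≡ ι t → frob (n ℕ.+ n) x ≡ x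
    frob-square {x} {t} eq = trans (frob-∘ n n x)
      (x-y≡0⇒x≡y (trans (solve 3 (λ a b x → a :+ :- x := (a :+ b) :+ :- (b :+ x)) refl (frob n (frob n x))
      (frob n x) x)
      (x≡y⇒x-y≡0 (trans (sym (frob-+ n (frob n x) x)) (trans (cong (frob n) eq) (trans (frob-ι n t) (sym eq)))))))

    -- The map φ + 1 sends the q^(2n (d + 1)) elements fixed by φ^(2 (d + 1)) to zeros of
    -- `alternating`, of which there are at most q^(n (2d + 1)), with fibres of at most q^n
    -- elements. The bounds are tight, and t is one of these zeros.
    trace-count : ∀ d t → length (fixed (n ℕ.* (suc d ℕ.+ suc d))) ≡ q ℕ.^ (n ℕ.* (suc d ℕ.+ suc d)) →
      count (λ x → frob n x + x ≟ ι t) elements ≡ q ℕ.^ n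
    trace-count d t len = trans (length-≡ (Uniqueₚ.filter⁺ T? elements-unique) (Uniqueₚ.filter⁺ T? fixed-unique) to
      from)
      (fibres-tight _≟_ (λ x → frob n x + x) (Uniqueₚ.filter⁺ K? elements-unique) into {a = q ℕ.^ n}
        {b = q ℕ.^ (n ℕ.* suc (d ℕ.+ d))} fibre-≤
        kernel-≤ enough (∈-filter⁺ K? (elements-complete (ι t)) (alternating-ι (suc d) t)))
      where
      M = n ℕ.* (suc d ℕ.+ suc d)
      T? : ∀ x → Dec (frob n x + x ≡ ι t)
      T? x = frob n x + x ≟ ι t
      K? : ∀ y → Dec (alternating n (suc d) y ≡ 0#)
      K? y = alternating n (suc d) y ≟ 0#
      fixed-unique : Unique (fixed M)
      fixed-unique = Uniqueₚ.filter⁺ (λ x → frob M x ≟ x) elements-unique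
      M≡ : M ≡ suc d ℕ.* (n ℕ.+ n)
      M≡ = trans (ℕₚ.*-comm n _) (trans (ℕₚ.*-distribʳ-+ n (suc d) (suc d)) (sym (ℕₚ.*-distribˡ-+ (suc d) n n)))
      to : ∀ {x} → x ∈ filter T? elements → x ∈ filter T? (fixed M)
      to {x} x∈ = let eq = proj₂ (∈-filter⁻ T? {xs = elements} x∈) in
        ∈-filter⁺ T? (∈-filter⁺ (λ x → frob M x ≟ x) (elements-complete x)
          (trans (cong (λ k → frob k x) M≡) (frob-multiple {n ℕ.+ n} (frob-square eq) (suc d)))) eq
      from : ∀ {x} → x ∈ filter T? (fixed M) → x ∈ filter T? elements
      from {x} x∈ = ∈-filter⁺ T? (elements-complete x) (proj₂ (∈-filter⁻ T? {xs = fixed M} x∈))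
      into : ∀ {x} → x ∈ fixed M → frob n x + x ∈ filter K? elements
      into {x} x∈ = ∈-filter⁺ K? (elements-complete _)
        (trans (alternating-∘ (suc d) x) (x≡y⇒x-y≡0 (proj₂ (∈-filter⁻ (λ x → frob M x ≟ x) {xs = elements} x∈))))
      fibre-≤ : ∀ {y} → y ∈ filter K? elements → count (λ x → frob n x + x ≟ y) (fixed M) ≤ q ℕ.^ n
      fibre-≤ {y} _ = ℕₚ.≤-trans (length-injection (λ x → x)
        (Uniqueₚ.filter⁺ (λ x → frob n x + x ≟ y) fixed-unique) (λ _ _ eq → eq)
          (λ {x} x∈ → ∈-filter⁺ (λ x → frob n x + x ≟ y) (elements-complete x)
            (proj₂ (∈-filter⁻ (λ x → frob n x + x ≟ y) {xs = fixed M} x∈))))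
        (count-frob-affine 0<n 1# (- y) (λ x → frob n x + x ≟ y)
          (λ {x} eq → trans (solve 3 (λ a x y → a :+ (con (ℤ.+ 1) :* x :+ :- y) := (a :+ x) :+ :- y) refl
          (frob n x) x y) (x≡y⇒x-y≡0 eq)))
      kernel-≤ : length (filter K? elements) ≤ q ℕ.^ (n ℕ.* suc (d ℕ.+ d))
      kernel-≤ = count-roots (alternatingP n (suc d)) _ (alternatingP-Monic d) K?
        (λ {y} eq → trans (eval-alternatingP n (suc d) y) eq)
      enough : q ℕ.^ (n ℕ.* suc (d ℕ.+ d)) ℕ.* q ℕ.^ n ≤ length (fixed M)
      enough = ℕₚ.≤-reflexive (trans (sym (ℕₚ.^-distribˡ-+-* q (n ℕ.* suc (d ℕ.+ d)) n))
        (trans (cong (q ℕ.^_) exponent) (sym len)))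
        where
        exponent : n ℕ.* suc (d ℕ.+ d) ℕ.+ n ≡ M
        exponent = trans (ℕₚ.+-comm _ n) (trans (sym (ℕₚ.*-suc n (suc (d ℕ.+ d))))
          (cong (λ k → n ℕ.* suc k) (sym (ℕₚ.+-suc d d))))

least : ∀ {P : ℕ → Set} → (∀ n → Dec (P n)) → ∀ b n → n < b → 0 < n → P n → ∃[ D ] 0 < D × P D ×
  (∀ k → 0 < k → k < D → ¬ P k)
least {P} P? (suc b) n (s≤s n≤b) 0<n pn = cases (ℕₚ.anyUpTo? (λ k → (0 ℕ.<? k) ×-dec P? k) n)
  where
  cases : Dec (∃[ k ] k < n × 0 < k × P k) → ∃[ D ] 0 < D × P D × (∀ k → 0 < k → k < D → ¬ P k)
  cases (yes (k , k<n , 0<k , pk)) = least P? b k (ℕₚ.<-≤-trans k<n n≤b) 0<k pk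
  cases (no none) = n , 0<n , pn , λ k 0<k k<n pk → none (k , k<n , 0<k , pk)

-- The factors 2 are removed one at a time, each being coprime to the odd number e.
odd-divides : ∀ k {e l} → ¬ (2 ∣ e) → e ∣ 2 ℕ.^ k ℕ.* l → e ∣ l
odd-divides zero {e} {l} odd e∣ = subst (e ∣_) (ℕₚ.*-identityˡ l) e∣
odd-divides (suc k) {e} {l} odd e∣ = odd-divides k odd
  (coprime-divisor coprime (subst (e ∣_) (ℕₚ.*-assoc 2 (2 ℕ.^ k) l) e∣))
  where
  coprime : Coprime e 2
  coprime (d∣e , d∣2) with irreducible[2] d∣2
  ... | inj₁ d≡1 = d≡1
  ... | inj₂ refl = ⊥-elim (odd d∣e)

odd-form : ∀ d → ¬ (2 ∣ d) → ∃[ j ] d ≡ suc (j ℕ.+ j)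
odd-form zero odd = ⊥-elim (odd (2 ∣0))
odd-form (suc zero) odd = 0 , refl
odd-form (suc (suc d)) odd = let j , eq = odd-form d (λ 2∣d → odd (∣m∣n⇒∣m+n (∣-refl {2}) 2∣d)) in suc j , cong suc (trans (cong suc eq) (cong suc (sym (ℕₚ.+-suc j j))))

∑μ-floorRecip : ∀ l → 0 < l → ∑ℤ μ (divisors l l) ≡ ℤ.+ floorRecip l
∑μ-floorRecip (suc zero) _ = ∑μ-one ℕₚ.≤-refl
∑μ-floorRecip (suc (suc l)) _ = ∑μ-vanishes {suc (suc l)} (s≤s (s≤s z≤n)) ℕₚ.≤-refl

-- Möbius inversion over the degree

module DegreeCount {F E : FiniteField} (emb : Embedding F E) where
  open Extension emb
  open Frobenius emb
  open TraceCount emb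
  open Field E

  Ord? : ∀ u n → Dec (Ord u n)
  Ord? u n = (frob n u ≟ u) ×-dec map′ (λ f k 0<k k<n → f k<n 0<k) (λ f {k} k<n 0<k → f k 0<k k<n)
    (ℕₚ.allUpTo? (λ k → (0 ℕ.<? k) →-dec ¬? (frob k u ≟ u)) n)

  -- The remainder of k modulo D is again a period of u, and it is smaller than the least positive
  -- one.
  period-divides : ∀ {u D} → 0 < D → Ord u D → ∀ {k} → frob k u ≡ u → D ∣ k
  period-divides {u} {D} 0<D (fix , ord) {k} eq = m%n≡0⇒n∣m k D (zero-remainder (k DivMod.% D) refl)
    where
    nz = ℕ.>-nonZero 0<D
    instance _ = nz
    frob-remainder : frob (k DivMod.% D) u ≡ u
    frob-remainder = trans (cong (frob (k DivMod.% D)) (sym (frob-multiple {D} fix (k DivMod./ D))))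
      (trans (sym (frob-∘ (k DivMod.% D) (k DivMod./ D ℕ.* D) u))
        (trans (cong (λ j → frob j u) (sym (DivMod.m≡m%n+[m/n]*n k D))) eq))
    zero-remainder : ∀ r → k DivMod.% D ≡ r → r ≡ 0
    zero-remainder zero _ = refl
    zero-remainder (suc r) r≡ = ⊥-elim (ord (k DivMod.% D) (subst (0 <_) (sym r≡) (s≤s z≤n)) (DivMod.m%n<n k D)
      frob-remainder)

  Ord-unique : ∀ {u D D′} → 0 < D → 0 < D′ → Ord u D → Ord u D′ → D ≡ D′
  Ord-unique 0<D 0<D′ o o′ = ∣-antisym (period-divides 0<D o (proj₁ o′)) (period-divides 0<D′ o′ (proj₁ o))

  module _ {m} k l (0<m : 0 < m) (m≡ : m ≡ 2 ℕ.^ k ℕ.* l) (l-odd : ¬ (2 ∣ l))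
           (len : length (fixed (2 ℕ.* m)) ≡ q ℕ.^ (2 ℕ.* m)) (t : F.Carrier)
             (half∈F : ∀ {u} → u + u ≡ ι t → σ u ≡ u) where
    private
      0<l : 0 < l
      0<l = ℕₚ.n≢0⇒n>0 (λ { refl → l-odd (2 ∣0) })

      l∣m : l ∣ m
      l∣m = divides (2 ℕ.^ k) m≡

      2m≡m+m : 2 ℕ.* m ≡ m ℕ.+ m
      2m≡m+m = cong (m ℕ.+_) (ℕₚ.+-identityʳ m)

    -- By `half∈F` these solutions lie in F, so they solve `frob n u + u ≡ ι t` for every n at once.
    -- Their constant contribution to the inversion is what produces the floor term.
    halves : ℕ
    halves = count (λ u → u + u ≟ ι t) elements

    A? : ∀ u → Dec (frob m u + u ≡ ι t × Ord u (2 ℕ.* m))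
    A? u = (frob m u + u ≟ ι t) ×-dec Ord? u (2 ℕ.* m)

    Y? : ∀ u → Dec (frob m u + u ≡ ι t × frob m u ≢ u)
    Y? u = (frob m u + u ≟ ι t) ×-dec ¬? (frob m u ≟ u)

    Y : List Carrier
    Y = filter Y? elements

    Y-unique : Unique Y
    Y-unique = Uniqueₚ.filter⁺ Y? elements-unique

    fixed-by : ℕ → Carrier → Set
    fixed-by n u = frob (n ℕ.+ n) u ≡ u

    fixed-by? : ∀ n u → Dec (fixed-by n u)
    fixed-by? n u = frob (n ℕ.+ n) u ≟ u

    -- For d = 2j + 1 the exponent n d is n plus j times 2n, and 2n is a period of u.
    frob-odd : ∀ n {d u} → ¬ (2 ∣ d) → fixed-by n u → frob (n ℕ.* d) u ≡ frob n u
    frob-odd n {d} {u} odd fix = let j , d≡ = odd-form d odd in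
      trans (cong (λ i → frob i u) (trans (cong (n ℕ.*_) d≡)
        (trans (ℕₚ.*-suc n (j ℕ.+ j)) (cong (n ℕ.+_) (trans (ℕₚ.*-distribˡ-+ n j j)
          (trans (cong₂ ℕ._+_ (ℕₚ.*-comm n j) (ℕₚ.*-comm n j)) (sym (ℕₚ.*-distribˡ-+ j n n))))))))
        (trans (frob-∘ n (j ℕ.* (n ℕ.+ n)) u) (cong (frob n) (frob-multiple {n ℕ.+ n} fix j)))

    half-fixed : ∀ {u} → u + u ≡ ι t → ∀ j → frob j u ≡ u
    half-fixed eq zero = refl
    half-fixed eq (suc j) = trans (cong σ (half-fixed eq j)) (half∈F eq)

    -- On elements with period 2n the maps `frob m` and `frob n` agree, because m / n is odd. So the
    -- members of `Y` with this period are the solutions of the equation for n in place of m, apart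
    -- from those counted by `halves`.
    count-fixed-by : ∀ n d → m ≡ n ℕ.* suc d → ¬ (2 ∣ suc d) → count (fixed-by? n) Y ℕ.+ halves ≡ q ℕ.^ n
    count-fixed-by n d m≡nd odd = trans (ℕₚ.+-comm _ halves)
      (trans (cong₂ ℕ._+_ halves≡ rest≡) (trans (count-¬ (λ u → frob m u ≟ u) Z) (trace-count 0<n d t len′)))
      where
      0<n : 0 < n
      0<n = ℕₚ.n≢0⇒n>0 (λ { refl → ℕₚ.<⇒≢ 0<m (sym m≡nd) })
      exponent : 2 ℕ.* m ≡ n ℕ.* (suc d ℕ.+ suc d)
      exponent = trans 2m≡m+m (trans (cong₂ ℕ._+_ m≡nd m≡nd) (sym (ℕₚ.*-distribˡ-+ n (suc d) (suc d))))
      len′ = subst (λ M → length (fixed M) ≡ q ℕ.^ M) exponent len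
      Z? : ∀ u → Dec (frob n u + u ≡ ι t)
      Z? u = frob n u + u ≟ ι t
      Z = filter Z? elements
      Z-unique = Uniqueₚ.filter⁺ Z? elements-unique
      halves≡ : halves ≡ count (λ u → frob m u ≟ u) Z
      halves≡ = length-≡ (Uniqueₚ.filter⁺ (λ u → u + u ≟ ι t) elements-unique)
        (Uniqueₚ.filter⁺ (λ u → frob m u ≟ u) Z-unique) to from
        where
        to : ∀ {u} → u ∈ filter (λ u → u + u ≟ ι t) elements → u ∈ filter (λ u → frob m u ≟ u) Z
        to {u} u∈ = let eq = proj₂ (∈-filter⁻ (λ u → u + u ≟ ι t) {xs = elements} u∈) in
          ∈-filter⁺ (λ u → frob m u ≟ u) (∈-filter⁺ Z? (elements-complete u)
            (trans (cong (_+ u) (half-fixed eq n)) eq)) (half-fixed eq m)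
        from : ∀ {u} → u ∈ filter (λ u → frob m u ≟ u) Z → u ∈ filter (λ u → u + u ≟ ι t) elements
        from {u} u∈ = let u∈Z , fix = ∈-filter⁻ (λ u → frob m u ≟ u) {xs = Z} u∈
                          eq = proj₂ (∈-filter⁻ Z? {xs = elements} u∈Z)
                          frob-n = trans (sym (trans (cong (λ i → frob i u) m≡nd)
                            (frob-odd n odd (frob-square 0<n eq)))) fix in
          ∈-filter⁺ (λ u → u + u ≟ ι t) (elements-complete u) (trans (cong (_+ u) (sym frob-n)) eq)
      rest≡ : count (fixed-by? n) Y ≡ count (λ u → ¬? (frob m u ≟ u)) Z
      rest≡ = length-≡ (Uniqueₚ.filter⁺ (fixed-by? n) Y-unique)
        (Uniqueₚ.filter⁺ (λ u → ¬? (frob m u ≟ u)) Z-unique) to from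
        where
        to : ∀ {u} → u ∈ filter (fixed-by? n) Y → u ∈ filter (λ u → ¬? (frob m u ≟ u)) Z
        to {u} u∈ = let u∈Y , fix = ∈-filter⁻ (fixed-by? n) {xs = Y} u∈
                        eq , moved = proj₂ (∈-filter⁻ Y? {xs = elements} u∈Y)
                        frob-n = trans (sym (frob-odd n odd fix)) (cong (λ i → frob i u) (sym m≡nd)) in
          ∈-filter⁺ (λ u → ¬? (frob m u ≟ u)) (∈-filter⁺ Z? (elements-complete u) (trans (cong (_+ u) frob-n) eq))
            moved
        from : ∀ {u} → u ∈ filter (λ u → ¬? (frob m u ≟ u)) Z → u ∈ filter (fixed-by? n) Y
        from {u} u∈ = let u∈Z , moved = ∈-filter⁻ (λ u → ¬? (frob m u ≟ u)) {xs = Z} u∈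
                          eq = proj₂ (∈-filter⁻ Z? {xs = elements} u∈Z)
                          fix = frob-square 0<n eq
                          frob-m = trans (cong (λ i → frob i u) m≡nd) (frob-odd n odd fix) in
          ∈-filter⁺ (fixed-by? n) (∈-filter⁺ Y? (elements-complete u) (trans (cong (_+ u) frob-m) eq , moved)) fix

    quotient-of : ℕ → ℕ
    quotient-of zero = 0
    quotient-of (suc d) = m ℕ./ suc d

    -- For d dividing l this is μ(d) times the indicator that u belongs to the field with q^(2m/d)
    -- elements.
    inversionTerm : ℕ → Carrier → ℤ
    inversionTerm d u = if ⌊ d ∣? l ⌋ then μ d ℤ.* (if ⌊ fixed-by? (quotient-of d) u ⌋ then ℤ.1ℤ else ℤ.0ℤ) else ℤ.0ℤ

    m≡quotient : ∀ {d} → 0 < d → d ∣ l → m ≡ quotient-of d ℕ.* d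
    m≡quotient {suc d} _ d∣l = sym (DivMod.m/n*n≡m (∣-trans d∣l l∣m))

    -- With e = 2m / deg u, an odd number, u is fixed by frob (2m/d) iff d divides e.
    ∑-inversionTerm : ∀ {u} → frob m u + u ≡ ι t → frob m u ≢ u → ∑ℤ (λ d → inversionTerm d u) (positives l) ≡
      (if ⌊ Ord? u (2 ℕ.* m) ⌋ then ℤ.1ℤ else ℤ.0ℤ)
    ∑-inversionTerm {u} eq moved = trans (∑ℤ-cong (positives l) term)
      (trans (sym (∑ℤ-filter (_∣? e) μ (positives l))) (value (e ℕ.≟ 1)))
      where
      fix-2m : frob (2 ℕ.* m) u ≡ u
      fix-2m = trans (cong (λ i → frob i u) 2m≡m+m) (frob-square 0<m eq)
      0<2m : 0 < 2 ℕ.* m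
      0<2m = ℕₚ.≤-trans 0<m (ℕₚ.m≤m+n m _)
      period = least (λ i → frob i u ≟ u) (suc (2 ℕ.* m)) (2 ℕ.* m) ℕₚ.≤-refl 0<2m fix-2m
      D = proj₁ period
      0<D : 0 < D
      0<D = proj₁ (proj₂ period)
      D-ord : Ord u D
      D-ord = proj₂ (proj₂ period)
      instance D-nonZero = ℕ.>-nonZero 0<D
      D∣2m : D ∣ 2 ℕ.* m
      D∣2m = period-divides 0<D D-ord fix-2m
      e = quotient D∣2m
      2m≡eD : 2 ℕ.* m ≡ e ℕ.* D
      2m≡eD = _∣_.equality D∣2m
      -- For even e the period D would divide m and φ would fix u, against `moved`.
      e-odd : ¬ (2 ∣ e)
      e-odd (divides c e≡) = moved (trans (cong (λ i → frob i u) m≡cD) (frob-multiple {D} (proj₁ D-ord) c))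
        where
        m≡cD : m ≡ c ℕ.* D
        m≡cD = ℕₚ.*-cancelˡ-≡ m (c ℕ.* D) 2
          (trans 2m≡eD (trans (cong (ℕ._* D) (trans e≡ (ℕₚ.*-comm c 2))) (ℕₚ.*-assoc 2 c D)))
      e∣l : e ∣ l
      e∣l = odd-divides (suc k) e-odd (divides D
        (trans (ℕₚ.*-assoc 2 (2 ℕ.^ k) l) (trans (cong (2 ℕ.*_) (sym m≡)) (trans 2m≡eD (ℕₚ.*-comm e D)))))
      0<e : 0 < e
      0<e = ℕₚ.n≢0⇒n>0 (λ e≡0 → ℕₚ.<⇒≢ 0<2m (sym (trans 2m≡eD (cong (ℕ._* D) e≡0))))
      e≤l : e ≤ l
      e≤l = ∣⇒≤ {{ℕ.>-nonZero 0<l}} e∣l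
      double : ∀ {d} → 0 < d → d ∣ l → 2 ℕ.* m ≡ d ℕ.* (quotient-of d ℕ.+ quotient-of d)
      double {d} 0<d d∣l = trans 2m≡m+m (trans (cong₂ ℕ._+_ mm mm)
        (sym (ℕₚ.*-distribˡ-+ d (quotient-of d) (quotient-of d))))
        where mm = trans (m≡quotient 0<d d∣l) (ℕₚ.*-comm (quotient-of d) d)
      to : ∀ {d} → 0 < d → d ∣ l → fixed-by (quotient-of d) u → d ∣ e
      to {d} 0<d d∣l fix = cases (period-divides 0<D D-ord fix)
        where
        cases : D ∣ quotient-of d ℕ.+ quotient-of d → d ∣ e
        cases (divides c c≡) = divides c (ℕₚ.*-cancelʳ-≡ e (c ℕ.* d) D
          (trans (sym 2m≡eD) (trans (double 0<d d∣l) (trans (cong (d ℕ.*_) c≡)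
          (trans (sym (ℕₚ.*-assoc d c D)) (cong (ℕ._* D) (ℕₚ.*-comm d c)))))))
      from : ∀ {d} → 0 < d → d ∣ e → fixed-by (quotient-of d) u
      from {d} 0<d d∣e@(divides c c≡) = trans (cong (λ i → frob i u) 2q≡) (frob-multiple {D} (proj₁ D-ord) c)
        where
        2q≡ : quotient-of d ℕ.+ quotient-of d ≡ c ℕ.* D
        2q≡ = ℕₚ.*-cancelˡ-≡ _ (c ℕ.* D) d {{ℕ.>-nonZero 0<d}}
          (trans (sym (double 0<d (∣-trans d∣e e∣l)))
          (trans 2m≡eD (trans (cong (ℕ._* D) (trans c≡ (ℕₚ.*-comm c d))) (ℕₚ.*-assoc d c D))))
      term : ∀ {d} → d ∈ positives l → inversionTerm d u ≡ (if ⌊ d ∣? e ⌋ then μ d else ℤ.0ℤ)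
      term {d} d∈ = cases (d ∣? l) (fixed-by? (quotient-of d) u) (d ∣? e)
        where
        0<d = proj₁ (∈-positives⁻ d∈)
        cases : (a : Dec (d ∣ l)) (b : Dec (fixed-by (quotient-of d) u)) (c : Dec (d ∣ e)) →
          (if ⌊ a ⌋ then μ d ℤ.* (if ⌊ b ⌋ then ℤ.1ℤ else ℤ.0ℤ) else ℤ.0ℤ) ≡ (if ⌊ c ⌋ then μ d else ℤ.0ℤ)
        cases (yes _) (yes _) (yes _) = ℤₚ.*-identityʳ (μ d)
        cases (yes _) (no _) (no _) = ℤₚ.*-zeroʳ (μ d)
        cases (no _) _ (no _) = refl
        cases (yes d∣l) (yes fix) (no d∤e) = ⊥-elim (d∤e (to 0<d d∣l fix))
        cases (yes _) (no moved′) (yes d∣e) = ⊥-elim (moved′ (from 0<d d∣e))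
        cases (no d∤l) _ (yes d∣e) = ⊥-elim (d∤l (∣-trans d∣e e∣l))
      -- The sum of μ over the divisors of e is 1 if e = 1 and 0 otherwise, and e = 1 means that the
      -- degree D of u is 2m.
      value : Dec (e ≡ 1) → ∑ℤ μ (divisors e l) ≡ (if ⌊ Ord? u (2 ℕ.* m) ⌋ then ℤ.1ℤ else ℤ.0ℤ)
      value (yes e≡1) = trans (cong (λ e → ∑ℤ μ (divisors e l)) e≡1)
        (trans (∑μ-one 0<l) (cong (λ b → if b then ℤ.1ℤ else ℤ.0ℤ)
        (sym (⌊⌋-true (Ord? u (2 ℕ.* m)) (subst (Ord u)
          (sym (trans 2m≡eD (trans (cong (ℕ._* D) e≡1) (ℕₚ.*-identityˡ D)))) D-ord)))))
      value (no e≢1) = trans (∑μ-vanishes (ℕₚ.≤∧≢⇒< 0<e (λ 1≡e → e≢1 (sym 1≡e))) e≤l)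
        (cong (λ b → if b then ℤ.1ℤ else ℤ.0ℤ)
        (sym (⌊⌋-false (Ord? u (2 ℕ.* m)) (λ o → e≢1
          (ℕₚ.*-cancelʳ-≡ e 1 D (trans (sym 2m≡eD)
          (trans (Ord-unique 0<2m 0<D o D-ord) (sym (ℕₚ.*-identityˡ D)))))))))

    -- By `count-fixed-by`, a divisor d of l selects q^(m/d) minus `halves` elements of `Y`, each
    -- weighted by μ(d).
    ∑-over-Y : ∀ {d} → d ∈ positives l → ∑ℤ (inversionTerm d) Y ≡ mobiusTerm q m l d ℤ.+ ℤ.- (ℤ.+ halves) ℤ.*
      (if ⌊ d ∣? l ⌋ then μ d else ℤ.0ℤ)
    ∑-over-Y {zero} d∈ = ⊥-elim (ℕₚ.<⇒≢ (proj₁ (∈-positives⁻ d∈)) refl)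
    ∑-over-Y {suc d} d∈ = cases (suc d ∣? l)
      where
      n = m ℕ./ suc d
      cases : (a : Dec (suc d ∣ l)) → ∑ℤ (λ u → if ⌊ a ⌋ then μ (suc d) ℤ.*
        (if ⌊ fixed-by? n u ⌋ then ℤ.1ℤ else ℤ.0ℤ) else ℤ.0ℤ) Y
        ≡ (if ⌊ a ⌋ then μ (suc d) ℤ.* (ℤ.+ (q ℕ.^ n)) else ℤ.0ℤ) ℤ.+ ℤ.- (ℤ.+ halves) ℤ.*
          (if ⌊ a ⌋ then μ (suc d) else ℤ.0ℤ)
      cases (no _) = trans (∑ℤ-0 Y) (sym (trans (ℤₚ.+-identityˡ _) (ℤₚ.*-zeroʳ (ℤ.- (ℤ.+ halves)))))
      cases (yes d∣l) = begin
        ∑ℤ (λ u → μ (suc d) ℤ.* (if ⌊ fixed-by? n u ⌋ then ℤ.1ℤ else ℤ.0ℤ)) Y  ≡⟨ ∑ℤ-*ˡ (μ (suc d)) _ Y ⟩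
        μ (suc d) ℤ.* ∑ℤ (λ u → if ⌊ fixed-by? n u ⌋ then ℤ.1ℤ else ℤ.0ℤ) Y
          ≡⟨ cong (λ z → μ (suc d) ℤ.* z) (trans (sym (count-∑ℤ (fixed-by? n) Y)) count≡) ⟩
        μ (suc d) ℤ.* (ℤ.+ (q ℕ.^ n) ℤ.+ ℤ.- (ℤ.+ halves))                      ≡⟨ ℤₚ.*-distribˡ-+ (μ (suc d)) _ _ ⟩
        μ (suc d) ℤ.* (ℤ.+ (q ℕ.^ n)) ℤ.+ μ (suc d) ℤ.* ℤ.- (ℤ.+ halves)
          ≡⟨ cong (λ z → μ (suc d) ℤ.* (ℤ.+ (q ℕ.^ n)) ℤ.+ z) (ℤₚ.*-comm (μ (suc d)) _) ⟩
        μ (suc d) ℤ.* (ℤ.+ (q ℕ.^ n)) ℤ.+ ℤ.- (ℤ.+ halves) ℤ.* μ (suc d)        ∎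
        where
        count≡ : ℤ.+ count (fixed-by? n) Y ≡ ℤ.+ (q ℕ.^ n) ℤ.+ ℤ.- (ℤ.+ halves)
        count≡ = begin
          ℤ.+ c                                              ≡⟨ sym (ℤₚ.+-identityʳ (ℤ.+ c)) ⟩
          ℤ.+ c ℤ.+ ℤ.0ℤ
            ≡⟨ cong (λ z → ℤ.+ c ℤ.+ z) (sym (ℤₚ.+-inverseʳ (ℤ.+ halves))) ⟩
          ℤ.+ c ℤ.+ (ℤ.+ halves ℤ.+ ℤ.- (ℤ.+ halves))
            ≡⟨ sym (ℤₚ.+-assoc (ℤ.+ c) (ℤ.+ halves) (ℤ.- (ℤ.+ halves))) ⟩
          (ℤ.+ c ℤ.+ ℤ.+ halves) ℤ.+ ℤ.- (ℤ.+ halves)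
            ≡⟨ cong (λ z → z ℤ.+ ℤ.- (ℤ.+ halves))
            (trans (sym (ℤₚ.pos-+ c halves)) (cong ℤ.+_
            (count-fixed-by n d (m≡quotient (s≤s z≤n) d∣l) (λ 2∣d → l-odd (∣-trans 2∣d d∣l))))) ⟩
          ℤ.+ (q ℕ.^ n) ℤ.+ ℤ.- (ℤ.+ halves)                 ∎
          where c = count (fixed-by? n) Y

    -- Elements of degree 2m are moved by φ, so they all belong to `Y`. The double sum over u and d
    -- detects them when d is summed first; summing over u first gives the Möbius sum, less `halves`
    -- times the sum of μ over the divisors of l.
    count-A : ℤ.+ count A? elements ≡ mobiusSum q m l ℤ.+ ℤ.- (ℤ.+ halves) ℤ.* (ℤ.+ floorRecip l)
    count-A = begin
      ℤ.+ count A? elements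
        ≡⟨ cong ℤ.+_ (length-≡ (Uniqueₚ.filter⁺ A? elements-unique)
        (Uniqueₚ.filter⁺ (λ u → Ord? u (2 ℕ.* m)) Y-unique) to from) ⟩
      ℤ.+ count (λ u → Ord? u (2 ℕ.* m)) Y                        ≡⟨ count-∑ℤ (λ u → Ord? u (2 ℕ.* m)) Y ⟩
      ∑ℤ (λ u → if ⌊ Ord? u (2 ℕ.* m) ⌋ then ℤ.1ℤ else ℤ.0ℤ) Y    ≡⟨ ∑ℤ-cong Y (λ u∈ → let eq , moved = proj₂ (∈-filter⁻ Y? {xs = elements} u∈) in sym (∑-inversionTerm eq moved)) ⟩
      ∑ℤ (λ u → ∑ℤ (λ d → inversionTerm d u) (positives l)) Y
        ≡⟨ ∑ℤ-swap (λ u d → inversionTerm d u) Y (positives l) ⟩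
      ∑ℤ (λ d → ∑ℤ (inversionTerm d) Y) (positives l)             ≡⟨ ∑ℤ-cong (positives l) ∑-over-Y ⟩
      ∑ℤ (λ d → mobiusTerm q m l d ℤ.+ c ℤ.* g d) (positives l)
        ≡⟨ ∑ℤ-+ (mobiusTerm q m l) (λ d → c ℤ.* g d) (positives l) ⟩
      ∑ℤ (mobiusTerm q m l) (positives l) ℤ.+ ∑ℤ (λ d → c ℤ.* g d) (positives l)
        ≡⟨ cong₂ ℤ._+_ (sym (mobiusSum-∑ℤ q m l)) (trans (∑ℤ-*ˡ c g (positives l))
            (cong (λ z → c ℤ.* z) (trans (sym (∑ℤ-filter (_∣? l) μ (positives l))) (∑μ-floorRecip l 0<l)))) ⟩
      mobiusSum q m l ℤ.+ c ℤ.* (ℤ.+ floorRecip l)                ∎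
      where
      c = ℤ.- (ℤ.+ halves)
      g : ℕ → ℤ
      g d = if ⌊ d ∣? l ⌋ then μ d else ℤ.0ℤ
      m<2m : m < 2 ℕ.* m
      m<2m = subst (m <_) (sym 2m≡m+m) (ℕₚ.m<m+n m 0<m)
      to : ∀ {u} → u ∈ filter A? elements → u ∈ filter (λ u → Ord? u (2 ℕ.* m)) Y
      to {u} u∈ = let eq , ord = proj₂ (∈-filter⁻ A? {xs = elements} u∈) in
        ∈-filter⁺ (λ u → Ord? u (2 ℕ.* m)) (∈-filter⁺ Y? (elements-complete u) (eq , proj₂ ord m 0<m m<2m)) ord
      from : ∀ {u} → u ∈ filter (λ u → Ord? u (2 ℕ.* m)) Y → u ∈ filter A? elements
      from {u} u∈ = let u∈Y , ord = ∈-filter⁻ (λ u → Ord? u (2 ℕ.* m)) {xs = Y} u∈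
                        eq , _ = proj₂ (∈-filter⁻ Y? {xs = elements} u∈Y) in
        ∈-filter⁺ A? (elements-complete u) (eq , ord)

-- Block form of the matrices and the relation for T²

tabulate-++ : ∀ {A : Set} m {n} (f : Fin (m ℕ.+ n) → A) → Vec.tabulate f ≡ Vec.tabulate (λ i → f (i ↑ˡ n)) ++
  Vec.tabulate (λ j → f (m ↑ʳ j))
tabulate-++ zero f = refl
tabulate-++ (suc m) f = cong (f zero ∷_) (tabulate-++ m (λ i → f (suc i)))

tabulate-remQuot : ∀ {A : Set} m (g : Fin 2 × Fin m → A) →
  Vec.tabulate (λ s → g (remQuot {2} m s)) ≡ Vec.tabulate (λ b → g (zero , b)) ++
    (Vec.tabulate (λ b → g (suc zero , b)) ++ [])
tabulate-remQuot m g = trans (tabulate-++ m (λ s → g (remQuot {2} m s))) (cong₂ _++_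
  (Vecₚ.tabulate-cong (λ b → cong g (Finₚ.remQuot-combine {2} zero b)))
  (trans (tabulate-++ m (λ j → g (remQuot {2} m (m ↑ʳ j))))
    (cong (_++ []) (Vecₚ.tabulate-cong (λ b → cong g (Finₚ.remQuot-combine {2} (suc zero) b))))))

module Blocks (F : FiniteField) where
  open Field F
  open Polynomial F
  open Linear F
  open Matrices F

  prodSpace : Space → Space → Space
  prodSpace S S′ = record
    { V = S.V × S′.V
    ; add = λ (a , b) (c , d) → S.add a c , S′.add b d
    ; smul = λ k (a , b) → S.smul k a , S′.smul k b
    ; 𝟘 = S.𝟘 , S′.𝟘
    ; add-assoc = λ _ _ _ → cong₂ _,_ (S.add-assoc _ _ _) (S′.add-assoc _ _ _)
    ; add-comm = λ _ _ → cong₂ _,_ (S.add-comm _ _) (S′.add-comm _ _)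
    ; add-identityˡ = λ _ → cong₂ _,_ (S.add-identityˡ _) (S′.add-identityˡ _)
    ; smul-add = λ _ _ _ → cong₂ _,_ (S.smul-add _ _ _) (S′.smul-add _ _ _)
    ; add-smul = λ _ _ _ → cong₂ _,_ (S.add-smul _ _ _) (S′.add-smul _ _ _)
    ; smul-smul = λ _ _ _ → cong₂ _,_ (S.smul-smul _ _ _) (S′.smul-smul _ _ _)
    ; 1-smul = λ _ → cong₂ _,_ (S.1-smul _) (S′.1-smul _)
    ; 0-smul = λ _ → cong₂ _,_ (S.0-smul _) (S′.0-smul _) }
    where
    module S = Space S
    module S′ = Space S′

  -- The empty third part is there because 2 * m unfolds to m + (m + 0).
  join : ∀ {m} → Vector m → Vector m → Vector (2 ℕ.* m)
  join x y = x ++ (y ++ [])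

  pairSpace : ℕ → Space
  pairSpace m = prodSpace (vecSpace m) (vecSpace m)

  join-linear : ∀ m → IsLinear (pairSpace m) (vecSpace (2 ℕ.* m)) (λ (x , y) → join x y)
  join-linear m = record { map-⊕ = λ (x , y) (x′ , y′) → join-+ x y x′ y′ ; map-• = λ c (x , y) → join-* c x y }
    where
    join-+ : ∀ (x y x′ y′ : Vector m) → join (x +ᵥ x′) (y +ᵥ y′) ≡ join x y +ᵥ join x′ y′
    join-+ x y x′ y′ = sym (trans (Vecₚ.zipWith-++ _+_ x (y ++ []) x′ (y′ ++ []))
      (cong ((x +ᵥ x′) ++_) (Vecₚ.zipWith-++ _+_ y [] y′ [])))
    join-* : ∀ c (x y : Vector m) → join (c *ᵥ x) (c *ᵥ y) ≡ c *ᵥ join x y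
    join-* c x y = sym (trans (Vecₚ.map-++ (c *_) x (y ++ [])) (cong ((c *ᵥ x) ++_) (Vecₚ.map-++ (c *_) y [])))

  join-injective : ∀ {m} (x y x′ y′ : Vector m) → join x y ≡ join x′ y′ → x ≡ x′ × y ≡ y′
  join-injective x y x′ y′ eq = Vecₚ.++-injectiveˡ x x′ eq , Vecₚ.++-injectiveˡ y y′ (Vecₚ.++-injectiveʳ x x′ eq)

  combine-++ : ∀ {k l n} (u : Vector k) (v : Vector l) (M : Vec (Vector n) k) N → combine (u ++ v) (M ++ N) ≡
    combine u M +ᵥ combine v N
  combine-++ {n = n} [] v [] N = sym (V.add-identityˡ n _)
  combine-++ {n = n} (a ∷ u) v (r ∷ M) N = trans (cong (a *ᵥ r +ᵥ_) (combine-++ u v M N)) (sym (V.add-assoc n _ _ _))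

  tsrEntry : ∀ {m} → Vec Carrier 2 → Defs.Matrix F m → Fin 2 × Fin m → Fin 2 × Fin m → Carrier
  tsrEntry c B (I , a) (J , b) =
    if toℕ J ≡ᵇ 1 then Vec.lookup c I * Vec.lookup (Vec.lookup B a) b
    else if toℕ I ≡ᵇ suc (toℕ J) then (if toℕ a ≡ᵇ toℕ b then 1# else 0#) else 0#

  tsr-entry : ∀ {m} c (B : Defs.Matrix F m) → Defs.tsr F m 2 c B ≡ Vec.tabulate λ r → Vec.tabulate λ s → tsrEntry c
    B (remQuot {2} m r) (remQuot {2} m s)
  tsr-entry c B = refl

  module _ {m} (c₀ c₁ : Carrier) (B : Defs.Matrix F m) where

    upper lower : Fin m → Vector (2 ℕ.* m)
    upper a = join 0ᵥ (c₀ *ᵥ Vec.lookup B a)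
    lower a = join (Vec.lookup (Defs.identity F m) a) (c₁ *ᵥ Vec.lookup B a)

    private
      tabulate-row : ∀ c a → Vec.tabulate (λ b → c * Vec.lookup (Vec.lookup B a) b) ≡ c *ᵥ Vec.lookup B a
      tabulate-row c a = trans (Vecₚ.tabulate-∘ (c *_) (Vec.lookup (Vec.lookup B a)))
        (cong (c *ᵥ_) (Vecₚ.tabulate∘lookup (Vec.lookup B a)))
      zeros : ∀ n → Vec.tabulate {n = n} (λ _ → 0#) ≡ 0ᵥ
      zeros zero = refl
      zeros (suc n) = cong (0# ∷_) (zeros n)

    tsr-blocks : Defs.tsr F m 2 (c₀ ∷ c₁ ∷ []) B ≡ Vec.tabulate upper ++ (Vec.tabulate lower ++ [])
    tsr-blocks = trans (tsr-entry (c₀ ∷ c₁ ∷ []) B)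
      (trans (tabulate-remQuot m (λ p → Vec.tabulate (λ s → e p (remQuot {2} m s)))) (cong₂ _++_
      (Vecₚ.tabulate-cong (λ a → trans (tabulate-remQuot m (e (zero , a)))
        (cong₂ join (zeros m) (tabulate-row c₀ a))))
      (cong (_++ []) (Vecₚ.tabulate-cong (λ a → trans (tabulate-remQuot m (e (suc zero , a)))
        (cong₂ join (sym (Vecₚ.lookup∘tabulate (λ i → Vec.tabulate λ j → if toℕ i ≡ᵇ toℕ j then 1# else 0#) a))
        (tabulate-row c₁ a)))))))
      where
      e = tsrEntry (c₀ ∷ c₁ ∷ []) B

    private
      upper-map : Vec.tabulate upper ≡ Vec.map (λ r → join 0ᵥ (c₀ *ᵥ r)) B
      upper-map = trans (Vecₚ.tabulate-∘ (λ r → join 0ᵥ (c₀ *ᵥ r)) (Vec.lookup B))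
        (cong (Vec.map _) (Vecₚ.tabulate∘lookup B))

      combine-affine : ∀ x y → combine (c₀ *ᵥ x +ᵥ c₁ *ᵥ y) B ≡ c₀ *ᵥ combine x B +ᵥ c₁ *ᵥ combine y B
      combine-affine x y = trans (map-⊕ (combine-linear B) (c₀ *ᵥ x) (c₁ *ᵥ y))
        (cong₂ _+ᵥ_ (map-• (combine-linear B) c₀ x) (map-• (combine-linear B) c₁ y))

      upper-linear : LinearV (λ r → join 0ᵥ (c₀ *ᵥ r))
      upper-linear = record
        { map-⊕ = λ u v → trans (cong₂ join (sym (V.add-identityˡ m 0ᵥ)) (V.smul-add m c₀ u v))
          (map-⊕ (join-linear m) (0ᵥ , c₀ *ᵥ u) (0ᵥ , c₀ *ᵥ v))
        ; map-• = λ k u → trans (cong₂ join (sym (V.smul-0 m k)) (V.smul-comm m c₀ k u))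
          (map-• (join-linear m) k (0ᵥ , c₀ *ᵥ u)) }

      combine-join : ∀ {n} (g h : Fin n → Vector m) (y : Vector n) →
        combine y (Vec.tabulate (λ a → join (g a) (h a))) ≡ join (combine y (Vec.tabulate g))
          (combine y (Vec.tabulate h))
      combine-join g h [] = sym (map-𝟘 (join-linear m))
      combine-join g h (a ∷ y) = trans (cong₂ _+ᵥ_ (sym (map-• (join-linear m) a (g zero , h zero)))
        (combine-join (λ i → g (suc i)) (λ i → h (suc i)) y))
        (sym (map-⊕ (join-linear m) (a *ᵥ g zero , a *ᵥ h zero)
        (combine y (Vec.tabulate (λ i → g (suc i))) , combine y (Vec.tabulate (λ i → h (suc i))))))

    -- Right multiplication of (x, y) by T, whose block columns are (0, I) and (c₀ B, c₁ B) from top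
    -- to bottom.
    blockOp : Vector m × Vector m → Vector m × Vector m
    blockOp (x , y) = y , combine (c₀ *ᵥ x +ᵥ c₁ *ᵥ y) B

    combine-tsr : ∀ x y → combine (join x y) (Defs.tsr F m 2 (c₀ ∷ c₁ ∷ []) B) ≡ join (proj₁ (blockOp (x , y)))
      (proj₂ (blockOp (x , y)))
    combine-tsr x y = begin
      combine (join x y) (Defs.tsr F m 2 (c₀ ∷ c₁ ∷ []) B)                 ≡⟨ cong (combine (join x y)) tsr-blocks ⟩
      combine (join x y) (Vec.tabulate upper ++ (Vec.tabulate lower ++ []))
        ≡⟨ trans (combine-++ x (y ++ []) _ _)
        (cong (combine x (Vec.tabulate upper) +ᵥ_) (trans (combine-++ y [] _ []) (V.add-identityʳ (2 ℕ.* m) _))) ⟩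
      combine x (Vec.tabulate upper) +ᵥ combine y (Vec.tabulate lower)
        ≡⟨ cong₂ _+ᵥ_ (trans (cong (combine x) upper-map) (combine-map upper-linear x B))
             (trans (combine-join (Vec.lookup (Defs.identity F m)) (λ a → c₁ *ᵥ Vec.lookup B a) y) (cong₂ join
               (trans (cong (combine y) (Vecₚ.tabulate∘lookup (Defs.identity F m))) (combine-identity y))
               (trans (cong (combine y) (trans (Vecₚ.tabulate-∘ (c₁ *ᵥ_) (Vec.lookup B))
                 (cong (Vec.map _) (Vecₚ.tabulate∘lookup B)))) (combine-map (smul-linear (vecSpace m) c₁) y B)))) ⟩
      join 0ᵥ (c₀ *ᵥ combine x B) +ᵥ join y (c₁ *ᵥ combine y B)
        ≡⟨ sym (map-⊕ (join-linear m) (0ᵥ , c₀ *ᵥ combine x B) (y , c₁ *ᵥ combine y B)) ⟩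
      join (0ᵥ +ᵥ y) (c₀ *ᵥ combine x B +ᵥ c₁ *ᵥ combine y B)
        ≡⟨ cong₂ join (V.add-identityˡ m y) (sym (combine-affine x y)) ⟩
      join y (combine (c₀ *ᵥ x +ᵥ c₁ *ᵥ y) B)                              ∎

    diagOp : Vector m × Vector m → Vector m × Vector m
    diagOp (x , y) = combine x B , combine y B

    blockOp-linear : IsLinear (pairSpace m) (pairSpace m) blockOp
    blockOp-linear = record
      { map-⊕ = λ (x , y) (x′ , y′) → cong (_ ,_)
        (trans (cong (λ z → combine z B) (trans (cong₂ _+ᵥ_ (V.smul-add m c₀ x x′) (V.smul-add m c₁ y y′))
        (V.interchange m (c₀ *ᵥ x) (c₀ *ᵥ x′) (c₁ *ᵥ y) (c₁ *ᵥ y′))))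
        (map-⊕ (combine-linear B) (c₀ *ᵥ x +ᵥ c₁ *ᵥ y) (c₀ *ᵥ x′ +ᵥ c₁ *ᵥ y′)))
      ; map-• = λ k (x , y) → cong (_ ,_)
        (trans (cong (λ z → combine z B) (trans (cong₂ _+ᵥ_ (V.smul-comm m c₀ k x) (V.smul-comm m c₁ k y))
        (sym (V.smul-add m k (c₀ *ᵥ x) (c₁ *ᵥ y))))) (map-• (combine-linear B) k (c₀ *ᵥ x +ᵥ c₁ *ᵥ y))) }

    diagOp-linear : IsLinear (pairSpace m) (pairSpace m) diagOp
    diagOp-linear = record
      { map-⊕ = λ (x , y) (x′ , y′) → cong₂ _,_ (map-⊕ (combine-linear B) x x′) (map-⊕ (combine-linear B) y y′)
      ; map-• = λ k (x , y) → cong₂ _,_ (map-• (combine-linear B) k x) (map-• (combine-linear B) k y) }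

    diag-block : ∀ p → diagOp (blockOp p) ≡ blockOp (diagOp p)
    diag-block (x , y) = cong (_ ,_) (cong (λ z → combine z B) (combine-affine x y))

    block² : ∀ p → blockOp (blockOp p) ≡ Space.add (pairSpace m) (Space.smul (pairSpace m) c₀ (diagOp p))
      (Space.smul (pairSpace m) c₁ (blockOp (diagOp p)))
    block² (x , y) = cong₂ _,_ (combine-affine x y)
      (trans (combine-affine y (combine (c₀ *ᵥ x +ᵥ c₁ *ᵥ y) B))
      (cong (λ z → c₀ *ᵥ combine y B +ᵥ c₁ *ᵥ combine z B) (combine-affine x y)))

    act-tsr : ∀ f x y → act (vecSpace (2 ℕ.* m)) (λ w → combine w (Defs.tsr F m 2 (c₀ ∷ c₁ ∷ []) B)) f (join x y)
      ≡ join (proj₁ (act (pairSpace m) blockOp f (x , y))) (proj₂ (act (pairSpace m) blockOp f (x , y)))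
    act-tsr f x y = sym (act-intertwine (pairSpace m) (vecSpace (2 ℕ.* m)) (join-linear m)
      (λ (x , y) → sym (combine-tsr x y)) f (x , y))

    charPoly-blockOp : ∀ p → act (pairSpace m) blockOp
      (Defs.charPoly F (2 ℕ.* m) (Defs.tsr F m 2 (c₀ ∷ c₁ ∷ []) B)) p ≡ Space.𝟘 (pairSpace m)
    charPoly-blockOp (x , y) = cong₂ _,_ (proj₁ zero-pair) (proj₂ zero-pair)
      where
      χ = Defs.charPoly F (2 ℕ.* m) (Defs.tsr F m 2 (c₀ ∷ c₁ ∷ []) B)
      zero-pair = join-injective _ _ 0ᵥ 0ᵥ
        (trans (sym (act-tsr χ x y)) (trans
        (CharacteristicPolynomial.cayley-hamilton F (Defs.tsr F m 2 (c₀ ∷ c₁ ∷ []) B) (join x y))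
        (sym (map-𝟘 (join-linear m)))))

    act-diagOp : ∀ f x y → act (pairSpace m) diagOp f (x , y) ≡
      (act (vecSpace m) (λ w → combine w B) f x , act (vecSpace m) (λ w → combine w B) f y)
    act-diagOp [] x y = refl
    act-diagOp (a ∷ f) x y = cong (λ (u , v) → a *ᵥ x +ᵥ combine u B , a *ᵥ y +ᵥ combine v B) (act-diagOp f x y)

  affine : Carrier → Carrier → Poly
  affine c₀ c₁ = c₀ ∷ c₁ ∷ []

  affine^ : Carrier → Carrier → ℕ → Poly
  affine^ c₀ c₁ zero = 1# ∷ []
  affine^ c₀ c₁ (suc n) = mulP (affine c₀ c₁) (affine^ c₀ c₁ n)

  -- hat c₀ c₁ f is (c₀ + c₁ X)^n f(X² / (c₀ + c₁ X)) for the monic polynomial f of degree n.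
  hat : Carrier → Carrier → ∀ {n} → Vector n → Poly
  hat c₀ c₁ [] = 1# ∷ []
  hat c₀ c₁ {suc n} (a ∷ v) = addP (scale a (affine^ c₀ c₁ (suc n))) (0# ∷ 0# ∷ hat c₀ c₁ v)

  affine^-DegLt : ∀ c₀ c₁ n → DegLt (affine^ c₀ c₁ n) (suc n)
  affine^-DegLt c₀ c₁ zero = DegLt-length (1# ∷ [])
  affine^-DegLt c₀ c₁ (suc n) = DegLt-mulP (affine c₀ c₁) (affine^ c₀ c₁ n) {2} {n} (DegLt-length (affine c₀ c₁))
    (affine^-DegLt c₀ c₁ n)

  -- The summand with the power of c₀ + c₁ X has degree at most n + 1 < 2 (n + 1), so the top
  -- coefficient comes from X² times the shorter polynomial.
  hat-Monic : ∀ c₀ c₁ {n} (v : Vector n) → Monic (hat c₀ c₁ v) (2 ℕ.* n)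
  hat-Monic c₀ c₁ [] = refl , DegLt-length (1# ∷ [])
  hat-Monic c₀ c₁ {suc n} (a ∷ v) = subst (Monic (hat c₀ c₁ (a ∷ v))) (sym 2+2n)
    ( trans (coef-addP low high (2 ℕ.+ 2 ℕ.* n))
      (trans (cong₂ _+_ (DegLt-scale a (affine^ c₀ c₁ (suc n)) (affine^-DegLt c₀ c₁ (suc n)) (2 ℕ.+ 2 ℕ.* n)
      (s≤s (s≤s (ℕₚ.m≤m+n n _)))) (proj₁ (hat-Monic c₀ c₁ v))) (+-identityˡ 1#))
    , DegLt-addP low high (DegLt-mono {low} (s≤s (s≤s (ℕₚ.≤-trans (ℕₚ.m≤m+n n (n ℕ.+ 0)) (ℕₚ.n≤1+n _))))
      (DegLt-scale a (affine^ c₀ c₁ (suc n)) (affine^-DegLt c₀ c₁ (suc n))))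
        (DegLt-∷ {0#} {0# ∷ hat c₀ c₁ v} (DegLt-∷ {0#} {hat c₀ c₁ v} (proj₂ (hat-Monic c₀ c₁ v)))) )
    where
    low = scale a (affine^ c₀ c₁ (suc n))
    high = 0# ∷ 0# ∷ hat c₀ c₁ v
    2+2n : 2 ℕ.* suc n ≡ 2 ℕ.+ 2 ℕ.* n
    2+2n = cong suc (ℕₚ.+-suc n (n ℕ.+ 0))

  module _ (S : Space) {T B : Space.V S → Space.V S} (lT : IsLinear S S T) (lB : IsLinear S S B) (c₀ c₁ : Carrier)
           (BT : ∀ v → B (T v) ≡ T (B v)) (T² : ∀ v → T (T v) ≡ Space.add S (Space.smul S c₀ (B v))
             (Space.smul S c₁ (T (B v)))) where
    private
      module AT = Action S T lT
      module AB = Action S B lB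
      module S = SpaceLaws S
      Y = affine c₀ c₁

    act-affine : ∀ v → act S T Y v ≡ Space.add S (Space.smul S c₀ v) (Space.smul S c₁ (T v))
    act-affine v = cong (Space.add S (Space.smul S c₀ v))
      (trans (cong T (trans (cong (Space.add S (Space.smul S c₁ v)) (map-𝟘 lT)) (S.add-identityʳ _))) (map-• lT c₁ v))

    act-commute : ∀ f g v → act S B f (act S T g v) ≡ act S T g (act S B f v)
    act-commute f g v = act-intertwine S S (AB.act-linear f)
      (λ w → sym (act-intertwine S S {T = B} lT (λ u → sym (BT u)) f w)) g v

    -- Stated for any commuting pair of operators with T² = (c₀ + c₁ T) B: it is applied to T with
    -- diag(B, B) on pairs, and to multiplication by α and β on the extension field.
    act-hat : ∀ {n} (c : Vector n) v → act S T (hat c₀ c₁ c) v ≡ act S B (mon c) (act S T (affine^ c₀ c₁ n) v)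
    act-hat [] v = sym (AB.act-one _)
    act-hat {suc n} (a ∷ c) v = begin
      act S T (addP (scale a Y^) (0# ∷ 0# ∷ hat c₀ c₁ c)) v
        ≡⟨ AT.act-addP (scale a Y^) (0# ∷ 0# ∷ hat c₀ c₁ c) v ⟩
      Space.add S (act S T (scale a Y^) v) (act S T (0# ∷ 0# ∷ hat c₀ c₁ c) v)
        ≡⟨ cong₂ (Space.add S) (AT.act-scale a Y^ v)
          (trans (AT.act-shift (0# ∷ hat c₀ c₁ c) v) (cong T (AT.act-shift (hat c₀ c₁ c) v))) ⟩
      Space.add S (Space.smul S a (act S T Y^ v)) (T (T (act S T (hat c₀ c₁ c) v)))
        ≡⟨ cong (Space.add S (Space.smul S a (act S T Y^ v))) (begin
             T (T (act S T (hat c₀ c₁ c) v))                              ≡⟨ cong (λ w → T (T w)) (act-hat c v) ⟩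
             T (T (act S B (mon c) (act S T (affine^ c₀ c₁ n) v)))        ≡⟨ trans (T² _) (sym (act-affine _)) ⟩
             act S T Y (B (act S B (mon c) (act S T (affine^ c₀ c₁ n) v)))
               ≡⟨ sym (act-intertwine S S {T = T} {T′ = T} lB BT Y (act S B (mon c) (act S T (affine^ c₀ c₁ n) v))) ⟩
             B (act S T Y (act S B (mon c) (act S T (affine^ c₀ c₁ n) v))) ≡⟨ cong B (sym (act-commute (mon c) Y _)) ⟩
             B (act S B (mon c) (act S T Y (act S T (affine^ c₀ c₁ n) v)))
               ≡⟨ cong (λ w → B (act S B (mon c) w)) (sym (AT.act-mulP Y (affine^ c₀ c₁ n) v)) ⟩
             B (act S B (mon c) (act S T Y^ v))                           ∎) ⟩
      Space.add S (Space.smul S a (act S T Y^ v)) (B (act S B (mon c) (act S T Y^ v))) ∎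
      where Y^ = affine^ c₀ c₁ (suc n)

  -- With c₀ = 1 the upper right block is B, so a normalized matrix determines B.
  upperRight : ∀ {m} → Defs.Matrix F (2 ℕ.* m) → Defs.Matrix F m
  upperRight {m} T = Vec.tabulate λ a → Vec.tabulate λ b → Vec.lookup (Vec.lookup T (Fin.combine {2} zero a))
    (Fin.combine {2} (suc zero) b)

  upperRight-tsr : ∀ {m} c₁ (B : Defs.Matrix F m) → upperRight (Defs.tsr F m 2 (1# ∷ c₁ ∷ []) B) ≡ B
  upperRight-tsr {m} c₁ B = trans (Vecₚ.tabulate-cong
    (λ a → trans (Vecₚ.tabulate-cong (λ b → entry a b)) (Vecₚ.tabulate∘lookup (Vec.lookup B a))))
    (Vecₚ.tabulate∘lookup B)
    where
    entry : ∀ a b → Vec.lookup (Vec.lookup (Defs.tsr F m 2 (1# ∷ c₁ ∷ []) B) (Fin.combine {2} zero a))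
      (Fin.combine {2} (suc zero) b) ≡ Vec.lookup (Vec.lookup B a) b
    entry a b = begin
      Vec.lookup (Vec.lookup (Defs.tsr F m 2 (1# ∷ c₁ ∷ []) B) (a ↑ˡ (1 ℕ.* m))) (m ↑ʳ (b ↑ˡ 0))
        ≡⟨ cong (λ T → Vec.lookup (Vec.lookup T (a ↑ˡ (1 ℕ.* m))) (m ↑ʳ (b ↑ˡ 0))) (tsr-blocks 1# c₁ B) ⟩
      Vec.lookup (Vec.lookup (Vec.tabulate (upper 1# c₁ B) ++ (Vec.tabulate (lower 1# c₁ B) ++ []))
        (a ↑ˡ (1 ℕ.* m))) (m ↑ʳ (b ↑ˡ 0))
        ≡⟨ cong (λ r → Vec.lookup r (m ↑ʳ (b ↑ˡ 0)))
          (trans (Vecₚ.lookup-++ˡ (Vec.tabulate (upper 1# c₁ B)) _ a) (Vecₚ.lookup∘tabulate (upper 1# c₁ B) a)) ⟩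
      Vec.lookup (join 0ᵥ (1# *ᵥ Vec.lookup B a)) (m ↑ʳ (b ↑ˡ 0))
        ≡⟨ trans (Vecₚ.lookup-++ʳ (0ᵥ {m}) ((1# *ᵥ Vec.lookup B a) ++ []) (b ↑ˡ 0))
          (Vecₚ.lookup-++ˡ (1# *ᵥ Vec.lookup B a) [] b) ⟩
      Vec.lookup (1# *ᵥ Vec.lookup B a) b
        ≡⟨ cong (λ r → Vec.lookup r b) (V.1-smul m (Vec.lookup B a)) ⟩
      Vec.lookup (Vec.lookup B a) b ∎

  -- Only the products c₀ B and c₁ B enter the matrix.
  tsr-normalize : ∀ {m} c₀ c₁ (B : Defs.Matrix F m) → c₀ ≢ 0# →
    Defs.tsr F m 2 (c₀ ∷ c₁ ∷ []) B ≡ Defs.tsr F m 2 (1# ∷ inv c₀ * c₁ ∷ []) (Vec.map (c₀ *ᵥ_) B)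
  tsr-normalize {m} c₀ c₁ B c₀≢0 = trans (tsr-blocks c₀ c₁ B) (trans (cong₂ (λ U L → U ++ (L ++ []))
      (Vecₚ.tabulate-cong (λ a → cong (join 0ᵥ) (sym (trans (V.1-smul m _) (Vecₚ.lookup-map a (c₀ *ᵥ_) B)))))
      (Vecₚ.tabulate-cong (λ a → cong (join (Vec.lookup (Defs.identity F m) a))
        (sym (trans (cong (inv c₀ * c₁ *ᵥ_) (Vecₚ.lookup-map a (c₀ *ᵥ_) B))
        (trans (sym (V.smul-smul m _ c₀ _)) (cong (_*ᵥ Vec.lookup B a) scalar)))))))
    (sym (tsr-blocks 1# (inv c₀ * c₁) (Vec.map (c₀ *ᵥ_) B))))
    where
    scalar : inv c₀ * c₁ * c₀ ≡ c₁
    scalar = trans (solve 3 (λ i c₁ c₀ → (i :* c₁) :* c₀ := (c₀ :* i) :* c₁) refl (inv c₀) c₁ c₀)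
      (trans (cong (_* c₁) (x*inv c₀≢0)) (*-identityˡ c₁))

-- Eigenvalues of a matrix with irreducible characteristic polynomial

module Eigenvalues {F E : FiniteField} (emb : Embedding F E) (p : ℕ) (0<p : 0 < p) where
  open Extension emb
  open Frobenius emb
  open IrreducibleRoots emb
  open Field E
  open Polynomial E using (roots-≤; Monic≉0)
  open Linear F
  open Matrices F using (Vector; 0ᵥ; combine; combine-linear)
  open Blocks F
  open CharacteristicPolynomial F

  m : ℕ
  m = suc p

  S : Space
  S = pairSpace m

  m<2m : m < 2 ℕ.* m
  m<2m = subst (m <_) (cong (m ℕ.+_) (sym (ℕₚ.+-identityʳ m))) (ℕₚ.m<m+n m (s≤s z≤n))

  3≤2m : 3 ≤ 2 ℕ.* m
  3≤2m = ℕₚ.≤-trans (s≤s (s≤s 0<p)) m<2m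

  TSR : F.Carrier → F.Carrier → Defs.Matrix F m → Defs.Matrix F (2 ℕ.* m)
  TSR c₀ c₁ B = Defs.tsr F m 2 (c₀ ∷ c₁ ∷ []) B

  χ : Defs.Matrix F (2 ℕ.* m) → PF.Poly
  χ T = Defs.charPoly F (2 ℕ.* m) T

  -- A nonzero vector on which polynomials in T are compared: an irreducible annihilator of it
  -- excludes nonzero annihilators of lower degree.
  witness : Space.V S
  witness = F.1# ∷ 0ᵥ , 0ᵥ

  witness≢𝟘 : witness ≢ Space.𝟘 S
  witness≢𝟘 eq = F.0≢1 (sym (cong (λ (x , _) → Vec.head x) eq))

  χ-vec : ∀ T → Σ (Vec F.Carrier (2 ℕ.* m)) λ h → χ T PF.≈ₚ PF.mon h
  χ-vec T = PF.Monic⇒mon (χ T) (charPoly-Monic T)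

  χ-Irr : ∀ T → Defs.IrreducibleP F (χ T) → Irr (proj₁ (χ-vec T))
  χ-Irr T irr = Irreducibility.irreducibleP⇒Irr F (proj₁ (χ-vec T)) (χ T) (proj₂ (χ-vec T)) irr

  act-hat-𝟘 : ∀ c₀ c₁ B (f : Vector m) → (∀ x → act (vecSpace m) (λ w → combine w B) (PF.mon f) x ≡ 0ᵥ) →
    ∀ w → act S (blockOp c₀ c₁ B) (hat c₀ c₁ f) w ≡ Space.𝟘 S
  act-hat-𝟘 c₀ c₁ B f kill w = trans (act-hat S (blockOp-linear c₀ c₁ B) (diagOp-linear c₀ c₁ B) c₀ c₁
    (diag-block c₀ c₁ B) (block² c₀ c₁ B) f w)
    (trans (act-diagOp c₀ c₁ B (PF.mon f) _ _) (cong₂ _,_ (kill _) (kill _)))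

  act-subP-𝟘 : ∀ {T : Space.V S → Space.V S} (lT : IsLinear S S T) f g w → act S T f w ≡ Space.𝟘 S → act S T g w ≡
    Space.𝟘 S → act S T (subP F f g) w ≡ Space.𝟘 S
  act-subP-𝟘 {T} lT f g w fw gw = trans (A.act-addP f (PF.scale (F.- F.1#) g) w) (trans (cong₂ (Space.add S) fw
    (trans (A.act-scale (F.- F.1#) g w)
      (trans (cong (Space.smul S (F.- F.1#)) gw) (SpaceLaws.smul-0 S (F.- F.1#))))) (Space.add-identityˡ S _))
    where module A = Action S T lT

  vanishing⇒≈0 : ∀ {T : Space.V S → Space.V S} (lT : IsLinear S S T) (h : Vec F.Carrier (2 ℕ.* m)) → Irr h → act S
    T (PF.mon h) witness ≡ Space.𝟘 S →
    ∀ f → PF.DegLt f (2 ℕ.* m) → act S T f witness ≡ Space.𝟘 S → f PF.≈ₚ []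
  vanishing⇒≈0 {T} lT h irr hw f lt fw = cases (PF.degree f)
    where
    cases : f PF.≈ₚ [] ⊎ (∃[ e ] PF.ExactDeg f e) → f PF.≈ₚ []
    cases (inj₁ f≈0) = f≈0
    cases (inj₂ (e , f≢0 , _)) = ⊥-elim (witness≢𝟘 (faithful S T lT h irr witness hw f lt (λ f≈0 → f≢0 (f≈0 e)) fw))

  -- The difference of two monic polynomials of degree 2m has lower degree and annihilates
  -- `witness`, as does the irreducible h. The alternative serves both directions: irreducibility is
  -- known of χ when T is given, and of `hat` when u is given.
  annihilated-equal : ∀ c₀ c₁ B f (h : Vec F.Carrier (2 ℕ.* m)) → Irr h → PF.Monic f (2 ℕ.* m) → f PF.≈ₚ PF.mon h ⊎
    χ (TSR c₀ c₁ B) PF.≈ₚ PF.mon h →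
    act S (blockOp c₀ c₁ B) f witness ≡ Space.𝟘 S → χ (TSR c₀ c₁ B) PF.≈ₚ f
  annihilated-equal c₀ c₁ B f h irr mf either fw = subP≈0⇒≈ F (χ T) f
    (vanishing⇒≈0 lT h irr (hw either) (subP F (χ T) f)
      (Monic-subP F (χ T) f (charPoly-Monic T) mf) (act-subP-𝟘 lT (χ T) f witness χw fw))
    where
    T = TSR c₀ c₁ B
    lT = blockOp-linear c₀ c₁ B
    χw = charPoly-blockOp c₀ c₁ B witness
    module A = Action S (blockOp c₀ c₁ B) lT
    hw : f PF.≈ₚ PF.mon h ⊎ χ T PF.≈ₚ PF.mon h → act S (blockOp c₀ c₁ B) (PF.mon h) witness ≡ Space.𝟘 S
    hw (inj₁ eq) = trans (sym (A.act-≈ f (PF.mon h) witness eq)) fw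
    hw (inj₂ eq) = trans (sym (A.act-≈ (χ T) (PF.mon h) witness eq)) χw

  evalι-hat : ∀ c₀ c₁ {n} (f : Vector n) {α β} → α * α ≡ (ι c₀ + ι c₁ * α) * β → evalι (hat c₀ c₁ f) α ≡ evalι
    (PF.mon f) β * evalι (affine^ c₀ c₁ n) α
  evalι-hat c₀ c₁ {n} f {α} {β} eq = trans (evalι-act α (hat c₀ c₁ f))
    (trans (act-hat extSpace (*-linear α) (*-linear β) c₀ c₁
      (λ v → solve 3 (λ a b v → b :* (a :* v) := a :* (b :* v)) refl α β v)
      (λ v → trans (sym (*-assoc α α v)) (trans (cong (_* v) eq)
        (solve 5 (λ c₀ c₁ a b v → ((c₀ :+ c₁ :* a) :* b) :* v := c₀ :* (b :* v) :+ c₁ :* (a :* (b :* v))) refl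
        (ι c₀) (ι c₁) α β v))) f 1#)
    (trans (act-evalι β (PF.mon f) _) (cong (evalι (PF.mon f) β *_) (sym (evalι-act α (affine^ c₀ c₁ n))))))

  evalι-affine : ∀ c₀ c₁ α → evalι (affine c₀ c₁) α ≡ ι c₀ + ι c₁ * α
  evalι-affine c₀ c₁ α = solve 3 (λ c₀ c₁ a → c₀ :+ a :* (c₁ :+ a :* con (ℤ.+ 0)) := c₀ :+ c₁ :* a) refl (ι c₀)
    (ι c₁) α

  evalι-affine^≢0 : ∀ c₀ c₁ {α} n → ι c₀ + ι c₁ * α ≢ 0# → evalι (affine^ c₀ c₁ n) α ≢ 0#
  evalι-affine^≢0 c₀ c₁ {α} zero ne eq = 0≢1
    (sym (trans (sym ι-1) (trans (sym (+-identityʳ (ι F.1#))) (trans (cong (ι F.1# +_) (sym (zeroʳ α))) eq))))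
  evalι-affine^≢0 c₀ c₁ {α} (suc n) ne eq = evalι-affine^≢0 c₀ c₁ n ne
    (xy≡0⇒y≡0 (λ e → ne (trans (sym (evalι-affine c₀ c₁ α)) e))
    (trans (sym (evalι-mulP (affine c₀ c₁) (affine^ c₀ c₁ n) α)) eq))

  -- Vieta for two distinct roots: subtract the equations and cancel α - γ.
  quadratic-sum : ∀ {a b α γ β} → α * α ≡ (a + b * α) * β → γ * γ ≡ (a + b * γ) * β → α ≢ γ → α + γ ≡ b * β
  quadratic-sum {a} {b} {α} {γ} {β} α² γ² α≢γ = x-y≡0⇒x≡y (xy≡0⇒y≡0 (λ eq → α≢γ (x-y≡0⇒x≡y eq)) (begin
    (α + - γ) * ((α + γ) + - (b * β))
      ≡⟨ solve 5 (λ a b x y β → (x :+ :- y) :* ((x :+ y) :+ :- (b :* β)) := (x :* x :+ :- ((a :+ b :* x) :* β)) :+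
        :- (y :* y :+ :- ((a :+ b :* y) :* β))) refl a b α γ β ⟩
    (α * α + - ((a + b * α) * β)) + - (γ * γ + - ((a + b * γ) * β))
      ≡⟨ cong₂ (λ u v → u + - v) (x≡y⇒x-y≡0 α²) (x≡y⇒x-y≡0 γ²) ⟩
    0# + - 0#
      ≡⟨ -‿inverseʳ 0# ⟩
    0# ∎))

  -- Here `sum` and `product` are Vieta's formulas for X² - c₁ β X - c₀ β, whose roots are α and its
  -- conjugate under `frob m`.
  record Analysis (c₀ c₁ : F.Carrier) (B : Defs.Matrix F m) (α : Carrier) : Set where
    field
      β : Carrier
      order-α : Ord α (2 ℕ.* m)
      c₀≢0 : c₀ ≢ F.0#
      β≢0 : β ≢ 0#
      sum : α + frob m α ≡ ι c₁ * β
      product : ι c₀ * β ≡ - (α * frob m α)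
      β-root : evalι (Defs.charPoly F m B) β ≡ 0#

  module _ (c₀ c₁ : F.Carrier) (B : Defs.Matrix F m) (irreducible : Defs.IrreducibleP F (χ (TSR c₀ c₁ B))) {α}
    (root : evalι (χ (TSR c₀ c₁ B)) α ≡ 0#) where
    private
      T = TSR c₀ c₁ B
      h = proj₁ (χ-vec T)
      χ≈h = proj₂ (χ-vec T)
      h-irr : Irr h
      h-irr = χ-Irr T irreducible
      h-root : evalι (PF.mon h) α ≡ 0#
      h-root = trans (sym (evalι-≈ (χ T) (PF.mon h) α χ≈h)) root
      α-ord : Ord α (2 ℕ.* m)
      α-ord = irr-root⇒Ord h h-irr h-root
      f-vec = PF.Monic⇒mon (Defs.charPoly F m B) (charPoly-Monic B)
      f = proj₁ f-vec
      χB≈f = proj₂ f-vec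

      kill : ∀ x → act (vecSpace m) (λ w → combine w B) (PF.mon f) x ≡ 0ᵥ
      kill x = trans (sym (Action.act-≈ (vecSpace m) (λ w → combine w B) (combine-linear B) (Defs.charPoly F m B)
        (PF.mon f) x χB≈f)) (cayley-hamilton B x)

      χ≈hat : χ T PF.≈ₚ hat c₀ c₁ f
      χ≈hat = annihilated-equal c₀ c₁ B (hat c₀ c₁ f) h h-irr (hat-Monic c₀ c₁ f) (inj₂ χ≈h)
        (act-hat-𝟘 c₀ c₁ B f kill witness)

      low-degree : ∀ g → PF.DegLt g 2 → evalι g α ≡ 0# → g PF.≈ₚ []
      low-degree g lt eq = Ord⇒minimal (proj₂ α-ord) g (PF.DegLt-mono {g} (ℕₚ.≤-trans (s≤s (s≤s z≤n)) 3≤2m) lt) eq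

      α≢0 : α ≢ 0#
      α≢0 eq = F.0≢1 (sym (low-degree (F.0# ∷ F.1# ∷ []) (PF.DegLt-length (F.0# ∷ F.1# ∷ []))
        (trans (evalι-affine F.0# F.1# α) (trans (cong₂ _+_ ι-0 (trans (cong (ι F.1# *_) eq) (zeroʳ _)))
        (+-identityˡ 0#))) 1))

      Y : Carrier
      Y = ι c₀ + ι c₁ * α

      -- If c₀ = c₁ = 0 then T² = 0, whereas T has an irreducible annihilator of degree 2m > 2.
      Y≢0 : Y ≢ 0#
      Y≢0 eq = F.0≢1 (sym (vanishing⇒≈0 (blockOp-linear c₀ c₁ B) h h-irr
        (trans (sym (A.act-≈ (χ T) (PF.mon h) witness χ≈h)) (charPoly-blockOp c₀ c₁ B witness))
          (F.0# ∷ F.0# ∷ F.1# ∷ []) (PF.DegLt-mono {F.0# ∷ F.0# ∷ F.1# ∷ []} 3≤2m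
            (PF.DegLt-length (F.0# ∷ F.0# ∷ F.1# ∷ []))) square≡𝟘 2))
        where
        module A = Action S (blockOp c₀ c₁ B) (blockOp-linear c₀ c₁ B)
        affine≈0 : affine c₀ c₁ PF.≈ₚ []
        affine≈0 = low-degree (affine c₀ c₁) (PF.DegLt-length (affine c₀ c₁)) (trans (evalι-affine c₀ c₁ α) eq)
        square≡𝟘 : act S (blockOp c₀ c₁ B) (F.0# ∷ F.0# ∷ F.1# ∷ []) witness ≡ Space.𝟘 S
        square≡𝟘 = trans (A.act-shift (F.0# ∷ F.1# ∷ []) witness)
          (trans (cong (blockOp c₀ c₁ B) (trans (A.act-shift (F.1# ∷ []) witness)
          (cong (blockOp c₀ c₁ B) (A.act-one witness))))
          (trans (block² c₀ c₁ B witness) (trans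
            (cong₂ (λ a b → Space.add S (Space.smul S a (diagOp c₀ c₁ B witness))
            (Space.smul S b (blockOp c₀ c₁ B (diagOp c₀ c₁ B witness)))) (affine≈0 0) (affine≈0 1))
            (trans (cong₂ (Space.add S) (Space.0-smul S _) (Space.0-smul S _)) (Space.add-identityˡ S _)))))

      -- The relation α² = (c₀ + c₁ α) β solved for β.
      b : Carrier
      b = inv Y * (α * α)

      α² : α * α ≡ Y * b
      α² = sym (trans (sym (*-assoc Y (inv Y) _)) (trans (cong (_* (α * α)) (x*inv Y≢0)) (*-identityˡ _)))

      b≢0 : b ≢ 0#
      b≢0 eq = α≢0 (xy≡0⇒y≡0 α≢0 (trans α² (trans (cong (Y *_) eq) (zeroʳ Y))))

      f-root : evalι (PF.mon f) b ≡ 0#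
      f-root = xy≡0⇒y≡0 (evalι-affine^≢0 c₀ c₁ m Y≢0)
        (trans (*-comm _ _) (trans (sym (evalι-hat c₀ c₁ f α²))
        (trans (sym (evalι-≈ (χ T) (hat c₀ c₁ f) α χ≈hat)) root)))

      conjugate² : ∀ k → frob k b ≡ b → frob k α * frob k α ≡ (ι c₀ + ι c₁ * frob k α) * b
      conjugate² k fix = trans (sym (frob-* k α α))
        (trans (cong (frob k) α²) (trans (frob-* k Y b)
        (cong₂ _*_ (trans (frob-+ k _ _) (cong₂ _+_ (frob-ι k c₀)
        (trans (frob-* k _ _) (cong (_* frob k α) (frob-ι k c₁))))) fix)))

      -- As b is a root of a polynomial of degree m, its conjugates up to index m cannot all be
      -- distinct, so some k with 0 < k ≤ m satisfies `frob k b ≡ b`. Then α, `frob k α` and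
      -- `frob (2k) α` are roots of one quadratic and Vieta gives `frob (2k) α ≡ α`; since α has
      -- degree 2m, k = m.
      frob-m-b : frob m b ≡ b
      frob-m-b = cases (ℕₚ.anyUpTo? (λ k → (0 ℕ.<? k) ×-dec (frob k b ≟ b)) (suc m))
        where
        cases : Dec (∃[ k ] k < suc m × 0 < k × frob k b ≡ b) → frob m b ≡ b
        cases (no none) = ⊥-elim (ℕₚ.1+n≰n (ℕₚ.≤-trans
          (ℕₚ.≤-reflexive (sym (Listₚ.length-applyUpTo (λ i → frob i b) (suc m))))
          (roots-≤ (map ι (PF.mon f)) m (conjugates b (suc m))
            (Monic≉0 {map ι (PF.mon f)} (Monic-mapι (PF.mon f) (PF.mon-Monic f)))
            (proj₂ (Monic-mapι (PF.mon f) (PF.mon-Monic f)))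
            (conjugates-unique (λ k 0<k k<n fix → none (k , k<n , 0<k , fix)))
              (conjugates-roots (PF.mon f) b (suc m) f-root))))
        cases (yes (k , s≤s k≤m , 0<k , fix)) = subst (λ j → frob j b ≡ b) (ℕₚ.≤-antisym k≤m m≤k) fix
          where
          α₁ = frob k α
          α₂ = frob k α₁
          α≢α₁ : α ≢ α₁
          α≢α₁ eq = proj₂ α-ord k 0<k (ℕₚ.≤-<-trans k≤m m<2m) (sym eq)
          α₁≢α₂ : α₁ ≢ α₂
          α₁≢α₂ eq = α≢α₁ (frob-injective k eq)
          frob-2k : frob (k ℕ.+ k) b ≡ b
          frob-2k = trans (frob-∘ k k b) (trans (cong (frob k) fix) fix)
          α₂≡α : α₂ ≡ α
          α₂≡α = trans (solve 2 (λ x y → x := (y :+ x) :+ :- y) refl α₂ α₁)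
            (trans (cong (_+ - α₁) (trans (quadratic-sum (conjugate² k fix)
            (subst (λ z → z * z ≡ (ι c₀ + ι c₁ * z) * b) (frob-∘ k k α) (conjugate² (k ℕ.+ k) frob-2k)) α₁≢α₂)
            (sym (quadratic-sum α² (conjugate² k fix) α≢α₁)))) (solve 2 (λ x y → (x :+ y) :+ :- y := x) refl α α₁))
          m≤k : m ≤ k
          m≤k = ℕₚ.≮⇒≥ (λ k<m → proj₂ α-ord (k ℕ.+ k) (ℕₚ.≤-trans 0<k (ℕₚ.m≤m+n k k))
            (subst (k ℕ.+ k <_) (cong (m ℕ.+_) (sym (ℕₚ.+-identityʳ m))) (ℕₚ.+-mono-< k<m k<m))
            (trans (frob-∘ k k α) α₂≡α))

      α-sum : α + frob m α ≡ ι c₁ * b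
      α-sum = quadratic-sum α² (conjugate² m frob-m-b) (λ eq → proj₂ α-ord m (s≤s z≤n) m<2m (sym eq))

      α-product : ι c₀ * b ≡ - (α * frob m α)
      α-product = begin
        ι c₀ * b
          ≡⟨ solve 4 (λ c₀ c₁ a b → c₀ :* b := (c₀ :+ c₁ :* a) :* b :+ :- (a :* (c₁ :* b))) refl (ι c₀) (ι c₁) α b ⟩
        (ι c₀ + ι c₁ * α) * b + - (α * (ι c₁ * b))           ≡⟨ cong₂ (λ u v → u + - (α * v)) (sym α²) (sym α-sum) ⟩
        α * α + - (α * (α + frob m α))
          ≡⟨ solve 2 (λ a b → a :* a :+ :- (a :* (a :+ b)) := :- (a :* b)) refl α (frob m α) ⟩
        - (α * frob m α)                                     ∎

      frob-α≢0 : frob m α ≢ 0#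
      frob-α≢0 eq = α≢0 (frob-injective m (trans eq (sym (frob-0 m))))

    analysis : Analysis c₀ c₁ B α
    analysis = record
      { β = b ; order-α = α-ord ; β≢0 = b≢0 ; sum = α-sum ; product = α-product
      -- For c₀ = 0 the product of α and its conjugate would vanish.
      ; c₀≢0 = λ eq → frob-α≢0 (xy≡0⇒y≡0 α≢0
        (trans (sym (-‿involutive _)) (trans
        (cong -_ (trans (sym α-product) (trans (cong (_* b) (trans (cong ι eq) ι-0)) (zeroˡ b)))) -0#≈0#)))
      ; β-root = trans (evalι-≈ (Defs.charPoly F m B) (PF.mon f) b χB≈f) f-root }

-- Matrices with a given irreducible annihilator

length-surjection : {A B : Set} (f : A → B) {xs : List A} {ys : List B} → Unique ys →
  (∀ {y} → y ∈ ys → ∃[ x ] x ∈ xs × f x ≡ y) → length ys ≤ length xs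
length-surjection f {xs} {ys} uy onto = ℕₚ.≤-trans (length-injection (λ y → y) uy (λ _ _ eq → eq)
    (λ {y} y∈ → let x , x∈ , eq = onto y∈ in subst (_∈ map f xs) eq (∈-map⁺ f x∈)))
  (ℕₚ.≤-reflexive (Listₚ.length-map f xs))

-- The matrix with rows v, vB, vB², … .
module Krylov (F : FiniteField) {p : ℕ} where
  open Field F
  open Polynomial F
  open Linear F
  open Matrices F
  open Companion F

  private
    m = suc p
    V′ = vecSpace m

  right : Defs.Matrix F m → Vector m → Vector m
  right B w = combine w B

  -- The coordinates x are read as a polynomial of degree below m, which is evaluated at B and
  -- applied to v.
  orbit : Defs.Matrix F m → Vector m → Vector m → Vector m
  orbit B v x = act V′ (right B) (Vec.toList x) v

  krylov : Defs.Matrix F m → Vector m → Defs.Matrix F m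
  krylov B v = mat (orbit B v)

  toList-+ : ∀ {n} (x y : Vector n) → Vec.toList (x +ᵥ y) ≡ addP (Vec.toList x) (Vec.toList y)
  toList-+ [] [] = refl
  toList-+ (a ∷ x) (b ∷ y) = cong (_ ∷_) (toList-+ x y)

  toList-* : ∀ c {n} (x : Vector n) → Vec.toList (c *ᵥ x) ≡ scale c (Vec.toList x)
  toList-* c [] = refl
  toList-* c (a ∷ x) = cong (_ ∷_) (toList-* c x)

  orbit-linear : ∀ B v → LinearV (orbit B v)
  orbit-linear B v = record
    { map-⊕ = λ x y → trans (cong (λ f → act V′ (right B) f v) (toList-+ x y))
      (A.act-addP (Vec.toList x) (Vec.toList y) v)
    ; map-• = λ c x → trans (cong (λ f → act V′ (right B) f v) (toList-* c x)) (A.act-scale c (Vec.toList x) v) }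
    where module A = Action V′ (right B) (combine-linear B)

  combine-krylov : ∀ B v x → combine x (krylov B v) ≡ orbit B v x
  combine-krylov B v = combine-mat (orbit-linear B v)

  shift-≈ : ∀ {n} a (x : Vector n) → (a ∷ Vec.toList x) ≈ₚ addP (Vec.toList (push a x)) (scale (top a x) (X^ n))
  shift-≈ a [] zero = sym (*-identityʳ a)
  shift-≈ a [] (suc i) = refl
  shift-≈ a (b ∷ x) zero = sym (trans (cong (a +_) (zeroʳ _)) (+-identityʳ a))
  shift-≈ a (b ∷ x) (suc i) = shift-≈ b x i

  module _ (c : Vector m) (B : Defs.Matrix F m) (v : Vector m) (kill : act V′ (right B) (mon c) v ≡ 0ᵥ) where
    private
      module A = Action V′ (right B) (combine-linear B)
      ⟪_⟫ : Poly → Vector m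
      ⟪ f ⟫ = act V′ (right B) f v

    -- Since c(B) annihilates v, the overflow X^m may be replaced by the lower terms of -c, just as
    -- in the residue ring; the orbit map thus carries multiplication by X to B.
    orbit-mulX : ∀ x → orbit B v (mulX c x) ≡ right B (orbit B v x)
    orbit-mulX x = sym (begin
      right B (orbit B v x)
        ≡⟨ sym (A.act-shift (Vec.toList x) v) ⟩
      ⟪ 0# ∷ Vec.toList x ⟫
        ≡⟨ A.act-≈ (0# ∷ Vec.toList x) (addP (Vec.toList (push 0# x)) (scale t (X^ m))) v (shift-≈ 0# x) ⟩
      ⟪ addP (Vec.toList (push 0# x)) (scale t (X^ m)) ⟫
        ≡⟨ trans (A.act-addP (Vec.toList (push 0# x)) (scale t (X^ m)) v)
        (cong (⟪ Vec.toList (push 0# x) ⟫ +ᵥ_) (trans (A.act-scale t (X^ m) v) (cong (t *ᵥ_) X^m≡))) ⟩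
      orbit B v (push 0# x) +ᵥ t *ᵥ (- 1# *ᵥ orbit B v c)
        ≡⟨ cong (orbit B v (push 0# x) +ᵥ_)
        (trans (cong (t *ᵥ_) (sym (map-• (orbit-linear B v) (- 1#) c)))
        (sym (map-• (orbit-linear B v) t (- 1# *ᵥ c)))) ⟩
      orbit B v (push 0# x) +ᵥ orbit B v (t *ᵥ (- 1# *ᵥ c))
        ≡⟨ sym (map-⊕ (orbit-linear B v) (push 0# x) (t *ᵥ (- 1# *ᵥ c))) ⟩
      orbit B v (mulX c x)                                                       ∎)
      where
      t = top 0# x
      X^m≡ : ⟪ X^ m ⟫ ≡ - 1# *ᵥ orbit B v c
      X^m≡ = SpaceLaws.add-zero⇒neg V′ (orbit B v c) ⟪ X^ m ⟫
        (trans (sym (A.act-addP (Vec.toList c) (X^ m) v))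
        (trans (sym (A.act-≈ (mon c) (addP (Vec.toList c) (X^ m)) v (mon-≈ c))) kill))

  toList-one : ∀ (c : Vector m) → Vec.toList (one c) ≈ₚ (1# ∷ [])
  toList-one c zero = refl
  toList-one c (suc i) = coef-0ᵥ c p i

  orbit-one : ∀ (c : Vector m) B v → orbit B v (one c) ≡ v
  orbit-one c B v = trans (A.act-≈ (Vec.toList (one c)) (1# ∷ []) v (toList-one c)) (A.act-one v)
    where module A = Action V′ (right B) (combine-linear B)

  -- An element of the kernel is a polynomial of degree below m annihilating v. As the irreducible c
  -- annihilates v as well and v is not zero, it must be zero.
  krylov-invertible : ∀ (c : Vector m) → Irr c → ∀ B v → v ≢ 0ᵥ → act V′ (right B) (mon c) v ≡ 0ᵥ → Defs.Invertible
    F m (krylov B v)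
  krylov-invertible c irr B v v≢0 kill = mat-invertible (orbit-linear B v) injective
    where
    injective : ∀ x → orbit B v x ≡ 0ᵥ → x ≡ 0ᵥ
    injective x eq = cases (x ≟ᵥ 0ᵥ)
      where
      cases : Dec (x ≡ 0ᵥ) → x ≡ 0ᵥ
      cases (yes x≡0) = x≡0
      cases (no x≢0) = ⊥-elim (v≢0 (faithful V′ (right B) (combine-linear B) c irr v kill (Vec.toList x)
        (DegLt-toList x) (λ eq′ → x≢0 (toList≈0 c x eq′)) eq))

  -- Through the orbit map, which is onto, B is multiplication by X modulo c, and that depends on c
  -- alone; so the map determines B. The vector v is the image of 1.
  krylov-injective : ∀ (c : Vector m) B B′ v v′ → (act V′ (right B) (mon c) v ≡ 0ᵥ) →
    (act V′ (right B′) (mon c) v′ ≡ 0ᵥ) →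
    Defs.Invertible F m (krylov B v) → krylov B v ≡ krylov B′ v′ → B ≡ B′ × v ≡ v′
  krylov-injective c B B′ v v′ kill kill′ (P⁻¹ , _ , P⁻¹P) eq = mat-ext B≡ , trans (sym (orbit-one c B v))
    (trans (same (one c)) (orbit-one c B′ v′))
    where
    same : ∀ x → orbit B v x ≡ orbit B′ v′ x
    same x = trans (sym (combine-krylov B v x)) (trans (cong (combine x) eq) (combine-krylov B′ v′ x))
    onto : ∀ w → orbit B v (combine w P⁻¹) ≡ w
    onto w = trans (sym (combine-krylov B v (combine w P⁻¹)))
      (trans (sym (combine-matMul w P⁻¹ (krylov B v))) (trans (cong (combine w) P⁻¹P) (combine-identity w)))
    B≡ : ∀ w → combine w B ≡ combine w B′
    B≡ w = begin
      combine w B                       ≡⟨ cong (right B) (sym (onto w)) ⟩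
      right B (orbit B v x)             ≡⟨ sym (orbit-mulX c B v kill x) ⟩
      orbit B v (mulX c x)              ≡⟨ same (mulX c x) ⟩
      orbit B′ v′ (mulX c x)            ≡⟨ orbit-mulX c B′ v′ kill′ x ⟩
      right B′ (orbit B′ v′ x)          ≡⟨ cong (right B′) (trans (sym (same x)) (onto w)) ⟩
      combine w B′                      ∎
      where x = combine w P⁻¹

  -- An invertible P arises from B = P⁻¹CP, where C is the companion matrix, and from the first row of P.
  krylov-surjective : ∀ (c : Vector m) P → Defs.Invertible F m P →
    ∃[ B ] ∃[ v ] v ≢ 0ᵥ × (∀ w → act V′ (right B) (mon c) w ≡ 0ᵥ) × krylov B v ≡ P
  krylov-surjective c P (P⁻¹ , PP⁻¹ , P⁻¹P) = B , v , v≢0 , kill , mat-ext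
    (λ x → trans (combine-krylov B v x) (krylov-row x))
    where
    back : ∀ w → combine (combine w P⁻¹) P ≡ w
    back w = trans (sym (combine-matMul w P⁻¹ P)) (trans (cong (combine w) P⁻¹P) (combine-identity w))
    forth : ∀ x → combine (combine x P) P⁻¹ ≡ x
    forth x = trans (sym (combine-matMul x P P⁻¹)) (trans (cong (combine x) PP⁻¹) (combine-identity x))
    φ : Vector m → Vector m
    φ w = combine (mulX c (combine w P⁻¹)) P
    φ-linear : LinearV φ
    φ-linear = ∘-linear {V′} {V′} {V′} (combine-linear P)
      (∘-linear {V′} {V′} {V′} (mulX-linear c) (combine-linear P⁻¹))
    B = mat φ
    v = combine (one c) P
    v≢0 : v ≢ 0ᵥ
    v≢0 eq = 0≢1 (sym (cong Vec.head (trans (sym (forth (one c)))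
      (trans (cong (λ w → combine w P⁻¹) eq) (map-𝟘 (combine-linear P⁻¹))))))
    intertwine : ∀ x → combine (mulX c x) P ≡ right B (combine x P)
    intertwine x = sym (trans (combine-mat φ-linear (combine x P)) (cong (λ z → combine (mulX c z) P) (forth x)))
    act-P : ∀ f x → combine (act V′ (mulX c) f x) P ≡ act V′ (right B) f (combine x P)
    act-P f x = act-intertwine V′ V′ (combine-linear P) intertwine f x
    kill : ∀ w → act V′ (right B) (mon c) w ≡ 0ᵥ
    kill w = trans (cong (act V′ (right B) (mon c)) (sym (back w)))
      (trans (sym (act-P (mon c) (combine w P⁻¹)))
      (trans (cong (λ z → combine z P) (act-mon c (combine w P⁻¹))) (map-𝟘 (combine-linear P))))
    krylov-row : ∀ x → orbit B v x ≡ combine x P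
    krylov-row x = trans (sym (act-P (Vec.toList x) (one c))) (cong (λ z → combine z P) (act-toList-one c x))

-- Double counting of matrices and inverse eigenvalues

module Correspondence {F E : FiniteField} (emb : Embedding F E) (p : ℕ) (0<p : 0 < p) where
  open Extension emb
  open Frobenius emb
  open IrreducibleRoots emb
  open DegreeCount emb using (Ord?)
  open Field E
  open Linear F
  open Matrices F using (Vector; 0ᵥ; combine; combine-linear; allVectors; allVectors-unique; allVectors-complete;
    _≟ᵥ_; _*ᵥ_)
  open Blocks F
  open CharacteristicPolynomial F
  open Eigenvalues emb p 0<p
  open Krylov F {p}

  frob-≢0 : ∀ k {x} → x ≢ 0# → frob k x ≢ 0#
  frob-≢0 k x≢0 eq = x≢0 (frob-injective k (trans eq (sym (frob-0 k))))

  Ord-inv : ∀ {x n} → Ord x n → Ord (inv x) n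
  Ord-inv {x} {n} (fix , ord) = trans (frob-inv n x) (cong inv fix) ,
    λ k 0<k k<n eq → ord k 0<k k<n (trans (sym (inv-involutive _))
      (trans (cong inv (trans (sym (frob-inv k x)) eq)) (inv-involutive x)))

  Ord⇒≢0 : ∀ {x} → Ord x (2 ℕ.* m) → x ≢ 0#
  Ord⇒≢0 (_ , ord) refl = ord 1 (s≤s z≤n) (ℕₚ.≤-trans (s≤s (s≤s z≤n)) 3≤2m) (frob-0 1)

  root? : ∀ T u → Dec (evalι (χ T) (inv u) ≡ 0#)
  root? T u = evalι (χ T) (inv u) ≟ 0#

  module FixedEigenvalue {u} (t : F.Carrier) (trace : frob m u + u ≡ ι t) (u-ord : Ord u (2 ℕ.* m)) where
    private
      α = inv u
      α₁ = frob m α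
      u≢0 = Ord⇒≢0 u-ord
      α≢0 = inv≢0 u≢0

    α-ord : Ord α (2 ℕ.* m)
    α-ord = Ord-inv u-ord

    s : F.Carrier
    s = F.- t

    β : Carrier
    β = - (α * α₁)

    α-sum : α + α₁ ≡ ι t * (α * α₁)
    α-sum = begin
      α + α₁                                          ≡⟨ sym (cong₂ _+_ (*-identityʳ α) (*-identityʳ α₁)) ⟩
      -- The first 1 becomes φ(u) φ(α) and the second u α, which makes α φ(α) a common factor.
      α * 1# + α₁ * 1#
        ≡⟨ cong₂ (λ x y → α * x + α₁ * y) (sym frob-uα) (sym (x*inv u≢0)) ⟩
      α * (frob m u * α₁) + α₁ * (u * α)
        ≡⟨ solve 4 (λ u₁ u a b → a :* (u₁ :* b) :+ b :* (u :* a) := (u₁ :+ u) :* (a :* b)) refl (frob m u) u α α₁ ⟩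
      (frob m u + u) * (α * α₁)                       ≡⟨ cong (_* (α * α₁)) trace ⟩
      ι t * (α * α₁)                                  ∎
      where
      frob-uα : frob m u * α₁ ≡ 1#
      frob-uα = trans (sym (frob-* m u α)) (trans (cong (frob m) (x*inv u≢0)) (frob-1 m))

    α-sum′ : α + α₁ ≡ ι s * β
    α-sum′ = trans α-sum (trans (solve 2 (λ t x → t :* x := (:- t) :* (:- x)) refl (ι t) (α * α₁))
      (cong (_* β) (sym (ι-neg t))))

    α² : α * α ≡ (ι F.1# + ι s * α) * β
    α² = begin
      α * α
        ≡⟨ solve 2 (λ a b → a :* a := :- (a :* b) :+ a :* (a :+ b)) refl α α₁ ⟩
      β + α * (α + α₁)
        ≡⟨ cong₂ _+_ (sym (trans (cong (_* β) ι-1) (*-identityˡ β))) (cong (α *_) α-sum′) ⟩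
      ι F.1# * β + α * (ι s * β)
        ≡⟨ solve 4 (λ o s a b → o :* b :+ a :* (s :* b) := (o :+ s :* a) :* b) refl (ι F.1#) (ι s) α β ⟩
      (ι F.1# + ι s * α) * β                           ∎

    frob-m-α₁ : frob m α₁ ≡ α
    frob-m-α₁ = trans (sym (frob-∘ m m α))
      (trans (cong (λ k → frob k α) (cong (m ℕ.+_) (sym (ℕₚ.+-identityʳ m)))) (proj₁ α-ord))

    -- φ exchanges α and φ(α), so it fixes β. If `frob k` with 0 < k < m fixed β, then `frob k α`
    -- would be the other root φ(α) of the quadratic, and `frob (m - k)` would fix α, which has
    -- degree 2m.
    β-ord : Ord β m
    β-ord = trans (frob-neg m _) (cong -_ (trans (frob-* m α α₁) (trans (cong (α₁ *_) frob-m-α₁) (*-comm α₁ α)))) ,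
      moved
      where
      moved : ∀ k → 0 < k → k < m → frob k β ≢ β
      moved k 0<k k<m fix = proj₂ α-ord (m ℕ.∸ k) (ℕₚ.m<n⇒0<n∸m k<m) (ℕₚ.≤-<-trans (ℕₚ.m∸n≤m m k) m<2m)
        (frob-collision k<m γ≡α₁)
        where
        γ = frob k α
        α≢γ : α ≢ γ
        α≢γ eq = proj₂ α-ord k 0<k (ℕₚ.<-trans k<m m<2m) (sym eq)
        γ² : γ * γ ≡ (ι F.1# + ι s * γ) * β
        γ² = trans (sym (frob-* k α α)) (trans (cong (frob k) α²)
          (trans (frob-* k _ β) (cong₂ _*_ (trans (frob-+ k _ _)
          (cong₂ _+_ (frob-ι k F.1#) (trans (frob-* k _ _) (cong (_* γ) (frob-ι k s))))) fix)))
        γ≡α₁ : γ ≡ α₁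
        γ≡α₁ = trans (solve 2 (λ x y → x := (y :+ x) :+ :- y) refl γ α)
          (trans (cong (_+ - α) (trans (quadratic-sum α² γ² α≢γ) (sym α-sum′)))
          (solve 2 (λ x y → (x :+ y) :+ :- x := y) refl α α₁))

    c : Vector m
    c = proj₁ (minimal-polynomial (s≤s z≤n) β-ord)

    c-root : evalι (PF.mon c) β ≡ 0#
    c-root = proj₂ (minimal-polynomial (s≤s z≤n) β-ord)

    c-irr : Irr c
    c-irr = Irreducibility.irreducibleP⇒Irr F c (PF.mon c) (λ _ → refl)
      (minimal⇒irreducible (PF.mon c) (s≤s z≤n) (PF.mon-Monic c) c-root (Ord⇒minimal (proj₂ β-ord)))

    Killed : Defs.Matrix F m → Set
    Killed B = ∀ w → act (vecSpace m) (right B) (PF.mon c) w ≡ 0ᵥ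

    -- Comparing the sum and the product of the conjugates of α, the unknown eigenvalue of B cancels
    -- and c₁ = - t c₀ remains. So u determines the quotient c₁ / c₀.
    normal-form : ∀ T → Defs.IsTSRI F m 2 T → evalι (χ T) α ≡ 0# → ∃[ B ] T ≡ TSR F.1# s B × Killed B
    normal-form T (((c₀ ∷ c₁ ∷ []) , B , refl) , irr) root = B₁ , T≡ , killed
      where
      module A = Analysis (analysis c₀ c₁ B irr root)
      c₁≡ : ι c₁ ≡ - ι t * ι c₀
      c₁≡ = *-cancelˡ A.β A.β≢0 (begin
        A.β * ι c₁                      ≡⟨ *-comm _ _ ⟩
        ι c₁ * A.β                      ≡⟨ sym A.sum ⟩
        α + α₁                          ≡⟨ trans α-sum
          (solve 2 (λ t x → t :* x := (:- t) :* (:- x)) refl (ι t) (α * α₁)) ⟩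
        - ι t * - (α * α₁)              ≡⟨ cong (- ι t *_) (sym A.product) ⟩
        - ι t * (ι c₀ * A.β)            ≡⟨ solve 3 (λ t c b → t :* (c :* b) := b :* (t :* c)) refl (- ι t) (ι c₀)
          A.β ⟩
        A.β * (- ι t * ι c₀)            ∎)
      slope : F.inv c₀ F.* c₁ ≡ s
      slope = ι-injective (begin
        ι (F.inv c₀ F.* c₁)             ≡⟨ trans (ι-* _ c₁) (cong (ι (F.inv c₀) *_) c₁≡) ⟩
        ι (F.inv c₀) * (- ι t * ι c₀)   ≡⟨ solve 3 (λ i t c → i :* (t :* c) := t :* (c :* i)) refl (ι (F.inv c₀))
          (- ι t) (ι c₀) ⟩
        - ι t * (ι c₀ * ι (F.inv c₀))   ≡⟨ cong (- ι t *_)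
          (trans (sym (ι-* c₀ _)) (trans (cong ι (F.x*inv A.c₀≢0)) ι-1)) ⟩
        - ι t * 1#                      ≡⟨ trans (*-identityʳ _) (sym (ι-neg t)) ⟩
        ι s                             ∎)
      B₁ = Vec.map (c₀ *ᵥ_) B
      T≡ : TSR c₀ c₁ B ≡ TSR F.1# s B₁
      T≡ = trans (tsr-normalize c₀ c₁ B A.c₀≢0) (cong (λ z → TSR F.1# z B₁) slope)
      -- For the normalized triple the product formula reads β = - α φ(α). Hence the characteristic
      -- polynomial of `B₁` vanishes at the given β, which has degree m, and so it is the minimal
      -- polynomial c.
      module A₁ = Analysis (analysis F.1# s B₁ (subst (λ T → Defs.IrreducibleP F (χ T)) T≡ irr)
        (subst (λ T → evalι (χ T) α ≡ 0#) T≡ root))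
      β≡ : A₁.β ≡ β
      β≡ = trans (sym (trans (cong (_* A₁.β) ι-1) (*-identityˡ _))) A₁.product
      χB≈c : Defs.charPoly F m B₁ PF.≈ₚ PF.mon c
      χB≈c = subP≈0⇒≈ F (Defs.charPoly F m B₁) (PF.mon c)
        (Ord⇒minimal (proj₂ β-ord) (subP F (Defs.charPoly F m B₁) (PF.mon c))
        (Monic-subP F (Defs.charPoly F m B₁) (PF.mon c) (charPoly-Monic B₁) (PF.mon-Monic c))
        (trans (evalι-addP (Defs.charPoly F m B₁) _ β)
          (trans (cong₂ _+_ (subst (λ z → evalι (Defs.charPoly F m B₁) z ≡ 0#) β≡ A₁.β-root)
          (trans (evalι-scale _ (PF.mon c) β) (trans (cong (_ *_) c-root) (zeroʳ _)))) (+-identityˡ 0#))))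
      killed : Killed B₁
      killed w = trans (sym (Action.act-≈ (vecSpace m) (right B₁) (combine-linear B₁) (Defs.charPoly F m B₁)
        (PF.mon c) w χB≈c)) (cayley-hamilton B₁ w)

    -- The polynomial `hat` of c vanishes at α and has degree 2m, the degree of α, so it is
    -- irreducible. It annihilates T because c annihilates B, and therefore it is the characteristic
    -- polynomial.
    killed⇒TSRI : ∀ B → Killed B → Defs.IsTSRI F m 2 (TSR F.1# s B) × evalι (χ (TSR F.1# s B)) α ≡ 0#
    killed⇒TSRI B killed = ((F.1# ∷ s ∷ [] , B , refl) , minimal⇒irreducible (χ T) (s≤s z≤n) (charPoly-Monic T)
      χ-root minimal) , χ-root
      where
      T = TSR F.1# s B
      f = hat F.1# s c
      minimal : ∀ g → PF.DegLt g (2 ℕ.* m) → evalι g α ≡ 0# → g PF.≈ₚ []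
      minimal = Ord⇒minimal (proj₂ α-ord)
      f-root : evalι f α ≡ 0#
      f-root = trans (evalι-hat F.1# s c α²) (trans (cong (_* evalι (affine^ F.1# s m) α) c-root) (zeroˡ _))
      h = PF.Monic⇒mon f (hat-Monic F.1# s c)
      h-irr : Irr (proj₁ h)
      h-irr = Irreducibility.irreducibleP⇒Irr F (proj₁ h) f (proj₂ h)
        (minimal⇒irreducible f (s≤s z≤n) (hat-Monic F.1# s c) f-root minimal)
      χ≈f : χ T PF.≈ₚ f
      χ≈f = annihilated-equal F.1# s B f (proj₁ h) h-irr (hat-Monic F.1# s c) (inj₁ (proj₂ h))
        (act-hat-𝟘 F.1# s B c killed witness)
      χ-root : evalι (χ T) α ≡ 0#
      χ-root = trans (evalι-≈ (χ T) f α χ≈f) f-root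

    nonzero-vectors : List (Vector m)
    nonzero-vectors = filter (λ v → ¬? (v ≟ᵥ 0ᵥ)) (allVectors m)

    length-nonzero-vectors : length nonzero-vectors ≡ q ℕ.^ m ℕ.∸ 1
    length-nonzero-vectors = cong ℕ.pred
      (trans (cong (ℕ._+ length nonzero-vectors)
      (sym (count-unique (_≟ᵥ 0ᵥ) (allVectors-unique m) (allVectors-complete 0ᵥ) refl (λ eq → eq))))
      (trans (count-¬ (_≟ᵥ 0ᵥ) (allVectors m)) (length-vectors F.elements m)))

    module _ (xs : List (Defs.Matrix F (2 ℕ.* m))) (ys : List (Defs.Matrix F m)) (xs-unique : Unique xs)
      (ys-unique : Unique ys)
             (xs-spec : ∀ T → (T ∈ xs → Defs.IsTSRI F m 2 T) × (Defs.IsTSRI F m 2 T → T ∈ xs))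
             (ys-spec : ∀ P → (P ∈ ys → Defs.Invertible F m P) × (Defs.Invertible F m P → P ∈ ys)) where
      private
        xs′ = filter (λ T → root? T u) xs
        pairs = cartesianProduct xs′ nonzero-vectors

        to : Defs.Matrix F (2 ℕ.* m) × Vector m → Defs.Matrix F m
        to (T , v) = krylov (upperRight T) v

        pair-spec : ∀ {T v} → (T , v) ∈ pairs → T ≡ TSR F.1# s (upperRight T) × Killed (upperRight T) × v ≢ 0ᵥ
        pair-spec {T} {v} Tv∈ =
          let T∈ , v∈ = ∈-cartesianProduct⁻ xs′ nonzero-vectors Tv∈
              T∈xs , root = ∈-filter⁻ (λ T → root? T u) {xs = xs} T∈
              B , T≡ , killed = normal-form T (proj₁ (xs-spec T) T∈xs) root
              B≡ = trans (sym (upperRight-tsr s B)) (cong upperRight (sym T≡))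
          in trans T≡ (cong (TSR F.1# s) B≡) , subst Killed B≡ killed , proj₂
            (∈-filter⁻ (λ v → ¬? (v ≟ᵥ 0ᵥ)) {xs = allVectors m} v∈)

        to-invertible : ∀ {Tv} → Tv ∈ pairs → Defs.Invertible F m (to Tv)
        to-invertible {T , v} Tv∈ = let _ , killed , v≢0 = pair-spec Tv∈ in krylov-invertible c c-irr (upperRight T) v v≢0 (killed v)

        to-injective : ∀ {Tv Tv′} → Tv ∈ pairs → Tv′ ∈ pairs → to Tv ≡ to Tv′ → Tv ≡ Tv′
        to-injective {T , v} {T′ , v′} p p′ eq =
          let T≡ , killed , _ = pair-spec p
              T′≡ , killed′ , _ = pair-spec p′
              B≡ , v≡ = krylov-injective c (upperRight T) (upperRight T′) v v′ (killed v) (killed′ v′)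
                (to-invertible p) eq
          in cong₂ _,_ (trans T≡ (trans (cong (TSR F.1# s) B≡) (sym T′≡))) v≡

        to-surjective : ∀ {P} → P ∈ ys → ∃[ Tv ] Tv ∈ pairs × to Tv ≡ P
        to-surjective {P} P∈ =
          let B , v , v≢0 , killed , eq = krylov-surjective c P (proj₁ (ys-spec P) P∈)
              tsri , root = killed⇒TSRI B killed
          in (TSR F.1# s B , v) ,
             ∈-cartesianProduct⁺ (∈-filter⁺ (λ T → root? T u) (proj₂ (xs-spec (TSR F.1# s B)) tsri) root)
               (∈-filter⁺ (λ v → ¬? (v ≟ᵥ 0ᵥ)) (allVectors-complete v) v≢0) ,
             trans (cong (λ B → krylov B v) (upperRight-tsr s B)) eq

      count-TSRI : count (λ T → root? T u) xs ℕ.* (q ℕ.^ m ℕ.∸ 1) ≡ length ys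
      count-TSRI = trans (cong (length xs′ ℕ.*_) (sym length-nonzero-vectors))
        (trans (sym (length-cartesianProductWith _,_ xs′ nonzero-vectors))
        (ℕₚ.≤-antisym (length-injection to (Uniqueₚ.cartesianProduct⁺ (Uniqueₚ.filter⁺ (λ T → root? T u) xs-unique)
          (Uniqueₚ.filter⁺ (λ v → ¬? (v ≟ᵥ 0ᵥ)) (allVectors-unique m)))
            to-injective (λ {Tv} p → proj₂ (ys-spec (to Tv)) (to-invertible p)))
          (length-surjection to ys-unique to-surjective)))

  -- That the trace φ(u) + u lies in F is expressed by its invariance under x ↦ x^q.
  Inverse-eigenvalue : Carrier → Set
  Inverse-eigenvalue u = Ord u (2 ℕ.* m) × σ (frob m u + u) ≡ frob m u + u

  inverse-eigenvalue? : ∀ u → Dec (Inverse-eigenvalue u)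
  inverse-eigenvalue? u = Ord? u (2 ℕ.* m) ×-dec (σ (frob m u + u) ≟ frob m u + u)

  inverse-eigenvalues : List Carrier
  inverse-eigenvalues = filter inverse-eigenvalue? elements

  -- Dividing α + φ(α) = c₁ β by α φ(α) = - c₀ β shows that the trace of 1/α is - c₁ / c₀.
  eigenvalue-inverse : ∀ T → Defs.IsTSRI F m 2 T → ∀ {α} → evalι (χ T) α ≡ 0# → Inverse-eigenvalue (inv α)
  eigenvalue-inverse T (((c₀ ∷ c₁ ∷ []) , B , refl) , irr) {α} root = Ord-inv A.order-α , trans (cong σ trace)
    (trans (σ-ι _) (sym trace))
    where
    module A = Analysis (analysis c₀ c₁ B irr root)
    α₁ = frob m α
    α≢0 = Ord⇒≢0 A.order-α
    α₁≢0 = frob-≢0 m α≢0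
    t = F.- (F.inv c₀ F.* c₁)
    trace : frob m (inv α) + inv α ≡ ι t
    trace = trans (cong (_+ inv α) (frob-inv m α)) (*-cancelˡ α α≢0 (*-cancelˡ α₁ α₁≢0 (begin
      α₁ * (α * (inv α₁ + inv α))
        ≡⟨ solve 4 (λ a a₁ i i₁ → a₁ :* (a :* (i₁ :+ i)) := a :* (a₁ :* i₁) :+ a₁ :* (a :* i)) refl α α₁ (inv α)
        (inv α₁) ⟩
      α * (α₁ * inv α₁) + α₁ * (α * inv α)               ≡⟨ cong₂ (λ x y → α * x + α₁ * y) (x*inv α₁≢0) (x*inv α≢0) ⟩
      α * 1# + α₁ * 1#                                   ≡⟨ trans (cong₂ _+_ (*-identityʳ α) (*-identityʳ α₁)) A.sum ⟩
      ι c₁ * A.β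
        ≡⟨ cong (_* A.β) (sym (trans (cong (_* ι c₁)
        (trans (sym (ι-* c₀ _)) (trans (cong ι (F.x*inv A.c₀≢0)) ι-1))) (*-identityˡ _))) ⟩
      ((ι c₀ * ι (F.inv c₀)) * ι c₁) * A.β
        ≡⟨ solve 4 (λ c i d b → ((c :* i) :* d) :* b := (:- (i :* d)) :* (:- (c :* b))) refl (ι c₀) (ι (F.inv c₀))
        (ι c₁) A.β ⟩
      - (ι (F.inv c₀) * ι c₁) * - (ι c₀ * A.β)
        ≡⟨ cong₂ _*_ (trans (cong -_ (sym (ι-* _ c₁))) (sym (ι-neg _))) (trans (cong -_ A.product) (-‿involutive _)) ⟩
      ι t * (α * α₁)
        ≡⟨ solve 3 (λ t a b → t :* (a :* b) := b :* (a :* t)) refl (ι t) α α₁ ⟩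
      α₁ * (α * ι t)                                     ∎)))

  -- The characteristic polynomial, irreducible of degree 2m, has exactly 2m roots in E, and
  -- inversion matches them with the elements u.
  count-eigenvalues : length (fixed (2 ℕ.* m)) ≡ q ℕ.^ (2 ℕ.* m) → ∀ T → Defs.IsTSRI F m 2 T → count (root? T)
    inverse-eigenvalues ≡ 2 ℕ.* m
  count-eigenvalues len T tsri@(_ , irr) = trans
    (length-bijection inv inv (Uniqueₚ.filter⁺ (root? T) (Uniqueₚ.filter⁺ inverse-eigenvalue? elements-unique))
    (Uniqueₚ.filter⁺ zero? elements-unique) to from)
      (irr-count-roots h (χ-Irr T irr) len)
    where
    h = proj₁ (χ-vec T)
    χ≈h = proj₂ (χ-vec T)
    zero? : ∀ x → Dec (evalι (PF.mon h) x ≡ 0#)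
    zero? x = evalι (PF.mon h) x ≟ 0#
    to : ∀ {u} → u ∈ filter (root? T) inverse-eigenvalues → inv u ∈ filter zero? elements × inv (inv u) ≡ u
    to {u} u∈ = ∈-filter⁺ zero? (elements-complete (inv u))
      (trans (sym (evalι-≈ (χ T) (PF.mon h) (inv u) χ≈h))
      (proj₂ (∈-filter⁻ (root? T) {xs = inverse-eigenvalues} u∈))) , inv-involutive u
    from : ∀ {x} → x ∈ filter zero? elements → inv x ∈ filter (root? T) inverse-eigenvalues × inv (inv x) ≡ x
    from {x} x∈ = ∈-filter⁺ (root? T) (∈-filter⁺ inverse-eigenvalue? (elements-complete (inv x))
      (eigenvalue-inverse T tsri root)) (subst (λ z → evalι (χ T) z ≡ 0#) (sym (inv-involutive x)) root) ,
      inv-involutive x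
      where
      root : evalι (χ T) x ≡ 0#
      root = trans (evalι-≈ (χ T) (PF.mon h) x χ≈h) (proj₂ (∈-filter⁻ zero? {xs = elements} x∈))

  module _ (len : length (fixed (2 ℕ.* m)) ≡ q ℕ.^ (2 ℕ.* m)) (xs : List (Defs.Matrix F (2 ℕ.* m)))
    (ys : List (Defs.Matrix F m)) (xs-unique : Unique xs) (ys-unique : Unique ys)
           (xs-spec : ∀ T → (T ∈ xs → Defs.IsTSRI F m 2 T) × (Defs.IsTSRI F m 2 T → T ∈ xs))
           (ys-spec : ∀ P → (P ∈ ys → Defs.Invertible F m P) × (Defs.Invertible F m P → P ∈ ys)) where

    TSRI-count : length xs ℕ.* (2 ℕ.* m ℕ.* (q ℕ.^ m ℕ.∸ 1)) ≡ length inverse-eigenvalues ℕ.* length ys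
    TSRI-count = begin
      length xs ℕ.* (2 ℕ.* m ℕ.* Q)
        ≡⟨ sym (ℕₚ.*-assoc (length xs) (2 ℕ.* m) Q) ⟩
      length xs ℕ.* (2 ℕ.* m) ℕ.* Q
        ≡⟨ cong (ℕ._* Q) (trans (sym (∑-const (2 ℕ.* m) xs))
        (sym (∑-cong xs (λ {T} T∈ → count-eigenvalues len T (proj₁ (xs-spec T) T∈))))) ⟩
      ∑ (λ T → count (root? T) inverse-eigenvalues) xs ℕ.* Q
        ≡⟨ cong (ℕ._* Q) (double-count root? xs inverse-eigenvalues) ⟩
      ∑ (λ u → count (λ T → root? T u) xs) inverse-eigenvalues ℕ.* Q
        ≡⟨ sym (∑-*ʳ (λ u → count (λ T → root? T u) xs) Q inverse-eigenvalues) ⟩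
      ∑ (λ u → count (λ T → root? T u) xs ℕ.* Q) inverse-eigenvalues            ≡⟨ ∑-cong inverse-eigenvalues each ⟩
      ∑ (λ _ → length ys) inverse-eigenvalues
        ≡⟨ ∑-const (length ys) inverse-eigenvalues ⟩
      length inverse-eigenvalues ℕ.* length ys                                  ∎
      where
      Q = q ℕ.^ m ℕ.∸ 1
      each : ∀ {u} → u ∈ inverse-eigenvalues → count (λ T → root? T u) xs ℕ.* Q ≡ length ys
      each {u} u∈ = let ord , fix = proj₂ (∈-filter⁻ inverse-eigenvalue? {xs = elements} u∈)
                        t , ιt≡ = σ-fixed⇒∈F _ fix
                    in FixedEigenvalue.count-TSRI t (sym ιt≡) ord xs ys xs-unique ys-unique xs-spec ys-spec

-- Summation over traces, parity of q and the final formula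

open import Data.Integer using (+_; -1ℤ; 1ℤ)
open import Data.Rational as ℚ using (ℚ; _/_)

+∑ : {A : Set} (f : A → ℕ) (xs : List A) → + ∑ f xs ≡ ∑ℤ (λ x → + f x) xs
+∑ f [] = refl
+∑ f (x ∷ xs) = trans (ℤₚ.pos-+ (f x) (∑ f xs)) (cong (λ z → + f x ℤ.+ z) (+∑ f xs))

∑ℤ-const : {A : Set} (c : ℤ) (xs : List A) → ∑ℤ (λ _ → c) xs ≡ + length xs ℤ.* c
∑ℤ-const c [] = refl
∑ℤ-const c (x ∷ xs) = trans (cong (λ z → c ℤ.+ z) (∑ℤ-const c xs)) (sym (ℤₚ.suc-* (+ length xs) c))

module EigenvalueCount {F E : FiniteField} (emb : Embedding F E) (p : ℕ) (0<p : 0 < p) (k l : ℕ)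
  (m≡ : suc p ≡ 2 ℕ.^ k ℕ.* l) (l-odd : ¬ (2 ∣ l))
  (len : length (Frobenius.fixed emb (2 ℕ.* suc p)) ≡ FiniteField.order F ℕ.^ (2 ℕ.* suc p)) where
  open Extension emb
  open Frobenius emb
  open DegreeCount emb
  open Eigenvalues emb p 0<p using (m; m<2m)
  open Correspondence emb p 0<p using (Inverse-eigenvalue; inverse-eigenvalue?; inverse-eigenvalues)
  open Field E

  with-trace? : ∀ t u → Dec (frob m u + u ≡ ι t × Ord u (2 ℕ.* m))
  with-trace? t u = (frob m u + u ≟ ι t) ×-dec Ord? u (2 ℕ.* m)

  trace? : ∀ u t → Dec (frob m u + u ≡ ι t)
  trace? u t = frob m u + u ≟ ι t

  -- The trace of each u is the image of exactly one t, as the embedding is injective.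
  count-by-trace : length inverse-eigenvalues ≡ ∑ (λ t → count (with-trace? t) elements) F.elements
  count-by-trace = begin
    length inverse-eigenvalues
      ≡⟨ sym (trans (∑-const 1 inverse-eigenvalues) (ℕₚ.*-identityʳ _)) ⟩
    ∑ (λ _ → 1) inverse-eigenvalues
      ≡⟨ sym (∑-cong inverse-eigenvalues unique-trace) ⟩
    ∑ (λ u → count (trace? u) F.elements) inverse-eigenvalues
      ≡⟨ double-count trace? inverse-eigenvalues F.elements ⟩
    ∑ (λ t → count (λ u → trace? u t) inverse-eigenvalues) F.elements
      ≡⟨ ∑-cong F.elements (λ {t} _ → length-≡
      (Uniqueₚ.filter⁺ (λ u → trace? u t) (Uniqueₚ.filter⁺ inverse-eigenvalue? elements-unique))
      (Uniqueₚ.filter⁺ (with-trace? t) elements-unique) to from) ⟩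
    ∑ (λ t → count (with-trace? t) elements) F.elements                 ∎
    where
    unique-trace : ∀ {u} → u ∈ inverse-eigenvalues → count (trace? u) F.elements ≡ 1
    unique-trace {u} u∈ = let _ , fix = proj₂ (∈-filter⁻ inverse-eigenvalue? {xs = elements} u∈)
                              t , ιt≡ = σ-fixed⇒∈F _ fix
                          in count-unique (trace? u) F.elements-unique (F.elements-complete t) (sym ιt≡)
                            (λ eq → ι-injective (trans (sym eq) (sym ιt≡)))
    to : ∀ {t u} → u ∈ filter (λ u → trace? u t) inverse-eigenvalues → u ∈ filter (with-trace? t) elements
    to {t} {u} u∈ = let u∈′ , eq = ∈-filter⁻ (λ u → trace? u t) {xs = inverse-eigenvalues} u∈
                        ord , _ = proj₂ (∈-filter⁻ inverse-eigenvalue? {xs = elements} u∈′)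
                    in ∈-filter⁺ (with-trace? t) (elements-complete u) (eq , ord)
    from : ∀ {t u} → u ∈ filter (with-trace? t) elements → u ∈ filter (λ u → trace? u t) inverse-eigenvalues
    from {t} {u} u∈ = let eq , ord = proj₂ (∈-filter⁻ (with-trace? t) {xs = elements} u∈)
                      in ∈-filter⁺ (λ u → trace? u t) (∈-filter⁺ inverse-eigenvalue? (elements-complete u)
                        (ord , trans (cong σ eq) (trans (σ-ι t) (sym eq)))) eq

  module _ (t : F.Carrier) (half∈F : ∀ {u} → u + u ≡ ι t → σ u ≡ u) where
    count-with-trace : + count (with-trace? t) elements ≡ mobiusSum q m l ℤ.+ ℤ.-
      (+ count (λ u → u + u ≟ ι t) elements) ℤ.* (+ floorRecip l)
    count-with-trace = count-A k l (s≤s z≤n) m≡ l-odd len t half∈F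

  double : ∀ u → u + u ≡ ι (F.1# F.+ F.1#) * u
  double u = trans (solve 1 (λ u → u :+ u := (con (ℤ.+ 1) :+ con (ℤ.+ 1)) :* u) refl u)
    (cong (_* u) (trans (sym (cong₂ _+_ ι-1 ι-1)) (sym (ι-+ F.1# F.1#))))

  -- For every t the equation 2 u = t has the single solution t / 2, which belongs to F. All q
  -- traces thus contribute equally, with `halves` equal to 1.
  odd-characteristic : F.1# F.+ F.1# ≢ F.0# → + length inverse-eigenvalues ≡ + q ℤ.*
    (mobiusSum q m l ℤ.- + floorRecip l)
  odd-characteristic 2≢0 = trans (cong +_ count-by-trace)
    (trans (+∑ _ F.elements) (trans (∑ℤ-cong F.elements (λ {t} _ → each t)) (∑ℤ-const _ F.elements)))
    where
    half : F.Carrier → Carrier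
    half t = ι (F.inv (F.1# F.+ F.1#) F.* t)
    2≢0′ : ι (F.1# F.+ F.1#) ≢ 0#
    2≢0′ eq = 2≢0 (ι≡0⇒≡0 eq)
    half-double : ∀ t → half t + half t ≡ ι t
    half-double t = trans (double (half t))
      (trans (sym (ι-* _ _)) (cong ι (trans (sym (F.*-assoc _ _ t))
      (trans (cong (F._* t) (F.x*inv 2≢0)) (F.*-identityˡ t)))))
    half-unique : ∀ {t u} → u + u ≡ ι t → u ≡ half t
    half-unique {t} {u} eq = *-cancelˡ (ι (F.1# F.+ F.1#)) 2≢0′
      (trans (sym (double u)) (trans eq (trans (sym (half-double t)) (double (half t)))))
    each : ∀ t → + count (with-trace? t) elements ≡ mobiusSum q m l ℤ.- + floorRecip l
    each t = trans (count-with-trace t (λ eq → trans (cong σ (half-unique eq))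
      (trans (σ-ι _) (sym (half-unique eq)))))
      (cong (λ z → mobiusSum q m l ℤ.+ z)
        (trans (cong (λ n → ℤ.- (+ n) ℤ.* (+ floorRecip l))
        (count-unique (λ u → u + u ≟ ι t) elements-unique (elements-complete (half t)) (half-double t)
        half-unique)) (ℤₚ.-1*i≡-i (+ floorRecip l))))

  even-characteristic : F.1# F.+ F.1# ≡ F.0# → + length inverse-eigenvalues ≡ + (q ∸ 1) ℤ.* mobiusSum q m l
  even-characteristic 2≡0 = begin
    + length inverse-eigenvalues
      ≡⟨ trans (cong +_ count-by-trace) (+∑ _ F.elements) ⟩
    ∑ℤ (λ t → + count (with-trace? t) elements) F.elements
      ≡⟨ sym (∑ℤ-drop nonzero? (λ t → + count (with-trace? t) elements) F.elements
      (λ {t} _ ¬¬0 → cong +_ (trace-zero t ¬¬0))) ⟩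
    ∑ℤ (λ t → + count (with-trace? t) elements) (Fermat.nonzero F)
      ≡⟨ ∑ℤ-cong (Fermat.nonzero F) (λ {t} t∈ → each t (proj₂ (∈-filter⁻ nonzero? {xs = F.elements} t∈))) ⟩
    ∑ℤ (λ _ → mobiusSum q m l) (Fermat.nonzero F)
      ≡⟨ ∑ℤ-const (mobiusSum q m l) (Fermat.nonzero F) ⟩
    + length (Fermat.nonzero F) ℤ.* mobiusSum q m l
      ≡⟨ cong (λ n → + n ℤ.* mobiusSum q m l) (cong ℕ.pred (Fermat.length-nonzero F)) ⟩
    + (q ∸ 1) ℤ.* mobiusSum q m l                                      ∎
    where
    nonzero? : ∀ t → Dec (t ≢ F.0#)
    nonzero? t = ¬? (t F.≟ F.0#)
    u+u≡0 : ∀ u → u + u ≡ 0#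
    u+u≡0 u = trans (double u) (trans (cong (_* u) (trans (cong ι 2≡0) ι-0)) (zeroˡ u))
    -- With 2 = 0 the equation φ(u) + u = 0 says φ(u) = u, which no element of degree 2m satisfies.
    trace-zero : ∀ t → ¬ (t ≢ F.0#) → count (with-trace? t) elements ≡ 0
    trace-zero t ¬¬0 = count-none (with-trace? t) elements
      (λ {u} _ (eq , ord) → ¬¬0 (λ t≡0 → proj₂ ord m (s≤s z≤n) m<2m
      (x-y≡0⇒x≡y (trans (cong (λ z → frob m u + z) (-u≡u u)) (trans eq (trans (cong ι t≡0) ι-0))))))
      where
      -u≡u : ∀ u → - u ≡ u
      -u≡u u = trans (solve 1 (λ u → :- u := (u :+ u) :+ :- u :+ :- u :+ :- u) refl u)
        (trans (cong (λ z → z + - u + - u + - u) (u+u≡0 u))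
        (trans (solve 1 (λ u → con (ℤ.+ 0) :+ :- u :+ :- u :+ :- u := u :+ :- (u :+ u) :+ :- (u :+ u)) refl u)
          (trans (cong (λ z → u + - z + - z) (u+u≡0 u))
          (solve 1 (λ u → u :+ :- con (ℤ.+ 0) :+ :- con (ℤ.+ 0) := u) refl u))))
    each : ∀ t → t ≢ F.0# → + count (with-trace? t) elements ≡ mobiusSum q m l
    each t t≢0 = trans (count-with-trace t (λ eq → ⊥-elim (no-half eq)))
      (trans (cong (λ n → mobiusSum q m l ℤ.+ ℤ.- (+ n) ℤ.* (+ floorRecip l))
      (count-none (λ u → u + u ≟ ι t) elements (λ _ → no-half)))
        (ℤₚ.+-identityʳ _))
      where
      no-half : ∀ {u} → u + u ≡ ι t → ⊥
      no-half {u} eq = t≢0 (ι≡0⇒≡0 (trans (sym eq) (u+u≡0 u)))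

-1^-even : ∀ j → -1ℤ ℤ.^ (j ℕ.+ j) ≡ 1ℤ
-1^-even zero = refl
-1^-even (suc j) = trans (cong (-1ℤ ℤ.^_) (cong suc (ℕₚ.+-suc j j)))
  (trans (sym (ℤₚ.*-assoc -1ℤ -1ℤ _)) (trans (ℤₚ.*-identityˡ _) (-1^-even j)))

-1^-odd : ∀ j → -1ℤ ℤ.^ suc (j ℕ.+ j) ≡ -1ℤ
-1^-odd j = cong (-1ℤ ℤ.*_) (-1^-even j)

module Characteristic (F : FiniteField) where
  open Field F
  open Fermat F

  -- For even q the power (-1)^q is 1, while Fermat's theorem makes it -1.
  even-order⇒2≡0 : ∀ j → order ≡ j ℕ.+ j → 1# + 1# ≡ 0#
  even-order⇒2≡0 j eq = trans (cong (λ z → 1# + z) (sym -1≡1)) (-‿inverseʳ 1#)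
    where
    square : ∀ j → (- 1#) ^ (j ℕ.+ j) ≡ 1#
    square zero = refl
    square (suc j) = trans (cong ((- 1#) ^_) (cong suc (ℕₚ.+-suc j j)))
      (trans (solve 1 (λ x → con (ℤ.-[1+ 0 ]) :* (con (ℤ.-[1+ 0 ]) :* x) := x) refl _) (square j))
    -1≡1 : - 1# ≡ 1#
    -1≡1 = trans (sym (fermat (- 1#))) (trans (cong ((- 1#) ^_) eq) (square j))

  -- If 2 = 0 and q is odd, then q · 1 equals 1, although it is 0.
  odd-order⇒2≢0 : ∀ j → order ≡ suc (j ℕ.+ j) → 1# + 1# ≢ 0#
  odd-order⇒2≢0 j eq 2≡0 = 0≢1 (trans (sym order·1)
    (trans (cong (_· 1#) eq) (trans (cong (λ z → 1# + z) (vanish j)) (+-identityʳ 1#))))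
    where
    vanish : ∀ j → (j ℕ.+ j) · 1# ≡ 0#
    vanish zero = refl
    vanish (suc j) = trans (cong (_· 1#) (cong suc (ℕₚ.+-suc j j)))
      (trans (sym (+-assoc 1# 1# _)) (trans (cong₂ _+_ 2≡0 (vanish j)) (+-identityˡ 0#)))

toℚᵘ-/1 : ∀ i → ℚ.toℚᵘ (i / 1) ℚᵘ.≃ ℚᵘ.mkℚᵘ i 0
toℚᵘ-/1 i = ℚₚ.toℚᵘ-fromℚᵘ (ℚᵘ.mkℚᵘ i 0)

/1-* : ∀ i j → (i / 1) ℚ.* (j / 1) ≡ (i ℤ.* j) / 1
/1-* i j = ℚₚ.toℚᵘ-injective (ℚᵘₚ.≃-trans (ℚₚ.toℚᵘ-homo-* (i / 1) (j / 1))
  (ℚᵘₚ.≃-trans (ℚᵘₚ.*-cong (toℚᵘ-/1 i) (toℚᵘ-/1 j)) (ℚᵘₚ.≃-sym (toℚᵘ-/1 (i ℤ.* j)))))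

/1-- : ∀ i j → (i / 1) ℚ.- (j / 1) ≡ (i ℤ.- j) / 1
/1-- i j = ℚₚ.toℚᵘ-injective (ℚᵘₚ.≃-trans (ℚₚ.toℚᵘ-homo-+ (i / 1) (ℚ.- (j / 1))) (ℚᵘₚ.≃-trans
  (ℚᵘₚ.+-cong (toℚᵘ-/1 i) (ℚᵘₚ.≃-trans (ℚₚ.toℚᵘ-homo‿- (j / 1)) (ℚᵘₚ.-‿cong (toℚᵘ-/1 j))))
    (ℚᵘₚ.≃-trans (ℚᵘ.*≡* (cong₂ ℤ._*_ (cong₂ ℤ._+_ (ℤₚ.*-identityʳ i) (ℤₚ.*-identityʳ (ℤ.- j))) refl))
    (ℚᵘₚ.≃-sym (toℚᵘ-/1 (i ℤ.- j))))))

-- Once the two parity fractions are known to be integers ε and δ, the whole identity is the image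
-- of one between integers.
rational-identity : ∀ (N D G q ε M r δ : ℤ) {ε′ δ′ : ℚ} → ε′ ≡ ε / 1 → δ′ ≡ δ / 1 → N ℤ.* D ≡ (q ℤ.- ε) ℤ.*
  (M ℤ.- r ℤ.* δ) ℤ.* G →
  (N / 1) ℚ.* (D / 1) ≡ ((q / 1) ℚ.- ε′) ℚ.* ((M / 1) ℚ.- (r / 1) ℚ.* δ′) ℚ.* (G / 1)
rational-identity N D G q ε M r δ refl refl eq = begin
  (N / 1) ℚ.* (D / 1)                                                     ≡⟨ trans (/1-* N D) (cong (_/ 1) eq) ⟩
  ((q ℤ.- ε) ℤ.* (M ℤ.- r ℤ.* δ) ℤ.* G) / 1
    ≡⟨ sym (/1-* ((q ℤ.- ε) ℤ.* (M ℤ.- r ℤ.* δ)) G) ⟩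
  (((q ℤ.- ε) ℤ.* (M ℤ.- r ℤ.* δ)) / 1) ℚ.* (G / 1)
    ≡⟨ cong (ℚ._* (G / 1)) (sym (/1-* (q ℤ.- ε) (M ℤ.- r ℤ.* δ))) ⟩
  ((q ℤ.- ε) / 1) ℚ.* ((M ℤ.- r ℤ.* δ) / 1) ℚ.* (G / 1)
    ≡⟨ cong₂ (λ x y → x ℚ.* y ℚ.* (G / 1)) (sym (/1-- q ε))
    (sym (trans (cong (λ z → (M / 1) ℚ.- z) (/1-* r δ)) (/1-- M (r ℤ.* δ)))) ⟩
  ((q / 1) ℚ.- (ε / 1)) ℚ.* ((M / 1) ℚ.- (r / 1) ℚ.* (δ / 1)) ℚ.* (G / 1) ∎

half-even : ∀ j n → n ≡ j ℕ.+ j → (1ℤ ℤ.+ -1ℤ ℤ.^ n) / 2 ≡ 1ℤ / 1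
half-even j n eq = cong (λ z → (1ℤ ℤ.+ z) / 2) (trans (cong (-1ℤ ℤ.^_) eq) (-1^-even j))

half-odd : ∀ j n → n ≡ suc (j ℕ.+ j) → (1ℤ ℤ.+ -1ℤ ℤ.^ n) / 2 ≡ ℤ.0ℤ / 1
half-odd j n eq = cong (λ z → (1ℤ ℤ.+ z) / 2) (trans (cong (-1ℤ ℤ.^_) eq) (-1^-odd j))

theorem5p4 : (F : FiniteField) (m k l : ℕ) →
    1 < m → m ≡ 2 ℕ.^ k ℕ.* l → l % 2 ≡ 1 →
    (N G : ℕ) →
    HasCard (IsTSRI F m 2) N →
    HasCard (Invertible F m) G →
    let q = FiniteField.order F in
    (+ N / 1) ℚ.* (+ (2 ℕ.* m ℕ.* (q ℕ.^ m ∸ 1)) / 1)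
    ≡ ((+ q / 1) ℚ.- ((1ℤ ℤ.+ -1ℤ ℤ.^ q) / 2))
    ℚ.* ((mobiusSum q m l / 1) ℚ.- (+ floorRecip l / 1) ℚ.* ((1ℤ ℤ.+ -1ℤ ℤ.^ (q ∸ 1)) / 2))
    ℚ.* (+ G / 1)
theorem5p4 F (suc p) k l (s≤s 0<p) m≡ l%2≡1 N G (xs , xs-unique , xs-spec , refl)
  (ys , ys-unique , ys-spec , refl) = by-parity (2 ∣? q)
  where
  open FixedExtension (fixed-extension F {2 ℕ.* suc p} (s≤s z≤n)) renaming (length-fixed≡ to len)
  q = FiniteField.order F
  m = suc p
  M = mobiusSum q m l
  D = 2 ℕ.* m ℕ.* (q ℕ.^ m ∸ 1)
  l-odd : ¬ (2 ∣ l)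
  l-odd 2∣l = ℕₚ.0≢1+n (trans (sym (n∣m⇒m%n≡0 l 2 2∣l)) l%2≡1)
  open EigenvalueCount embedding p 0<p k l m≡ l-odd len using (odd-characteristic; even-characteristic)
  open Correspondence embedding p 0<p using (inverse-eigenvalues; TSRI-count)
  module FF = Field F
  A = inverse-eigenvalues
  total : + length xs ℤ.* + D ≡ + length A ℤ.* + length ys
  total = trans (sym (ℤₚ.pos-* (length xs) D))
    (trans (cong +_ (TSRI-count len xs ys xs-unique ys-unique xs-spec ys-spec)) (ℤₚ.pos-* (length A) (length ys)))
  -- The condition n ≠ 0 matters because truncated subtraction gives 0 ∸ 1 = 0, which is even.
  pred-even : ∀ j n → n ≢ 0 → n ≡ j ℕ.+ j → ∃[ i ] n ∸ 1 ≡ suc (i ℕ.+ i)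
  pred-even zero n n≢0 n≡ = ⊥-elim (n≢0 n≡)
  pred-even (suc j) n n≢0 n≡ = j , trans (cong (_∸ 1) n≡) (ℕₚ.+-suc j j)
  -- The fractions are 1 and 0 for even q, and 0 and 1 for odd q; these choices reproduce the two
  -- formulas for the number of inverse eigenvalues.
  by-parity : Dec (2 ∣ q) → (+ length xs / 1) ℚ.* (+ D / 1)
    ≡ ((+ q / 1) ℚ.- ((1ℤ ℤ.+ -1ℤ ℤ.^ q) / 2)) ℚ.*
      ((M / 1) ℚ.- (+ floorRecip l / 1) ℚ.* ((1ℤ ℤ.+ -1ℤ ℤ.^ (q ∸ 1)) / 2)) ℚ.* (+ length ys / 1)
  by-parity (yes (divides j q≡j*2)) = rational-identity (+ length xs) (+ D) (+ length ys) (+ q) 1ℤ M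
    (+ floorRecip l) ℤ.0ℤ (half-even j q q≡) (half-odd (proj₁ pred) (q ∸ 1) (proj₂ pred))
    (trans total (cong (ℤ._* + length ys)
      (trans (even-characteristic (Characteristic.even-order⇒2≡0 F j q≡))
      (cong₂ ℤ._*_ q-1≡ (sym (trans (cong (λ z → M ℤ.- z) (ℤₚ.*-zeroʳ (+ floorRecip l))) (ℤₚ.+-identityʳ M)))))))
    where
    q≡ : q ≡ j ℕ.+ j
    q≡ = trans q≡j*2 (trans (ℕₚ.*-comm j 2) (cong (j ℕ.+_) (ℕₚ.+-identityʳ j)))
    pred = pred-even j q FF.order≢0 q≡
    q-1≡ : + (q ∸ 1) ≡ + q ℤ.- 1ℤ
    q-1≡ = sym (trans (ℤₚ.m-n≡m⊖n q 1) (ℤₚ.⊖-≥ (ℕₚ.n≢0⇒n>0 FF.order≢0)))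
  by-parity (no 2∤q) = rational-identity (+ length xs) (+ D) (+ length ys) (+ q) ℤ.0ℤ M (+ floorRecip l) 1ℤ
    (half-odd (proj₁ odd) q (proj₂ odd)) (half-even (proj₁ odd) (q ∸ 1) (cong (_∸ 1) (proj₂ odd)))
    (trans total (cong (ℤ._* + length ys)
      (trans (odd-characteristic (Characteristic.odd-order⇒2≢0 F (proj₁ odd) (proj₂ odd)))
      (cong₂ ℤ._*_ (sym (ℤₚ.+-identityʳ (+ q))) (cong (λ z → M ℤ.- z) (sym (ℤₚ.*-identityʳ (+ floorRecip l))))))))
    where
    odd = odd-form q 2∤q
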